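{- Let $F$ be a $k$-graph with $k\ge 3$ and let $d\in[0,1]$. If for every $\varepsilon>0$ there exists $m\in\mathbb N$ such that every $(d+\varepsilon)$-dense $m$-reduced $k$-graph embeds $F$, then $\pi_{k-2}(F)\le d$.
   Context: A $k$-graph is a pair $H=(V,E)$ with $E$ a set of $k$-element subsets of the finite set $V$; $H$ is $F$-free if it has no subhypergraph isomorphic to $F$. For a set $I$, $[I]^j$ denotes the set of $j$-element subsets of $I$, and $[m]=\{1,\dots,m\}$. For $0\le j<k$ and a $j$-graph $G$ on $V$, $\mathcal K_k(G)$ is the set of $k$-subsets of $V$ all of whose $j$-subsets are edges of $G$. A $k$-graph $H=(V,E)$ on $n$ vertices is $(d,\mu,j)$-dense if $|\mathcal K_k(G)\cap E|\ge d|\mathcal K_k(G)|-\mu n^k$ for every $j$-graph $G$ on $V$; $\pi_j(F)$ is the supremum of all $d\in[0,1]$ such that for every $\mu>0$ and $n_0\in\mathbb N$ there is an $F$-free $(d,\mu,j)$-dense $k$-graph with at least $n_0$ vertices. Reduced $k$-graphs: let $I$ be a finite index set with $|I|=m$. For each $\mathcal X\in[I]^{k-1}$ let $\mathcal P_{\mathcal X}$ be a finite nonempty set (vertex class), these sets being pairwise disjoint. For each $\mathcal Y\in[I]^k$ let $\mathcal A_{\mathcal Y}$ be a $k$-partite $k$-graph with vertex partition $\{\mathcal P_{\mathcal X}:\mathcal X\in[\mathcal Y]^{k-1}\}$ (its constituent). The $k$-graph $\mathcal A$ with vertex set $\bigcup_{\mathcal X}\mathcal P_{\mathcal X}$ and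 edge set $\bigcup_{\mathcal Y}E(\mathcal A_{\mathcal Y})$ is an $m$-reduced $k$-graph. It is $d$-dense if $|E(\mathcal A_{\mathcal Y})|\ge d\prod_{\mathcal X\in[\mathcal Y]^{k-1}}|\mathcal P_{\mathcal X}|$ for every $\mathcal Y\in[I]^k$. The shadow of $F$ is $\partial F=\{S: |S|=k-1,\ S\subset e \text{ for some } e\in E(F)\}$. A reduced map from $F$ to $\mathcal A$ is a pair $(\phi,\psi)$ with $\phi:V(F)\to I$ and $\psi:\partial F\to V(\mathcal A)$ such that: for every $S\in\partial F$, $\phi(S)$ is a $(k-1)$-set $\mathcal X\in[I]^{k-1}$ and $\psi(S)\in\mathcal P_{\mathcal X}$; and for every edge $e=\{i_1,\dots,i_k\}\in E(F)$, $\phi(e)=\mathcal Y\in[I]^k$ and $\{\psi(e\setminus\{i_1\}),\dots,\psi(e\setminus\{i_k\})\}\in E(\mathcal A_{\mathcal Y})$. $\mathcal A$ embeds $F$ if there is a reduced map from $F$ to $\mathcal A$.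
   Formalization: The density d, as well as ε, μ and the densities compared with d in π_{k-2}(F) ≤ d, are taken to be rational; the case of real d follows by applying the result to rationals slightly larger than d. -}

module Defs where

open import Data.Bool using (Bool; true; false; _∧_; _∨_; not; if_then_else_)
open import Data.Nat as ℕ using (ℕ; zero; suc; _≡ᵇ_; _^_)
open import Data.Fin using (Fin; zero; suc; _≟_)
open import Data.Fin.Subset using (Subset; ∣_∣; _∈_; _─_; ⁅_⁆)
open import Data.Vec using (Vec; []; _∷_; lookup; tabulate)
open import Data.List using (List; []; _∷_; _++_; map; concatMap; upTo)
open import Data.Product using (Σ; _×_; ∃; ∃-syntax; _,_)
open import Data.Integer using (+_)
open import Data.Rational using (ℚ; _/_; _≤_; _<_; _+_; _*_; _-_; 0ℚ; 1ℚ)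
open import Relation.Nullary using (¬_; does)
open import Relation.Binary.PropositionalEquality using (_≡_)
open import Function using (_∘_)

ℕ→ℚ : ℕ → ℚ
ℕ→ℚ n = (+ n) / 1

countTrue : List Bool → ℕ
countTrue []            = 0
countTrue (true  ∷ bs)  = suc (countTrue bs)
countTrue (false ∷ bs)  = countTrue bs

allSubsets : (n : ℕ) → List (Subset n)
allSubsets zero    = [] ∷ []
allSubsets (suc n) = map (true ∷_) (allSubsets n) ++ map (false ∷_) (allSubsets n)

anyFin : ∀ {f} → (Fin f → Bool) → Bool
anyFin {zero}  P = false
anyFin {suc f} P = P zero ∨ anyFin (P ∘ suc)

allFinB : ∀ {f} → (Fin f → Bool) → Bool
allFinB {zero}  P = true
allFinB {suc f} P = P zero ∧ allFinB (P ∘ suc)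

subB : ∀ {n} → Subset n → Subset n → Bool
subB T S = allFinB (λ i → not (lookup T i) ∨ lookup S i)

image : ∀ {f n} → (Fin f → Fin n) → Subset f → Subset n
image φ S = tabulate (λ i → anyFin (λ x → lookup S x ∧ does (φ x ≟ i)))

-- k-graphs: a vertex set Fin vn and an edge indicator; the edges are
-- exactly the k-element subsets e with E e ≡ true.

record Graph : Set where
  field
    vn : ℕ
    E  : Subset vn → Bool
open Graph public

edgeB : (k : ℕ) (H : Graph) → Subset (vn H) → Bool
edgeB k H e = E H e ∧ (∣ e ∣ ≡ᵇ k)

IsEdge : (k : ℕ) (H : Graph) → Subset (vn H) → Set
IsEdge k H e = edgeB k H e ≡ true

Contains : (k : ℕ) (H F : Graph) → Set
Contains k H F =
  Σ (Fin (vn F) → Fin (vn H)) λ φ →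
    (∀ x y → φ x ≡ φ y → x ≡ y) ×
    (∀ e → IsEdge k F e → IsEdge k H (image φ e))

Free : (k : ℕ) (F H : Graph) → Set
Free k F H = ¬ Contains k H F

inKB : ∀ {n} (k j : ℕ) (G : Subset n → Bool) → Subset n → Bool
inKB {n} k j G S =
  (∣ S ∣ ≡ᵇ k) ∧ allB (allSubsets n)
  where
    allB : List (Subset n) → Bool
    allB []       = true
    allB (T ∷ Ts) = (not (subB T S ∧ (∣ T ∣ ≡ᵇ j)) ∨ G T) ∧ allB Ts

sizeK : ∀ {n} (k j : ℕ) (G : Subset n → Bool) → ℕ
sizeK {n} k j G = countTrue (map (inKB k j G) (allSubsets n))

sizeKE : (k j : ℕ) (H : Graph) (G : Subset (vn H) → Bool) → ℕ
sizeKE k j H G = countTrue (map (λ S → inKB k j G S ∧ edgeB k H S) (allSubsets (vn H)))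

Dense : (k j : ℕ) (d μ : ℚ) (H : Graph) → Set
Dense k j d μ H =
  ∀ (G : Subset (vn H) → Bool) →
    d * ℕ→ℚ (sizeK k j G) - μ * ℕ→ℚ (vn H ^ k) ≤ ℕ→ℚ (sizeKE k j H G)

InPiSet : (k j : ℕ) (F : Graph) (d : ℚ) → Set
InPiSet k j F d =
  ∀ (μ : ℚ) → 0ℚ < μ → ∀ (n₀ : ℕ) →
    ∃[ H ] (n₀ ℕ.≤ vn H × Free k F H × Dense k j d μ H)

-- π_j(F) ≤ d  (the supremum over [0,1] of InPiSet is at most d); since
-- InPiSet is downward closed it suffices to exclude rationals in (d,1].
PiLe : (k j : ℕ) (F : Graph) (d : ℚ) → Set
PiLe k j F d = ∀ (d' : ℚ) → d < d' → d' ≤ 1ℚ → ¬ InPiSet k j F d'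

-- m-reduced k-graphs with index set I = Fin m.
-- Vertex class 𝒫_𝒳 (𝒳 a (k-1)-subset of Fin m) is {0,…,size 𝒳 - 1},
-- tagged by 𝒳 (so the classes are pairwise disjoint).
-- A vertex tuple of the constituent 𝒜_𝒴 (one vertex from each class
-- 𝒫_{𝒴∖{i}}, i ∈ 𝒴) is encoded as t : Fin m → ℕ, t i ∈ 𝒫_{𝒴∖{i}};
-- values outside 𝒴 are irrelevant (normalised to 0 by `canon`).

record Reduced (k m : ℕ) : Set where
  field
    size     : Subset m → ℕ
    nonempty : ∀ (X : Subset m) → ∣ X ∣ ≡ k ℕ.∸ 1 → 1 ℕ.≤ size X
    edgeA    : Subset m → (Fin m → ℕ) → Bool
open Reduced public

canon : ∀ {m} → Subset m → (Fin m → ℕ) → (Fin m → ℕ)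
canon Y t i = if lookup Y i then t i else 0

IsEdgeA : ∀ {k m} (A : Reduced k m) (Y : Subset m) (t : Fin m → ℕ) → Set
IsEdgeA A Y t =
  (∀ i → i ∈ Y → t i ℕ.< size A (Y ─ ⁅ i ⁆)) × edgeA A Y (canon Y t) ≡ true

consF : ∀ {m} → ℕ → (Fin m → ℕ) → (Fin (suc m) → ℕ)
consF v f zero    = v
consF v f (suc i) = f i

tuples : ∀ {m} → (Fin m → ℕ) → List (Fin m → ℕ)
tuples {zero}  b = (λ ()) ∷ []
tuples {suc m} b = concatMap (λ v → map (consF v) (tuples (b ∘ suc))) (upTo (b zero))

bound : ∀ {k m} (A : Reduced k m) (Y : Subset m) → Fin m → ℕ
bound A Y i = if lookup Y i then size A (Y ─ ⁅ i ⁆) else 1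

edgeCount : ∀ {k m} (A : Reduced k m) (Y : Subset m) → ℕ
edgeCount A Y = countTrue (map (edgeA A Y) (tuples (bound A Y)))

prodSizes : ∀ {k m} (A : Reduced k m) (Y : Subset m) → ℕ
prodSizes {m = m} A Y = go (bound A Y)
  where
    go : ∀ {r} → (Fin r → ℕ) → ℕ
    go {zero}  b = 1
    go {suc r} b = b zero ℕ.* go (b ∘ suc)

DenseR : ∀ {k m} (d : ℚ) (A : Reduced k m) → Set
DenseR {k} {m} d A =
  ∀ (Y : Subset m) → ∣ Y ∣ ≡ k →
    d * ℕ→ℚ (prodSizes A Y) ≤ ℕ→ℚ (edgeCount A Y)

InShadow : (k : ℕ) (F : Graph) → Subset (vn F) → Set
InShadow k F S = ∣ S ∣ ≡ k ℕ.∸ 1 × ∃[ e ] (IsEdge k F e × (∀ x → x ∈ S → x ∈ e))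

-- reduced map (φ, ψ); ψ(S) ∈ 𝒫_{φ(S)} is recorded by its index in that class
ReducedMap : ∀ {k m} (F : Graph) (A : Reduced k m) →
             (Fin (vn F) → Fin m) → (Subset (vn F) → ℕ) → Set
ReducedMap {k} F A φ ψ =
  (∀ S → InShadow k F S →
     ∣ image φ S ∣ ≡ k ℕ.∸ 1 × ψ S ℕ.< size A (image φ S)) ×
  (∀ e → IsEdge k F e →
     ∣ image φ e ∣ ≡ k ×
     ∃[ t ] (IsEdgeA A (image φ e) t × (∀ x → x ∈ e → t (φ x) ≡ ψ (e ─ ⁅ x ⁆))))

Embeds : ∀ {k m} (F : Graph) (A : Reduced k m) → Set
Embeds {m = m} F A = ∃[ φ ] ∃[ ψ ] ReducedMap F A φ ψ

{-# OPTIONS --safe #-}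
-- The regularity lemma is replaced by sampling. Observe a k-graph H, dense for some d′ > d, through random vertex
-- sets A, B: the top of a (k-1)-tuple records its edges with A, and the lower information of a tuple records the
-- edges that contain at least two vertices of A ∪ B. Energy increments give bounded |A| and |B| for which, on
-- average, adding M further vertices to A or B hardly changes the conditional probabilities. Then, for a random
-- M-tuple of vertices, an edge may be replaced by its conditional probability given the tops of its faces (and the
-- lower information), and the tops themselves may be resampled independently given the lower information. Testing
-- the density condition on random (k-2)-graphs that are unions of lower classes, together with Ramsey's theorem,
-- shows that with positive probability all k-subsets of m random vertices have conditional density at least d′ - ε
-- given the lower information. Sampling N tops for each (k-1)-set then yields a reduced k-graph of density d + ε,
-- which embeds F. Doing this in many transversals of a blow-up of the index set and applying Kővári–Sós–Turán
-- makes the embedding injective on vertices; by pigeonhole one fixed pattern occurs with positive probability, and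
-- undoing the two replacements gives a copy of F in H.

module Submission where

open import Defs hiding (E; bound; size)
open import Data.Bool using (Bool; true; false; _∧_; _∨_; not; if_then_else_)
import Data.Bool.Properties as Boolₚ
open import Data.Empty using (⊥; ⊥-elim)
open import Data.Fin as Fin using (Fin; zero; suc; toℕ; punchIn; punchOut; _↑ˡ_; _↑ʳ_; join; combine; remQuot)
open import Data.Fin.Induction using (<-wellFounded)
import Data.Fin.Properties as Finₚ
import Data.Fin.Subset as Sub
open import Data.Fin.Subset using (Subset; ⁅_⁆; _─_)
import Data.Fin.Subset.Properties as Subₚ
open import Data.Integer as ℤ using (-[1+_])
import Data.Integer.Properties as ℤₚ
open import Data.List as List using (List; []; _∷_; _++_; length; allFin; upTo)
open import Data.List.Membership.Propositional as Membership using (_∈_; lose)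
import Data.List.Membership.Propositional.Properties as ∈ₚ
import Data.List.Properties as Listₚ
open import Data.List.Relation.Unary.All as All using (All; []; _∷_)
import Data.List.Relation.Unary.All.Properties as Allₚ
open import Data.List.Relation.Unary.AllPairs using (AllPairs; []; _∷_)
open import Data.List.Relation.Unary.Any as Any using (Any; here; there)
open import Data.List.Relation.Unary.Unique.Propositional using (Unique)
import Data.List.Relation.Unary.Unique.Propositional.Properties as Uniqueₚ
open import Data.Nat as ℕ using (ℕ; zero; suc; s≤s; z≤n; _≡ᵇ_)
import Data.Nat.Properties as ℕₚ
open import Data.Product using (∃-syntax; Σ-syntax; _×_; _,_; proj₁; proj₂)
import Data.Product.Properties as Productₚ
open import Data.Rational
open import Data.Rational.Properties
open import Data.Rational.Unnormalised as ℚᵘ using (mkℚᵘ; *≡*)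
import Data.Rational.Unnormalised.Properties as ℚᵘₚ
open import Data.Sum using (_⊎_; inj₁; inj₂; [_,_]′)
open import Data.Unit using (⊤; tt)
open import Data.Vec as Vec using (Vec; []; _∷_; lookup; tabulate; insertAt; removeAt; replicate; _[_]≔_)
import Data.Vec.Properties as Vecₚ
open import Function using (_∘_; id)
open import Induction.WellFounded using (Acc; acc)
open import Relation.Binary using (DecidableEquality; tri<; tri≈; tri>)
open import Relation.Binary.PropositionalEquality
open import Relation.Nullary using (Dec; yes; no; ¬_; does; contradiction; ¬?)
open import Relation.Nullary.Decidable using (dec-true; dec-false; _×-dec_; _→-dec_; _⊎-dec_; map′)
open import Relation.Nullary.Decidable.Core using (dec⇒maybe)
open import Tactic.RingSolver using (solve-∀)
open import Tactic.RingSolver.Core.AlmostCommutativeRing using (AlmostCommutativeRing; fromCommutativeRing)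

-- The level k-2: a k-tuple with at least two members in the environment has at most k-2 free
-- vertices. Prescribing lower information is therefore a condition on (k-2)-sets, which is what a
-- test graph can express. Tops lie one level higher and cannot be tested, so they are resampled
-- instead.
--
-- Two environments: undoing the first replacement adds the other vertices of the random tuple to
-- `A`, which changes what a top is. The second replacement must keep the meaning of tops and refine
-- only the lower information, so it adds those vertices to `B`, which tops do not see. A size of
-- `B` is picked for every size of `A`; the next `A` absorbs the old `A` and `B`, so its energy
-- stays monotone although `B` starts afresh.
--
-- The case k = 3 is separate: a colouring can force different colours on two vertices only if some
-- (k-2)-set contains both, so a random vertex set replaces the random colouring.
--
-- Order of choices: the sizes of `A` and `B` depend on the hypergraph, but are bounded in advance.
-- Numbers of classes are computed from sizes alone, so every constant, down to the error μ and the
-- least number of vertices, is fixed before the hypergraph is.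

module Rationals where

  ℚ-ring : AlmostCommutativeRing _ _
  ℚ-ring = fromCommutativeRing +-*-commutativeRing (λ x → dec⇒maybe (0ℚ ≟ x))

  0≤1 : 0ℚ ≤ 1ℚ
  0≤1 = nonNegative⁻¹ 1ℚ

  0<1 : 0ℚ < 1ℚ
  0<1 = positive⁻¹ 1ℚ

  ≤⇒0≤- : ∀ {p q} → p ≤ q → 0ℚ ≤ q - p
  ≤⇒0≤- {p} {q} le = subst (_≤ q - p) (+-inverseʳ p) (+-monoˡ-≤ (- p) le)

  private
    cancel-lem : ∀ p q → (q - p) + p ≡ q
    cancel-lem = solve-∀ ℚ-ring

  0≤-⇒≤ : ∀ {p q} → 0ℚ ≤ q - p → p ≤ q
  0≤-⇒≤ {p} {q} le = subst₂ _≤_ (+-identityˡ p) (cancel-lem p q) (+-monoˡ-≤ p le)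

  -- Turns an inequality into a ring identity plus a visibly nonnegative term, so that the ring
  -- solver does the rearranging in all later estimates.
  by-difference : ∀ {p q e} → q - p ≡ e → 0ℚ ≤ e → p ≤ q
  by-difference eq le = 0≤-⇒≤ (subst (0ℚ ≤_) (sym eq) le)

  <⇒0<- : ∀ {p q} → p < q → 0ℚ < q - p
  <⇒0<- {p} {q} lt = subst (_< q - p) (+-inverseʳ p) (+-monoˡ-< (- p) lt)

  0<-⇒< : ∀ {p q} → 0ℚ < q - p → p < q
  0<-⇒< {p} {q} lt = subst₂ _<_ (+-identityˡ p) (cancel-lem p q) (+-monoˡ-< p lt)

  *-nonneg : ∀ {p q} → 0ℚ ≤ p → 0ℚ ≤ q → 0ℚ ≤ p * q
  *-nonneg {p} {q} 0≤p 0≤q = nonNegative⁻¹ (p * q)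
    where instance
      _ = nonNegative 0≤p
      _ = nonNegative 0≤q
      _ = nonNeg*nonNeg⇒nonNeg p q

  *-pos : ∀ {p q} → 0ℚ < p → 0ℚ < q → 0ℚ < p * q
  *-pos {p} {q} 0<p 0<q = positive⁻¹ (p * q)
    where instance
      _ = positive 0<p
      _ = positive 0<q
      _ = pos*pos⇒pos p q

  +-nonneg : ∀ {p q} → 0ℚ ≤ p → 0ℚ ≤ q → 0ℚ ≤ p + q
  +-nonneg 0≤p 0≤q = +-mono-≤ 0≤p 0≤q

  +-pos-nonneg : ∀ {p q} → 0ℚ < p → 0ℚ ≤ q → 0ℚ < p + q
  +-pos-nonneg 0<p 0≤q = +-mono-<-≤ 0<p 0≤q

  *-monoˡ : ∀ c {p q} → 0ℚ ≤ c → p ≤ q → c * p ≤ c * q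
  *-monoˡ c 0≤c = *-monoˡ-≤-nonNeg c {{nonNegative 0≤c}}

  *-monoʳ : ∀ c {p q} → 0ℚ ≤ c → p ≤ q → p * c ≤ q * c
  *-monoʳ c 0≤c = *-monoʳ-≤-nonNeg c {{nonNegative 0≤c}}

  *-mono : ∀ {p q r s} → 0ℚ ≤ p → 0ℚ ≤ s → p ≤ q → r ≤ s → p * r ≤ q * s
  *-mono {p} {q} {r} {s} 0≤p 0≤s p≤q r≤s = ≤-trans (*-monoˡ p 0≤p r≤s) (*-monoʳ s 0≤s p≤q)

  *-cancelˡ : ∀ c {p q} → 0ℚ < c → c * p ≤ c * q → p ≤ q
  *-cancelˡ c 0<c = *-cancelˡ-≤-pos c {{positive 0<c}}

  x≤x+ : ∀ {x y} → 0ℚ ≤ y → x ≤ x + y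
  x≤x+ {x} {y} 0≤y = subst (_≤ x + y) (+-identityʳ x) (+-monoʳ-≤ x 0≤y)

  *≤ˡ : ∀ {x y} → 0ℚ ≤ x → y ≤ 1ℚ → x * y ≤ x
  *≤ˡ {x} {y} 0≤x y≤1 = subst (x * y ≤_) (*-identityʳ x) (*-monoˡ x 0≤x y≤1)

  *≤ʳ : ∀ {x y} → 0ℚ ≤ y → x ≤ 1ℚ → x * y ≤ y
  *≤ʳ {x} {y} 0≤y x≤1 = subst (x * y ≤_) (*-identityˡ y) (*-monoʳ y 0≤y x≤1)

  *-≤1 : ∀ {x y} → 0ℚ ≤ x → x ≤ 1ℚ → y ≤ 1ℚ → x * y ≤ 1ℚ
  *-≤1 0≤x x≤1 y≤1 = ≤-trans (*≤ˡ 0≤x y≤1) x≤1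

  private
    sq-neg : ∀ x → (- x) * (- x) ≡ x * x
    sq-neg = solve-∀ ℚ-ring
    abs-sq : ∀ t x → (t * t + x * x) - (1ℚ + 1ℚ) * t * x ≡ (t - x) * (t - x)
    abs-sq = solve-∀ ℚ-ring

  sq-nonneg : ∀ x → 0ℚ ≤ x * x
  sq-nonneg x with ≤-total 0ℚ x
  ... | inj₁ 0≤x = *-nonneg 0≤x 0≤x
  ... | inj₂ x≤0 = subst (0ℚ ≤_) (sq-neg x) (*-nonneg (neg-antimono-≤ x≤0) (neg-antimono-≤ x≤0))

  x≤∣x∣ : ∀ x → x ≤ ∣ x ∣
  x≤∣x∣ x with ≤-total 0ℚ x
  ... | inj₁ 0≤x = ≤-reflexive (sym (0≤p⇒∣p∣≡p 0≤x))
  ... | inj₂ x≤0 = ≤-trans x≤0 (0≤∣p∣ x)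

  -x≤∣x∣ : ∀ x → - x ≤ ∣ x ∣
  -x≤∣x∣ x = subst (- x ≤_) (∣-p∣≡∣p∣ x) (x≤∣x∣ (- x))

  ∣x∣-elim : ∀ {c} x → x ≤ c → - x ≤ c → ∣ x ∣ ≤ c
  ∣x∣-elim x p q with ∣p∣≡p∨∣p∣≡-p x
  ... | inj₁ e = subst (_≤ _) (sym e) p
  ... | inj₂ e = subst (_≤ _) (sym e) q

  ∣x∣²≡x² : ∀ x → ∣ x ∣ * ∣ x ∣ ≡ x * x
  ∣x∣²≡x² x with ∣p∣≡p∨∣p∣≡-p x
  ... | inj₁ e rewrite e = refl
  ... | inj₂ e rewrite e = sq-neg x

  -- Expands `(t - ∣ x ∣)² ≥ 0`. With a free parameter `t` this stands in for the Cauchy-Schwarz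
  -- inequality, as square roots leave the rationals.
  am-gm : ∀ t x → (1ℚ + 1ℚ) * t * ∣ x ∣ ≤ t * t + x * x
  am-gm t x = by-difference (trans (cong (λ z → (t * t + z) - (1ℚ + 1ℚ) * t * ∣ x ∣) (sym (∣x∣²≡x² x))) (abs-sq t ∣ x ∣))
    (sq-nonneg (t - ∣ x ∣))

  -- Total reciprocal: inv 0 = 0.
  abstract
    inv : ℚ → ℚ
    inv p with p ≟ 0ℚ
    ... | yes _  = 0ℚ
    ... | no p≢0 = (1/ p) {{≢-nonZero p≢0}}

    inv-inverse : ∀ {p} → 0ℚ < p → p * inv p ≡ 1ℚ
    inv-inverse {p} 0<p with p ≟ 0ℚ
    ... | yes p≡0 = contradiction (sym p≡0) (<⇒≢ 0<p)
    ... | no p≢0  = *-inverseʳ p {{≢-nonZero p≢0}}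

    inv-pos : ∀ {p} → 0ℚ < p → 0ℚ < inv p
    inv-pos {p} 0<p with p ≟ 0ℚ
    ... | yes p≡0 = contradiction (sym p≡0) (<⇒≢ 0<p)
    ... | no p≢0  = positive⁻¹ _ {{1/pos⇒pos p {{positive 0<p}}}}

  0≤⇒0≡⊎0< : ∀ {p} → 0ℚ ≤ p → p ≡ 0ℚ ⊎ 0ℚ < p
  0≤⇒0≡⊎0< {p} 0≤p with 0ℚ <? p
  ... | yes lt = inj₂ lt
  ... | no  ge = inj₁ (≤-antisym (≮⇒≥ ge) 0≤p)

  abstract
    inv-zero : inv 0ℚ ≡ 0ℚ
    inv-zero = refl

    inv-nonneg : ∀ {p} → 0ℚ ≤ p → 0ℚ ≤ inv p
    inv-nonneg {p} 0≤p with 0≤⇒0≡⊎0< 0≤p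
    ... | inj₁ refl = ≤-refl
    ... | inj₂ lt   = <⇒≤ (inv-pos lt)

  𝟙 : Bool → ℚ
  𝟙 true  = 1ℚ
  𝟙 false = 0ℚ

  𝟙-nonneg : ∀ b → 0ℚ ≤ 𝟙 b
  𝟙-nonneg true  = 0≤1
  𝟙-nonneg false = ≤-refl

  𝟙-≤1 : ∀ b → 𝟙 b ≤ 1ℚ
  𝟙-≤1 true  = ≤-refl
  𝟙-≤1 false = 0≤1

  𝟙-∧ : ∀ a b → 𝟙 (a ∧ b) ≡ 𝟙 a * 𝟙 b
  𝟙-∧ true  b = sym (*-identityˡ (𝟙 b))
  𝟙-∧ false b = sym (*-zeroˡ (𝟙 b))

  𝟙-*-≤ : ∀ b {x} → 0ℚ ≤ x → 𝟙 b * x ≤ x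
  𝟙-*-≤ b 0≤x = *≤ʳ 0≤x (𝟙-≤1 b)

  private
    toℚᵘ-ℕ : ∀ n → toℚᵘ (ℕ→ℚ n) ℚᵘ.≃ mkℚᵘ (ℤ.+ n) 0
    toℚᵘ-ℕ n = toℚᵘ-fromℚᵘ (mkℚᵘ (ℤ.+ n) 0)

  ℕ→ℚ-+ : ∀ m n → ℕ→ℚ (m ℕ.+ n) ≡ ℕ→ℚ m + ℕ→ℚ n
  ℕ→ℚ-+ m n = toℚᵘ-injective (ℚᵘₚ.≃-trans (toℚᵘ-ℕ (m ℕ.+ n)) (ℚᵘₚ.≃-trans
      (*≡* (cong (ℤ._* (ℤ.+ 1)) (sym (cong₂ ℤ._+_ (ℤₚ.*-identityʳ (ℤ.+ m)) (ℤₚ.*-identityʳ (ℤ.+ n))))))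
      (ℚᵘₚ.≃-sym (ℚᵘₚ.≃-trans (toℚᵘ-homo-+ (ℕ→ℚ m) (ℕ→ℚ n)) (ℚᵘₚ.+-cong (toℚᵘ-ℕ m) (toℚᵘ-ℕ n))))))

  ℕ→ℚ-suc : ∀ n → ℕ→ℚ (suc n) ≡ 1ℚ + ℕ→ℚ n
  ℕ→ℚ-suc n = ℕ→ℚ-+ 1 n

  ℕ→ℚ-* : ∀ m n → ℕ→ℚ (m ℕ.* n) ≡ ℕ→ℚ m * ℕ→ℚ n
  ℕ→ℚ-* zero n = sym (*-zeroˡ (ℕ→ℚ n))
  ℕ→ℚ-* (suc m) n = begin
    ℕ→ℚ (n ℕ.+ m ℕ.* n)          ≡⟨ ℕ→ℚ-+ n (m ℕ.* n) ⟩
    ℕ→ℚ n + ℕ→ℚ (m ℕ.* n)       ≡⟨ cong (ℕ→ℚ n +_) (ℕ→ℚ-* m n) ⟩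
    ℕ→ℚ n + ℕ→ℚ m * ℕ→ℚ n      ≡⟨ cong (_+ ℕ→ℚ m * ℕ→ℚ n) (sym (*-identityˡ (ℕ→ℚ n))) ⟩
    1ℚ * ℕ→ℚ n + ℕ→ℚ m * ℕ→ℚ n ≡⟨ sym (*-distribʳ-+ (ℕ→ℚ n) 1ℚ (ℕ→ℚ m)) ⟩
    (1ℚ + ℕ→ℚ m) * ℕ→ℚ n        ≡⟨ cong (_* ℕ→ℚ n) (sym (ℕ→ℚ-suc m)) ⟩
    ℕ→ℚ (suc m) * ℕ→ℚ n          ∎
    where open ≡-Reasoning

  ℕ→ℚ-nonneg : ∀ n → 0ℚ ≤ ℕ→ℚ n
  ℕ→ℚ-nonneg zero    = ≤-refl
  ℕ→ℚ-nonneg (suc n) = subst (0ℚ ≤_) (sym (ℕ→ℚ-suc n)) (+-nonneg 0≤1 (ℕ→ℚ-nonneg n))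

  ℕ→ℚ-pos : ∀ n → 0ℚ < ℕ→ℚ (suc n)
  ℕ→ℚ-pos n = subst (0ℚ <_) (sym (ℕ→ℚ-suc n)) (+-pos-nonneg 0<1 (ℕ→ℚ-nonneg n))

  ℕ→ℚ-mono : ∀ {m n} → m ℕ.≤ n → ℕ→ℚ m ≤ ℕ→ℚ n
  ℕ→ℚ-mono {m} {n} m≤n = subst (λ z → ℕ→ℚ m ≤ ℕ→ℚ z) (ℕₚ.m+[n∸m]≡n m≤n)
    (subst (ℕ→ℚ m ≤_) (sym (ℕ→ℚ-+ m (n ℕ.∸ m))) (x≤x+ (ℕ→ℚ-nonneg (n ℕ.∸ m))))

  private
    denominator-* : ∀ p → ℕ→ℚ (↧ₙ p) * p ≡ ↥ p / 1
    denominator-* p = toℚᵘ-injective (ℚᵘₚ.≃-trans (toℚᵘ-homo-* (ℕ→ℚ (↧ₙ p)) p)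
      (ℚᵘₚ.≃-trans (ℚᵘₚ.*-congʳ {toℚᵘ p} (toℚᵘ-ℕ (↧ₙ p)))
       (ℚᵘₚ.≃-trans (cross p) (ℚᵘₚ.≃-sym (toℚᵘ-fromℚᵘ (mkℚᵘ (↥ p) 0))))))
      where
      cross : ∀ p → mkℚᵘ (↧ p) 0 ℚᵘ.* toℚᵘ p ℚᵘ.≃ mkℚᵘ (↥ p) 0
      cross p@(mkℚ i d _) = *≡* (trans (ℤₚ.*-identityʳ _) (trans (ℤₚ.*-comm (ℤ.+ suc d) i) (cong (λ z → i ℤ.* (ℤ.+ suc z)) (sym (ℕₚ.+-identityʳ d)))))

  -- The denominator of `ε` is a witness: multiplying by it leaves the numerator, a positive
  -- integer.
  archimedean : ∀ {ε} → 0ℚ < ε → ∃[ N ] 1ℚ ≤ ℕ→ℚ N * ε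
  archimedean {mkℚ (ℤ.+ suc i) d c} 0<ε = suc d , subst (1ℚ ≤_) (sym (denominator-* (mkℚ (ℤ.+ suc i) d c))) (ℕ→ℚ-mono {1} {suc i} (ℕ.s≤s ℕ.z≤n))
  archimedean {mkℚ (ℤ.+ zero) d c} 0<ε = contradiction 0<ε λ { (*<* (ℤ.+<+ ())) }
  archimedean {mkℚ -[1+ i ] d c} 0<ε = contradiction 0<ε λ { (*<* ()) }

  archimedean′ : ∀ {ε} C → 0ℚ < ε → ∃[ N ] C ≤ ℕ→ℚ N * ε
  archimedean′ {ε} C 0<ε with C ≤? 0ℚ
  ... | yes C≤0 = 0 , subst (C ≤_) (sym (*-zeroˡ ε)) C≤0
  ... | no  C≰0 with archimedean (*-pos 0<ε (inv-pos (≰⇒> C≰0)))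
  ...   | N , le = N , subst₂ _≤_ (*-identityˡ C) eq (*-monoʳ C (<⇒≤ (≰⇒> C≰0)) le)
    where
    re : ∀ n e i c → n * (e * i) * c ≡ n * e * (c * i)
    re = solve-∀ ℚ-ring
    eq : ℕ→ℚ N * (ε * inv C) * C ≡ ℕ→ℚ N * ε
    eq = trans (re (ℕ→ℚ N) ε (inv C) C) (trans (cong (ℕ→ℚ N * ε *_) (inv-inverse (≰⇒> C≰0))) (*-identityʳ _))

open Rationals

-- Finite probability distributions and expectations

module Expectation where

  ∑ : ∀ {A : Set} → List A → (A → ℚ) → ℚ
  ∑ []       f = 0ℚ
  ∑ (x ∷ xs) f = f x + ∑ xs f

  private
    interchange : ∀ a b c d → (a + b) + (c + d) ≡ (a + c) + (b + d)
    interchange = solve-∀ ℚ-ring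
    left-comm : ∀ w c x → w * (c * x) ≡ c * (w * x)
    left-comm = solve-∀ ℚ-ring

  module _ {A : Set} where

    ∑-cong : ∀ (xs : List A) {f g} → (∀ x → f x ≡ g x) → ∑ xs f ≡ ∑ xs g
    ∑-cong []       e = refl
    ∑-cong (x ∷ xs) e = cong₂ _+_ (e x) (∑-cong xs e)

    ∑-mono : ∀ (xs : List A) {f g} → (∀ x → f x ≤ g x) → ∑ xs f ≤ ∑ xs g
    ∑-mono []       le = ≤-refl
    ∑-mono (x ∷ xs) le = +-mono-≤ (le x) (∑-mono xs le)

    ∑-+ : ∀ (xs : List A) f g → ∑ xs (λ x → f x + g x) ≡ ∑ xs f + ∑ xs g
    ∑-+ []       f g = refl
    ∑-+ (x ∷ xs) f g = trans (cong (f x + g x +_) (∑-+ xs f g)) (interchange (f x) (g x) (∑ xs f) (∑ xs g))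

    ∑-* : ∀ (xs : List A) c f → ∑ xs (λ x → c * f x) ≡ c * ∑ xs f
    ∑-* []       c f = sym (*-zeroʳ c)
    ∑-* (x ∷ xs) c f = trans (cong (c * f x +_) (∑-* xs c f)) (sym (*-distribˡ-+ c (f x) (∑ xs f)))

    ∑-const : ∀ (xs : List A) c → ∑ xs (λ _ → c) ≡ ℕ→ℚ (length xs) * c
    ∑-const []       c = sym (*-zeroˡ c)
    ∑-const (x ∷ xs) c = begin
      c + ∑ xs (λ _ → c)               ≡⟨ cong₂ _+_ (sym (*-identityˡ c)) (∑-const xs c) ⟩
      1ℚ * c + ℕ→ℚ (length xs) * c   ≡⟨ sym (*-distribʳ-+ c 1ℚ (ℕ→ℚ (length xs))) ⟩
      (1ℚ + ℕ→ℚ (length xs)) * c     ≡⟨ cong (_* c) (sym (ℕ→ℚ-suc (length xs))) ⟩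
      ℕ→ℚ (suc (length xs)) * c       ∎
      where open ≡-Reasoning

    ∑-zero : ∀ (xs : List A) → ∑ xs (λ _ → 0ℚ) ≡ 0ℚ
    ∑-zero xs = trans (∑-const xs 0ℚ) (*-zeroʳ (ℕ→ℚ (length xs)))

    ∑-++ : ∀ (xs ys : List A) f → ∑ (xs ++ ys) f ≡ ∑ xs f + ∑ ys f
    ∑-++ []       ys f = sym (+-identityˡ (∑ ys f))
    ∑-++ (x ∷ xs) ys f = trans (cong (f x +_) (∑-++ xs ys f)) (sym (+-assoc (f x) (∑ xs f) (∑ ys f)))

    ∑-map : ∀ {B : Set} (g : B → A) (xs : List B) f → ∑ (List.map g xs) f ≡ ∑ xs (f ∘ g)
    ∑-map g []       f = refl
    ∑-map g (x ∷ xs) f = cong (f (g x) +_) (∑-map g xs f)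

    ∑-concatMap : ∀ {B : Set} (g : B → List A) (xs : List B) f → ∑ (List.concatMap g xs) f ≡ ∑ xs (λ x → ∑ (g x) f)
    ∑-concatMap g []       f = refl
    ∑-concatMap g (x ∷ xs) f = trans (∑-++ (g x) _ f) (cong (∑ (g x) f +_) (∑-concatMap g xs f))

    ∑-nonneg : ∀ (xs : List A) {f} → (∀ x → 0ℚ ≤ f x) → 0ℚ ≤ ∑ xs f
    ∑-nonneg []       nn = ≤-refl
    ∑-nonneg (x ∷ xs) nn = +-nonneg (nn x) (∑-nonneg xs nn)

  ∑-swap : ∀ {A B : Set} (xs : List A) (ys : List B) (f : A → B → ℚ) → ∑ xs (λ x → ∑ ys (f x)) ≡ ∑ ys (λ y → ∑ xs (λ x → f x y))
  ∑-swap []       ys f = sym (∑-zero ys)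
  ∑-swap (x ∷ xs) ys f = trans (cong (∑ ys (f x) +_) (∑-swap xs ys f)) (go ys)
    where
    go : ∀ ys → ∑ ys (f x) + ∑ ys (λ y → ∑ xs (λ x → f x y)) ≡ ∑ ys (λ y → f x y + ∑ xs (λ x → f x y))
    go []       = refl
    go (y ∷ ys) = trans (interchange (f x y) (∑ ys (f x)) (∑ xs (λ x → f x y)) _) (cong (f x y + ∑ xs (λ x → f x y) +_) (go ys))

  private
    weigh : ∀ {A : Set} → List (ℚ × A) → (A → ℚ) → ℚ
    weigh l f = ∑ l (λ wx → proj₁ wx * f (proj₂ wx))

    NN : ∀ {A : Set} → List (ℚ × A) → Set
    NN = All (λ wx → 0ℚ ≤ proj₁ wx)

    weigh-scale : ∀ {A : Set} (w : ℚ) (l : List (ℚ × A)) f → weigh (List.map (λ vx → w * proj₁ vx , proj₂ vx) l) f ≡ w * weigh l f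
    weigh-scale w l f = trans (∑-map (λ vx → w * proj₁ vx , proj₂ vx) l (λ wx → proj₁ wx * f (proj₂ wx)))
      (trans (∑-cong l (λ vx → *-assoc w (proj₁ vx) (f (proj₂ vx)))) (∑-* l w _))

    bindL : ∀ {A B : Set} → List (ℚ × A) → (A → List (ℚ × B)) → List (ℚ × B)
    bindL l k = List.concatMap (λ wx → List.map (λ vy → proj₁ wx * proj₁ vy , proj₂ vy) (k (proj₂ wx))) l

    weigh-bind : ∀ {A B : Set} (l : List (ℚ × A)) (k : A → List (ℚ × B)) f → weigh (bindL l k) f ≡ weigh l (λ x → weigh (k x) f)
    weigh-bind l k f = trans (∑-concatMap _ l _) (∑-cong l (λ wx → weigh-scale (proj₁ wx) (k (proj₂ wx)) f))

    scale-NN : ∀ {A : Set} {w} {l : List (ℚ × A)} → 0ℚ ≤ w → NN l → NN (List.map (λ vx → w * proj₁ vx , proj₂ vx) l)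
    scale-NN nw ns = Allₚ.map⁺ (All.map (*-nonneg nw) ns)

    bind-NN : ∀ {A B : Set} {l : List (ℚ × A)} {k : A → List (ℚ × B)} → NN l → (∀ x → NN (k x)) → NN (bindL l k)
    bind-NN []       nk = []
    bind-NN {l = (w , x) ∷ l} (p ∷ ps) nk = Allₚ.++⁺ (scale-NN p (nk x)) (bind-NN ps nk)

  -- Points may be repeated and may have weight 0, so that mixing and reweighting are plain list
  -- operations.
  record Dist (A : Set) : Set where
    constructor dist
    field
      pts : List (ℚ × A)
      nn  : NN pts
      tot : weigh pts (λ _ → 1ℚ) ≡ 1ℚ

  open Dist

  abstract
    𝔼 : ∀ {A : Set} → Dist A → (A → ℚ) → ℚ
    𝔼 d f = weigh (pts d) f

    pointD : ∀ {A : Set} → A → Dist A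
    pointD x = dist ((1ℚ , x) ∷ []) (0≤1 ∷ []) refl

    bindD : ∀ {A B : Set} → Dist A → (A → Dist B) → Dist B
    bindD d k = dist (bindL (pts d) (pts ∘ k)) (bind-NN (nn d) (nn ∘ k))
      (trans (weigh-bind (pts d) (pts ∘ k) _) (trans (∑-cong (pts d) (λ wx → cong (proj₁ wx *_) (tot (k (proj₂ wx))))) (tot d)))

    -- Change of measure with density `r / 𝔼 d r`; an indicator `r` gives conditioning on an event.
    tiltD : ∀ {A : Set} (d : Dist A) (r : A → ℚ) → (∀ x → 0ℚ ≤ r x) → 0ℚ < 𝔼 d r → Dist A
    tiltD d r nr pos = dist (List.map (λ wx → inv (𝔼 d r) * (proj₁ wx * r (proj₂ wx)) , proj₂ wx) (pts d)) (go (nn d))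
      (trans (∑-map _ (pts d) _) (trans (∑-cong (pts d) (λ wx → *-identityʳ _)) (trans (∑-* (pts d) (inv (𝔼 d r)) (λ wx → proj₁ wx * r (proj₂ wx))) (trans (*-comm (inv (𝔼 d r)) (𝔼 d r)) (inv-inverse pos)))))
      where
      go : ∀ {l} → NN l → NN (List.map (λ wx → inv (𝔼 d r) * (proj₁ wx * r (proj₂ wx)) , proj₂ wx) l)
      go []       = []
      go {(w , x) ∷ l} (p ∷ ps) = *-nonneg (<⇒≤ (inv-pos pos)) (*-nonneg p (nr x)) ∷ go ps

    uniformD : ∀ {A : Set} → A → List A → Dist A
    uniformD {A} x xs = dist (List.map (w ,_) (x ∷ xs)) (go (x ∷ xs))
      (trans (∑-map (w ,_) (x ∷ xs) (λ wx → proj₁ wx * 1ℚ)) (trans (∑-const (x ∷ xs) (w * 1ℚ)) (trans (cong (ℕ→ℚ (suc (length xs)) *_) (*-identityʳ w)) (inv-inverse (ℕ→ℚ-pos (length xs))))))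
      where
      w : ℚ
      w = inv (ℕ→ℚ (suc (length xs)))
      go : ∀ (l : List A) → NN (List.map (w ,_) l)
      go []      = []
      go (_ ∷ l) = <⇒≤ (inv-pos (ℕ→ℚ-pos (length xs))) ∷ go l

    bernoulliD : (p : ℚ) → 0ℚ ≤ p → p ≤ 1ℚ → Dist Bool
    bernoulliD p 0≤p p≤1 = dist ((p , true) ∷ (1ℚ - p , false) ∷ []) (0≤p ∷ ≤⇒0≤- p≤1 ∷ []) (lem p)
      where
      lem : ∀ p → p * 1ℚ + ((1ℚ - p) * 1ℚ + 0ℚ) ≡ 1ℚ
      lem = solve-∀ ℚ-ring

    𝔼-bernoulli : ∀ p l u → 𝔼 (bernoulliD p l u) 𝟙 ≡ p
    𝔼-bernoulli p l u = lem p
      where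
      lem : ∀ p → p * 1ℚ + ((1ℚ - p) * 0ℚ + 0ℚ) ≡ p
      lem = solve-∀ ℚ-ring

    𝔼-point : ∀ {A : Set} (x : A) f → 𝔼 (pointD x) f ≡ f x
    𝔼-point x f = trans (+-identityʳ _) (*-identityˡ (f x))

    𝔼-bind : ∀ {A B : Set} (d : Dist A) (k : A → Dist B) f → 𝔼 (bindD d k) f ≡ 𝔼 d (λ x → 𝔼 (k x) f)
    𝔼-bind d k f = weigh-bind (pts d) (pts ∘ k) f

    𝔼-tilt : ∀ {A : Set} (d : Dist A) r nr pos f → 𝔼 (tiltD d r nr pos) f ≡ inv (𝔼 d r) * 𝔼 d (λ x → r x * f x)
    𝔼-tilt d r nr pos f = trans (∑-map _ (pts d) _) (trans (∑-cong (pts d) (λ wx → re (inv (𝔼 d r)) (proj₁ wx) (r (proj₂ wx)) (f (proj₂ wx)))) (∑-* (pts d) (inv (𝔼 d r)) _))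
      where
      re : ∀ i w r f → (i * (w * r)) * f ≡ i * (w * (r * f))
      re = solve-∀ ℚ-ring

    𝔼-uniform : ∀ {A : Set} (x : A) xs f → 𝔼 (uniformD x xs) f ≡ inv (ℕ→ℚ (suc (length xs))) * ∑ (x ∷ xs) f
    𝔼-uniform x xs f = trans (∑-map (inv (ℕ→ℚ (suc (length xs))) ,_) (x ∷ xs) (λ wx → proj₁ wx * f (proj₂ wx))) (∑-* (x ∷ xs) (inv (ℕ→ℚ (suc (length xs)))) f)


    𝔼-cong : ∀ {A : Set} (d : Dist A) → ∀ {f g : A → ℚ} → (∀ x → f x ≡ g x) → 𝔼 d f ≡ 𝔼 d g
    𝔼-cong d e = ∑-cong (pts d) (λ wx → cong (proj₁ wx *_) (e (proj₂ wx)))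

    𝔼-mono : ∀ {A : Set} (d : Dist A) → ∀ {f g : A → ℚ} → (∀ x → f x ≤ g x) → 𝔼 d f ≤ 𝔼 d g
    𝔼-mono d {f} {g} le = go (nn d)
      where
      go : ∀ {l} → NN l → weigh l f ≤ weigh l g
      go []       = ≤-refl
      go {(w , x) ∷ l} (p ∷ ps) = +-mono-≤ (*-monoˡ w p (le x)) (go ps)

    𝔼-+ : ∀ {A : Set} (d : Dist A) → ∀ (f g : A → ℚ) → 𝔼 d (λ x → f x + g x) ≡ 𝔼 d f + 𝔼 d g
    𝔼-+ d f g = trans (∑-cong (pts d) (λ wx → *-distribˡ-+ (proj₁ wx) (f (proj₂ wx)) (g (proj₂ wx)))) (∑-+ (pts d) _ _)

    𝔼-* : ∀ {A : Set} (d : Dist A) → ∀ c (f : A → ℚ) → 𝔼 d (λ x → c * f x) ≡ c * 𝔼 d f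
    𝔼-* d c f = trans (∑-cong (pts d) (λ wx → left-comm (proj₁ wx) c (f (proj₂ wx)))) (∑-* (pts d) c _)

    𝔼-const : ∀ {A : Set} (d : Dist A) → ∀ c → 𝔼 d (λ _ → c) ≡ c
    𝔼-const d c = trans (trans (∑-cong (pts d) (λ wx → trans (cong (proj₁ wx *_) (sym (*-identityʳ c))) (left-comm (proj₁ wx) c 1ℚ))) (∑-* (pts d) c (λ wx → proj₁ wx * 1ℚ)))
      (trans (cong (c *_) (tot d)) (*-identityʳ c))

    𝔼-swap : ∀ {A : Set} (d : Dist A) → ∀ {B : Set} (e : Dist B) (f : A → B → ℚ) → 𝔼 d (λ x → 𝔼 e (f x)) ≡ 𝔼 e (λ y → 𝔼 d (λ x → f x y))
    𝔼-swap d e f = trans (∑-cong (pts d) (λ wx → sym (∑-* (pts e) (proj₁ wx) _)))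
      (trans (∑-swap (pts d) (pts e) (λ wx vy → proj₁ wx * (proj₁ vy * f (proj₂ wx) (proj₂ vy))))
      (∑-cong (pts e) (λ vy → trans (∑-cong (pts d) (λ wx → left-comm (proj₁ wx) (proj₁ vy) _)) (∑-* (pts d) (proj₁ vy) _))))

    𝔼-∑ : ∀ {A : Set} (d : Dist A) → ∀ {B : Set} (ys : List B) (f : A → B → ℚ) → 𝔼 d (λ x → ∑ ys (f x)) ≡ ∑ ys (λ y → 𝔼 d (λ x → f x y))
    𝔼-∑ d ys f = trans (∑-cong (pts d) (λ wx → sym (∑-* ys (proj₁ wx) _))) (∑-swap (pts d) ys _)

    -- x carries positive mass; phrased through expectations so that weights stay hidden.
    Charged : ∀ {A : Set} → Dist A → A → Set
    Charged d x = ∀ r → (∀ y → 0ℚ ≤ r y) → 0ℚ < r x → 0ℚ < 𝔼 d r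

    private
      weigh-nonneg : ∀ {A : Set} (r : A → ℚ) → (∀ y → 0ℚ ≤ r y) → ∀ {l} → NN l → 0ℚ ≤ weigh l r
      weigh-nonneg r nr []       = ≤-refl
      weigh-nonneg r nr {(w , x) ∷ l} (p ∷ ps) = +-nonneg (*-nonneg p (nr x)) (weigh-nonneg r nr ps)

    charged⇒positive : ∀ {A : Set} (d : Dist A) → ∀ {x} r → Charged d x → (∀ y → 0ℚ ≤ r y) → 0ℚ < r x → 0ℚ < 𝔼 d r
    charged⇒positive d r ch = ch r

    -- Points of weight 0 contribute nothing. The recursion carries along that the remaining part of
    -- the list never outweighs `d`, which is why a point of positive weight found there is charged
    -- in `d`.
    𝔼-cong-charged : ∀ {A : Set} (d : Dist A) → ∀ {f g : A → ℚ} → (∀ x → Charged d x → f x ≡ g x) → 𝔼 d f ≡ 𝔼 d g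
    𝔼-cong-charged d {f} {g} e = go (pts d) (nn d) (λ r nr → ≤-refl)
      where
      go : ∀ l → NN l → (∀ r → (∀ y → 0ℚ ≤ r y) → weigh l r ≤ 𝔼 d r) → weigh l f ≡ weigh l g
      go []            []       below = refl
      go ((w , x) ∷ l) (p ∷ ps) below = cong₂ _+_ head (go l ps λ r nr → ≤-trans (subst (_≤ w * r x + weigh l r) (+-identityˡ (weigh l r)) (+-monoˡ-≤ (weigh l r) (*-nonneg p (nr x)))) (below r nr))
        where
        head : w * f x ≡ w * g x
        head with 0≤⇒0≡⊎0< p
        ... | inj₁ refl = trans (*-zeroˡ (f x)) (sym (*-zeroˡ (g x)))
        ... | inj₂ 0<w  = cong (w *_) (e x λ r nr 0<rx → <-≤-trans (+-pos-nonneg (*-pos 0<w 0<rx) (weigh-nonneg r nr ps)) (below r nr))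

    𝔼-positive⇒∃ : ∀ {A : Set} (d : Dist A) → ∀ (f : A → ℚ) → 0ℚ < 𝔼 d f → ∃[ x ] 0ℚ < f x
    𝔼-positive⇒∃ d f = go (pts d) (nn d)
      where
      go : ∀ l → NN l → 0ℚ < weigh l f → ∃[ x ] 0ℚ < f x
      go [] [] 0<0 = contradiction refl (<⇒≢ 0<0)
      go ((w , x) ∷ l) (p ∷ ps) lt with 0ℚ <? f x
      ... | yes 0<fx = x , 0<fx
      ... | no  0≮fx = go l ps (<-≤-trans lt (subst (w * f x + weigh l f ≤_) (+-identityˡ (weigh l f)) (+-monoˡ-≤ (weigh l f) (subst (w * f x ≤_) (*-zeroʳ w) (*-monoˡ w p (≮⇒≥ 0≮fx))))))

    charged-uniform : ∀ {A : Set} (x : A) xs y → ∃[ l ] ∃[ r ] x ∷ xs ≡ l ++ y ∷ r → Charged (uniformD x xs) y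
    charged-uniform x xs y (l , r , eq) f nf 0<fy = subst (0ℚ <_) (sym (𝔼-uniform x xs f))
      (*-pos (inv-pos (ℕ→ℚ-pos (length xs))) (subst (λ z → 0ℚ < ∑ z f) (sym eq) (subst (0ℚ <_) (sym (∑-++ l (y ∷ r) f))
        (subst (_< ∑ l f + ∑ (y ∷ r) f) (+-identityˡ 0ℚ) (+-mono-≤-< (∑-nonneg l nf) (+-pos-nonneg 0<fy (∑-nonneg r nf)))))))

    charged-bind : ∀ {A B : Set} (d : Dist A) (k : A → Dist B) x y → Charged d x → Charged (k x) y → Charged (bindD d k) y
    charged-bind d k x y cx cy r nr 0<ry = subst (0ℚ <_) (sym (𝔼-bind d k r))
      (cx (λ x → 𝔼 (k x) r) (λ x → subst (_≤ 𝔼 (k x) r) (𝔼-const (k x) 0ℚ) (𝔼-mono (k x) nr)) (cy r nr 0<ry))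

    charged-point : ∀ {A : Set} (x : A) → Charged (pointD x) x
    charged-point x r nr 0<rx = subst (0ℚ <_) (sym (𝔼-point x r)) 0<rx

  module _ {A : Set} (d : Dist A) where

    private
      sub-eq : ∀ a b → a + (- 1ℚ) * b ≡ a - b
      sub-eq = solve-∀ ℚ-ring

    𝔼-*ʳ : ∀ c f → 𝔼 d (λ x → f x * c) ≡ 𝔼 d f * c
    𝔼-*ʳ c f = trans (𝔼-cong d (λ x → *-comm (f x) c)) (trans (𝔼-* d c f) (*-comm c (𝔼 d f)))

    𝔼-- : ∀ f g → 𝔼 d (λ x → f x - g x) ≡ 𝔼 d f - 𝔼 d g
    𝔼-- f g = trans (𝔼-cong d (λ x → sym (sub-eq (f x) (g x)))) (trans (𝔼-+ d f _) (trans (cong (𝔼 d f +_) (𝔼-* d (- 1ℚ) g)) (sub-eq (𝔼 d f) (𝔼 d g))))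

    𝔼-nonneg : ∀ {f} → (∀ x → 0ℚ ≤ f x) → 0ℚ ≤ 𝔼 d f
    𝔼-nonneg {f} nf = subst (_≤ 𝔼 d f) (𝔼-const d 0ℚ) (𝔼-mono d nf)

    𝔼-≤const : ∀ {f c} → (∀ x → f x ≤ c) → 𝔼 d f ≤ c
    𝔼-≤const {f} {c} le = subst (𝔼 d f ≤_) (𝔼-const d c) (𝔼-mono d le)

    𝔼-abs : ∀ (f : A → ℚ) → ∣ 𝔼 d f ∣ ≤ 𝔼 d (λ x → ∣ f x ∣)
    𝔼-abs f = ∣x∣-elim (𝔼 d f) (𝔼-mono d (λ x → x≤∣x∣ (f x)))
      (subst (_≤ 𝔼 d (λ x → ∣ f x ∣)) (trans (𝔼-* d (- 1ℚ) f) (neg1 (𝔼 d f))) (𝔼-mono d (λ x → subst (_≤ ∣ f x ∣) (sym (neg1 (f x))) (-x≤∣x∣ (f x)))))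
      where
      neg1 : ∀ a → (- 1ℚ) * a ≡ - a
      neg1 = solve-∀ ℚ-ring

    -- Bounds a first moment by a second moment: `am-gm` averaged over the distribution, then
    -- divided by `2t`.
    𝔼-abs-by-square : ∀ {t} (f : A → ℚ) → 0ℚ < t → 𝔼 d (λ x → f x * f x) ≤ t * t → 𝔼 d (λ x → ∣ f x ∣) ≤ t
    𝔼-abs-by-square {t} f 0<t le = *-cancelˡ ((1ℚ + 1ℚ) * t) (*-pos (positive⁻¹ (1ℚ + 1ℚ)) 0<t) (begin
      (1ℚ + 1ℚ) * t * 𝔼 d (λ x → ∣ f x ∣)         ≡⟨ sym (𝔼-* d ((1ℚ + 1ℚ) * t) _) ⟩
      𝔼 d (λ x → (1ℚ + 1ℚ) * t * ∣ f x ∣)         ≤⟨ 𝔼-mono d (λ x → am-gm t (f x)) ⟩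
      𝔼 d (λ x → t * t + f x * f x)               ≡⟨ trans (𝔼-+ d _ _) (cong (_+ 𝔼 d (λ x → f x * f x)) (𝔼-const d (t * t))) ⟩
      t * t + 𝔼 d (λ x → f x * f x)               ≤⟨ +-monoʳ-≤ (t * t) le ⟩
      t * t + t * t                              ≡⟨ dbl t ⟩
      (1ℚ + 1ℚ) * t * t                           ∎)
      where
      open ≤-Reasoning
      dbl : ∀ t → t * t + t * t ≡ (1ℚ + 1ℚ) * t * t
      dbl = solve-∀ ℚ-ring

  mapD : ∀ {A B : Set} → (A → B) → Dist A → Dist B
  mapD g d = bindD d (pointD ∘ g)

  𝔼-map : ∀ {A B : Set} (g : A → B) (d : Dist A) f → 𝔼 (mapD g d) f ≡ 𝔼 d (f ∘ g)
  𝔼-map g d f = trans (𝔼-bind d (pointD ∘ g) f) (𝔼-cong d (λ x → 𝔼-point (g x) f))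

  abstract
    ΠD : ∀ {A : Set} {q} → Vec (Dist A) q → Dist (Vec A q)
    ΠD []       = pointD []
    ΠD (d ∷ ds) = bindD d (λ x → mapD (x ∷_) (ΠD ds))

    𝔼-Π[] : ∀ {A : Set} (f : Vec A 0 → ℚ) → 𝔼 (ΠD []) f ≡ f []
    𝔼-Π[] f = 𝔼-point [] f

    𝔼-Π∷ : ∀ {A : Set} {q} (d : Dist A) (ds : Vec (Dist A) q) f → 𝔼 (ΠD (d ∷ ds)) f ≡ 𝔼 d (λ x → 𝔼 (ΠD ds) (λ xs → f (x ∷ xs)))
    𝔼-Π∷ d ds f = trans (𝔼-bind d (λ x → mapD (x ∷_) (ΠD ds)) f) (𝔼-cong d (λ x → 𝔼-map (x ∷_) (ΠD ds) f))

    charged-Π : ∀ {A : Set} {q} (ds : Vec (Dist A) q) xs → (∀ i → Charged (lookup ds i) (lookup xs i)) → Charged (ΠD ds) xs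
    charged-Π []       []       ch = charged-point []
    charged-Π (d ∷ ds) (x ∷ xs) ch = charged-bind d (λ x → mapD (x ∷_) (ΠD ds)) x (x ∷ xs) (ch zero) (charged-bind (ΠD ds) (λ ys → pointD (x ∷ ys)) xs (x ∷ xs) (charged-Π ds xs (ch ∘ suc)) (charged-point (x ∷ xs)))

  𝔼-Π-pull : ∀ {A : Set} {q} (ds : Vec (Dist A) (suc q)) j f →
    𝔼 (ΠD ds) f ≡ 𝔼 (lookup ds j) (λ x → 𝔼 (ΠD (removeAt ds j)) (λ xs → f (insertAt xs j x)))
  𝔼-Π-pull (d ∷ ds) zero f = 𝔼-Π∷ d ds f
  𝔼-Π-pull (d ∷ ds@(_ ∷ _)) (suc j) f = begin
    𝔼 (ΠD (d ∷ ds)) f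
      ≡⟨ 𝔼-Π∷ d ds f ⟩
    𝔼 d (λ y → 𝔼 (ΠD ds) (λ xs → f (y ∷ xs)))
      ≡⟨ 𝔼-cong d (λ y → 𝔼-Π-pull ds j (λ xs → f (y ∷ xs))) ⟩
    𝔼 d (λ y → 𝔼 (lookup ds j) (λ x → 𝔼 (ΠD (removeAt ds j)) (λ xs → f (y ∷ insertAt xs j x))))
      ≡⟨ 𝔼-swap d (lookup ds j) _ ⟩
    𝔼 (lookup ds j) (λ x → 𝔼 d (λ y → 𝔼 (ΠD (removeAt ds j)) (λ xs → f (y ∷ insertAt xs j x))))
      ≡⟨ 𝔼-cong (lookup ds j) (λ x → sym (𝔼-Π∷ d (removeAt ds j) (λ xs → f (insertAt xs (suc j) x)))) ⟩
    𝔼 (lookup ds j) (λ x → 𝔼 (ΠD (d ∷ removeAt ds j)) (λ xs → f (insertAt xs (suc j) x))) ∎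
    where open ≡-Reasoning

  private
    lookup-insertAt : ∀ {A : Set} {q} (xs : Vec A q) j x {i} (j≢i : j ≢ i) → lookup (insertAt xs j x) i ≡ lookup xs (punchOut j≢i)
    lookup-insertAt xs j x {i} j≢i = trans (cong (lookup (insertAt xs j x)) (sym (Finₚ.punchIn-punchOut j≢i))) (Vecₚ.insertAt-punchIn xs j x (punchOut j≢i))

  -- Injectivity of `ι` makes the selected coordinates independent. The coordinate `ι zero` is
  -- pulled to the front; the other selected indices avoid it and are renumbered by `punchOut`.
  𝔼-marginal : ∀ {A : Set} {q r} (ds : Vec (Dist A) q) (ι : Fin r → Fin q) → (∀ {i j} → ι i ≡ ι j → i ≡ j) → ∀ f →
    𝔼 (ΠD ds) (λ xs → f (tabulate (λ i → lookup xs (ι i)))) ≡ 𝔼 (ΠD (tabulate (λ i → lookup ds (ι i)))) f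
  𝔼-marginal {r = zero} ds ι inj f = trans (𝔼-const (ΠD ds) (f [])) (sym (𝔼-Π[] f))
  𝔼-marginal {q = zero} {suc r} ds ι inj f with ι zero
  ... | ()
  𝔼-marginal {q = suc q} {suc r} ds ι inj f = begin
    𝔼 (ΠD ds) (λ xs → f (tabulate (λ i → lookup xs (ι i))))
      ≡⟨ 𝔼-Π-pull ds j _ ⟩
    𝔼 (lookup ds j) (λ x → 𝔼 (ΠD (removeAt ds j)) (λ xs → f (tabulate (λ i → lookup (insertAt xs j x) (ι i)))))
      ≡⟨ 𝔼-cong (lookup ds j) (λ x → 𝔼-cong (ΠD (removeAt ds j)) (λ xs → cong f (cong₂ _∷_ (Vecₚ.insertAt-lookup xs j x)
           (Vecₚ.tabulate-cong (λ i → lookup-insertAt xs j x (j≢ i)))))) ⟩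
    𝔼 (lookup ds j) (λ x → 𝔼 (ΠD (removeAt ds j)) (λ xs → f (x ∷ tabulate (λ i → lookup xs (ι′ i)))))
      ≡⟨ 𝔼-cong (lookup ds j) (λ x → 𝔼-marginal (removeAt ds j) ι′ ι′-inj (λ ys → f (x ∷ ys))) ⟩
    𝔼 (lookup ds j) (λ x → 𝔼 (ΠD (tabulate (λ i → lookup (removeAt ds j) (ι′ i)))) (λ ys → f (x ∷ ys)))
      ≡⟨ 𝔼-cong (lookup ds j) (λ x → cong (λ es → 𝔼 (ΠD es) (λ ys → f (x ∷ ys))) (Vecₚ.tabulate-cong (λ i → Vecₚ.removeAt-punchOut ds (j≢ i)))) ⟩
    𝔼 (lookup ds j) (λ x → 𝔼 (ΠD (tabulate (λ i → lookup ds (ι (suc i))))) (λ ys → f (x ∷ ys)))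
      ≡⟨ sym (𝔼-Π∷ (lookup ds j) _ f) ⟩
    𝔼 (ΠD (tabulate (λ i → lookup ds (ι i)))) f ∎
    where
    open ≡-Reasoning
    j = ι zero
    j≢ : ∀ i → j ≢ ι (suc i)
    j≢ i e with inj e
    ... | ()
    ι′ : Fin r → Fin q
    ι′ i = punchOut (j≢ i)
    ι′-inj : ∀ {i i′} → ι′ i ≡ ι′ i′ → i ≡ i′
    ι′-inj {i} {i′} e = Finₚ.suc-injective (inj (Finₚ.punchOut-injective (j≢ i) (j≢ i′) e))

  𝔼-Π-++ : ∀ {A : Set} {q r} (ds : Vec (Dist A) q) (es : Vec (Dist A) r) f →
    𝔼 (ΠD (ds Vec.++ es)) f ≡ 𝔼 (ΠD ds) (λ xs → 𝔼 (ΠD es) (λ ys → f (xs Vec.++ ys)))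
  𝔼-Π-++ []       es f = sym (𝔼-Π[] _)
  𝔼-Π-++ (d ∷ ds) es f = trans (𝔼-Π∷ d (ds Vec.++ es) f) (trans (𝔼-cong d (λ x → 𝔼-Π-++ ds es (λ zs → f (x ∷ zs)))) (sym (𝔼-Π∷ d ds _)))

open Expectation

-- Conditional expectation and energy

infix 4 _≟ᵇ_
_≟ᵇ_ : ∀ {q} → DecidableEquality (Vec Bool q)
_≟ᵇ_ = Vecₚ.≡-dec Boolₚ._≟_

-- Plays the part of a σ-algebra whose atoms are the fibres of `see`.
record Obs (A : Set) : Set₁ where
  field
    Value : Set
    _≟ᵛ_  : DecidableEquality Value
    see   : A → Value

_≈[_]_ : ∀ {A : Set} → A → Obs A → A → Set
x ≈[ o ] y = Obs.see o x ≡ Obs.see o y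

Measurable : ∀ {A : Set} → Obs A → (A → ℚ) → Set
Measurable o f = ∀ {x y} → x ≈[ o ] y → f x ≡ f y

module Conditional {A : Set} (d : Dist A) (o : Obs A) where
  open Obs o

  at : Value → A → ℚ
  at b y = 𝟙 (does (see y ≟ᵛ b))

  at-nonneg : ∀ b y → 0ℚ ≤ at b y
  at-nonneg b y = 𝟙-nonneg (does (see y ≟ᵛ b))

  at-self : ∀ x → at (see x) x ≡ 1ℚ
  at-self x = cong 𝟙 (dec-true (see x ≟ᵛ see x) refl)

  mass : Value → ℚ
  mass b = 𝔼 d (at b)

  mass-nonneg : ∀ b → 0ℚ ≤ mass b
  mass-nonneg b = 𝔼-nonneg d (at-nonneg b)

  mass-charged : ∀ {x} → Charged d x → 0ℚ < mass (see x)
  mass-charged {x} ch = charged⇒positive d (at (see x)) ch (at-nonneg (see x)) (subst (0ℚ <_) (sym (at-self x)) 0<1)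

  -- Junk value: 0 if o never shows b.
  cexp : (A → ℚ) → Value → ℚ
  cexp g b = inv (mass b) * 𝔼 d (λ y → at b y * g y)

  CE : (A → ℚ) → A → ℚ
  CE g x = cexp g (see x)

  CE-measurable : ∀ g → Measurable o (CE g)
  CE-measurable g e = cong (cexp g) e

  cexp-nonneg : ∀ {g} → (∀ x → 0ℚ ≤ g x) → ∀ b → 0ℚ ≤ cexp g b
  cexp-nonneg ng b = *-nonneg (inv-nonneg (mass-nonneg b)) (𝔼-nonneg d (λ y → *-nonneg (at-nonneg b y) (ng y)))

  cexp-≤1 : ∀ {g} → (∀ x → g x ≤ 1ℚ) → ∀ b → cexp g b ≤ 1ℚ
  cexp-≤1 {g} g≤1 b with 0≤⇒0≡⊎0< (mass-nonneg b)
  ... | inj₁ m≡0 = subst (λ z → inv z * 𝔼 d (λ y → at b y * g y) ≤ 1ℚ) (sym m≡0) (subst (_≤ 1ℚ) (sym (trans (cong (_* 𝔼 d (λ y → at b y * g y)) inv-zero) (*-zeroˡ (𝔼 d (λ y → at b y * g y))))) 0≤1)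
  ... | inj₂ 0<m = subst (cexp g b ≤_) (trans (*-comm (inv (mass b)) (mass b)) (inv-inverse 0<m))
        (*-monoˡ (inv (mass b)) (<⇒≤ (inv-pos 0<m)) (𝔼-mono d (λ y → *≤ˡ (at-nonneg b y) (g≤1 y))))

  private
    move : ∀ (g Φ : A → ℚ) → Measurable o Φ → ∀ x y →
      at (see x) y * g y * (inv (mass (see x)) * Φ x) ≡ at (see y) x * (g y * (inv (mass (see y)) * Φ y))
    move g Φ m x y with see y ≟ᵛ see x | see x ≟ᵛ see y
    ... | yes e | yes _ = trans (cong₂ (λ u v → 1ℚ * g y * (inv (mass u) * v)) (sym e) (m (sym e))) (*-assoc 1ℚ (g y) _)
    ... | no _  | no _  = trans (cong (_* (inv (mass (see x)) * Φ x)) (*-zeroˡ (g y))) (trans (*-zeroˡ (inv (mass (see x)) * Φ x)) (sym (*-zeroˡ (g y * (inv (mass (see y)) * Φ y)))))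
    ... | yes e | no ¬e = contradiction (sym e) ¬e
    ... | no ¬e | yes e = contradiction (sym e) ¬e
    re : ∀ i s p → i * s * p ≡ s * (i * p)
    re = solve-∀ ℚ-ring
    re′ : ∀ m g i p → m * (g * (i * p)) ≡ (m * i) * (g * p)
    re′ = solve-∀ ℚ-ring

  -- Both sides are double expectations over `x` and `y` with the symmetric kernel `at (see x) y`.
  -- By `move`, `Φ` and the reciprocal mass may be evaluated at `y` instead of `x`, and then the
  -- kernel integrates to the mass of the class of `y`. The product of mass and reciprocal is 1 only
  -- at charged points, which suffices under an expectation.
  CE-projection : ∀ (g Φ : A → ℚ) → Measurable o Φ → 𝔼 d (λ x → CE g x * Φ x) ≡ 𝔼 d (λ x → g x * Φ x)
  CE-projection g Φ m = begin
    𝔼 d (λ x → CE g x * Φ x)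
      ≡⟨ 𝔼-cong d (λ x → trans (re (inv (mass (see x))) _ (Φ x)) (sym (𝔼-*ʳ d (inv (mass (see x)) * Φ x) (λ y → at (see x) y * g y)))) ⟩
    𝔼 d (λ x → 𝔼 d (λ y → at (see x) y * g y * (inv (mass (see x)) * Φ x)))
      ≡⟨ 𝔼-swap d d _ ⟩
    𝔼 d (λ y → 𝔼 d (λ x → at (see x) y * g y * (inv (mass (see x)) * Φ x)))
      ≡⟨ 𝔼-cong d (λ y → trans (𝔼-cong d (λ x → move g Φ m x y)) (𝔼-*ʳ d (g y * (inv (mass (see y)) * Φ y)) (at (see y)))) ⟩
    𝔼 d (λ y → mass (see y) * (g y * (inv (mass (see y)) * Φ y)))
      ≡⟨ 𝔼-cong-charged d (λ y ch → trans (re′ (mass (see y)) (g y) (inv (mass (see y))) (Φ y)) (trans (cong (_* (g y * Φ y)) (inv-inverse (mass-charged ch))) (*-identityˡ _))) ⟩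
    𝔼 d (λ y → g y * Φ y) ∎
    where open ≡-Reasoning

  energy : (A → ℚ) → ℚ
  energy g = 𝔼 d (λ x → CE g x * CE g x)

  energy-nonneg : ∀ g → 0ℚ ≤ energy g
  energy-nonneg g = 𝔼-nonneg d (λ x → sq-nonneg (CE g x))

  condD : ∀ b → 0ℚ < mass b → Dist A
  condD b pos = tiltD d (at b) (at-nonneg b) pos

  𝔼-condD : ∀ b pos f → 𝔼 (condD b pos) f ≡ cexp f b
  𝔼-condD b pos f = 𝔼-tilt d (at b) (at-nonneg b) pos f

Refines : ∀ {A : Set} → Obs A → Obs A → Set
Refines o o′ = ∀ {x y} → x ≈[ o ] y → x ≈[ o′ ] y

module Refinement {A : Set} (d : Dist A) (fine coarse : Obs A) (ref : Refines fine coarse) (g : A → ℚ) where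
  private
    module F = Conditional d fine
    module C = Conditional d coarse
    expand : ∀ f c → (f - c) * (f - c) ≡ (f * f - (1ℚ + 1ℚ) * (f * c)) + c * c
    expand = solve-∀ ℚ-ring
    collapse : ∀ f c → (f - (1ℚ + 1ℚ) * c) + c ≡ f - c
    collapse = solve-∀ ℚ-ring

  -- In the expanded square the projection property, used once for each observation, turns the mixed
  -- term into the coarse energy.
  pythagoras : 𝔼 d (λ x → (F.CE g x - C.CE g x) * (F.CE g x - C.CE g x)) ≡ F.energy g - C.energy g
  pythagoras = begin
    𝔼 d (λ x → (F.CE g x - C.CE g x) * (F.CE g x - C.CE g x))
      ≡⟨ 𝔼-cong d (λ x → expand (F.CE g x) (C.CE g x)) ⟩
    𝔼 d (λ x → (F.CE g x * F.CE g x - (1ℚ + 1ℚ) * (F.CE g x * C.CE g x)) + C.CE g x * C.CE g x)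
      ≡⟨ trans (𝔼-+ d _ _) (cong (_+ C.energy g) (trans (𝔼-- d _ _) (cong (λ z → F.energy g - z) (𝔼-* d (1ℚ + 1ℚ) _)))) ⟩
    (F.energy g - (1ℚ + 1ℚ) * 𝔼 d (λ x → F.CE g x * C.CE g x)) + C.energy g
      ≡⟨ cong (λ z → (F.energy g - (1ℚ + 1ℚ) * z) + C.energy g) (trans (F.CE-projection g (C.CE g) (C.CE-measurable g ∘ ref)) (sym (C.CE-projection g (C.CE g) (C.CE-measurable g)))) ⟩
    (F.energy g - (1ℚ + 1ℚ) * C.energy g) + C.energy g
      ≡⟨ collapse (F.energy g) (C.energy g) ⟩
    F.energy g - C.energy g ∎
    where open ≡-Reasoning

  energy-mono : C.energy g ≤ F.energy g
  energy-mono = 0≤-⇒≤ (subst (0ℚ ≤_) pythagoras (𝔼-nonneg d (λ x → sq-nonneg (F.CE g x - C.CE g x))))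

  -- Against a `fine`-measurable factor, `g` may be replaced by its fine conditional expectation at
  -- no cost. Passing on to the coarse one costs an L¹ distance that does not depend on `Φ`.
  decouple : ∀ Φ → Measurable fine Φ → (∀ x → 0ℚ ≤ Φ x) → (∀ x → Φ x ≤ 1ℚ) →
    ∣ 𝔼 d (λ x → g x * Φ x) - 𝔼 d (λ x → C.CE g x * Φ x) ∣ ≤ 𝔼 d (λ x → ∣ F.CE g x - C.CE g x ∣)
  decouple Φ m nΦ Φ≤1 = begin
    ∣ 𝔼 d (λ x → g x * Φ x) - 𝔼 d (λ x → C.CE g x * Φ x) ∣
      ≡⟨ cong (λ z → ∣ z - 𝔼 d (λ x → C.CE g x * Φ x) ∣) (sym (F.CE-projection g Φ m)) ⟩
    ∣ 𝔼 d (λ x → F.CE g x * Φ x) - 𝔼 d (λ x → C.CE g x * Φ x) ∣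
      ≡⟨ cong ∣_∣ (trans (sym (𝔼-- d _ _)) (𝔼-cong d (λ x → fac (F.CE g x) (C.CE g x) (Φ x)))) ⟩
    ∣ 𝔼 d (λ x → (F.CE g x - C.CE g x) * Φ x) ∣
      ≤⟨ 𝔼-abs d _ ⟩
    𝔼 d (λ x → ∣ (F.CE g x - C.CE g x) * Φ x ∣)
      ≤⟨ 𝔼-mono d (λ x → ≤-trans (≤-reflexive (trans (∣p*q∣≡∣p∣*∣q∣ (F.CE g x - C.CE g x) (Φ x)) (cong (∣ F.CE g x - C.CE g x ∣ *_) (0≤p⇒∣p∣≡p (nΦ x))))) (*≤ˡ (0≤∣p∣ (F.CE g x - C.CE g x)) (Φ≤1 x))) ⟩
    𝔼 d (λ x → ∣ F.CE g x - C.CE g x ∣) ∎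
    where
    open ≤-Reasoning
    fac : ∀ f c p → f * p - c * p ≡ (f - c) * p
    fac = solve-∀ ℚ-ring

∑-allSubsets-delta : ∀ {q} (c : Vec Bool q) (g : Vec Bool q → ℚ) → ∑ (allSubsets q) (λ b → 𝟙 (does (c ≟ᵇ b)) * g b) ≡ g c
∑-allSubsets-delta {zero} [] g = trans (+-identityʳ _) (*-identityˡ (g []))
∑-allSubsets-delta {suc q} (x ∷ c) g = trans (∑-++ (List.map (true ∷_) (allSubsets q)) _ _)
  (trans (cong₂ _+_ (∑-map (true ∷_) (allSubsets q) _) (∑-map (false ∷_) (allSubsets q) _)) (go x))
  where
  hit : ∀ y → ∑ (allSubsets q) (λ b → 𝟙 (does ((y ∷ c) ≟ᵇ (y ∷ b))) * g (y ∷ b)) ≡ g (y ∷ c)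
  hit y = trans (∑-cong (allSubsets q) (λ b → cong (λ z → 𝟙 z * g (y ∷ b)) (lem b))) (∑-allSubsets-delta c (g ∘ (y ∷_)))
    where
    lem : ∀ b → does ((y ∷ c) ≟ᵇ (y ∷ b)) ≡ does (c ≟ᵇ b)
    lem b = cong (_∧ does (c ≟ᵇ b)) (dec-true (y Boolₚ.≟ y) refl)
  miss : ∀ y z → y ≢ z → ∑ (allSubsets q) (λ b → 𝟙 (does ((y ∷ c) ≟ᵇ (z ∷ b))) * g (z ∷ b)) ≡ 0ℚ
  miss y z y≢z = trans (∑-cong (allSubsets q) (λ b → trans (cong (λ t → 𝟙 t * g (z ∷ b)) (dec-false ((y ∷ c) ≟ᵇ (z ∷ b)) (y≢z ∘ Vecₚ.∷-injectiveˡ))) (*-zeroˡ (g (z ∷ b))))) (∑-zero (allSubsets q))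
  go : ∀ x → ∑ (allSubsets q) (λ b → 𝟙 (does ((x ∷ c) ≟ᵇ (true ∷ b))) * g (true ∷ b)) + ∑ (allSubsets q) (λ b → 𝟙 (does ((x ∷ c) ≟ᵇ (false ∷ b))) * g (false ∷ b)) ≡ g (x ∷ c)
  go true  = trans (cong₂ _+_ (hit true) (miss true false λ ())) (+-identityʳ _)
  go false = trans (cong₂ _+_ (miss false true λ ()) (hit false)) (+-identityˡ _)

𝔼-by-values : ∀ {A : Set} {q} (d : Dist A) (τ : A → Vec Bool q) (f : A → Vec Bool q → ℚ) →
  𝔼 d (λ x → f x (τ x)) ≡ ∑ (allSubsets q) (λ b → 𝔼 d (λ x → 𝟙 (does (τ x ≟ᵇ b)) * f x b))
𝔼-by-values {q = q} d τ f = trans (𝔼-cong d (λ x → sym (∑-allSubsets-delta (τ x) (f x)))) (𝔼-∑ d (allSubsets q) (λ x b → 𝟙 (does (τ x ≟ᵇ b)) * f x b))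

markov : ∀ {A : Set} (d : Dist A) (f : A → ℚ) t → (∀ x → 0ℚ ≤ f x) → 0ℚ ≤ t → t * 𝔼 d (λ x → 𝟙 (does (t ≤? f x))) ≤ 𝔼 d f
markov d f t nf 0≤t = subst (_≤ 𝔼 d f) (𝔼-* d t _) (𝔼-mono d λ x → lem (nf x) (t ≤? f x))
  where
  lem : ∀ {y} → 0ℚ ≤ y → (D : Dec (t ≤ y)) → t * 𝟙 (does D) ≤ y
  lem {y} ny (yes le) = subst (_≤ y) (sym (*-identityʳ t)) le
  lem {y} ny (no _)   = subst (_≤ y) (sym (*-zeroʳ t)) ny

-- There are only finitely many values, so those of mass below κ contribute little.
small-mass : ∀ {A : Set} {q} (d : Dist A) (τ : A → Vec Bool q) κ → 0ℚ ≤ κ →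
  𝔼 d (λ x → 𝟙 (does (𝔼 d (λ y → 𝟙 (does (τ y ≟ᵇ τ x))) <? κ))) ≤ ℕ→ℚ (length (allSubsets q)) * κ
small-mass {q = q} d τ κ 0≤κ = subst (_≤ ℕ→ℚ (length (allSubsets q)) * κ) (sym (𝔼-by-values d τ (λ _ b → 𝟙 (does (m b <? κ)))))
  (≤-trans (∑-mono (allSubsets q) (λ b → bnd b (m b <? κ))) (≤-reflexive (∑-const (allSubsets q) κ)))
  where
  m : Vec Bool q → ℚ
  m b = 𝔼 d (λ y → 𝟙 (does (τ y ≟ᵇ b)))
  bnd : ∀ b (D : Dec (m b < κ)) → 𝔼 d (λ x → 𝟙 (does (τ x ≟ᵇ b)) * 𝟙 (does D)) ≤ κ
  bnd b (yes lt) = subst (_≤ κ) (sym (trans (𝔼-*ʳ d 1ℚ _) (*-identityʳ (m b)))) (<⇒≤ lt)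
  bnd b (no _)   = subst (_≤ κ) (sym (trans (𝔼-*ʳ d 0ℚ _) (*-zeroʳ (m b)))) 0≤κ

-- Index tuples, environments and resampling

vec-ext : ∀ {A : Set} {q} {xs ys : Vec A q} → (∀ i → lookup xs i ≡ lookup ys i) → xs ≡ ys
vec-ext {xs = xs} {ys} e = trans (sym (Vecₚ.tabulate∘lookup xs)) (trans (Vecₚ.tabulate-cong e) (Vecₚ.tabulate∘lookup ys))

infixl 9 _⟦_⟧
_⟦_⟧ : ∀ {A : Set} {q r} → Vec A q → Vec (Fin q) r → Vec A r
xs ⟦ ι ⟧ = Vec.map (lookup xs) ι

lookup-⟦⟧ : ∀ {A : Set} {q r} (xs : Vec A q) (ι : Vec (Fin q) r) i → lookup (xs ⟦ ι ⟧) i ≡ lookup xs (lookup ι i)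
lookup-⟦⟧ xs ι i = Vecₚ.lookup-map i (lookup xs) ι

⟦⟧-tabulate : ∀ {A : Set} {q r} (xs : Vec A q) (ι : Vec (Fin q) r) → tabulate (λ i → lookup xs (lookup ι i)) ≡ xs ⟦ ι ⟧
⟦⟧-tabulate xs ι = vec-ext (λ i → trans (Vecₚ.lookup∘tabulate _ i) (sym (lookup-⟦⟧ xs ι i)))

⟦⟧-assoc : ∀ {A : Set} {q r s} (xs : Vec A q) (ι : Vec (Fin q) r) (κ : Vec (Fin r) s) → xs ⟦ ι ⟧ ⟦ κ ⟧ ≡ xs ⟦ ι ⟦ κ ⟧ ⟧
⟦⟧-assoc xs ι κ = vec-ext (λ i → trans (lookup-⟦⟧ (xs ⟦ ι ⟧) κ i) (trans (lookup-⟦⟧ xs ι (lookup κ i)) (sym (trans (lookup-⟦⟧ xs (ι ⟦ κ ⟧) i) (cong (lookup xs) (lookup-⟦⟧ ι κ i))))))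

removeAt-map : ∀ {A B : Set} {q} (f : A → B) (xs : Vec A (suc q)) i → removeAt (Vec.map f xs) i ≡ Vec.map f (removeAt xs i)
removeAt-map f (x ∷ xs)        zero    = refl
removeAt-map f (x ∷ xs@(_ ∷ _)) (suc i) = cong (f x ∷_) (removeAt-map f xs i)

lookup-removeAt-punchIn : ∀ {A : Set} {q} (xs : Vec A (suc q)) i l → lookup (removeAt xs i) l ≡ lookup xs (punchIn i l)
lookup-removeAt-punchIn (x ∷ xs)         zero    l       = refl
lookup-removeAt-punchIn (x ∷ xs@(_ ∷ _)) (suc i) zero    = refl
lookup-removeAt-punchIn (x ∷ xs@(_ ∷ _)) (suc i) (suc l) = lookup-removeAt-punchIn xs i l

Injectiveᵛ : ∀ {A : Set} {r} → Vec A r → Set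
Injectiveᵛ ι = ∀ {i j} → lookup ι i ≡ lookup ι j → i ≡ j

-- Increasing tuples are the canonical representatives of r-element sets of indices.
Increasing : ∀ {M r} → Vec (Fin M) r → Set
Increasing s = ∀ p q → p Fin.< q → lookup s p Fin.< lookup s q

increasing? : ∀ {M r} (s : Vec (Fin M) r) → Dec (Increasing s)
increasing? s = Finₚ.all? λ p → Finₚ.all? λ q → dec→ (p Finₚ.<? q) (lookup s p Finₚ.<? lookup s q)
  where
  dec→ : ∀ {P Q : Set} → Dec P → Dec Q → Dec (P → Q)
  dec→ (no ¬p) _       = yes λ p → contradiction p ¬p
  dec→ (yes p) (yes q) = yes λ _ → q
  dec→ (yes p) (no ¬q) = no λ f → ¬q (f p)

increasing⇒injective : ∀ {M r} {s : Vec (Fin M) r} → Increasing s → Injectiveᵛ s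
increasing⇒injective {s = s} inc {i} {j} e with Finₚ.<-cmp i j
... | tri< i<j _ _ = contradiction (inc i j i<j) (Finₚ.<-irrefl e)
... | tri≈ _ i≡j _ = i≡j
... | tri> _ _ j<i = contradiction (inc j i j<i) (Finₚ.<-irrefl (sym e))

increasing-reflects : ∀ {M r} {s : Vec (Fin M) r} → Increasing s → ∀ {p q} → lookup s p Fin.< lookup s q → p Fin.< q
increasing-reflects {s = s} inc {p} {q} lt with Finₚ.<-cmp p q
... | tri< p<q _ _  = p<q
... | tri≈ _ refl _ = contradiction lt (Finₚ.<-irrefl refl)
... | tri> _ _ q<p  = contradiction lt (Finₚ.<-asym (inc q p q<p))

increasing-⟦⟧ : ∀ {M q r} {s : Vec (Fin M) q} {t : Vec (Fin q) r} → Increasing s → Increasing t → Increasing (s ⟦ t ⟧)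
increasing-⟦⟧ {s = s} {t} is it p q p<q = subst₂ Fin._<_ (sym (lookup-⟦⟧ s t p)) (sym (lookup-⟦⟧ s t q)) (is _ _ (it p q p<q))

punchIn-mono : ∀ {q} (i : Fin (suc q)) {p r} → p Fin.< r → punchIn i p Fin.< punchIn i r
punchIn-mono zero    p<r = ℕ.s≤s p<r
punchIn-mono (suc i) {zero}  {suc r} p<r = ℕ.s≤s ℕ.z≤n
punchIn-mono (suc i) {suc p} {suc r} p<r = ℕ.s≤s (punchIn-mono i (ℕ.s≤s⁻¹ p<r))

increasing-removeAt : ∀ {M q} {s : Vec (Fin M) (suc q)} → Increasing s → ∀ i → Increasing (removeAt s i)
increasing-removeAt {s = s} inc i p q p<q =
  subst₂ Fin._<_ (sym (lookup-removeAt-punchIn s i p)) (sym (lookup-removeAt-punchIn s i q)) (inc _ _ (punchIn-mono i p<q))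

abstract
  injective⇒surjective : ∀ {r} (f : Fin r → Fin r) → (∀ {i j} → f i ≡ f j → i ≡ j) → ∀ y → ∃[ x ] f x ≡ y
  injective⇒surjective {suc r} f inj y with Finₚ.any? (λ x → f x Finₚ.≟ y)
  ... | yes hit = hit
  ... | no miss = contradiction (Finₚ.injective⇒≤ {f = λ x → punchOut {i = y} {f x} (λ e → miss (x , sym e))}
          (λ {a} {b} e → inj (Finₚ.punchOut-injective (λ e → miss (a , sym e)) (λ e → miss (b , sym e)) e))) ℕₚ.1+n≰n

  -- Induction on `p`. Let `q` be a preimage of `p`. If `q < p`, then `f q ≡ q` by induction, a
  -- contradiction. If `p < q`, then `f p < p`, so `f (f p) ≡ f p` by induction and injectivity
  -- gives the claim.
  strictMono⇒id : ∀ {r} (f : Fin r → Fin r) → (∀ {p q} → p Fin.< q → f p Fin.< f q) → ∀ p → f p ≡ p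
  strictMono⇒id f mono p = go p (<-wellFounded p)
    where
    inj : ∀ {i j} → f i ≡ f j → i ≡ j
    inj {i} {j} e with Finₚ.<-cmp i j
    ... | tri< i<j _ _ = contradiction (mono i<j) (Finₚ.<-irrefl e)
    ... | tri≈ _ i≡j _ = i≡j
    ... | tri> _ _ j<i = contradiction (mono j<i) (Finₚ.<-irrefl (sym e))
    go : ∀ p → Acc Fin._<_ p → f p ≡ p
    go p (acc rec) with injective⇒surjective f inj p
    ... | q , fq≡p with Finₚ.<-cmp q p
    ...   | tri< q<p _ _  = contradiction (trans (sym (go q (rec q<p))) fq≡p) (λ e → Finₚ.<-irrefl e q<p)
    ...   | tri≈ _ refl _ = fq≡p
    ...   | tri> _ _ p<q  = inj (go (f p) (rec fp<p))
      where
      fp<p : f p Fin.< p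
      fp<p = subst (f p Fin.<_) fq≡p (mono p<q)

Covered : ∀ {M r} → Vec (Fin M) r → Fin M → Set
Covered s i = ∃[ l ] lookup s l ≡ i

covered? : ∀ {M r} (s : Vec (Fin M) r) i → Dec (Covered s i)
covered? s i = Finₚ.any? (λ l → lookup s l Finₚ.≟ i)

-- If every entry of `s′` occurred in `s`, sending positions in `s′` to positions in `s` would be
-- strictly monotone, hence the identity, and the tuples would agree. This is why, in the hybrid
-- arguments, every other edge or face has a vertex outside the one being replaced.
increasing-uncovered : ∀ {M r} {s s′ : Vec (Fin M) r} → Increasing s → Increasing s′ → s ≢ s′ → ∃[ p ] ¬ Covered s (lookup s′ p)
increasing-uncovered {r = r} {s} {s′} inc inc′ s≢s′ with Finₚ.any? (λ p → ¬? (covered? s (lookup s′ p)))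
... | yes found = found
... | no  none  = contradiction (vec-ext (λ p → trans (cong (lookup s) (sym (strictMono⇒id f f-mono p))) (proj₂ (cov p)))) s≢s′
  where
  cov : ∀ p → Covered s (lookup s′ p)
  cov p with covered? s (lookup s′ p)
  ... | yes c = c
  ... | no ¬c = contradiction (p , ¬c) none
  f : Fin r → Fin r
  f p = proj₁ (cov p)
  f-mono : ∀ {p q} → p Fin.< q → f p Fin.< f q
  f-mono {p} {q} p<q = increasing-reflects {s = s} inc (subst₂ Fin._<_ (sym (proj₂ (cov p))) (sym (proj₂ (cov q))) (inc′ p q p<q))

allVecs : ∀ {A : Set} → List A → ∀ k → List (Vec A k)
allVecs xs zero    = [] ∷ []
allVecs xs (suc k) = List.concatMap (λ x → List.map (x ∷_) (allVecs xs k)) xs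

∈-allVecs : ∀ {A : Set} {xs : List A} {k} (t : Vec A k) → (∀ i → lookup t i ∈ xs) → t ∈ allVecs xs k
∈-allVecs []      m = here refl
∈-allVecs {xs = xs} (x ∷ t) m = ∈ₚ.∈-concatMap⁺ (λ x → List.map (x ∷_) (allVecs xs _)) (Any.map (λ { refl → ∈ₚ.∈-map⁺ (x ∷_) (∈-allVecs t (m ∘ suc)) }) (m zero))

module _ {A B : Set} where

  map-fromList-≡ : ∀ {f g : A → B} {xs : List A} {x} → Vec.map f (Vec.fromList xs) ≡ Vec.map g (Vec.fromList xs) → x ∈ xs → f x ≡ g x
  map-fromList-≡ e (here refl) = Vecₚ.∷-injectiveˡ e
  map-fromList-≡ e (there m)   = map-fromList-≡ (Vecₚ.∷-injectiveʳ e) m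

-- In an index type `I ⊎ E` the left summand names coordinates of the tuple under observation and
-- the right summand names vertices of the environment.
IsEnv : ∀ {I E : Set} → I ⊎ E → Set
IsEnv (inj₁ _) = ⊥
IsEnv (inj₂ _) = ⊤

isEnv? : ∀ {I E : Set} (x : I ⊎ E) → Dec (IsEnv x)
isEnv? (inj₁ _) = no λ ()
isEnv? (inj₂ _) = yes tt

One Two : ∀ {I : Set} {k} → (I → Set) → Vec I k → Set
One Ev t = ∃[ p ] Ev (lookup t p)
Two Ev t = ∃[ p ] ∃[ q ] (p ≢ q × Ev (lookup t p) × Ev (lookup t q))

one? : ∀ {I E : Set} {k} (t : Vec (I ⊎ E) k) → Dec (One IsEnv t)
one? t = Finₚ.any? (λ p → isEnv? (lookup t p))

two? : ∀ {I E : Set} {k} (t : Vec (I ⊎ E) k) → Dec (Two IsEnv t)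
two? t = Finₚ.any? (λ p → Finₚ.any? (λ q → ¬? (p Finₚ.≟ q) ×-dec isEnv? (lookup t p) ×-dec isEnv? (lookup t q)))

indices : ∀ {E : Set} K → List E → List (Fin K ⊎ E)
indices K es = List.map inj₁ (allFin K) ++ List.map inj₂ es

∈-indices : ∀ {E : Set} {K} {es : List E} → (∀ e → e ∈ es) → ∀ i → i ∈ indices K es
∈-indices c (inj₁ i) = ∈ₚ.∈-++⁺ˡ (∈ₚ.∈-map⁺ inj₁ (∈ₚ.∈-allFin i))
∈-indices {K = K} c (inj₂ e) = ∈ₚ.∈-++⁺ʳ (List.map inj₁ (allFin K)) (∈ₚ.∈-map⁺ inj₂ (c e))

envs : ∀ a b → List (Fin a ⊎ Fin b)
envs a b = indices a (allFin b)

∈-envs : ∀ {a b} i → i ∈ envs a b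
∈-envs = ∈-indices ∈ₚ.∈-allFin

assign : ∀ {V E : Set} {K} → Vec V K → (E → V) → Fin K ⊎ E → V
assign x w = [ lookup x , w ]′

-- While the coordinates in `T` are resampled all other coordinates are frozen, so these count as
-- environment vertices too.
Outside : ∀ {M r} {E : Set} → Vec (Fin M) r → Fin M ⊎ E → Set
Outside T (inj₁ i) = ¬ Covered T i
Outside T (inj₂ _) = ⊤

position : ∀ {M r} → Vec (Fin M) r → Fin M → Fin r ⊎ Fin M
position T i with covered? T i
... | yes (l , _) = inj₁ l
... | no _        = inj₂ i

position-inj₁ : ∀ {M r} (T : Vec (Fin M) r) i {l} → position T i ≡ inj₁ l → lookup T l ≡ i
position-inj₁ T i e with covered? T i
position-inj₁ T i refl | yes (l , p) = p

position-inj₂ : ∀ {M r} (T : Vec (Fin M) r) i {u} → position T i ≡ inj₂ u → u ≡ i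
position-inj₂ T i e with covered? T i
position-inj₂ T i refl | no _ = refl

position-injective : ∀ {M r} (T : Vec (Fin M) r) {i i′} → position T i ≡ position T i′ → i ≡ i′
position-injective T {i} {i′} e with position T i in p | position T i′ in p′
position-injective T refl | inj₁ l | inj₁ _ = trans (sym (position-inj₁ T _ p)) (position-inj₁ T _ p′)
position-injective T refl | inj₂ u | inj₂ _ = trans (sym (position-inj₂ T _ p)) (position-inj₂ T _ p′)
position-injective T () | inj₁ _ | inj₂ _
position-injective T () | inj₂ _ | inj₁ _

position-covered : ∀ {M r} (T : Vec (Fin M) r) → Injectiveᵛ T → ∀ l → position T (lookup T l) ≡ inj₁ l
position-covered T inj l with covered? T (lookup T l)
... | yes (l′ , p) = cong inj₁ (inj p)
... | no ¬c        = contradiction (l , refl) ¬c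

position-outside : ∀ {M r} (T : Vec (Fin M) r) {i} → ¬ Covered T i → position T i ≡ inj₂ i
position-outside T {i} ¬c with covered? T i
... | yes c = contradiction c ¬c
... | no _  = refl

splice : ∀ {V : Set} {M r} → Vec (Fin M) r → Vec V r → Vec V M → Vec V M
splice T x u = tabulate (λ i → assign x (lookup u) (position T i))

splice-⟦⟧ : ∀ {V : Set} {M r} (T : Vec (Fin M) r) → Injectiveᵛ T → (x : Vec V r) (u : Vec V M) → splice T x u ⟦ T ⟧ ≡ x
splice-⟦⟧ T inj x u = vec-ext (λ l → trans (lookup-⟦⟧ (splice T x u) T l) (trans (Vecₚ.lookup∘tabulate _ (lookup T l)) (cong (assign x (lookup u)) (position-covered T inj l))))

lookup-join : ∀ {V : Set} {r M} (x : Vec V r) (u : Vec V M) s → lookup (x Vec.++ u) (join r M s) ≡ assign x (lookup u) s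
lookup-join x u (inj₁ l) = Vecₚ.lookup-++ˡ x u l
lookup-join x u (inj₂ i) = Vecₚ.lookup-++ʳ x u i

join-injective : ∀ r M {s s′ : Fin r ⊎ Fin M} → join r M s ≡ join r M s′ → s ≡ s′
join-injective r M {s} {s′} e = trans (sym (Finₚ.splitAt-join r M s)) (trans (cong (Fin.splitAt r) e) (Finₚ.splitAt-join r M s′))

module Uniform {V : Set} (𝒰 : Dist V) where

  U : ∀ q → Dist (Vec V q)
  U q = ΠD (replicate q 𝒰)

  U-++ : ∀ p {q} (f : Vec V (p ℕ.+ q) → ℚ) → 𝔼 (U (p ℕ.+ q)) f ≡ 𝔼 (U p) (λ xs → 𝔼 (U q) (λ ys → f (xs Vec.++ ys)))
  U-++ zero    f = sym (𝔼-Π[] _)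
  U-++ (suc p) f = trans (𝔼-Π∷ 𝒰 _ f) (trans (𝔼-cong 𝒰 (λ x → U-++ p (λ xs → f (x ∷ xs)))) (sym (𝔼-Π∷ 𝒰 _ _)))

  U-charged : (∀ x → Charged 𝒰 x) → ∀ {q} (xs : Vec V q) → Charged (U q) xs
  U-charged ch {q} xs = charged-Π (replicate q 𝒰) xs (λ i → subst (λ d → Charged d (lookup xs i)) (sym (Vecₚ.lookup-replicate i 𝒰)) (ch (lookup xs i)))

  U-marginal : ∀ {q r} (ι : Fin r → Fin q) → (∀ {i j} → ι i ≡ ι j → i ≡ j) → (f : Vec V r → ℚ) →
    𝔼 (U q) (λ xs → f (tabulate (λ i → lookup xs (ι i)))) ≡ 𝔼 (U r) f
  U-marginal {q} {r} ι inj f = trans (𝔼-marginal (replicate q 𝒰) ι inj f) (cong (λ ds → 𝔼 (ΠD ds) f)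
    (vec-ext (λ i → trans (Vecₚ.lookup∘tabulate _ i) (trans (Vecₚ.lookup-replicate (ι i) 𝒰) (sym (Vecₚ.lookup-replicate i 𝒰))))))

  U-⟦⟧ : ∀ {q r} (ι : Vec (Fin q) r) → Injectiveᵛ ι → (f : Vec V r → ℚ) → 𝔼 (U q) (λ xs → f (xs ⟦ ι ⟧)) ≡ 𝔼 (U r) f
  U-⟦⟧ ι inj f = trans (𝔼-cong (U _) (λ xs → cong f (sym (⟦⟧-tabulate xs ι)))) (U-marginal (lookup ι) inj f)

  -- `position T` sends the coordinates of the spliced tuple injectively to the r + M independent
  -- coordinates of `x` and `u`, so the spliced tuple is again uniform.
  resample : ∀ {M r} (T : Vec (Fin M) r) (g : Vec V M → ℚ) → 𝔼 (U M) g ≡ 𝔼 (U M) (λ u → 𝔼 (U r) (λ x → g (splice T x u)))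
  resample {M} {r} T g = sym (begin
    𝔼 (U M) (λ u → 𝔼 (U r) (λ x → g (splice T x u)))
      ≡⟨ 𝔼-swap (U M) (U r) _ ⟩
    𝔼 (U r) (λ x → 𝔼 (U M) (λ u → g (splice T x u)))
      ≡⟨ 𝔼-cong (U r) (λ x → 𝔼-cong (U M) (λ u → cong g (Vecₚ.tabulate-cong (λ i → sym (lookup-join x u (position T i)))))) ⟩
    𝔼 (U r) (λ x → 𝔼 (U M) (λ u → g (tabulate (λ i → lookup (x Vec.++ u) (join r M (position T i))))))
      ≡⟨ sym (U-++ r _) ⟩
    𝔼 (U (r ℕ.+ M)) (λ z → g (tabulate (λ i → lookup z (join r M (position T i)))))
      ≡⟨ U-marginal (join r M ∘ position T) (position-injective T ∘ join-injective r M) g ⟩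
    𝔼 (U M) g ∎)
    where open ≡-Reasoning

  module _ {M r : ℕ} (T : Vec (Fin M) r) (T-inj : Injectiveᵛ T) (fine : Vec V M → Obs (Vec V r)) (coarse : Obs (Vec V r))
           (ref : ∀ u → Refines (fine u) coarse) (g : Vec V r → ℚ) (Φ : Vec V M → ℚ)
           (nΦ : ∀ v → 0ℚ ≤ Φ v) (Φ≤1 : ∀ v → Φ v ≤ 1ℚ) (meas : ∀ u → Measurable (fine u) (λ x → Φ (splice T x u))) where

    -- The coordinates in `T` are resampled as `x` with the others frozen at `u`. The factor `Φ` is
    -- then a function of `fine u`, so `Refinement.decouple` applies for each `u` separately.
    decouple-at : ∣ 𝔼 (U M) (λ v → g (v ⟦ T ⟧) * Φ v) - 𝔼 (U M) (λ v → Conditional.CE (U r) coarse g (v ⟦ T ⟧) * Φ v) ∣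
      ≤ 𝔼 (U M) (λ u → 𝔼 (U r) (λ x → ∣ Conditional.CE (U r) (fine u) g x - Conditional.CE (U r) coarse g x ∣))
    decouple-at = begin
      ∣ 𝔼 (U M) (λ v → g (v ⟦ T ⟧) * Φ v) - 𝔼 (U M) (λ v → c (v ⟦ T ⟧) * Φ v) ∣
        ≡⟨ cong₂ (λ p q → ∣ p - q ∣) (unfold g) (unfold c) ⟩
      ∣ 𝔼 (U M) (λ u → 𝔼 (U r) (λ x → g x * Φ (splice T x u))) - 𝔼 (U M) (λ u → 𝔼 (U r) (λ x → c x * Φ (splice T x u))) ∣
        ≡⟨ cong ∣_∣ (sym (𝔼-- (U M) _ _)) ⟩
      ∣ 𝔼 (U M) (λ u → 𝔼 (U r) (λ x → g x * Φ (splice T x u)) - 𝔼 (U r) (λ x → c x * Φ (splice T x u))) ∣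
        ≤⟨ 𝔼-abs (U M) _ ⟩
      𝔼 (U M) (λ u → ∣ 𝔼 (U r) (λ x → g x * Φ (splice T x u)) - 𝔼 (U r) (λ x → c x * Φ (splice T x u)) ∣)
        ≤⟨ 𝔼-mono (U M) (λ u → Refinement.decouple (U r) (fine u) coarse (ref u) g (λ x → Φ (splice T x u)) (meas u) (λ x → nΦ (splice T x u)) (λ x → Φ≤1 (splice T x u))) ⟩
      𝔼 (U M) (λ u → 𝔼 (U r) (λ x → ∣ Conditional.CE (U r) (fine u) g x - c x ∣)) ∎
      where
      open ≤-Reasoning
      c : Vec V r → ℚ
      c = Conditional.CE (U r) coarse g
      unfold : ∀ (f : Vec V r → ℚ) → 𝔼 (U M) (λ v → f (v ⟦ T ⟧) * Φ v) ≡ 𝔼 (U M) (λ u → 𝔼 (U r) (λ x → f x * Φ (splice T x u)))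
      unfold f = trans (resample T (λ v → f (v ⟦ T ⟧) * Φ v)) (𝔼-cong (U M) (λ u → 𝔼-cong (U r) (λ x → cong (λ z → f z * Φ (splice T x u)) (splice-⟦⟧ T T-inj x u))))

-- Observing a hypergraph through an environment

-- A symmetric k-ary relation is observed (k = suc j) through its values on tuples that mix unknown
-- coordinates with the vertices of an environment.
module Observation {n : ℕ} (j : ℕ) (Hv : Vec (Fin n) (suc j) → Bool) where

  V : Set
  V = Fin n

  k : ℕ
  k = suc j

  Same₁ Same₂ : ∀ {I : Set} → (I → Set) → (I → V) → (I → V) → Set
  Same₁ Ev y y′ = ∀ (t : Vec _ k) → One Ev t → Hv (Vec.map y t) ≡ Hv (Vec.map y′ t)
  Same₂ Ev y y′ = ∀ (t : Vec _ k) → Two Ev t → Hv (Vec.map y t) ≡ Hv (Vec.map y′ t)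

  module _ {I₁ I₂ : Set} {y₁ y₁′ : I₁ → V} {y₂ y₂′ : I₂ → V} (Ev₁ : I₁ → Set) (Ev₂ : I₂ → Set)
           (g : I₁ → I₂) (env : ∀ i → Ev₁ i → Ev₂ (g i)) (e : ∀ i → y₂ (g i) ≡ y₁ i) (e′ : ∀ i → y₂′ (g i) ≡ y₁′ i) where

    private
      move : ∀ (t : Vec I₁ k) → Hv (Vec.map y₂ (Vec.map g t)) ≡ Hv (Vec.map y₂′ (Vec.map g t)) → Hv (Vec.map y₁ t) ≡ Hv (Vec.map y₁′ t)
      move t eq = trans (cong Hv (sym (trans (sym (Vecₚ.map-∘ y₂ g t)) (Vecₚ.map-cong e t)))) (trans eq (cong Hv (trans (sym (Vecₚ.map-∘ y₂′ g t)) (Vecₚ.map-cong e′ t))))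
      env-map : ∀ (t : Vec I₁ k) p → Ev₁ (lookup t p) → Ev₂ (lookup (Vec.map g t) p)
      env-map t p ev = subst Ev₂ (sym (Vecₚ.lookup-map p g t)) (env (lookup t p) ev)

    -- What is known about one family of vertices passes to any family that can be re-read inside it
    -- with environment indices going to environment indices. The later comparisons of environments
    -- are instances for suitable maps `g`.
    transfer₁ : Same₁ Ev₂ y₂ y₂′ → Same₁ Ev₁ y₁ y₁′
    transfer₁ same t (p , ev) = move t (same (Vec.map g t) (p , env-map t p ev))

    transfer₂ : Same₂ Ev₂ y₂ y₂′ → Same₂ Ev₁ y₁ y₁′
    transfer₂ same t (p , q , p≢q , ev , ev′) = move t (same (Vec.map g t) (p , q , p≢q , env-map t p ev , env-map t q ev′))

  module Info (K : ℕ) {E : Set} (es : List E) (complete : ∀ e → e ∈ es) where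

    abstract
      width : ℕ
      width = length (allVecs (indices K es) k)

      -- The number of recorded bits depends on `K`, `k` and the size of the environment, not on the
      -- hypergraph. Constants chosen before the hypergraph may therefore refer to it.
      width≡ : width ≡ length (allVecs (indices K es) k)
      width≡ = refl

      info : (Vec (Fin K ⊎ E) k → Bool) → (Fin K ⊎ E → V) → Vec Bool width
      info P y = Vec.map (λ t → P t ∧ Hv (Vec.map y t)) (Vec.fromList (allVecs (indices K es) k))

      info-sound : ∀ {P y y′} → info P y ≡ info P y′ → ∀ t → P t ≡ true → Hv (Vec.map y t) ≡ Hv (Vec.map y′ t)
      info-sound {P} {y} {y′} eq t Pt = trans (cong (_∧ Hv (Vec.map y t)) (sym Pt)) (trans (map-fromList-≡ eq (∈-allVecs t (λ i → ∈-indices complete (lookup t i)))) (cong (_∧ Hv (Vec.map y′ t)) Pt))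

      info-complete : ∀ {P y y′} → (∀ t → P t ≡ true → Hv (Vec.map y t) ≡ Hv (Vec.map y′ t)) → info P y ≡ info P y′
      info-complete {P} {y} {y′} same = Vecₚ.map-cong (λ t → go t (P t) refl) (Vec.fromList (allVecs (indices K es) k))
        where
        go : ∀ t b → P t ≡ b → b ∧ Hv (Vec.map y t) ≡ b ∧ Hv (Vec.map y′ t)
        go t true  e = same t e
        go t false e = refl

  private
    does-true : ∀ {P : Set} (D : Dec P) → does D ≡ true → P
    does-true (yes p) _ = p

  module LowInfo K a b = Info K (envs a b) ∈-envs
  module FullInfo a = Info j (allFin a) ∈ₚ.∈-allFin

  env : ∀ {a b} → Vec V a → Vec V b → Fin a ⊎ Fin b → V
  env A B = assign A (lookup B)

  low : ∀ {K a b} → Vec V a → Vec V b → Vec V K → Vec Bool (LowInfo.width K a b)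
  low {K} {a} {b} A B x = LowInfo.info K a b (does ∘ two?) (assign x (env A B))

  Top : ℕ → Set
  Top a = Vec Bool (FullInfo.width a)

  -- Tops look at `A` only: they have to stay the same when vertices are added to `B`.
  full : ∀ {a} → Vec V a → Vec V j → Top a
  full {a} A z = FullInfo.info a (does ∘ one?) (assign z (lookup A))

  low-sound : ∀ {K a b} {A : Vec V a} {B : Vec V b} {x x′ : Vec V K} → low A B x ≡ low A B x′ → Same₂ IsEnv (assign x (env A B)) (assign x′ (env A B))
  low-sound {K} {a} {b} eq t two = LowInfo.info-sound K a b eq t (dec-true (two? t) two)

  low-complete : ∀ {K a b} {A : Vec V a} {B : Vec V b} {x x′ : Vec V K} → Same₂ IsEnv (assign x (env A B)) (assign x′ (env A B)) → low A B x ≡ low A B x′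
  low-complete {K} {a} {b} same = LowInfo.info-complete K a b (λ t e → same t (does-true (two? t) e))

  full-sound : ∀ {a} {A : Vec V a} {x x′ : Vec V j} → full A x ≡ full A x′ → Same₁ IsEnv (assign x (lookup A)) (assign x′ (lookup A))
  full-sound {a} eq t one = FullInfo.info-sound a eq t (dec-true (one? t) one)

  full-complete : ∀ {a} {A : Vec V a} {x x′ : Vec V j} → Same₁ IsEnv (assign x (lookup A)) (assign x′ (lookup A)) → full A x ≡ full A x′
  full-complete {a} same = FullInfo.info-complete a (λ t e → same t (does-true (one? t) e))

  lowObs : ∀ K {a b} → Vec V a → Vec V b → Obs (Vec V K)
  lowObs K A B = record { _≟ᵛ_ = _≟ᵇ_ ; see = low A B }

  faces : ∀ {a} → Vec V a → Vec V k → Vec (Top a) k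
  faces A x = tabulate (λ i → full A (removeAt x i))

  cellObs : ∀ {a b} → Vec V a → Vec V b → Obs (Vec V k)
  cellObs A B = record { _≟ᵛ_ = Productₚ.≡-dec _≟ᵇ_ (Vecₚ.≡-dec _≟ᵇ_) ; see = λ x → low A B x , faces A x }

  abstract
    -- A k-tuple containing an environment vertex misses some coordinate, so it is seen by one of the faces.
    missing : ∀ {E : Set} (t : Vec (Fin k ⊎ E) k) → One IsEnv t → ∃[ i ] (∀ p → lookup t p ≢ inj₁ i)
    missing {E} t (p₀ , ev) with Finₚ.any? (λ i → Finₚ.all? (λ p → not-inj₁ (lookup t p) i))
      where
      not-inj₁ : ∀ (x : Fin k ⊎ E) i → Dec (x ≢ inj₁ i)
      not-inj₁ (inj₂ e) i = yes λ ()
      not-inj₁ (inj₁ l) i with l Finₚ.≟ i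
      ... | yes refl = no λ f → f refl
      ... | no l≢i   = yes λ { refl → l≢i refl }
    ... | yes found = found
    ... | no  none  = contradiction (trans (sym (proj₂ (hit i₀))) (trans (cong (lookup t) hit-p₀) eq)) λ { refl → ⊥-elim (subst IsEnv (trans (cong (lookup t) (sym hit-p₀)) (proj₂ (hit i₀))) ev) }
      where
      hit : ∀ i → ∃[ p ] lookup t p ≡ inj₁ i
      hit i with Finₚ.any? (λ p → is-inj₁ (lookup t p))
        where
        is-inj₁ : ∀ (x : Fin k ⊎ E) → Dec (x ≡ inj₁ i)
        is-inj₁ (inj₂ e) = no λ ()
        is-inj₁ (inj₁ l) with l Finₚ.≟ i
        ... | yes refl = yes refl
        ... | no l≢i   = no λ { refl → l≢i refl }
      ... | yes h = h
      ... | no ¬h = contradiction (i , λ p e → ¬h (p , e)) none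
      surj : ∃[ i ] proj₁ (hit i) ≡ p₀
      surj = injective⇒surjective (proj₁ ∘ hit) (λ {i} {i′} e → inj₁-inj (trans (sym (proj₂ (hit i))) (trans (cong (lookup t) e) (proj₂ (hit i′))))) p₀
        where
        inj₁-inj : ∀ {i i′ : Fin k} → _≡_ {A = Fin k ⊎ E} (inj₁ i) (inj₁ i′) → i ≡ i′
        inj₁-inj refl = refl
      i₀ : Fin k
      i₀ = proj₁ surj
      hit-p₀ : proj₁ (hit i₀) ≡ p₀
      hit-p₀ = proj₂ surj
      eq : lookup t p₀ ≡ inj₁ i₀
      eq = trans (cong (lookup t) (sym hit-p₀)) (proj₂ (hit i₀))

  faces⇒Same₁ : ∀ {a} {A : Vec V a} {x x′ : Vec V k} → faces A x ≡ faces A x′ → Same₁ IsEnv (assign x (lookup A)) (assign x′ (lookup A))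
  faces⇒Same₁ {a} {A} {x} {x′} eq t one with missing t one
  ... | i , miss = trans (cong Hv (agree x)) (trans (full-sound {A = A} {removeAt x i} {removeAt x′ i} eqᵢ t′ one′) (cong Hv (sym (agree x′))))
    where
    eqᵢ : full A (removeAt x i) ≡ full A (removeAt x′ i)
    eqᵢ = trans (sym (Vecₚ.lookup∘tabulate (λ i → full A (removeAt x i)) i)) (trans (cong (λ z → lookup z i) eq) (Vecₚ.lookup∘tabulate (λ i → full A (removeAt x′ i)) i))
    shrink : ∀ (s : Fin k ⊎ Fin a) → s ≢ inj₁ i → Fin j ⊎ Fin a
    shrink (inj₁ l) ne = inj₁ (punchOut {i = i} {l} (λ e → ne (cong inj₁ (sym e))))
    shrink (inj₂ e) ne = inj₂ e
    t′ : Vec (Fin j ⊎ Fin a) k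
    t′ = tabulate (λ p → shrink (lookup t p) (miss p))
    shrink-ev : ∀ (x : Vec V k) s ne → assign x (lookup A) s ≡ assign (removeAt x i) (lookup A) (shrink s ne)
    shrink-ev x (inj₁ l) ne = sym (Vecₚ.removeAt-punchOut x _)
    shrink-ev x (inj₂ e) ne = refl
    agree : ∀ x → Vec.map (assign x (lookup A)) t ≡ Vec.map (assign (removeAt x i) (lookup A)) t′
    agree x = vec-ext (λ p → trans (Vecₚ.lookup-map p _ t) (trans (shrink-ev x (lookup t p) (miss p)) (sym (trans (Vecₚ.lookup-map p _ t′) (cong (assign (removeAt x i) (lookup A)) (Vecₚ.lookup∘tabulate (λ p → shrink (lookup t p) (miss p)) p))))))
    one′ : One IsEnv t′
    one′ = proj₁ one , subst IsEnv (sym (Vecₚ.lookup∘tabulate (λ p → shrink (lookup t p) (miss p)) (proj₁ one))) (keep (lookup t (proj₁ one)) (miss (proj₁ one)) (proj₂ one))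
      where
      keep : ∀ s ne → IsEnv s → IsEnv (shrink s ne)
      keep (inj₂ _) ne _ = tt

  Same₁⇒faces : ∀ {a} {A : Vec V a} {x x′ : Vec V k} → Same₁ IsEnv (assign x (lookup A)) (assign x′ (lookup A)) → faces A x ≡ faces A x′
  Same₁⇒faces {a} {A} {x} {x′} same = Vecₚ.tabulate-cong (λ i → full-complete {A = A} {removeAt x i} {removeAt x′ i} (transfer₁ {y₂ = assign x (lookup A)} {assign x′ (lookup A)} IsEnv IsEnv (grow i) (λ { (inj₂ _) _ → tt }) (λ s → ok x i s) (λ s → ok x′ i s) same))
    where
    grow : Fin k → Fin j ⊎ Fin a → Fin k ⊎ Fin a
    grow i (inj₁ l) = inj₁ (punchIn i l)
    grow i (inj₂ e) = inj₂ e
    ok : ∀ x i s → assign x (lookup A) (grow i s) ≡ assign (removeAt x i) (lookup A) s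
    ok x i (inj₁ l) = sym (lookup-removeAt-punchIn x i l)
    ok x i (inj₂ e) = refl

  module _ {M a b : ℕ} (A : Vec V a) (B : Vec V b) where

    -- v and v′ cannot be told apart at the coordinates T by anything that does not mention all of T.
    Rel₁ : Vec (Fin M) k → Vec V M → Vec V M → Set
    Rel₁ T v v′ = Same₂ (Outside T) (assign v (env A B)) (assign v′ (env A B)) × Same₁ (Outside T) (assign v (lookup A)) (assign v′ (lookup A))

    Rel₂ : Vec (Fin M) j → Vec V M → Vec V M → Set
    Rel₂ s v v′ = Same₂ (Outside s) (assign v (env A B)) (assign v′ (env A B))

    private
      place : ∀ {K} {E : Set} → Vec (Fin M) K → Fin K ⊎ E → Fin M ⊎ E
      place R (inj₁ l) = inj₁ (lookup R l)
      place R (inj₂ e) = inj₂ e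

      place-ev : ∀ {K} {E : Set} (R : Vec (Fin M) K) v (w : E → V) i → assign v w (place R i) ≡ assign (v ⟦ R ⟧) w i
      place-ev R v w (inj₁ l) = sym (lookup-⟦⟧ v R l)
      place-ev R v w (inj₂ e) = refl

      place-env : ∀ {K r} {E : Set} (R : Vec (Fin M) K) (T : Vec (Fin M) r) (i : Fin K ⊎ E) → IsEnv i → Outside T (place R i)
      place-env R T (inj₂ e) _ = tt

    -- Valid for every `R`, even `R = T`: the two environment entries of a recorded tuple lie
    -- outside any `T`.
    low-invariant : ∀ {K r} (R : Vec (Fin M) K) (T : Vec (Fin M) r) {v v′} → Same₂ (Outside T) (assign v (env A B)) (assign v′ (env A B)) → low A B (v ⟦ R ⟧) ≡ low A B (v′ ⟦ R ⟧)
    low-invariant R T {v} {v′} same = low-complete {A = A} {B} {v ⟦ R ⟧} {v′ ⟦ R ⟧} (transfer₂ {y₂ = assign v (env A B)} {assign v′ (env A B)} IsEnv (Outside T) (place R) (place-env R T) (place-ev R v _) (place-ev R v′ _) same)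

    faces-invariant : ∀ T R {v v′} → Rel₁ T v v′ → faces A (v ⟦ R ⟧) ≡ faces A (v′ ⟦ R ⟧)
    faces-invariant T R {v} {v′} (_ , same) = Same₁⇒faces {A = A} {v ⟦ R ⟧} {v′ ⟦ R ⟧} (transfer₁ {y₂ = assign v (lookup A)} {assign v′ (lookup A)} IsEnv (Outside T) (place R) (place-env R T) (place-ev R v _) (place-ev R v′ _) same)

    -- A coordinate of `R` not covered by `T` is an outside entry, so the edge at `R` is itself one
    -- of the tuples compared by `Same₁`.
    edge-invariant : ∀ T R {v v′} → ∃[ p ] ¬ Covered T (lookup R p) → Rel₁ T v v′ → Hv (v ⟦ R ⟧) ≡ Hv (v′ ⟦ R ⟧)
    edge-invariant T R {v} {v′} (p , ¬c) (_ , same) = trans (cong Hv (agree v)) (trans (same (Vec.map inj₁ R) (p , subst (Outside T) (sym (Vecₚ.lookup-map p inj₁ R)) ¬c)) (cong Hv (sym (agree v′))))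
      where
      agree : ∀ v → v ⟦ R ⟧ ≡ Vec.map (assign v (lookup A)) (Vec.map inj₁ R)
      agree v = Vecₚ.map-∘ (assign v (lookup A)) inj₁ R

    module _ (Hv-repeat : ∀ y {p q} → p ≢ q → lookup y p ≡ lookup y q → Hv y ≡ false) where

      full-invariant : ∀ s s′ {v v′} → ∃[ p ] ¬ Covered s (lookup s′ p) → Rel₂ s v v′ → full A (v ⟦ s′ ⟧) ≡ full A (v′ ⟦ s′ ⟧)
      full-invariant s s′ {v} {v′} (l₀ , ¬c) same = full-complete {A = A} {v ⟦ s′ ⟧} {v′ ⟦ s′ ⟧} go
        where
        lift : Fin j ⊎ Fin a → Fin M ⊎ (Fin a ⊎ Fin b)
        lift (inj₁ l) = inj₁ (lookup s′ l)
        lift (inj₂ e) = inj₂ (inj₁ e)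
        lift-ev : ∀ v i → assign v (env A B) (lift i) ≡ assign (v ⟦ s′ ⟧) (lookup A) i
        lift-ev v (inj₁ l) = sym (lookup-⟦⟧ v s′ l)
        lift-ev v (inj₂ e) = refl
        agree : ∀ v (t : Vec _ k) → Vec.map (assign (v ⟦ s′ ⟧) (lookup A)) t ≡ Vec.map (assign v (env A B)) (Vec.map lift t)
        agree v t = sym (trans (sym (Vecₚ.map-∘ (assign v (env A B)) lift t)) (Vecₚ.map-cong (lift-ev v) t))
        -- send the environment to the uncovered coordinate: a collision is either a repetition or a second outside vertex
        squash : Fin j ⊎ Fin a → Fin j
        squash (inj₁ l) = l
        squash (inj₂ e) = l₀
        out : ∀ x → squash x ≡ l₀ → Outside s (lift x)
        out (inj₁ l) refl = ¬c
        out (inj₂ e) _    = tt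
        repeated : ∀ (t : Vec _ k) {p q} → p ≢ q → lookup t p ≡ lookup t q → Hv (Vec.map (assign (v ⟦ s′ ⟧) (lookup A)) t) ≡ Hv (Vec.map (assign (v′ ⟦ s′ ⟧) (lookup A)) t)
        repeated t {p} {q} p≢q e = trans (rep v) (sym (rep v′))
          where
          rep : ∀ v → Hv (Vec.map (assign (v ⟦ s′ ⟧) (lookup A)) t) ≡ false
          rep v = Hv-repeat _ p≢q (trans (Vecₚ.lookup-map p _ t) (trans (cong (assign (v ⟦ s′ ⟧) (lookup A)) e) (sym (Vecₚ.lookup-map q _ t))))
        outside² : ∀ (t : Vec _ k) {p q} → p ≢ q → Outside s (lift (lookup t p)) → Outside s (lift (lookup t q)) → Hv (Vec.map (assign (v ⟦ s′ ⟧) (lookup A)) t) ≡ Hv (Vec.map (assign (v′ ⟦ s′ ⟧) (lookup A)) t)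
        outside² t {p} {q} p≢q o o′ = trans (cong Hv (agree v t)) (trans (same (Vec.map lift t) (p , q , p≢q , subst (Outside s) (sym (Vecₚ.lookup-map p lift t)) o , subst (Outside s) (sym (Vecₚ.lookup-map q lift t)) o′)) (cong Hv (sym (agree v′ t))))
        go : Same₁ IsEnv (assign (v ⟦ s′ ⟧) (lookup A)) (assign (v′ ⟦ s′ ⟧) (lookup A))
        go t _ with Finₚ.pigeonhole (ℕₚ.n<1+n j) (λ p → squash (lookup t p))
        ... | p , q , p<q , e with lookup t p in tp | lookup t q in tq
        ...   | inj₁ l | inj₁ l′ = repeated t (λ { refl → Finₚ.<-irrefl refl p<q }) (trans tp (trans (cong inj₁ e) (sym tq)))
        ...   | inj₁ l | inj₂ e′ = outside² t (λ { refl → Finₚ.<-irrefl refl p<q }) (subst (Outside s ∘ lift) (sym tp) (out (inj₁ l) e)) (subst (Outside s ∘ lift) (sym tq) tt)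
        ...   | inj₂ e′ | inj₁ l = outside² t (λ { refl → Finₚ.<-irrefl refl p<q }) (subst (Outside s ∘ lift) (sym tp) tt) (subst (Outside s ∘ lift) (sym tq) (out (inj₁ l) (sym e)))
        ...   | inj₂ e′ | inj₂ e″ = outside² t (λ { refl → Finₚ.<-irrefl refl p<q }) (subst (Outside s ∘ lift) (sym tp) tt) (subst (Outside s ∘ lift) (sym tq) tt)

    private
      -- re-reads an index of v = splice T x u as an index of x over the environment extended by u
      frame : ∀ {r} {E E′ : Set} → Vec (Fin M) r → (Fin M → E′) → (E → E′) → Fin M ⊎ E → Fin r ⊎ E′
      frame T new old (inj₁ i) = [ inj₁ , inj₂ ∘ new ]′ (position T i)
      frame T new old (inj₂ e) = inj₂ (old e)

      frame-env : ∀ {r} {E E′ : Set} (T : Vec (Fin M) r) (new : Fin M → E′) (old : E → E′) i → Outside T i → IsEnv (frame T new old i)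
      frame-env T new old (inj₁ i) ¬c rewrite position-outside T ¬c = tt
      frame-env T new old (inj₂ e) _ = tt

      frame-ev : ∀ {r} {E E′ : Set} (T : Vec (Fin M) r) (new : Fin M → E′) (old : E → E′) (x : Vec V r) (u : Vec V M) (w : E → V) (w′ : E′ → V) →
        (∀ i → w′ (new i) ≡ lookup u i) → (∀ e → w′ (old e) ≡ w e) → ∀ i → assign x w′ (frame T new old i) ≡ assign (splice T x u) w i
      frame-ev T new old x u w w′ hn ho (inj₁ i) = trans (go (position T i)) (sym (Vecₚ.lookup∘tabulate _ i))
        where
        go : ∀ s → assign x w′ ([ inj₁ , inj₂ ∘ new ]′ s) ≡ assign x (lookup u) s
        go (inj₁ l) = refl
        go (inj₂ i) = hn i
      frame-ev T new old x u w w′ hn ho (inj₂ e) = ho e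

    cell-fine⇒Rel₁ : ∀ T (u : Vec V M) {x x′} → x ≈[ cellObs (u Vec.++ A) B ] x′ → Rel₁ T (splice T x u) (splice T x′ u)
    cell-fine⇒Rel₁ T u {x} {x′} eq =
        transfer₂ (Outside T) IsEnv (frame T new old) (frame-env T new old) (λ i → frame-ev T new old x u _ _ hn ho i) (λ i → frame-ev T new old x′ u _ _ hn ho i) (low-sound {A = u Vec.++ A} {B} {x} {x′} (cong proj₁ eq))
      , transfer₁ (Outside T) IsEnv (frame T (_↑ˡ a) (M ↑ʳ_)) (frame-env T (_↑ˡ a) (M ↑ʳ_)) (λ i → frame-ev T (_↑ˡ a) (M ↑ʳ_) x u _ _ (Vecₚ.lookup-++ˡ u A) (Vecₚ.lookup-++ʳ u A) i) (λ i → frame-ev T (_↑ˡ a) (M ↑ʳ_) x′ u _ _ (Vecₚ.lookup-++ˡ u A) (Vecₚ.lookup-++ʳ u A) i) (faces⇒Same₁ {A = u Vec.++ A} {x} {x′} (cong proj₂ eq))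
      where
      new : Fin M → Fin (M ℕ.+ a) ⊎ Fin b
      new i = inj₁ (i ↑ˡ a)
      old : Fin a ⊎ Fin b → Fin (M ℕ.+ a) ⊎ Fin b
      old (inj₁ l) = inj₁ (M ↑ʳ l)
      old (inj₂ l) = inj₂ l
      hn : ∀ i → env (u Vec.++ A) B (new i) ≡ lookup u i
      hn i = Vecₚ.lookup-++ˡ u A i
      ho : ∀ e → env (u Vec.++ A) B (old e) ≡ env A B e
      ho (inj₁ l) = Vecₚ.lookup-++ʳ u A l
      ho (inj₂ l) = refl

    low-fine⇒Rel₂ : ∀ s (u : Vec V M) {x x′} → x ≈[ lowObs j A (u Vec.++ B) ] x′ → Rel₂ s (splice s x u) (splice s x′ u)
    low-fine⇒Rel₂ s u {x} {x′} eq = transfer₂ (Outside s) IsEnv (frame s new old) (frame-env s new old) (λ i → frame-ev s new old x u _ _ hn ho i) (λ i → frame-ev s new old x′ u _ _ hn ho i) (low-sound {A = A} {u Vec.++ B} {x} {x′} eq)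
      where
      new : Fin M → Fin a ⊎ Fin (M ℕ.+ b)
      new i = inj₂ (i ↑ˡ b)
      old : Fin a ⊎ Fin b → Fin a ⊎ Fin (M ℕ.+ b)
      old (inj₁ l) = inj₁ l
      old (inj₂ l) = inj₂ (M ↑ʳ l)
      hn : ∀ i → env A (u Vec.++ B) (new i) ≡ lookup u i
      hn i = Vecₚ.lookup-++ˡ u B i
      ho : ∀ e → env A (u Vec.++ B) (old e) ≡ env A B e
      ho (inj₁ l) = refl
      ho (inj₂ l) = Vecₚ.lookup-++ʳ u B l

  widen : ∀ {K} {E E′ : Set} → (E → E′) → Fin K ⊎ E → Fin K ⊎ E′
  widen o (inj₁ l) = inj₁ l
  widen o (inj₂ e) = inj₂ (o e)

  private
    widen-env : ∀ {K} {E E′ : Set} (o : E → E′) (i : Fin K ⊎ E) → IsEnv i → IsEnv (widen o i)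
    widen-env o (inj₂ e) _ = tt
    widen-ev : ∀ {K} {E E′ : Set} (o : E → E′) (x : Vec V K) (w : E → V) (w′ : E′ → V) → (∀ e → w′ (o e) ≡ w e) → ∀ i → assign x w′ (widen o i) ≡ assign x w i
    widen-ev o x w w′ h (inj₁ l) = refl
    widen-ev o x w w′ h (inj₂ e) = h e

  low-refine : ∀ {K a b a′ b′} {A : Vec V a} {B : Vec V b} {A′ : Vec V a′} {B′ : Vec V b′} (o : Fin a ⊎ Fin b → Fin a′ ⊎ Fin b′) → (∀ e → env A′ B′ (o e) ≡ env A B e) → Refines (lowObs K A′ B′) (lowObs K A B)
  low-refine {A = A} {B} {A′} {B′} o h {x} {y} eq = low-complete {A = A} {B} {x} {y} (transfer₂ IsEnv IsEnv (widen o) (widen-env o) (widen-ev o x _ _ h) (widen-ev o y _ _ h) (low-sound {A = A′} {B′} {x} {y} eq))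

  cell-refine : ∀ {a b a′ b′} {A : Vec V a} {B : Vec V b} {A′ : Vec V a′} {B′ : Vec V b′} (o : Fin a ⊎ Fin b → Fin a′ ⊎ Fin b′) → (∀ e → env A′ B′ (o e) ≡ env A B e) →
    (o₁ : Fin a → Fin a′) → (∀ e → lookup A′ (o₁ e) ≡ lookup A e) → Refines (cellObs A′ B′) (cellObs A B)
  cell-refine {A = A} {B} {A′} {B′} o h o₁ h₁ {x} {y} eq = cong₂ _,_ (low-refine {A = A} {B} {A′} {B′} o h {x} {y} (cong proj₁ eq))
    (Same₁⇒faces {A = A} {x} {y} (transfer₁ IsEnv IsEnv (widen o₁) (widen-env o₁) (widen-ev o₁ x _ _ h₁) (widen-ev o₁ y _ _ h₁) (faces⇒Same₁ {A = A′} {x} {y} (cong proj₂ eq))))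

-- Hybrid arguments

∏ : ∀ {X : Set} → List X → (X → ℚ) → ℚ
∏ []       f = 1ℚ
∏ (x ∷ xs) f = f x * ∏ xs f

∏-nonneg : ∀ {X : Set} (xs : List X) {f} → (∀ x → 0ℚ ≤ f x) → 0ℚ ≤ ∏ xs f
∏-nonneg []       nf = 0≤1
∏-nonneg (x ∷ xs) nf = *-nonneg (nf x) (∏-nonneg xs nf)

∏-≤1 : ∀ {X : Set} (xs : List X) {f} → (∀ x → 0ℚ ≤ f x) → (∀ x → f x ≤ 1ℚ) → ∏ xs f ≤ 1ℚ
∏-≤1 []       nf f≤1 = ≤-refl
∏-≤1 (x ∷ xs) nf f≤1 = *-≤1 (nf x) (f≤1 x) (∏-≤1 xs nf f≤1)

∏-cong-∈ : ∀ {X : Set} (xs : List X) {f g : X → ℚ} → (∀ {x} → x ∈ xs → f x ≡ g x) → ∏ xs f ≡ ∏ xs g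
∏-cong-∈ []       e = refl
∏-cong-∈ (x ∷ xs) e = cong₂ _*_ (e (here refl)) (∏-cong-∈ xs (e ∘ there))

triangle : ∀ x y z → ∣ x - z ∣ ≤ ∣ x - y ∣ + ∣ y - z ∣
triangle x y z = subst (λ w → ∣ w ∣ ≤ ∣ x - y ∣ + ∣ y - z ∣) (lem x y z) (∣p+q∣≤∣p∣+∣q∣ (x - y) (y - z))
  where
  lem : ∀ x y z → (x - y) + (y - z) ≡ x - z
  lem = solve-∀ ℚ-ring

∣∑∣-≤ : ∀ {X : Set} (xs : List X) (f g : X → ℚ) {e : X → ℚ} → (∀ x → ∣ f x - g x ∣ ≤ e x) → ∣ ∑ xs f - ∑ xs g ∣ ≤ ∑ xs e
∣∑∣-≤ []       f g le = ≤-refl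
∣∑∣-≤ (x ∷ xs) f g {e} le = ≤-trans (subst (λ w → ∣ w ∣ ≤ ∣ f x - g x ∣ + ∣ ∑ xs f - ∑ xs g ∣) (lem (f x) (g x) (∑ xs f) (∑ xs g)) (∣p+q∣≤∣p∣+∣q∣ (f x - g x) (∑ xs f - ∑ xs g)))
  (+-mono-≤ (le x) (∣∑∣-≤ xs f g le))
  where
  lem : ∀ a b c d → (a - b) + (c - d) ≡ (a + c) - (b + d)
  lem = solve-∀ ℚ-ring

∣x-x∣≡0 : ∀ x → ∣ x - x ∣ ≡ 0ℚ
∣x-x∣≡0 x = trans (cong ∣_∣ (+-inverseʳ x)) (0≤p⇒∣p∣≡p ≤-refl)

suc-bound : ∀ q e → e + ℕ→ℚ q * e ≡ ℕ→ℚ (suc q) * e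
suc-bound q e = trans (cong (_+ ℕ→ℚ q * e) (sym (*-identityˡ e))) (trans (sym (*-distribʳ-+ e 1ℚ (ℕ→ℚ q))) (cong (_* e) (sym (ℕ→ℚ-suc q))))

module Hybrid {n : ℕ} (j : ℕ) (Hv : Vec (Fin n) (suc j) → Bool) (Hv-repeat : ∀ y {p q} → p ≢ q → lookup y p ≡ lookup y q → Hv y ≡ false)
              (𝒰 : Dist (Fin n)) (𝒰-charged : ∀ x → Charged 𝒰 x) where
  open Observation j Hv public
  open Uniform 𝒰 public

  edge : Vec V k → ℚ
  edge x = 𝟙 (Hv x)

  -- The conditional edge probability as a function of abstract data. The tops need not come from
  -- one tuple of vertices, since sampled tops will be inserted; combinations that never occur get
  -- the junk value 0.
  hat : ∀ {a b} → Vec V a → Vec V b → Vec Bool (LowInfo.width k a b) → Vec (Top a) k → ℚ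
  hat A B ℓ ps = Conditional.cexp (U k) (cellObs A B) edge (ℓ , ps)

  h : ∀ {a b} → Vec V a → Vec V b → Vec V k → ℚ
  h A B x = hat A B (low A B x) (faces A x)

  hat-nonneg : ∀ {a b} (A : Vec V a) (B : Vec V b) ℓ ps → 0ℚ ≤ hat A B ℓ ps
  hat-nonneg A B ℓ ps = Conditional.cexp-nonneg (U k) (cellObs A B) {edge} (λ x → 𝟙-nonneg (Hv x)) (ℓ , ps)

  hat-≤1 : ∀ {a b} (A : Vec V a) (B : Vec V b) ℓ ps → hat A B ℓ ps ≤ 1ℚ
  hat-≤1 A B ℓ ps = Conditional.cexp-≤1 (U k) (cellObs A B) {edge} (λ x → 𝟙-≤1 (Hv x)) (ℓ , ps)

  is : ∀ {a} → Vec V a → Top a → Vec V j → ℚ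
  is A p z = 𝟙 (does (full A z ≟ᵇ p))

  tops : ∀ a → List (Top a)
  tops a = allSubsets (FullInfo.width a)

  module Gaps {M a b : ℕ} (A : Vec V a) (B : Vec V b) where

    gap₁ : ℚ
    gap₁ = 𝔼 (U M) (λ u → 𝔼 (U k) (λ x → ∣ Conditional.CE (U k) (cellObs (u Vec.++ A) B) edge x - Conditional.CE (U k) (cellObs A B) edge x ∣))

    gap₂-at : Top a → ℚ
    gap₂-at p = 𝔼 (U M) (λ u → 𝔼 (U j) (λ x → ∣ Conditional.CE (U j) (lowObs j A (u Vec.++ B)) (is A p) x - Conditional.CE (U j) (lowObs j A B) (is A p) x ∣))

    gap₂ : ℚ
    gap₂ = ∑ (tops a) gap₂-at

    refine₁ : ∀ (u : Vec V M) → Refines (cellObs (u Vec.++ A) B) (cellObs A B)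
    refine₁ u {x} {y} = cell-refine {A = A} {B} {u Vec.++ A} {B} (λ { (inj₁ l) → inj₁ (M ↑ʳ l) ; (inj₂ l) → inj₂ l }) (λ { (inj₁ l) → Vecₚ.lookup-++ʳ u A l ; (inj₂ l) → refl }) (M ↑ʳ_) (Vecₚ.lookup-++ʳ u A) {x} {y}

    refine₂ : ∀ (u : Vec V M) → Refines (lowObs j A (u Vec.++ B)) (lowObs j A B)
    refine₂ u {x} {y} = low-refine {A = A} {B} {A} {u Vec.++ B} (λ { (inj₁ l) → inj₁ l ; (inj₂ l) → inj₂ (M ↑ʳ l) }) (λ { (inj₁ l) → refl ; (inj₂ l) → Vecₚ.lookup-++ʳ u B l }) {x} {y}

    h-invariant : ∀ T R {v v′ : Vec V M} → Rel₁ A B T v v′ → h A B (v ⟦ R ⟧) ≡ h A B (v′ ⟦ R ⟧)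
    h-invariant T R {v} {v′} rel = cong₂ (hat A B) (low-invariant A B R T {v} {v′} (proj₁ rel)) (faces-invariant A B T R {v} {v′} rel)

    -- Edges are replaced one at a time and the finished factors are collected in `P`. The edges
    -- still to come have a vertex outside `T`, and the finished factors depend on lower information
    -- and tops only. Both are invariant under `Rel₁` at `T`, so each replacement costs at most
    -- `gap₁`.
    edges-hybrid : (Ts : List (Vec (Fin M) k)) → All Increasing Ts → AllPairs _≢_ Ts → (P : Vec V M → ℚ) → (∀ v → 0ℚ ≤ P v) → (∀ v → P v ≤ 1ℚ) →
      (∀ {T} → T ∈ Ts → ∀ {v v′} → Rel₁ A B T v v′ → P v ≡ P v′) →
      ∣ 𝔼 (U M) (λ v → P v * ∏ Ts (λ T → edge (v ⟦ T ⟧))) - 𝔼 (U M) (λ v → P v * ∏ Ts (λ T → h A B (v ⟦ T ⟧))) ∣ ≤ ℕ→ℚ (length Ts) * gap₁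
    edges-hybrid [] _ _ P nP P≤1 inv = ≤-reflexive (trans (∣x-x∣≡0 (𝔼 (U M) (λ v → P v * 1ℚ))) (sym (*-zeroˡ gap₁)))
    edges-hybrid (T ∷ Ts) (incT ∷ incTs) (fresh ∷ distinct) P nP P≤1 invP = begin
      ∣ 𝔼 (U M) (λ v → P v * (edge (v ⟦ T ⟧) * ∏e v)) - 𝔼 (U M) (λ v → P v * (h A B (v ⟦ T ⟧) * ∏h v)) ∣
        ≡⟨ cong₂ (λ p q → ∣ p - q ∣) (𝔼-cong (U M) (λ v → re (P v) (edge (v ⟦ T ⟧)) (∏e v))) (𝔼-cong (U M) (λ v → sym (*-assoc (P v) (h A B (v ⟦ T ⟧)) (∏h v)))) ⟩
      ∣ 𝔼 (U M) (λ v → edge (v ⟦ T ⟧) * Φ v) - 𝔼 (U M) (λ v → P′ v * ∏h v) ∣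
        ≤⟨ triangle (𝔼 (U M) (λ v → edge (v ⟦ T ⟧) * Φ v)) (𝔼 (U M) (λ v → h A B (v ⟦ T ⟧) * Φ v)) (𝔼 (U M) (λ v → P′ v * ∏h v)) ⟩
      ∣ 𝔼 (U M) (λ v → edge (v ⟦ T ⟧) * Φ v) - 𝔼 (U M) (λ v → h A B (v ⟦ T ⟧) * Φ v) ∣ + ∣ 𝔼 (U M) (λ v → h A B (v ⟦ T ⟧) * Φ v) - 𝔼 (U M) (λ v → P′ v * ∏h v) ∣
        ≤⟨ +-mono-≤ step (≤-trans (≤-reflexive (cong (λ p → ∣ p - 𝔼 (U M) (λ v → P′ v * ∏h v) ∣) (𝔼-cong (U M) (λ v → re′ (h A B (v ⟦ T ⟧)) (P v) (∏e v))))) rest) ⟩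
      gap₁ + ℕ→ℚ (length Ts) * gap₁
        ≡⟨ suc-bound (length Ts) gap₁ ⟩
      ℕ→ℚ (suc (length Ts)) * gap₁ ∎
      where
      open ≤-Reasoning
      re : ∀ p e q → p * (e * q) ≡ e * (p * q)
      re = solve-∀ ℚ-ring
      re′ : ∀ h p q → h * (p * q) ≡ (p * h) * q
      re′ = solve-∀ ℚ-ring
      ∏e ∏h Φ P′ : Vec V M → ℚ
      ∏e v = ∏ Ts (λ T → edge (v ⟦ T ⟧))
      ∏h v = ∏ Ts (λ T → h A B (v ⟦ T ⟧))
      Φ v = P v * ∏e v
      P′ v = P v * h A B (v ⟦ T ⟧)
      n∏e : ∀ v → 0ℚ ≤ ∏e v
      n∏e v = ∏-nonneg Ts (λ T → 𝟙-nonneg (Hv (v ⟦ T ⟧)))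
      ∏e≤1 : ∀ v → ∏e v ≤ 1ℚ
      ∏e≤1 v = ∏-≤1 Ts (λ T → 𝟙-nonneg (Hv (v ⟦ T ⟧))) (λ T → 𝟙-≤1 (Hv (v ⟦ T ⟧)))
      Φ-inv : ∀ {v v′} → Rel₁ A B T v v′ → Φ v ≡ Φ v′
      Φ-inv {v} {v′} rel = cong₂ _*_ (invP (here refl) rel) (∏-cong-∈ Ts (λ {R} R∈ → cong 𝟙 (edge-invariant A B T R {v} {v′} (increasing-uncovered {s = T} {R} incT (All.lookup incTs R∈) (All.lookup fresh R∈)) rel)))
      step : ∣ 𝔼 (U M) (λ v → edge (v ⟦ T ⟧) * Φ v) - 𝔼 (U M) (λ v → h A B (v ⟦ T ⟧) * Φ v) ∣ ≤ gap₁
      step = decouple-at T (λ {i} {i′} → increasing⇒injective {s = T} incT {i} {i′}) (λ u → cellObs (u Vec.++ A) B) (cellObs A B) (λ u {x} {y} → refine₁ u {x} {y}) edge Φ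
        (λ v → *-nonneg (nP v) (n∏e v)) (λ v → *-≤1 (nP v) (P≤1 v) (∏e≤1 v)) (λ u {x} {y} eq → Φ-inv (cell-fine⇒Rel₁ A B T u {x} {y} eq))
      rest : ∣ 𝔼 (U M) (λ v → P′ v * ∏e v) - 𝔼 (U M) (λ v → P′ v * ∏h v) ∣ ≤ ℕ→ℚ (length Ts) * gap₁
      rest = edges-hybrid Ts incTs distinct P′ (λ v → *-nonneg (nP v) (hat-nonneg A B _ _)) (λ v → *-≤1 (nP v) (P≤1 v) (hat-≤1 A B _ _))
        (λ {R} R∈ {v} {v′} rel → cong₂ _*_ (invP (there R∈) rel) (h-invariant R T {v} {v′} rel))

    junk : Top a
    junk = replicate _ false

    private
      module L = Conditional (U j) (lowObs j A B)

    lawAt : ∀ ℓ → Dec (0ℚ < L.mass ℓ) → Dist (Top a)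
    lawAt ℓ (yes pos) = mapD (full A) (L.condD ℓ pos)
    lawAt ℓ (no _)    = pointD junk

    private
      lawDec : ∀ (s : Vec (Fin M) j) → Dec (Increasing s) → Vec V M → Dist (Top a)
      lawDec s (yes _) v = lawAt (low A B (v ⟦ s ⟧)) (0ℚ <? L.mass (low A B (v ⟦ s ⟧)))
      lawDec s (no _)  v = pointD junk

      realDec : ∀ (s : Vec (Fin M) j) → Dec (Increasing s) → Vec V M → Top a
      realDec s (yes _) v = full A (v ⟦ s ⟧)
      realDec s (no _)  v = junk

    -- The conditional distribution of the top of a (k-1)-tuple with the lower information of v at s; tuples that
    -- are not increasing carry no information.
    law : Vec (Fin M) j → Vec V M → Dist (Top a)
    law s v = lawDec s (increasing? s) v

    real : Vec (Fin M) j → Vec V M → Top a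
    real s v = realDec s (increasing? s) v

    law-increasing : ∀ s v → Increasing s → law s v ≡ lawAt (low A B (v ⟦ s ⟧)) (0ℚ <? L.mass (low A B (v ⟦ s ⟧)))
    law-increasing s v inc with increasing? s
    ... | yes _   = refl
    ... | no ¬inc = contradiction inc ¬inc

    real-increasing : ∀ {s} v → Increasing s → real s v ≡ full A (v ⟦ s ⟧)
    real-increasing {s} v inc with increasing? s
    ... | yes _   = refl
    ... | no ¬inc = contradiction inc ¬inc

    private
      𝔼-lawAt : ∀ ℓ D (f : Top a → ℚ) → 0ℚ < L.mass ℓ → 𝔼 (lawAt ℓ D) f ≡ L.cexp (f ∘ full A) ℓ
      𝔼-lawAt ℓ (yes pos) f _  = trans (𝔼-map (full A) (L.condD ℓ pos) f) (L.𝔼-condD ℓ pos (f ∘ full A))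
      𝔼-lawAt ℓ (no ¬pos) f lt = contradiction lt ¬pos

    cexp-by-tops : ∀ (f : Top a → ℚ) ℓ → L.cexp (f ∘ full A) ℓ ≡ ∑ (tops a) (λ p → L.cexp (is A p) ℓ * f p)
    cexp-by-tops f ℓ = begin
      inv (L.mass ℓ) * 𝔼 (U j) (λ y → L.at ℓ y * f (full A y))
        ≡⟨ cong (inv (L.mass ℓ) *_) (𝔼-by-values (U j) (full A) (λ y p → L.at ℓ y * f p)) ⟩
      inv (L.mass ℓ) * ∑ (tops a) (λ p → 𝔼 (U j) (λ y → is A p y * (L.at ℓ y * f p)))
        ≡⟨ sym (∑-* (tops a) (inv (L.mass ℓ)) _) ⟩
      ∑ (tops a) (λ p → inv (L.mass ℓ) * 𝔼 (U j) (λ y → is A p y * (L.at ℓ y * f p)))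
        ≡⟨ ∑-cong (tops a) (λ p → trans (cong (inv (L.mass ℓ) *_) (trans (𝔼-cong (U j) (λ y → re (is A p y) (L.at ℓ y) (f p))) (𝔼-*ʳ (U j) (f p) _))) (sym (*-assoc (inv (L.mass ℓ)) _ (f p)))) ⟩
      ∑ (tops a) (λ p → L.cexp (is A p) ℓ * f p) ∎
      where
      open ≡-Reasoning
      re : ∀ i t f → i * (t * f) ≡ (t * i) * f
      re = solve-∀ ℚ-ring

    𝔼-law : ∀ {s} v (f : Top a → ℚ) → Increasing s → 𝔼 (law s v) f ≡ ∑ (tops a) (λ p → L.CE (is A p) (v ⟦ s ⟧) * f p)
    𝔼-law {s} v f inc with increasing? s
    ... | no ¬inc = contradiction inc ¬inc
    ... | yes _   = trans (𝔼-lawAt _ (0ℚ <? L.mass (low A B (v ⟦ s ⟧))) f (L.mass-charged (U-charged 𝒰-charged (v ⟦ s ⟧)))) (cexp-by-tops f (low A B (v ⟦ s ⟧)))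

    law-invariant : ∀ {r} s (T : Vec (Fin M) r) {v v′} → Same₂ (Outside T) (assign v (env A B)) (assign v′ (env A B)) → law s v ≡ law s v′
    law-invariant s T {v} {v′} same with increasing? s
    ... | no _  = refl
    ... | yes _ = cong (λ ℓ → lawAt ℓ (0ℚ <? L.mass ℓ)) (low-invariant A B s T {v} {v′} same)

    real-invariant : ∀ {s s′} → s ≢ s′ → Increasing s → ∀ {v v′} → Rel₂ A B s v v′ → real s′ v ≡ real s′ v′
    real-invariant {s} {s′} s≢s′ inc {v} {v′} rel with increasing? s′
    ... | no _     = refl
    ... | yes inc′ = full-invariant A B Hv-repeat s s′ {v} {v′} (increasing-uncovered {s = s} {s′} inc inc′ s≢s′) rel

    gap₂-nonneg : 0ℚ ≤ gap₂
    gap₂-nonneg = ∑-nonneg (tops a) (λ p → 𝔼-nonneg (U M) (λ u → 𝔼-nonneg (U j) (λ x → 0≤∣p∣ _)))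

    -- At an increasing slot both sides split into sums over the possible tops `p`, and each
    -- difference is a decoupling of the indicator of `p`; the costs `gap₂-at p` add up to `gap₂`.
    -- At any other slot the law is a point mass at `junk` and the sides agree.
    slot-step : ∀ s (Φ : Vec V M → Top a → ℚ) → (∀ v p → 0ℚ ≤ Φ v p) → (∀ v p → Φ v p ≤ 1ℚ) →
      (Increasing s → ∀ {v v′} → Rel₂ A B s v v′ → ∀ p → Φ v p ≡ Φ v′ p) →
      ∣ 𝔼 (U M) (λ v → 𝔼 (law s v) (Φ v)) - 𝔼 (U M) (λ v → Φ v (real s v)) ∣ ≤ gap₂
    slot-step s Φ nΦ Φ≤1 invΦ = go (increasing? s)
      where
      go : Dec (Increasing s) → ∣ 𝔼 (U M) (λ v → 𝔼 (law s v) (Φ v)) - 𝔼 (U M) (λ v → Φ v (real s v)) ∣ ≤ gap₂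
      go (no ¬inc) = ≤-trans (≤-reflexive (trans (cong (λ z → ∣ z - 𝔼 (U M) (λ v → Φ v (real s v)) ∣) (𝔼-cong (U M) same)) (∣x-x∣≡0 (𝔼 (U M) (λ v → Φ v (real s v)))))) gap₂-nonneg
        where
        same : ∀ v → 𝔼 (law s v) (Φ v) ≡ Φ v (real s v)
        same v with increasing? s
        ... | yes inc = contradiction inc ¬inc
        ... | no _    = 𝔼-point junk (Φ v)
      go (yes inc) = ≤-trans (≤-reflexive (cong₂ (λ p q → ∣ p - q ∣) left right)) (≤-trans (∣∑∣-≤ (tops a) (λ p → 𝔼 (U M) (λ v → L.CE (is A p) (v ⟦ s ⟧) * Φ v p)) (λ p → 𝔼 (U M) (λ v → is A p (v ⟦ s ⟧) * Φ v p)) each) ≤-refl)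
        where
        left : 𝔼 (U M) (λ v → 𝔼 (law s v) (Φ v)) ≡ ∑ (tops a) (λ p → 𝔼 (U M) (λ v → L.CE (is A p) (v ⟦ s ⟧) * Φ v p))
        left = trans (𝔼-cong (U M) (λ v → 𝔼-law {s} v (Φ v) inc)) (𝔼-∑ (U M) (tops a) _)
        right : 𝔼 (U M) (λ v → Φ v (real s v)) ≡ ∑ (tops a) (λ p → 𝔼 (U M) (λ v → is A p (v ⟦ s ⟧) * Φ v p))
        right = trans (𝔼-cong (U M) (λ v → cong (Φ v) (real-increasing {s} v inc))) (𝔼-by-values (U M) (λ v → full A (v ⟦ s ⟧)) Φ)
        swap-abs : ∀ x y → ∣ x - y ∣ ≡ ∣ y - x ∣
        swap-abs x y = trans (sym (∣-p∣≡∣p∣ (x - y))) (cong ∣_∣ (lem x y))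
          where
          lem : ∀ x y → - (x - y) ≡ y - x
          lem = solve-∀ ℚ-ring
        each : ∀ p → ∣ 𝔼 (U M) (λ v → L.CE (is A p) (v ⟦ s ⟧) * Φ v p) - 𝔼 (U M) (λ v → is A p (v ⟦ s ⟧) * Φ v p) ∣ ≤ gap₂-at p
        each p = subst (_≤ gap₂-at p) (swap-abs (𝔼 (U M) (λ v → is A p (v ⟦ s ⟧) * Φ v p)) (𝔼 (U M) (λ v → L.CE (is A p) (v ⟦ s ⟧) * Φ v p))) (decouple-at s (λ {i} {i′} → increasing⇒injective {s = s} inc {i} {i′}) (λ u → lowObs j A (u Vec.++ B)) (lowObs j A B) (λ u {x} {y} → refine₂ u {x} {y}) (is A p) (λ v → Φ v p)
          (λ v → nΦ v p) (λ v → Φ≤1 v p) (λ u {x} {y} eq → invΦ inc (low-fine⇒Rel₂ A B s u {x} {y} eq) p))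

    laws : ∀ {q} → Vec (Vec (Fin M) j) q → Vec V M → Dist (Vec (Top a) q)
    laws ss v = ΠD (Vec.map (λ s → law s v) ss)

    reals : ∀ {q} → Vec (Vec (Fin M) j) q → Vec V M → Vec (Top a) q
    reals ss v = Vec.map (λ s → real s v) ss

    -- Slots are exchanged one by one. The laws of the slots still to come are functions of lower
    -- information, and the real tops already inserted sit at different faces, where
    -- `full-invariant` applies; distinctness of the slots enters there.
    slots-hybrid : ∀ {q} (ss : Vec (Vec (Fin M) j) q) → Injectiveᵛ ss → (Ψ : Vec V M → Vec (Top a) q → ℚ) → (∀ v ζ → 0ℚ ≤ Ψ v ζ) → (∀ v ζ → Ψ v ζ ≤ 1ℚ) →
      (∀ l → Increasing (lookup ss l) → ∀ {v v′} → Rel₂ A B (lookup ss l) v v′ → ∀ ζ → Ψ v ζ ≡ Ψ v′ ζ) →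
      ∣ 𝔼 (U M) (λ v → 𝔼 (laws ss v) (Ψ v)) - 𝔼 (U M) (λ v → Ψ v (reals ss v)) ∣ ≤ ℕ→ℚ q * gap₂
    slots-hybrid [] inj Ψ nΨ Ψ≤1 invΨ = ≤-reflexive (trans (cong (λ z → ∣ z - 𝔼 (U M) (λ v → Ψ v []) ∣) (𝔼-cong (U M) (λ v → 𝔼-Π[] (Ψ v)))) (trans (∣x-x∣≡0 (𝔼 (U M) (λ v → Ψ v []))) (sym (*-zeroˡ gap₂))))
    slots-hybrid {suc q} (s ∷ ss) inj Ψ nΨ Ψ≤1 invΨ = begin
      ∣ 𝔼 (U M) (λ v → 𝔼 (laws (s ∷ ss) v) (Ψ v)) - 𝔼 (U M) (λ v → Ψ v (real s v ∷ reals ss v)) ∣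
        ≡⟨ cong (λ z → ∣ z - 𝔼 (U M) (λ v → Ψ v (real s v ∷ reals ss v)) ∣) (𝔼-cong (U M) (λ v → 𝔼-Π∷ (law s v) (Vec.map (λ s → law s v) ss) (Ψ v))) ⟩
      ∣ 𝔼 (U M) (λ v → 𝔼 (law s v) (Φ v)) - 𝔼 (U M) (λ v → Ψ v (real s v ∷ reals ss v)) ∣
        ≤⟨ triangle (𝔼 (U M) (λ v → 𝔼 (law s v) (Φ v))) (𝔼 (U M) (λ v → Φ v (real s v))) (𝔼 (U M) (λ v → Ψ v (real s v ∷ reals ss v))) ⟩
      ∣ 𝔼 (U M) (λ v → 𝔼 (law s v) (Φ v)) - 𝔼 (U M) (λ v → Φ v (real s v)) ∣ + ∣ 𝔼 (U M) (λ v → Φ v (real s v)) - 𝔼 (U M) (λ v → Ψ v (real s v ∷ reals ss v)) ∣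
        ≤⟨ +-mono-≤ (slot-step s Φ (λ v p → 𝔼-nonneg (laws ss v) (λ ζ → nΨ v (p ∷ ζ))) (λ v p → 𝔼-≤const (laws ss v) (λ ζ → Ψ≤1 v (p ∷ ζ))) Φ-inv) rest ⟩
      gap₂ + ℕ→ℚ q * gap₂
        ≡⟨ suc-bound q gap₂ ⟩
      ℕ→ℚ (suc q) * gap₂ ∎
      where
      open ≤-Reasoning
      Φ : Vec V M → Top a → ℚ
      Φ v p = 𝔼 (laws ss v) (λ ζ → Ψ v (p ∷ ζ))
      Φ-inv : Increasing s → ∀ {v v′} → Rel₂ A B s v v′ → ∀ p → Φ v p ≡ Φ v′ p
      Φ-inv inc {v} {v′} rel p = trans (cong (λ ds → 𝔼 (ΠD ds) (λ ζ → Ψ v (p ∷ ζ))) (Vecₚ.map-cong (λ s′ → law-invariant s′ s {v} {v′} rel) ss)) (𝔼-cong (laws ss v′) (λ ζ → invΨ zero inc rel (p ∷ ζ)))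
      rest : ∣ 𝔼 (U M) (λ v → Φ v (real s v)) - 𝔼 (U M) (λ v → Ψ v (real s v ∷ reals ss v)) ∣ ≤ ℕ→ℚ q * gap₂
      rest = slots-hybrid ss (λ e → Finₚ.suc-injective (inj e)) (λ v ζ → Ψ v (real s v ∷ ζ)) (λ v ζ → nΨ v _) (λ v ζ → Ψ≤1 v _)
        (λ l inc {v} {v′} rel ζ → trans (cong (λ p → Ψ v (p ∷ ζ)) (real-invariant {lookup ss l} {s} (λ e → suc≢zero l (inj e)) inc {v} {v′} rel)) (invΨ (suc l) inc rel (real s v′ ∷ ζ)))
        where
        suc≢zero : ∀ l → _≢_ {A = Fin (suc q)} (suc l) zero
        suc≢zero l ()

-- Energy increments and the choice of environment sizes

module _ {X Y : Set} (d : Dist X) (e : Dist Y) (fine : X → Obs Y) (coarse : Obs Y) (ref : ∀ u → Refines (fine u) coarse) (g : Y → ℚ) where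

  -- `am-gm` holds pointwise, and `pythagoras` evaluates the mean square as an energy increment. The
  -- parameter `t` is matched with the size of the increment afterwards.
  increment-bound : ∀ t → (1ℚ + 1ℚ) * t * 𝔼 d (λ u → 𝔼 e (λ x → ∣ Conditional.CE e (fine u) g x - Conditional.CE e coarse g x ∣))
    ≤ t * t + (𝔼 d (λ u → Conditional.energy e (fine u) g) - Conditional.energy e coarse g)
  increment-bound t = begin
    (1ℚ + 1ℚ) * t * 𝔼 d (λ u → 𝔼 e (λ x → ∣ δ u x ∣))
      ≡⟨ trans (sym (𝔼-* d ((1ℚ + 1ℚ) * t) _)) (𝔼-cong d (λ u → sym (𝔼-* e ((1ℚ + 1ℚ) * t) _))) ⟩
    𝔼 d (λ u → 𝔼 e (λ x → (1ℚ + 1ℚ) * t * ∣ δ u x ∣))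
      ≤⟨ 𝔼-mono d (λ u → 𝔼-mono e (λ x → am-gm t (δ u x))) ⟩
    𝔼 d (λ u → 𝔼 e (λ x → t * t + δ u x * δ u x))
      ≡⟨ 𝔼-cong d (λ u → trans (𝔼-+ e _ _) (cong₂ _+_ (𝔼-const e (t * t)) (Refinement.pythagoras e (fine u) coarse (ref u) g))) ⟩
    𝔼 d (λ u → t * t + (Conditional.energy e (fine u) g - Conditional.energy e coarse g))
      ≡⟨ trans (𝔼-+ d _ _) (cong₂ _+_ (𝔼-const d (t * t)) (trans (𝔼-- d _ _) (cong (λ z → 𝔼 d (λ u → Conditional.energy e (fine u) g) - z) (𝔼-const d (Conditional.energy e coarse g))))) ⟩
    t * t + (𝔼 d (λ u → Conditional.energy e (fine u) g) - Conditional.energy e coarse g) ∎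
    where
    open ≤-Reasoning
    δ : X → Y → ℚ
    δ u x = Conditional.CE e (fine u) g x - Conditional.CE e coarse g x

module Energy {n : ℕ} (j : ℕ) (Hv : Vec (Fin n) (suc j) → Bool) (Hv-repeat : ∀ y {p q} → p ≢ q → lookup y p ≡ lookup y q → Hv y ≡ false)
              (𝒰 : Dist (Fin n)) (𝒰-charged : ∀ x → Charged 𝒰 x) where
  open Hybrid j Hv Hv-repeat 𝒰 𝒰-charged

  private
    energy₁ : ∀ {a b} → Vec V a → Vec V b → ℚ
    energy₁ A B = Conditional.energy (U k) (cellObs A B) edge

    energy₂ : ∀ {a b} → Vec V a → Vec V b → Top a → ℚ
    energy₂ A B p = Conditional.energy (U j) (lowObs j A B) (is A p)

  q₁ q₂ : ℕ → ℕ → ℚ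
  q₁ a b = 𝔼 (U a) (λ A → 𝔼 (U b) (λ B → energy₁ A B))
  q₂ a b = 𝔼 (U a) (λ A → 𝔼 (U b) (λ B → ∑ (tops a) (energy₂ A B)))

  q₁-nonneg : ∀ a b → 0ℚ ≤ q₁ a b
  q₁-nonneg a b = 𝔼-nonneg (U a) (λ A → 𝔼-nonneg (U b) (λ B → Conditional.energy-nonneg (U k) (cellObs A B) edge))

  q₂-nonneg : ∀ a b → 0ℚ ≤ q₂ a b
  q₂-nonneg a b = 𝔼-nonneg (U a) (λ A → 𝔼-nonneg (U b) (λ B → ∑-nonneg (tops a) (λ p → Conditional.energy-nonneg (U j) (lowObs j A B) (is A p))))

  q₁-≤1 : ∀ a b → q₁ a b ≤ 1ℚ
  q₁-≤1 a b = 𝔼-≤const (U a) (λ A → 𝔼-≤const (U b) (λ B → 𝔼-≤const (U k) (λ x → *-≤1 (hat-nonneg A B _ _) (hat-≤1 A B _ _) (hat-≤1 A B _ _))))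

  -- The conditional probabilities of the different tops add up to 1, so their squares add up to at
  -- most 1, however many tops there are.
  q₂-≤1 : ∀ a b → q₂ a b ≤ 1ℚ
  q₂-≤1 a b = 𝔼-≤const (U a) (λ A → 𝔼-≤const (U b) (λ B → bound A B))
    where
    bound : ∀ (A : Vec V a) (B : Vec V b) → ∑ (tops a) (energy₂ A B) ≤ 1ℚ
    bound A B = begin
      ∑ (tops a) (energy₂ A B)
        ≤⟨ ∑-mono (tops a) (λ p → 𝔼-mono (U j) (λ x → *≤ˡ (C.cexp-nonneg {is A p} (λ z → 𝟙-nonneg (does (full A z ≟ᵇ p))) _) (C.cexp-≤1 {is A p} (λ z → 𝟙-≤1 (does (full A z ≟ᵇ p))) _))) ⟩
      ∑ (tops a) (λ p → 𝔼 (U j) (C.CE (is A p)))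
        ≡⟨ ∑-cong (tops a) (λ p → trans (𝔼-cong (U j) (λ x → sym (*-identityʳ (C.CE (is A p) x)))) (C.CE-projection (is A p) (λ _ → 1ℚ) (λ _ → refl))) ⟩
      ∑ (tops a) (λ p → 𝔼 (U j) (λ z → is A p z * 1ℚ))
        ≡⟨ sym (𝔼-by-values (U j) (full A) (λ _ _ → 1ℚ)) ⟩
      𝔼 (U j) (λ _ → 1ℚ)
        ≡⟨ 𝔼-const (U j) 1ℚ ⟩
      1ℚ ∎
      where
      open ≤-Reasoning
      module C = Conditional (U j) (lowObs j A B)

  -- The new first set contains the old first set `X` and the old second set `Y`, so its cells are
  -- finer whatever the new second set is. Hence the second set may be chosen afresh for every size
  -- of the first.
  q₁-mono : ∀ p b c b″ → q₁ p b ≤ q₁ (p ℕ.+ (b ℕ.+ c)) b″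
  q₁-mono p b c b″ = begin
    𝔼 (U p) (λ X → 𝔼 (U b) (λ Y → energy₁ X Y))
      ≤⟨ 𝔼-mono (U p) (λ X → 𝔼-mono (U b) (λ Y → subst (_≤ 𝔼 (U c) (λ Z → 𝔼 (U b″) (λ B → energy₁ (X Vec.++ (Y Vec.++ Z)) B))) (trans (𝔼-cong (U c) (λ Z → 𝔼-const (U b″) (energy₁ X Y))) (𝔼-const (U c) (energy₁ X Y)))
           (𝔼-mono (U c) (λ Z → 𝔼-mono (U b″) (λ B → Refinement.energy-mono (U k) (cellObs (X Vec.++ (Y Vec.++ Z)) B) (cellObs X Y) (λ {x} {y} → ref X Y Z B {x} {y}) edge))))) ⟩
    𝔼 (U p) (λ X → 𝔼 (U b) (λ Y → 𝔼 (U c) (λ Z → 𝔼 (U b″) (λ B → energy₁ (X Vec.++ (Y Vec.++ Z)) B))))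
      ≡⟨ 𝔼-cong (U p) (λ X → sym (U-++ b _)) ⟩
    𝔼 (U p) (λ X → 𝔼 (U (b ℕ.+ c)) (λ Y → 𝔼 (U b″) (λ B → energy₁ (X Vec.++ Y) B)))
      ≡⟨ sym (U-++ p _) ⟩
    𝔼 (U (p ℕ.+ (b ℕ.+ c))) (λ A → 𝔼 (U b″) (λ B → energy₁ A B)) ∎
    where
    open ≤-Reasoning
    ref : ∀ (X : Vec V p) (Y : Vec V b) (Z : Vec V c) (B : Vec V b″) → Refines (cellObs (X Vec.++ (Y Vec.++ Z)) B) (cellObs X Y)
    ref X Y Z B {x} {y} = cell-refine {A = X} {Y} {X Vec.++ (Y Vec.++ Z)} {B} (λ { (inj₁ l) → inj₁ (l ↑ˡ _) ; (inj₂ l) → inj₁ (p ↑ʳ (l ↑ˡ c)) })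
      (λ { (inj₁ l) → Vecₚ.lookup-++ˡ X _ l ; (inj₂ l) → trans (Vecₚ.lookup-++ʳ X (Y Vec.++ Z) (l ↑ˡ c)) (Vecₚ.lookup-++ˡ Y Z l) }) (_↑ˡ _) (Vecₚ.lookup-++ˡ X _) {x} {y}

  #tops : ℕ → ℚ
  #tops a = ℕ→ℚ (length (tops a))

  𝔼₂ : ∀ a b → (Vec V a → Vec V b → ℚ) → ℚ
  𝔼₂ a b f = 𝔼 (U a) (λ A → 𝔼 (U b) (f A))

  private
    2t-pos : ∀ {t} → 0ℚ < t → 0ℚ < (1ℚ + 1ℚ) * t
    2t-pos = *-pos (positive⁻¹ (1ℚ + 1ℚ))

    𝔼₂-scale : ∀ a b c f → 𝔼₂ a b (λ A B → c * f A B) ≡ c * 𝔼₂ a b f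
    𝔼₂-scale a b c f = trans (𝔼-cong (U a) (λ A → 𝔼-* (U b) c (f A))) (𝔼-* (U a) c _)

    𝔼₂-affine : ∀ a b c f g → 𝔼₂ a b (λ A B → c + (f A B - g A B)) ≡ c + (𝔼₂ a b f - 𝔼₂ a b g)
    𝔼₂-affine a b c f g = trans (𝔼-cong (U a) (λ A → trans (𝔼-+ (U b) _ _) (cong₂ _+_ (𝔼-const (U b) c) (𝔼-- (U b) (f A) (g A)))))
      (trans (𝔼-+ (U a) _ _) (cong₂ _+_ (𝔼-const (U a) c) (𝔼-- (U a) _ _)))

  module _ (M : ℕ) where

    gap₁-bound : ∀ {a b t} → 0ℚ < t → q₁ (M ℕ.+ a) b - q₁ a b ≤ t * t → 𝔼₂ a b (λ A B → Gaps.gap₁ {M} A B) ≤ t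
    gap₁-bound {a} {b} {t} 0<t le = *-cancelˡ ((1ℚ + 1ℚ) * t) (2t-pos 0<t) (begin
      (1ℚ + 1ℚ) * t * 𝔼₂ a b (λ A B → Gaps.gap₁ {M} A B)
        ≡⟨ sym (𝔼₂-scale a b ((1ℚ + 1ℚ) * t) _) ⟩
      𝔼₂ a b (λ A B → (1ℚ + 1ℚ) * t * Gaps.gap₁ {M} A B)
        ≤⟨ 𝔼-mono (U a) (λ A → 𝔼-mono (U b) (λ B → increment-bound (U M) (U k) (λ u → cellObs (u Vec.++ A) B) (cellObs A B) (λ u {x} {y} → Gaps.refine₁ A B u {x} {y}) edge t)) ⟩
      𝔼₂ a b (λ A B → t * t + (𝔼 (U M) (λ u → energy₁ (u Vec.++ A) B) - energy₁ A B))
        ≡⟨ 𝔼₂-affine a b (t * t) _ _ ⟩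
      t * t + (𝔼₂ a b (λ A B → 𝔼 (U M) (λ u → energy₁ (u Vec.++ A) B)) - q₁ a b)
        ≡⟨ cong (λ z → t * t + (z - q₁ a b)) (trans (𝔼-cong (U a) (λ A → 𝔼-swap (U b) (U M) _)) (trans (𝔼-swap (U a) (U M) _) (sym (U-++ M _)))) ⟩
      t * t + (q₁ (M ℕ.+ a) b - q₁ a b)
        ≤⟨ +-monoʳ-≤ (t * t) le ⟩
      t * t + t * t
        ≡⟨ dbl t ⟩
      (1ℚ + 1ℚ) * t * t ∎)
      where
      open ≤-Reasoning
      dbl : ∀ t → t * t + t * t ≡ (1ℚ + 1ℚ) * t * t
      dbl = solve-∀ ℚ-ring

    gap₂-bound : ∀ {a b t} → 0ℚ < t → 0ℚ < #tops a → q₂ a (M ℕ.+ b) - q₂ a b ≤ t * (t * inv (#tops a)) → 𝔼₂ a b (λ A B → Gaps.gap₂ {M} A B) ≤ t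
    gap₂-bound {a} {b} {t} 0<t 0<P le = *-cancelˡ ((1ℚ + 1ℚ) * τ) (2t-pos 0<τ) (begin
      (1ℚ + 1ℚ) * τ * 𝔼₂ a b (λ A B → Gaps.gap₂ {M} A B)
        ≡⟨ sym (𝔼₂-scale a b ((1ℚ + 1ℚ) * τ) _) ⟩
      𝔼₂ a b (λ A B → (1ℚ + 1ℚ) * τ * Gaps.gap₂ {M} A B)
        ≤⟨ 𝔼-mono (U a) (λ A → 𝔼-mono (U b) (λ B → sum-bound A B)) ⟩
      𝔼₂ a b (λ A B → #tops a * (τ * τ) + (𝔼 (U M) (λ u → ∑ (tops a) (energy₂ A (u Vec.++ B))) - ∑ (tops a) (energy₂ A B)))
        ≡⟨ 𝔼₂-affine a b (#tops a * (τ * τ)) _ _ ⟩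
      #tops a * (τ * τ) + (𝔼₂ a b (λ A B → 𝔼 (U M) (λ u → ∑ (tops a) (energy₂ A (u Vec.++ B)))) - q₂ a b)
        ≡⟨ cong (λ z → #tops a * (τ * τ) + (z - q₂ a b)) (𝔼-cong (U a) (λ A → trans (𝔼-swap (U b) (U M) _) (sym (U-++ M _)))) ⟩
      #tops a * (τ * τ) + (q₂ a (M ℕ.+ b) - q₂ a b)
        ≤⟨ +-monoʳ-≤ (#tops a * (τ * τ)) le ⟩
      #tops a * (τ * τ) + t * τ
        ≡⟨ cong (_+ t * τ) (trans (re (#tops a) t (inv (#tops a))) (trans (cong (_* (t * τ)) (inv-inverse 0<P)) (*-identityˡ (t * τ)))) ⟩
      t * τ + t * τ
        ≡⟨ dbl t τ ⟩
      (1ℚ + 1ℚ) * τ * t ∎)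
      where
      open ≤-Reasoning
      τ : ℚ
      τ = t * inv (#tops a)
      0<τ : 0ℚ < τ
      0<τ = *-pos 0<t (inv-pos 0<P)
      re : ∀ p t i → p * ((t * i) * (t * i)) ≡ (p * i) * (t * (t * i))
      re = solve-∀ ℚ-ring
      dbl : ∀ t τ → t * τ + t * τ ≡ (1ℚ + 1ℚ) * τ * t
      dbl = solve-∀ ℚ-ring
      sum-bound : ∀ (A : Vec V a) (B : Vec V b) → (1ℚ + 1ℚ) * τ * Gaps.gap₂ {M} A B ≤ #tops a * (τ * τ) + (𝔼 (U M) (λ u → ∑ (tops a) (energy₂ A (u Vec.++ B))) - ∑ (tops a) (energy₂ A B))
      sum-bound A B = begin
        (1ℚ + 1ℚ) * τ * Gaps.gap₂ {M} A B
          ≡⟨ sym (∑-* (tops a) ((1ℚ + 1ℚ) * τ) _) ⟩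
        ∑ (tops a) (λ p → (1ℚ + 1ℚ) * τ * Gaps.gap₂-at {M} A B p)
          ≤⟨ ∑-mono (tops a) (λ p → increment-bound (U M) (U j) (λ u → lowObs j A (u Vec.++ B)) (lowObs j A B) (λ u {x} {y} → Gaps.refine₂ A B u {x} {y}) (is A p) τ) ⟩
        ∑ (tops a) (λ p → τ * τ + (𝔼 (U M) (λ u → energy₂ A (u Vec.++ B) p) - energy₂ A B p))
          ≡⟨ trans (∑-+ (tops a) _ _) (cong₂ _+_ (∑-const (tops a) (τ * τ)) (∑-sub (tops a) (λ p → 𝔼 (U M) (λ u → energy₂ A (u Vec.++ B) p)) (energy₂ A B))) ⟩
        #tops a * (τ * τ) + (∑ (tops a) (λ p → 𝔼 (U M) (λ u → energy₂ A (u Vec.++ B) p)) - ∑ (tops a) (energy₂ A B))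
          ≡⟨ cong (λ z → #tops a * (τ * τ) + (z - ∑ (tops a) (energy₂ A B))) (sym (𝔼-∑ (U M) (tops a) _)) ⟩
        #tops a * (τ * τ) + (𝔼 (U M) (λ u → ∑ (tops a) (energy₂ A (u Vec.++ B))) - ∑ (tops a) (energy₂ A B)) ∎
        where
        ∑-sub : ∀ {X : Set} (xs : List X) f g → ∑ xs (λ x → f x - g x) ≡ ∑ xs f - ∑ xs g
        ∑-sub []       f g = refl
        ∑-sub (x ∷ xs) f g = trans (cong (f x - g x +_) (∑-sub xs f g)) (lem (f x) (g x) (∑ xs f) (∑ xs g))
          where
          lem : ∀ a b c d → (a - b) + (c - d) ≡ (a + c) - (b + d)
          lem = solve-∀ ℚ-ring

-- Telescoping: `K` consecutive steps, each larger than `η`, would lift `f` above 1.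
small-step : ∀ K {η} → 1ℚ < ℕ→ℚ K * η → (f : ℕ → ℚ) → (∀ i → 0ℚ ≤ f i) → (∀ i → f i ≤ 1ℚ) → ∃[ i ] (i ℕ.< K × f (suc i) - f i ≤ η)
small-step K {η} big f nf f≤1 with search K
  where
  search : ∀ K → (∃[ i ] (i ℕ.< K × f (suc i) - f i ≤ η)) ⊎ (ℕ→ℚ K * η ≤ f K - f 0)
  search zero = inj₂ (subst₂ _≤_ (sym (*-zeroˡ η)) (sym (+-inverseʳ (f 0))) ≤-refl)
  search (suc K) with search K
  ... | inj₁ (i , i<K , le) = inj₁ (i , ℕₚ.m<n⇒m<1+n i<K , le)
  ... | inj₂ ge with f (suc K) - f K ≤? η
  ...   | yes le = inj₁ (K , ℕₚ.n<1+n K , le)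
  ...   | no  gt = inj₂ (subst₂ _≤_ (suc-bound K η) (lem (f (suc K)) (f K) (f 0)) (+-mono-≤ (<⇒≤ (≰⇒> gt)) ge))
    where
    lem : ∀ a b c → (a - b) + (b - c) ≡ a - c
    lem = solve-∀ ℚ-ring
... | inj₁ found = found
... | inj₂ ge    = contradiction (<-≤-trans big (≤-trans ge (≤-trans (by-difference (lem (f K) (f 0)) (nf 0)) (f≤1 K)))) (<-irrefl refl)
  where
  lem : ∀ a b → a - (a - b) ≡ b
  lem = solve-∀ ℚ-ring

module Select (M : ℕ) {η₁ : ℚ} (K₁ : ℕ) (big₁ : 1ℚ < ℕ→ℚ K₁ * η₁) (η₂ : ℕ → ℚ) (K₂ : ℕ → ℕ) (big₂ : ∀ a → 1ℚ < ℕ→ℚ (K₂ a) * η₂ a) where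

  -- The size of `A` at stage i. The next stage makes room for `M` extra vertices and for the
  -- largest second set that stage i can use, so that `q₁-mono` applies between consecutive stages.
  scale : ℕ → ℕ
  scale zero    = 0
  scale (suc i) = (M ℕ.+ scale i) ℕ.+ K₂ (scale i) ℕ.* M

  bound : ℕ
  bound = scale K₁

  private
    scale-step : ∀ i → scale i ℕ.≤ scale (suc i)
    scale-step i = ℕₚ.≤-trans (ℕₚ.m≤n+m (scale i) M) (ℕₚ.m≤m+n (M ℕ.+ scale i) _)

    scale-mono : ∀ {i j} → i ℕ.≤ j → scale i ℕ.≤ scale j
    scale-mono {i} {j} i≤j = subst (λ z → scale i ℕ.≤ scale z) (ℕₚ.m+[n∸m]≡n i≤j) (go (j ℕ.∸ i))
      where
      go : ∀ d → scale i ℕ.≤ scale (i ℕ.+ d)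
      go zero    = ℕₚ.≤-reflexive (cong scale (sym (ℕₚ.+-identityʳ i)))
      go (suc d) = ℕₚ.≤-trans (go d) (subst (λ z → scale (i ℕ.+ d) ℕ.≤ scale z) (sym (ℕₚ.+-suc i d)) (scale-step (i ℕ.+ d)))

  select : (q₁ q₂ : ℕ → ℕ → ℚ) → (∀ a b → 0ℚ ≤ q₁ a b) → (∀ a b → q₁ a b ≤ 1ℚ) → (∀ a b → 0ℚ ≤ q₂ a b) → (∀ a b → q₂ a b ≤ 1ℚ) →
    (∀ p b c b″ → q₁ p b ≤ q₁ (p ℕ.+ (b ℕ.+ c)) b″) →
    ∃[ a ] ∃[ b ] (a ℕ.≤ bound × b ℕ.≤ bound × q₁ (M ℕ.+ a) b - q₁ a b ≤ η₁ × q₂ a (M ℕ.+ b) - q₂ a b ≤ η₂ a)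
  select q₁ q₂ n₁ l₁ n₂ l₂ mono = scale i , lowScale i , scale-mono (ℕₚ.<⇒≤ i<K) , ℕₚ.≤-trans (b≤ i) (ℕₚ.≤-trans (ℕₚ.m≤n+m _ (M ℕ.+ scale i)) (scale-mono i<K)) ,
      ≤-trans (+-monoˡ-≤ (- q₁ (scale i) (lowScale i)) climb) le , proj₂ (proj₂ (pick i))
    where
    pick : ∀ i → ∃[ l ] (l ℕ.< K₂ (scale i) × q₂ (scale i) (M ℕ.+ l ℕ.* M) - q₂ (scale i) (l ℕ.* M) ≤ η₂ (scale i))
    pick i = small-step (K₂ (scale i)) (big₂ (scale i)) (λ l → q₂ (scale i) (l ℕ.* M)) (λ l → n₂ _ _) (λ l → l₂ _ _)
    lowScale : ℕ → ℕ
    lowScale i = proj₁ (pick i) ℕ.* M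
    b≤ : ∀ i → lowScale i ℕ.≤ K₂ (scale i) ℕ.* M
    b≤ i = ℕₚ.*-monoˡ-≤ M (ℕₚ.<⇒≤ (proj₁ (proj₂ (pick i))))
    -- The pigeonhole for `q₁` runs over stages at which the second set has already been chosen to
    -- make the increment of `q₂` small.
    top = small-step K₁ big₁ (λ i → q₁ (scale i) (lowScale i)) (λ i → n₁ _ _) (λ i → l₁ _ _)
    i = proj₁ top
    i<K : i ℕ.< K₁
    i<K = proj₁ (proj₂ top)
    le : q₁ (scale (suc i)) (lowScale (suc i)) - q₁ (scale i) (lowScale i) ≤ η₁
    le = proj₂ (proj₂ top)
    -- Adding `M` vertices to `A` gains no more energy than going to the next stage, whose first set
    -- also contains the second set of stage i.
    climb : q₁ (M ℕ.+ scale i) (lowScale i) ≤ q₁ (scale (suc i)) (lowScale (suc i))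
    climb = subst (λ z → q₁ (M ℕ.+ scale i) (lowScale i) ≤ q₁ ((M ℕ.+ scale i) ℕ.+ z) (lowScale (suc i))) (ℕₚ.m+[n∸m]≡n (b≤ i))
      (mono (M ℕ.+ scale i) (lowScale i) (K₂ (scale i) ℕ.* M ℕ.∸ lowScale i) (lowScale (suc i)))

-- Ramsey's theorem

increasing-[] : ∀ {M} → Increasing {M} []
increasing-[] ()

increasing-suc : ∀ {M r} {s : Vec (Fin M) r} → Increasing s → Increasing (Vec.map suc s)
increasing-suc {s = s} inc p q p<q = subst₂ Fin._<_ (sym (Vecₚ.lookup-map p suc s)) (sym (Vecₚ.lookup-map q suc s)) (s≤s (inc p q p<q))

increasing-zero∷ : ∀ {M r} {s : Vec (Fin M) r} → Increasing s → Increasing (zero ∷ Vec.map suc s)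
increasing-zero∷ {s = s} inc zero    (suc q) _   = subst (λ z → 0 ℕ.< Fin.toℕ z) (sym (Vecₚ.lookup-map q suc s)) (s≤s z≤n)
increasing-zero∷ {s = s} inc (suc p) (suc q) p<q = increasing-suc {s = s} inc p q (ℕ.s≤s⁻¹ p<q)

increasing-tail : ∀ {M r} {x : Fin M} {s : Vec (Fin M) r} → Increasing (x ∷ s) → Increasing s
increasing-tail inc p q p<q = inc (suc p) (suc q) (s≤s p<q)

unsuc : ∀ {M r} (s : Vec (Fin (suc M)) r) → Increasing s → (∀ p → 0 ℕ.< Fin.toℕ (lookup s p)) → Σ[ s′ ∈ Vec (Fin M) r ] (s ≡ Vec.map suc s′ × Increasing s′)
unsuc []          inc above = [] , refl , increasing-[]
unsuc (zero ∷ s)  inc above = contradiction (above zero) λ ()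
unsuc {M} (suc x ∷ s) inc above with unsuc s (increasing-tail {s = s} inc) (above ∘ suc)
... | s′ , refl , inc′ = x ∷ s′ , refl , inc″
  where
  inc″ : Increasing (x ∷ s′)
  inc″ zero    (suc q) _   = ℕ.s≤s⁻¹ (subst (suc x Fin.<_) (Vecₚ.lookup-map q suc s′) (inc zero (suc q) (s≤s z≤n)))
  inc″ (suc p) (suc q) p<q = inc′ p q (ℕ.s≤s⁻¹ p<q)

increasing-cases : ∀ {M r} (T : Vec (Fin (suc M)) (suc r)) → Increasing T →
  (Σ[ T′ ∈ Vec (Fin M) r ] (T ≡ zero ∷ Vec.map suc T′ × Increasing T′)) ⊎ (Σ[ T′ ∈ Vec (Fin M) (suc r) ] (T ≡ Vec.map suc T′ × Increasing T′))
increasing-cases (zero ∷ T) inc with unsuc T (increasing-tail {s = T} inc) (λ p → inc zero (suc p) (s≤s z≤n))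
... | T′ , refl , inc′ = inj₁ (T′ , refl , inc′)
increasing-cases (suc x ∷ T) inc = inj₂ (unsuc (suc x ∷ T) inc above)
  where
  above : ∀ p → 0 ℕ.< Fin.toℕ (lookup (suc x ∷ T) p)
  above zero    = s≤s z≤n
  above (suc p) = ℕₚ.≤-trans (s≤s z≤n) (inc zero (suc p) (s≤s z≤n))

⟦suc⟧ : ∀ {A : Set} {q r} (x : A) (xs : Vec A q) (ι : Vec (Fin q) r) → (x ∷ xs) ⟦ Vec.map suc ι ⟧ ≡ xs ⟦ ι ⟧
⟦suc⟧ x xs ι = sym (Vecₚ.map-∘ (lookup (x ∷ xs)) suc ι)

increasing-allFin : ∀ q → Increasing (Vec.allFin q)
increasing-allFin q p r p<r = subst₂ Fin._<_ (sym (Vecₚ.lookup-allFin p)) (sym (Vecₚ.lookup-allFin r)) p<r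

Constantly : ∀ {q r} → Vec Bool q → Bool → Vec (Fin q) r → Set
Constantly γ c κ = ∀ i → lookup γ (lookup κ i) ≡ c

private
  lift-const : ∀ {q r} {γ : Vec Bool q} {c x} {κ : Vec (Fin q) r} → Constantly γ c κ → Constantly (x ∷ γ) c (Vec.map suc κ)
  lift-const {γ = γ} {x = x} {κ} h i = trans (cong (lookup (x ∷ γ)) (Vecₚ.lookup-map i suc κ)) (h i)

  cons-const : ∀ {q r} {γ : Vec Bool q} {c} {κ : Vec (Fin q) r} → Constantly γ c κ → Constantly (c ∷ γ) c (zero ∷ Vec.map suc κ)
  cons-const h zero    = refl
  cons-const {γ = γ} {c} {κ} h (suc i) = lift-const {γ = γ} {κ = κ} h i

majority : ∀ {q} (γ : Vec Bool q) s t → s ℕ.+ t ℕ.≤ q →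
  (Σ[ κ ∈ Vec (Fin q) s ] (Increasing κ × Constantly γ true κ)) ⊎ (Σ[ κ ∈ Vec (Fin q) t ] (Increasing κ × Constantly γ false κ))
majority γ zero    t       le = inj₁ ([] , increasing-[] , λ ())
majority γ (suc s) zero    le = inj₂ ([] , increasing-[] , λ ())
majority (true ∷ γ) (suc s) (suc t) (s≤s le) with majority γ s (suc t) le
... | inj₁ (κ , inc , h) = inj₁ (zero ∷ Vec.map suc κ , increasing-zero∷ {s = κ} inc , cons-const {γ = γ} {κ = κ} h)
... | inj₂ (κ , inc , h) = inj₂ (Vec.map suc κ , increasing-suc {s = κ} inc , lift-const {γ = γ} {κ = κ} h)
majority (false ∷ γ) (suc s) (suc t) (s≤s le) with majority γ (suc s) t (ℕₚ.≤-trans (ℕₚ.≤-reflexive (sym (ℕₚ.+-suc s t))) le)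
... | inj₁ (κ , inc , h) = inj₁ (Vec.map suc κ , increasing-suc {s = κ} inc , lift-const {γ = γ} {κ = κ} h)
... | inj₂ (κ , inc , h) = inj₂ (zero ∷ Vec.map suc κ , increasing-zero∷ {s = κ} inc , cons-const {γ = γ} {κ = κ} h)

mutual
  -- Erdős and Rado: first pass to a subsequence on which the colour depends on the least entry
  -- only, then keep the entries of the more frequent colour among t + t.
  ramsey : ∀ k t → ∃[ R ] (∀ {A : Set} (col : Vec A k → Bool) (xs : Vec A R) →
    Σ[ ι ∈ Vec (Fin R) t ] (Increasing ι × ∃[ c ] (∀ T → Increasing T → col (xs ⟦ ι ⟧ ⟦ T ⟧) ≡ c)))
  ramsey zero t = t , λ col xs → Vec.allFin t , increasing-allFin t , col [] , λ { [] _ → refl }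
  ramsey (suc k) t with end-homogeneous k (t ℕ.+ t)
  ... | R , go = R , ans
    where
    ans : ∀ {A : Set} (col : Vec A (suc k) → Bool) (xs : Vec A R) → Σ[ ι ∈ Vec (Fin R) t ] (Increasing ι × ∃[ c ] (∀ T → Increasing T → col (xs ⟦ ι ⟧ ⟦ T ⟧) ≡ c))
    ans col xs with go col xs
    ... | ι , inc , γ , hom = pick (majority γ t t ℕₚ.≤-refl)
      where
      build : ∀ c → Σ[ κ ∈ Vec (Fin (t ℕ.+ t)) t ] (Increasing κ × Constantly γ c κ) → Σ[ ι ∈ Vec (Fin R) t ] (Increasing ι × ∃[ c ] (∀ T → Increasing T → col (xs ⟦ ι ⟧ ⟦ T ⟧) ≡ c))
      build c (κ , incκ , const) = ι ⟦ κ ⟧ , increasing-⟦⟧ {s = ι} {κ} inc incκ , c , λ T incT → trans (cong col (trans (cong (_⟦ T ⟧) (sym (⟦⟧-assoc xs ι κ))) (⟦⟧-assoc (xs ⟦ ι ⟧) κ T)))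
        (trans (hom (κ ⟦ T ⟧) (increasing-⟦⟧ {s = κ} {T} incκ incT)) (trans (cong (lookup γ) (lookup-⟦⟧ κ T zero)) (const (lookup T zero))))
      pick : (Σ[ κ ∈ Vec (Fin (t ℕ.+ t)) t ] (Increasing κ × Constantly γ true κ)) ⊎ (Σ[ κ ∈ Vec (Fin (t ℕ.+ t)) t ] (Increasing κ × Constantly γ false κ)) → _
      pick (inj₁ x) = build true x
      pick (inj₂ x) = build false x

  -- Keep the first element `x`, apply Ramsey's theorem for `k` to the colouring `col (x ∷ _)` of
  -- the rest so that all tuples starting with `x` get one colour, and recurse inside the
  -- subsequence found.
  end-homogeneous : ∀ k q → ∃[ R ] (∀ {A : Set} (col : Vec A (suc k) → Bool) (xs : Vec A R) →
    Σ[ ι ∈ Vec (Fin R) q ] (Increasing ι × Σ[ γ ∈ Vec Bool q ] (∀ T → Increasing T → col (xs ⟦ ι ⟧ ⟦ T ⟧) ≡ lookup γ (lookup T zero))))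
  end-homogeneous k zero = 0 , λ col xs → [] , increasing-[] , [] , λ { (() ∷ _) }
  end-homogeneous k (suc q) with end-homogeneous k q
  ... | R₁ , go₁ with ramsey k R₁
  ...   | R₂ , go₂ = suc R₂ , ans
    where
    ans : ∀ {A : Set} (col : Vec A (suc k) → Bool) (xs : Vec A (suc R₂)) → Σ[ ι ∈ Vec (Fin (suc R₂)) (suc q) ] (Increasing ι × Σ[ γ ∈ Vec Bool (suc q) ] (∀ T → Increasing T → col (xs ⟦ ι ⟧ ⟦ T ⟧) ≡ lookup γ (lookup T zero)))
    ans col (x ∷ xs) with go₂ (λ y → col (x ∷ y)) xs
    ... | ι₂ , inc₂ , c , hom₂ with go₁ col (xs ⟦ ι₂ ⟧)
    ...   | ι₁ , inc₁ , γ , hom₁ = zero ∷ Vec.map suc (ι₂ ⟦ ι₁ ⟧) , increasing-zero∷ {s = ι₂ ⟦ ι₁ ⟧} (increasing-⟦⟧ {s = ι₂} {ι₁} inc₂ inc₁) , c ∷ γ , hom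
      where
      ys≡ : (x ∷ xs) ⟦ Vec.map suc (ι₂ ⟦ ι₁ ⟧) ⟧ ≡ xs ⟦ ι₂ ⟧ ⟦ ι₁ ⟧
      ys≡ = trans (⟦suc⟧ x xs (ι₂ ⟦ ι₁ ⟧)) (sym (⟦⟧-assoc xs ι₂ ι₁))
      hom : ∀ T → Increasing T → col ((x ∷ xs) ⟦ zero ∷ Vec.map suc (ι₂ ⟦ ι₁ ⟧) ⟧ ⟦ T ⟧) ≡ lookup (c ∷ γ) (lookup T zero)
      hom T incT with increasing-cases T incT
      ... | inj₁ (T′ , refl , incT′) = trans (cong (λ z → col (x ∷ z)) (trans (⟦suc⟧ x _ T′) (trans (cong (_⟦ T′ ⟧) ys≡) (⟦⟧-assoc (xs ⟦ ι₂ ⟧) ι₁ T′)))) (hom₂ (ι₁ ⟦ T′ ⟧) (increasing-⟦⟧ {s = ι₁} {T′} inc₁ incT′))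
      ... | inj₂ (T′ , refl , incT′) = trans (cong col (trans (⟦suc⟧ x _ T′) (cong (_⟦ T′ ⟧) ys≡))) (trans (hom₁ T′ incT′) (cong (lookup (c ∷ γ)) (sym (Vecₚ.lookup-map zero suc T′))))

-- Boxes in dense products

𝔼-Π-map : ∀ {A B : Set} {q} (g : A → B) (ds : Vec (Dist A) q) (f : Vec B q → ℚ) → 𝔼 (ΠD (Vec.map (mapD g) ds)) f ≡ 𝔼 (ΠD ds) (f ∘ Vec.map g)
𝔼-Π-map g []       f = trans (𝔼-Π[] f) (sym (𝔼-Π[] _))
𝔼-Π-map g (d ∷ ds) f = trans (𝔼-Π∷ (mapD g d) _ f) (trans (𝔼-map g d _) (trans (𝔼-cong d (λ x → 𝔼-Π-map g ds (λ ys → f (g x ∷ ys)))) (sym (𝔼-Π∷ d ds _))))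

∑-member : ∀ {X : Set} {xs : List X} {x} {f : X → ℚ} → (∀ y → 0ℚ ≤ f y) → x ∈ xs → f x ≤ ∑ xs f
∑-member {xs = y ∷ xs} nf (here refl) = x≤x+ (∑-nonneg xs nf)
∑-member {xs = y ∷ xs} {x} {f} nf (there m) = ≤-trans (∑-member nf m) (subst (_≤ f y + ∑ xs f) (+-identityˡ (∑ xs f)) (+-monoˡ-≤ (∑ xs f) (nf y)))

∑-search : ∀ {X : Set} (xs : List X) (f : X → ℚ) e → (∃[ x ] e ≤ f x) ⊎ (∑ xs f ≤ ℕ→ℚ (length xs) * e)
∑-search [] f e = inj₂ (≤-reflexive (sym (*-zeroˡ e)))
∑-search (y ∷ ys) f e = go (e ≤? f y) (∑-search ys f e)
  where
  go : Dec (e ≤ f y) → (∃[ x ] e ≤ f x) ⊎ (∑ ys f ≤ ℕ→ℚ (length ys) * e) → (∃[ x ] e ≤ f x) ⊎ (f y + ∑ ys f ≤ ℕ→ℚ (suc (length ys)) * e)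
  go (yes p) _         = inj₁ (y , p)
  go (no _)  (inj₁ r)  = inj₁ r
  go (no ¬p) (inj₂ le) = inj₂ (subst (f y + ∑ ys f ≤_) (trans (cong (_+ ℕ→ℚ (length ys) * e) (sym (*-identityˡ e))) (trans (sym (*-distribʳ-+ e 1ℚ (ℕ→ℚ (length ys)))) (cong (_* e) (sym (ℕ→ℚ-suc (length ys)))))) (+-mono-≤ (<⇒≤ (≰⇒> ¬p)) le))

-- Dividing by one more than the length makes the contradiction strict: if no term reached `e`, the
-- sum would be at most `length xs * e`, which is less than `c`. It also covers the empty list.
pigeonhole-search : ∀ {X : Set} (xs : List X) (f : X → ℚ) {c} → 0ℚ < c → c ≤ ∑ xs f → ∃[ x ] c * inv (ℕ→ℚ (suc (length xs))) ≤ f x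
pigeonhole-search {X} xs f {c} 0<c le = go (∑-search xs f e)
  where
  e : ℚ
  e = c * inv (ℕ→ℚ (suc (length xs)))
  0<e : 0ℚ < e
  0<e = *-pos 0<c (inv-pos (ℕ→ℚ-pos (length xs)))
  re : ∀ c i n → c * i + n * (c * i) ≡ c * ((1ℚ + n) * i)
  re = solve-∀ ℚ-ring
  total : e + ℕ→ℚ (length xs) * e ≡ c
  total = trans (re c (inv (ℕ→ℚ (suc (length xs)))) (ℕ→ℚ (length xs))) (trans (cong (λ z → c * (z * inv (ℕ→ℚ (suc (length xs))))) (sym (ℕ→ℚ-suc (length xs)))) (trans (cong (c *_) (inv-inverse (ℕ→ℚ-pos (length xs)))) (*-identityʳ c)))
  strict : ℕ→ℚ (length xs) * e < c
  strict = subst₂ _<_ (+-identityˡ (ℕ→ℚ (length xs) * e)) total (+-monoˡ-< (ℕ→ℚ (length xs) * e) 0<e)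
  go : (∃[ x ] e ≤ f x) ⊎ (∑ xs f ≤ ℕ→ℚ (length xs) * e) → ∃[ x ] e ≤ f x
  go (inj₁ found) = found
  go (inj₂ le′)   = contradiction (<-≤-trans strict (≤-trans le le′)) (<-irrefl refl)

abstract
  ∑-pigeonhole : ∀ {X : Set} (xs : List X) (f : X → ℚ) {c} → 0ℚ < c → c ≤ ∑ xs f → ∃[ x ] c * inv (ℕ→ℚ (suc (length xs))) ≤ f x
  ∑-pigeonhole = pigeonhole-search

uniformFin : ∀ r → Dist (Fin (suc r))
uniformFin r = uniformD zero (List.tabulate suc)

trues : ∀ {q} → Vec Bool q → ℕ
trues []          = 0
trues (true ∷ γ)  = suc (trues γ)
trues (false ∷ γ) = trues γ

∑-tabulate : ∀ {X : Set} {q} (g : Fin q → X) (f : X → ℚ) → ∑ (List.tabulate g) f ≡ ∑ (allFin q) (f ∘ g)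
∑-tabulate {q = zero}  g f = refl
∑-tabulate {q = suc q} g f = cong (f (g zero) +_) (trans (∑-tabulate (g ∘ suc) f) (sym (∑-tabulate suc (f ∘ g))))

∑-trues : ∀ {q} (γ : Vec Bool q) → ∑ (allFin q) (𝟙 ∘ lookup γ) ≡ ℕ→ℚ (trues γ)
∑-trues []          = refl
∑-trues (true ∷ γ)  = trans (cong (1ℚ +_) (trans (∑-tabulate suc (𝟙 ∘ lookup (true ∷ γ))) (∑-trues γ))) (sym (ℕ→ℚ-suc (trues γ)))
∑-trues (false ∷ γ) = trans (+-identityˡ _) (trans (∑-tabulate suc (𝟙 ∘ lookup (false ∷ γ))) (∑-trues γ))

𝔼-uniformFin : ∀ r (f : Fin (suc r) → ℚ) → 𝔼 (uniformFin r) f ≡ inv (ℕ→ℚ (suc r)) * ∑ (allFin (suc r)) f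
𝔼-uniformFin r f = trans (𝔼-uniform zero (List.tabulate suc) f) (cong (λ z → inv (ℕ→ℚ (suc z)) * ∑ (allFin (suc r)) f) (Listₚ.length-tabulate {n = r} suc))

uniformFin-charged : ∀ r x → Charged (uniformFin r) x
uniformFin-charged r x = charged-uniform zero (List.tabulate suc) x (∈ₚ.∈-∃++ (∈ₚ.∈-allFin x))

few-or-many : ∀ {q} (γ : Vec Bool q) f → (Σ[ κ ∈ Vec (Fin q) f ] (Increasing κ × Constantly γ true κ)) ⊎ (trues γ ℕ.≤ f)
few-or-many γ zero = inj₁ ([] , increasing-[] , λ ())
few-or-many [] (suc f) = inj₂ z≤n
few-or-many (true ∷ γ) (suc f) with few-or-many γ f
... | inj₁ (κ , inc , h) = inj₁ (zero ∷ Vec.map suc κ , increasing-zero∷ {s = κ} inc , λ { zero → refl ; (suc i) → trans (cong (lookup (true ∷ γ)) (Vecₚ.lookup-map i suc κ)) (h i) })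
... | inj₂ le = inj₂ (s≤s le)
few-or-many (false ∷ γ) (suc f) with few-or-many γ (suc f)
... | inj₁ (κ , inc , h) = inj₁ (Vec.map suc κ , increasing-suc {s = κ} inc , λ i → trans (cong (lookup (false ∷ γ)) (Vecₚ.lookup-map i suc κ)) (h i))
... | inj₂ le = inj₂ le

pick : ∀ {X : Set} {m f} → Vec (Vec X f) m → Vec (Fin f) m → Vec X m
pick = Vec.zipWith lookup

IsBox : ∀ {r m f} → (Vec (Fin r) m → Bool) → Vec (Vec (Fin r) f) m → Set
IsBox D g = (∀ i → Injectiveᵛ (lookup g i)) × (∀ τ → D (pick g τ) ≡ true)

half : ℚ
half = inv (1ℚ + 1ℚ)

half-half : ∀ x → x * half + x * half ≡ x
half-half x = trans (re x half) (trans (cong (x *_) (inv-inverse (positive⁻¹ (1ℚ + 1ℚ)))) (*-identityʳ x))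
  where
  re : ∀ x h → x * h + x * h ≡ x * ((1ℚ + 1ℚ) * h)
  re = solve-∀ ℚ-ring

half-pos : ∀ {x} → 0ℚ < x → 0ℚ < x * half
half-pos 0<x = *-pos 0<x (inv-pos (positive⁻¹ (1ℚ + 1ℚ)))

-- Kővári–Sós–Turán; the sizes of the later factors are chosen first.
find-box : ∀ m f {ρ} → 0ℚ < ρ → ∃[ r ] Σ[ ds ∈ Vec (Dist (Fin (suc r))) m ] (∀ D → ρ ≤ 𝔼 (ΠD ds) (𝟙 ∘ D) → ∃[ g ] IsBox {suc r} {m} {f} D g)
find-box zero f {ρ} 0<ρ = 0 , [] , λ D le → [] , (λ ()) , λ { [] → go D (D []) refl le }
  where
  go : ∀ (D : Vec (Fin 1) 0 → Bool) b → D [] ≡ b → ρ ≤ 𝔼 (ΠD []) (𝟙 ∘ D) → D [] ≡ true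
  go D true  e le = e
  go D false e le = contradiction (<-≤-trans 0<ρ (≤-trans le (≤-reflexive (trans (𝔼-Π[] (𝟙 ∘ D)) (cong 𝟙 e))))) (<-irrefl refl)
find-box (suc m) f {ρ} 0<ρ = r₀ ℕ.+ suc r′ , mapD left (uniformFin r₀) ∷ Vec.map (mapD right) ds , ans
  where
  room = archimedean′ (ℕ→ℚ f) (half-pos 0<ρ)
  r₀ : ℕ
  r₀ = proj₁ room
  big : ℕ→ℚ f ≤ ℕ→ℚ r₀ * (ρ * half)
  big = proj₂ room
  rec = find-box m f (*-pos (half-pos 0<ρ) (inv-pos (ℕ→ℚ-pos (length (allVecs (allFin (suc r₀)) f)))))
  r′ : ℕ
  r′ = proj₁ rec
  ds : Vec (Dist (Fin (suc r′))) m
  ds = proj₁ (proj₂ rec)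
  -- All factors have to live on one set of copies. It consists of two blocks, the first for the
  -- first factor and the second for all others, and each distribution is supported on its own
  -- block.
  left : Fin (suc r₀) → Fin (suc (r₀ ℕ.+ suc r′))
  left x = x ↑ˡ suc r′
  right : Fin (suc r′) → Fin (suc (r₀ ℕ.+ suc r′))
  right x = suc r₀ ↑ʳ x
  cands : List (Vec (Fin (suc r₀)) f)
  cands = allVecs (allFin (suc r₀)) f
  ans : ∀ D → ρ ≤ 𝔼 (ΠD (mapD left (uniformFin r₀) ∷ Vec.map (mapD right) ds)) (𝟙 ∘ D) → ∃[ g ] IsBox {suc (r₀ ℕ.+ suc r′)} {suc m} {f} D g
  ans D le = Vec.map left κ ∷ Vec.map (Vec.map right) g , inj , cover
    where
    D′ : Fin (suc r₀) → Vec (Fin (suc r′)) m → Bool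
    D′ x t = D (left x ∷ Vec.map right t)
    fibre : Vec (Fin (suc r′)) m → Vec Bool (suc r₀)
    fibre t = tabulate (λ x → D′ x t)
    Good : Vec (Fin (suc r₀)) f → Vec (Fin (suc r′)) m → Set
    Good κ t = Increasing κ × Constantly (fibre t) true κ
    good? : ∀ κ t → Dec (Good κ t)
    good? κ t = increasing? κ ×-dec Finₚ.all? (λ i → lookup (fibre t) (lookup κ i) Boolₚ.≟ true)
    density : Vec (Fin (suc r′)) m → ℚ
    density t = 𝔼 (uniformFin r₀) (λ x → 𝟙 (D′ x t))
    density≡ : ∀ t → density t ≡ inv (ℕ→ℚ (suc r₀)) * ℕ→ℚ (trues (fibre t))
    density≡ t = trans (𝔼-uniformFin r₀ _) (cong (inv (ℕ→ℚ (suc r₀)) *_) (trans (∑-cong (allFin (suc r₀)) (λ x → cong 𝟙 (sym (Vecₚ.lookup∘tabulate (λ x → D′ x t) x)))) (∑-trues (fibre t))))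
    density≤1 : ∀ t → density t ≤ 1ℚ
    density≤1 t = 𝔼-≤const (uniformFin r₀) (λ x → 𝟙-≤1 (D′ x t))
    nonneg : ∀ t κ → 0ℚ ≤ 𝟙 (does (good? κ t))
    nonneg t κ = 𝟙-nonneg (does (good? κ t))
    -- By the choice of `r₀`, a fibre with at most `f` points has density at most `ρ * half`. Every
    -- other fibre contains one of the finitely many candidate f-sets, among which a pigeonhole then
    -- decides.
    cover-density : ∀ t → density t ≤ ρ * half + ∑ cands (λ κ → 𝟙 (does (good? κ t)))
    cover-density t = split (few-or-many (fibre t) f)
      where
      split : (Σ[ κ ∈ Vec (Fin (suc r₀)) f ] Good κ t) ⊎ (trues (fibre t) ℕ.≤ f) → density t ≤ ρ * half + ∑ cands (λ κ → 𝟙 (does (good? κ t)))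
      split (inj₁ (κ , good)) = ≤-trans (density≤1 t) (≤-trans (subst (_≤ ∑ cands (λ κ → 𝟙 (does (good? κ t)))) (cong 𝟙 (dec-true (good? κ t) good)) (∑-member (nonneg t) (∈-allVecs κ (λ i → ∈ₚ.∈-allFin (lookup κ i)))))
            (subst (_≤ ρ * half + ∑ cands (λ κ → 𝟙 (does (good? κ t)))) (+-identityˡ _) (+-monoˡ-≤ (∑ cands (λ κ → 𝟙 (does (good? κ t)))) (<⇒≤ (half-pos 0<ρ)))))
      split (inj₂ few) = ≤-trans (≤-trans (≤-reflexive (density≡ t)) small) (x≤x+ (∑-nonneg cands (nonneg t)))
        where
        small : inv (ℕ→ℚ (suc r₀)) * ℕ→ℚ (trues (fibre t)) ≤ ρ * half
        small = *-cancelˡ (ℕ→ℚ (suc r₀)) (ℕ→ℚ-pos r₀) (begin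
          ℕ→ℚ (suc r₀) * (inv (ℕ→ℚ (suc r₀)) * ℕ→ℚ (trues (fibre t))) ≡⟨ trans (sym (*-assoc (ℕ→ℚ (suc r₀)) (inv (ℕ→ℚ (suc r₀))) _)) (trans (cong (_* ℕ→ℚ (trues (fibre t))) (inv-inverse (ℕ→ℚ-pos r₀))) (*-identityˡ (ℕ→ℚ (trues (fibre t))))) ⟩
          ℕ→ℚ (trues (fibre t)) ≤⟨ ℕ→ℚ-mono few ⟩
          ℕ→ℚ f ≤⟨ big ⟩
          ℕ→ℚ r₀ * (ρ * half) ≤⟨ *-monoʳ (ρ * half) (<⇒≤ (half-pos 0<ρ)) (ℕ→ℚ-mono (ℕₚ.n≤1+n r₀)) ⟩
          ℕ→ℚ (suc r₀) * (ρ * half) ∎)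
          where open ≤-Reasoning
    total : ρ ≤ ρ * half + ∑ cands (λ κ → 𝔼 (ΠD ds) (λ t → 𝟙 (does (good? κ t))))
    total = begin
      ρ ≤⟨ le ⟩
      𝔼 (ΠD (mapD left (uniformFin r₀) ∷ Vec.map (mapD right) ds)) (𝟙 ∘ D)
        ≡⟨ trans (𝔼-Π∷ _ _ (𝟙 ∘ D)) (trans (𝔼-map left (uniformFin r₀) _) (𝔼-cong (uniformFin r₀) (λ x → 𝔼-Π-map right ds _))) ⟩
      𝔼 (uniformFin r₀) (λ x → 𝔼 (ΠD ds) (λ t → 𝟙 (D′ x t)))
        ≡⟨ 𝔼-swap (uniformFin r₀) (ΠD ds) _ ⟩
      𝔼 (ΠD ds) density
        ≤⟨ 𝔼-mono (ΠD ds) cover-density ⟩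
      𝔼 (ΠD ds) (λ t → ρ * half + ∑ cands (λ κ → 𝟙 (does (good? κ t))))
        ≡⟨ trans (𝔼-+ (ΠD ds) _ _) (cong₂ _+_ (𝔼-const (ΠD ds) (ρ * half)) (𝔼-∑ (ΠD ds) cands _)) ⟩
      ρ * half + ∑ cands (λ κ → 𝔼 (ΠD ds) (λ t → 𝟙 (does (good? κ t)))) ∎
      where open ≤-Reasoning
    halved : ρ * half ≤ ∑ cands (λ κ → 𝔼 (ΠD ds) (λ t → 𝟙 (does (good? κ t))))
    halved = subst₂ _≤_ (trans (cong (_+ - (ρ * half)) (sym (half-half ρ))) (lem (ρ * half) (ρ * half))) (lem′ (ρ * half) _) (+-monoˡ-≤ (- (ρ * half)) total)
      where
      lem : ∀ a b → (a + b) - b ≡ a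
      lem = solve-∀ ℚ-ring
      lem′ : ∀ a b → (a + b) - a ≡ b
      lem′ = solve-∀ ℚ-ring
    chosen = ∑-pigeonhole cands (λ κ → 𝔼 (ΠD ds) (λ t → 𝟙 (does (good? κ t)))) (half-pos 0<ρ) halved
    κ : Vec (Fin (suc r₀)) f
    κ = proj₁ chosen
    sub = proj₂ (proj₂ rec) (λ t → does (good? κ t)) (proj₂ chosen)
    g : Vec (Vec (Fin (suc r′)) f) m
    g = proj₁ sub
    does⇒ : ∀ {P : Set} (d : Dec P) → does d ≡ true → P
    does⇒ (yes p) _ = p
    goodτ : ∀ τ → Good κ (pick g τ)
    goodτ τ = does⇒ (good? κ (pick g τ)) (proj₂ (proj₂ sub) τ)
    pick-map : ∀ {m} (g : Vec (Vec (Fin (suc r′)) f) m) τ → pick (Vec.map (Vec.map right) g) τ ≡ Vec.map right (pick g τ)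
    pick-map []      []      = refl
    pick-map (x ∷ g) (i ∷ τ) = cong₂ _∷_ (Vecₚ.lookup-map i right x) (pick-map g τ)
    cover : ∀ τ → D (pick (Vec.map left κ ∷ Vec.map (Vec.map right) g) τ) ≡ true
    cover (i ∷ τ) = trans (cong D (cong₂ _∷_ (Vecₚ.lookup-map i left κ) (pick-map g τ))) (trans (sym (Vecₚ.lookup∘tabulate (λ x → D′ x (pick g τ)) (lookup κ i))) (proj₂ (goodτ τ) i))
    κ-inj : Injectiveᵛ κ
    -- That `κ` is increasing is known only through some point of the box. The position `p` supplies
    -- one; for f = 0 there is no position and nothing to show.
    κ-inj {p} {q} e = increasing⇒injective {s = κ} (proj₁ (goodτ (Vec.replicate m p))) e
    inj : ∀ i → Injectiveᵛ (lookup (Vec.map left κ ∷ Vec.map (Vec.map right) g) i)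
    inj zero {p} {q} e = κ-inj (Finₚ.↑ˡ-injective (suc r′) _ _ (trans (sym (Vecₚ.lookup-map p left κ)) (trans e (Vecₚ.lookup-map q left κ))))
    inj (suc i) {p} {q} e = proj₁ (proj₂ sub) i (Finₚ.↑ʳ-injective (suc r₀) _ _ (trans (sym (Vecₚ.lookup-map p right (lookup g i))) (trans (cong (λ z → lookup z p) (sym (Vecₚ.lookup-map i (Vec.map right) g))) (trans e (trans (cong (λ z → lookup z q) (Vecₚ.lookup-map i (Vec.map right) g)) (Vecₚ.lookup-map q right (lookup g i)))))))

abstract
  box : ∀ m f {ρ} → 0ℚ < ρ → ∃[ r ] Σ[ ds ∈ Vec (Dist (Fin (suc r))) m ] (∀ D → ρ ≤ 𝔼 (ΠD ds) (𝟙 ∘ D) → ∃[ g ] IsBox {suc r} {m} {f} D g)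
  box = find-box

-- Vertex tuples and vertex sets

insert : ∀ {n} → Fin n → Subset n → Subset n
insert x S = S [ x ]≔ true

card-insert : ∀ {n} (S : Subset n) x → lookup S x ≡ false → Sub.∣ insert x S ∣ ≡ suc Sub.∣ S ∣
card-insert (false ∷ S) zero    e = refl
card-insert (true ∷ S)  (suc x) e = cong suc (card-insert S x e)
card-insert (false ∷ S) (suc x) e = card-insert S x e

insert-member : ∀ {n} (S : Subset n) x → lookup S x ≡ true → insert x S ≡ S
insert-member (true ∷ S) zero    e = refl
insert-member (b ∷ S)    (suc x) e = cong (b ∷_) (insert-member S x e)

setOf : ∀ {n q} → Vec (Fin n) q → Subset n
setOf []      = replicate _ false
setOf (x ∷ y) = insert x (setOf y)

setOf-complete : ∀ {n q} (y : Vec (Fin n) q) l → lookup (setOf y) (lookup y l) ≡ true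
setOf-complete (x ∷ y) zero = Vecₚ.lookup∘update x (setOf y) true
setOf-complete (x ∷ y) (suc l) with x Finₚ.≟ lookup y l
... | yes e  = trans (cong (λ z → lookup (insert x (setOf y)) z) (sym e)) (Vecₚ.lookup∘update x (setOf y) true)
... | no x≢ = trans (Vecₚ.lookup∘update′ (x≢ ∘ sym) (setOf y) true) (setOf-complete y l)

setOf-sound : ∀ {n q} (y : Vec (Fin n) q) i → lookup (setOf y) i ≡ true → Covered y i
setOf-sound [] i e = contradiction (trans (sym e) (Vecₚ.lookup-replicate i false)) λ ()
setOf-sound (x ∷ y) i e with x Finₚ.≟ i
... | yes x≡i = zero , x≡i
... | no x≢i with setOf-sound y i (trans (sym (Vecₚ.lookup∘update′ (x≢i ∘ sym) (setOf y) true)) e)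
...   | l , p = suc l , p

subset-ext : ∀ {n} {S T : Subset n} → (∀ i → lookup S i ≡ true → lookup T i ≡ true) → (∀ i → lookup T i ≡ true → lookup S i ≡ true) → S ≡ T
subset-ext {S = S} {T} f g = vec-ext λ i → eq (lookup S i) (lookup T i) (f i) (g i)
  where
  eq : ∀ a b → (a ≡ true → b ≡ true) → (b ≡ true → a ≡ true) → a ≡ b
  eq true  b f g = sym (f refl)
  eq false true  f g = g refl
  eq false false f g = refl

setOf-⊆ : ∀ {n q r} (y : Vec (Fin n) q) (z : Vec (Fin n) r) → (∀ l → Covered z (lookup y l)) → ∀ i → lookup (setOf y) i ≡ true → lookup (setOf z) i ≡ true
setOf-⊆ y z c i e with setOf-sound y i e
... | l , refl with c l
...   | l′ , p = subst (λ w → lookup (setOf z) w ≡ true) p (setOf-complete z l′)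

card-⊥ : ∀ n → Sub.∣ replicate n false ∣ ≡ 0
card-⊥ zero    = refl
card-⊥ (suc n) = card-⊥ n

distinct : ∀ {n q} → Vec (Fin n) q → Bool
distinct []      = true
distinct (x ∷ y) = not (lookup (setOf y) x) ∧ distinct y

card-setOf≤ : ∀ {n q} (y : Vec (Fin n) q) → Sub.∣ setOf y ∣ ℕ.≤ q
card-setOf≤ {n} [] = ℕₚ.≤-reflexive (card-⊥ n)
card-setOf≤ (x ∷ y) with lookup (setOf y) x in e
... | true  = ℕₚ.≤-trans (ℕₚ.≤-reflexive (cong Sub.∣_∣ (insert-member (setOf y) x e))) (ℕₚ.m≤n⇒m≤1+n (card-setOf≤ y))
... | false = ℕₚ.≤-trans (ℕₚ.≤-reflexive (card-insert (setOf y) x e)) (s≤s (card-setOf≤ y))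

card-distinct : ∀ {n q} (y : Vec (Fin n) q) → distinct y ≡ true → Sub.∣ setOf y ∣ ≡ q
card-distinct {n} [] e = card-⊥ n
card-distinct (x ∷ y) e with lookup (setOf y) x in m
... | false = trans (card-insert (setOf y) x m) (cong suc (card-distinct y e))

card-repeat : ∀ {n q} (y : Vec (Fin n) q) → distinct y ≡ false → Sub.∣ setOf y ∣ ℕ.< q
card-repeat (x ∷ y) e with lookup (setOf y) x in m
... | true  = s≤s (ℕₚ.≤-trans (ℕₚ.≤-reflexive (cong Sub.∣_∣ (insert-member (setOf y) x m))) (card-setOf≤ y))
... | false = s≤s (ℕₚ.≤-trans (ℕₚ.≤-reflexive (card-insert (setOf y) x m)) (card-repeat y e))

distinct⇒injective : ∀ {n q} (y : Vec (Fin n) q) → distinct y ≡ true → Injectiveᵛ y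
distinct⇒injective (x ∷ y) e {zero}  {zero}  _ = refl
distinct⇒injective (x ∷ y) e {zero}  {suc j} p with lookup (setOf y) x in m
... | false = contradiction (trans (sym m) (trans (cong (lookup (setOf y)) p) (setOf-complete y j))) λ ()
distinct⇒injective (x ∷ y) e {suc i} {zero}  p with lookup (setOf y) x in m
... | false = contradiction (trans (sym m) (trans (cong (lookup (setOf y)) (sym p)) (setOf-complete y i))) λ ()
distinct⇒injective (x ∷ y) e {suc i} {suc j} p with lookup (setOf y) x
... | false = cong suc (distinct⇒injective y e p)

injective⇒distinct : ∀ {n q} (y : Vec (Fin n) q) → Injectiveᵛ y → distinct y ≡ true
injective⇒distinct [] inj = refl
injective⇒distinct (x ∷ y) inj with lookup (setOf y) x in m
... | false = injective⇒distinct y (λ e → Finₚ.suc-injective (inj e))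
... | true with setOf-sound y x m
...   | l , p = contradiction (inj {suc l} {zero} p) λ ()

elems : ∀ {n} (S : Subset n) → Vec (Fin n) Sub.∣ S ∣
elems []          = []
elems (true ∷ S)  = zero ∷ Vec.map suc (elems S)
elems (false ∷ S) = Vec.map suc (elems S)

elems-increasing : ∀ {n} (S : Subset n) → Increasing (elems S)
elems-increasing []          = increasing-[]
elems-increasing (true ∷ S)  = increasing-zero∷ {s = elems S} (elems-increasing S)
elems-increasing (false ∷ S) = increasing-suc {s = elems S} (elems-increasing S)

elems-sound : ∀ {n} (S : Subset n) l → lookup S (lookup (elems S) l) ≡ true
elems-sound (true ∷ S)  zero    = refl
elems-sound (true ∷ S)  (suc l) = trans (cong (lookup (true ∷ S)) (Vecₚ.lookup-map l suc (elems S))) (elems-sound S l)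
elems-sound (false ∷ S) l       = trans (cong (lookup (false ∷ S)) (Vecₚ.lookup-map l suc (elems S))) (elems-sound S l)

elems-complete : ∀ {n} (S : Subset n) i → lookup S i ≡ true → Covered (elems S) i
elems-complete (true ∷ S) zero e = zero , refl
elems-complete (true ∷ S) (suc i) e with elems-complete S i e
... | l , p = suc l , trans (Vecₚ.lookup-map l suc (elems S)) (cong suc p)
elems-complete (false ∷ S) (suc i) e with elems-complete S i e
... | l , p = l , trans (Vecₚ.lookup-map l suc (elems S)) (cong suc p)

trues≡card : ∀ {n} (S : Subset n) → trues S ≡ Sub.∣ S ∣
trues≡card []          = refl
trues≡card (true ∷ S)  = cong suc (trues≡card S)
trues≡card (false ∷ S) = trues≡card S

∑-allSubsets : ∀ n (f : Subset (suc n) → ℚ) → ∑ (allSubsets (suc n)) f ≡ ∑ (allSubsets n) (f ∘ (true ∷_)) + ∑ (allSubsets n) (f ∘ (false ∷_))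
∑-allSubsets n f = trans (∑-++ (List.map (true ∷_) (allSubsets n)) _ f) (cong₂ _+_ (∑-map (true ∷_) (allSubsets n) f) (∑-map (false ∷_) (allSubsets n) f))

-- `insert x` is a bijection from the sets without `x` to the sets with `x`.
∑-insert : ∀ {n} (x : Fin n) (g : Subset n → ℚ) → ∑ (allSubsets n) (λ S → 𝟙 (not (lookup S x)) * g (insert x S)) ≡ ∑ (allSubsets n) (λ S → 𝟙 (lookup S x) * g S)
∑-insert {suc n} zero g = begin
  ∑ (allSubsets (suc n)) (λ S → 𝟙 (not (lookup S zero)) * g (insert zero S))
    ≡⟨ ∑-allSubsets n _ ⟩
  ∑ (allSubsets n) (λ S → 0ℚ * g (true ∷ S)) + ∑ (allSubsets n) (λ S → 1ℚ * g (true ∷ S))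
    ≡⟨ cong (_+ ∑ (allSubsets n) (λ S → 1ℚ * g (true ∷ S))) (zeros (λ S → g (true ∷ S))) ⟩
  0ℚ + ∑ (allSubsets n) (λ S → 1ℚ * g (true ∷ S))
    ≡⟨ trans (+-comm 0ℚ (∑ (allSubsets n) (λ S → 1ℚ * g (true ∷ S)))) (cong (∑ (allSubsets n) (λ S → 1ℚ * g (true ∷ S)) +_) (sym (zeros (λ S → g (false ∷ S))))) ⟩
  ∑ (allSubsets n) (λ S → 1ℚ * g (true ∷ S)) + ∑ (allSubsets n) (λ S → 0ℚ * g (false ∷ S))
    ≡⟨ sym (∑-allSubsets n _) ⟩
  ∑ (allSubsets (suc n)) (λ S → 𝟙 (lookup S zero) * g S) ∎
  where
  open ≡-Reasoning
  zeros : ∀ (f : Subset n → ℚ) → ∑ (allSubsets n) (λ S → 0ℚ * f S) ≡ 0ℚ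
  zeros f = trans (∑-* (allSubsets n) 0ℚ f) (*-zeroˡ (∑ (allSubsets n) f))
∑-insert {suc n} (suc x) g = trans (∑-allSubsets n _) (trans (cong₂ _+_ (∑-insert x (g ∘ (true ∷_))) (∑-insert x (g ∘ (false ∷_)))) (sym (∑-allSubsets n _)))

factorial : ℕ → ℚ
factorial zero    = 1ℚ
factorial (suc q) = ℕ→ℚ (suc q) * factorial q

module Vertices (n′ : ℕ) where
  n : ℕ
  n = suc n′
  open Uniform (uniformFin n′)

  1/n : ℚ
  1/n = inv (ℕ→ℚ n)

  1/n-nonneg : 0ℚ ≤ 1/n
  1/n-nonneg = <⇒≤ (inv-pos (ℕ→ℚ-pos n′))

  ofSize : ℕ → Subset n → ℚ
  ofSize q S = 𝟙 (Sub.∣ S ∣ ≡ᵇ q)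

  -- orderings q = q! / n^q
  orderings : ℕ → ℚ
  orderings zero    = 1ℚ
  orderings (suc q) = 1/n * ℕ→ℚ (suc q) * orderings q

  orderings-power : ∀ q → orderings q * ℕ→ℚ (n ℕ.^ q) ≡ factorial q
  orderings-power zero    = *-identityˡ 1ℚ
  orderings-power (suc q) = begin
    1/n * ℕ→ℚ (suc q) * orderings q * ℕ→ℚ (n ℕ.* n ℕ.^ q)       ≡⟨ cong (1/n * ℕ→ℚ (suc q) * orderings q *_) (ℕ→ℚ-* n (n ℕ.^ q)) ⟩
    1/n * ℕ→ℚ (suc q) * orderings q * (ℕ→ℚ n * ℕ→ℚ (n ℕ.^ q))   ≡⟨ re 1/n (ℕ→ℚ (suc q)) (orderings q) (ℕ→ℚ n) (ℕ→ℚ (n ℕ.^ q)) ⟩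
    (ℕ→ℚ n * 1/n) * (ℕ→ℚ (suc q) * (orderings q * ℕ→ℚ (n ℕ.^ q))) ≡⟨ cong₂ (λ x y → x * (ℕ→ℚ (suc q) * y)) (inv-inverse (ℕ→ℚ-pos n′)) (orderings-power q) ⟩
    1ℚ * (ℕ→ℚ (suc q) * factorial q)                           ≡⟨ *-identityˡ (ℕ→ℚ (suc q) * factorial q) ⟩
    ℕ→ℚ (suc q) * factorial q ∎
    where
    open ≡-Reasoning
    re : ∀ i s o m p → i * s * o * (m * p) ≡ (m * i) * (s * (o * p))
    re = solve-∀ ℚ-ring

  orderings-nonneg : ∀ q → 0ℚ ≤ orderings q
  orderings-nonneg zero    = 0≤1
  orderings-nonneg (suc q) = *-nonneg (*-nonneg 1/n-nonneg (ℕ→ℚ-nonneg (suc q))) (orderings-nonneg q)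

  -- Every q-set is listed by q! distinct tuples. In the induction a new first vertex `x` is
  -- inserted: by `∑-insert` the sum runs over the larger sets containing `x`, and summing over `x`
  -- counts each of them once for each of its q + 1 elements.
  𝔼-tuples : ∀ q (g : Subset n → ℚ) → 𝔼 (U q) (λ y → 𝟙 (distinct y) * g (setOf y)) ≡ orderings q * ∑ (allSubsets n) (λ S → ofSize q S * g S)
  𝔼-tuples zero g = trans (𝔼-Π[] _) (trans (*-identityˡ _) (sym (trans (*-identityˡ _) (empty n g))))
    where
    empty : ∀ n (g : Subset n → ℚ) → ∑ (allSubsets n) (λ S → 𝟙 (Sub.∣ S ∣ ≡ᵇ 0) * g S) ≡ g (replicate n false)
    empty zero    g = trans (+-identityʳ _) (*-identityˡ (g []))
    empty (suc n) g = trans (∑-allSubsets n _) (trans (cong₂ _+_ (trans (∑-* (allSubsets n) 0ℚ (g ∘ (true ∷_))) (*-zeroˡ (∑ (allSubsets n) (g ∘ (true ∷_))))) (empty n (g ∘ (false ∷_)))) (+-identityˡ _))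
  𝔼-tuples (suc q) g = begin
    𝔼 (U (suc q)) (λ y → 𝟙 (distinct y) * g (setOf y))
      ≡⟨ 𝔼-Π∷ (uniformFin n′) _ _ ⟩
    𝔼 (uniformFin n′) (λ x → 𝔼 (U q) (λ y → 𝟙 (not (lookup (setOf y) x) ∧ distinct y) * g (insert x (setOf y))))
      ≡⟨ 𝔼-cong (uniformFin n′) (λ x → 𝔼-cong (U q) (λ y → trans (cong (_* g (insert x (setOf y))) (𝟙-∧ (not (lookup (setOf y) x)) (distinct y))) (re (𝟙 (not (lookup (setOf y) x))) (𝟙 (distinct y)) (g (insert x (setOf y)))))) ⟩
    𝔼 (uniformFin n′) (λ x → 𝔼 (U q) (λ y → 𝟙 (distinct y) * (𝟙 (not (lookup (setOf y) x)) * g (insert x (setOf y)))))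
      ≡⟨ 𝔼-cong (uniformFin n′) (λ x → 𝔼-tuples q (λ S → 𝟙 (not (lookup S x)) * g (insert x S))) ⟩
    𝔼 (uniformFin n′) (λ x → orderings q * ∑ (allSubsets n) (λ S → ofSize q S * (𝟙 (not (lookup S x)) * g (insert x S))))
      ≡⟨ trans (𝔼-* (uniformFin n′) (orderings q) _) (cong (orderings q *_) (𝔼-uniformFin n′ _)) ⟩
    orderings q * (1/n * ∑ (allFin n) (λ x → ∑ (allSubsets n) (λ S → ofSize q S * (𝟙 (not (lookup S x)) * g (insert x S)))))
      ≡⟨ cong (λ z → orderings q * (1/n * z)) (∑-cong (allFin n) (λ x → trans (∑-cong (allSubsets n) (λ S → resize x S (lookup S x) refl)) (∑-insert x (λ S → ofSize (suc q) S * g S)))) ⟩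
    orderings q * (1/n * ∑ (allFin n) (λ x → ∑ (allSubsets n) (λ S → 𝟙 (lookup S x) * (ofSize (suc q) S * g S))))
      ≡⟨ cong (λ z → orderings q * (1/n * z)) (∑-swap (allFin n) (allSubsets n) (λ x S → 𝟙 (lookup S x) * (ofSize (suc q) S * g S))) ⟩
    orderings q * (1/n * ∑ (allSubsets n) (λ S → ∑ (allFin n) (λ x → 𝟙 (lookup S x) * (ofSize (suc q) S * g S))))
      ≡⟨ cong (λ z → orderings q * (1/n * z)) (trans (∑-cong (allSubsets n) (λ S → trans (pull S) (sized S (Sub.∣ S ∣ ≡ᵇ suc q) refl))) (∑-* (allSubsets n) (ℕ→ℚ (suc q)) _)) ⟩
    orderings q * (1/n * (ℕ→ℚ (suc q) * ∑ (allSubsets n) (λ S → ofSize (suc q) S * g S)))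
      ≡⟨ re′ (orderings q) 1/n (ℕ→ℚ (suc q)) _ ⟩
    1/n * ℕ→ℚ (suc q) * orderings q * ∑ (allSubsets n) (λ S → ofSize (suc q) S * g S) ∎
    where
    open ≡-Reasoning
    re : ∀ a b c → a * b * c ≡ b * (a * c)
    re = solve-∀ ℚ-ring
    re′ : ∀ o i s z → o * (i * (s * z)) ≡ i * s * o * z
    re′ = solve-∀ ℚ-ring
    resize : ∀ x S b → lookup S x ≡ b → ofSize q S * (𝟙 (not (lookup S x)) * g (insert x S)) ≡ 𝟙 (not (lookup S x)) * (ofSize (suc q) (insert x S) * g (insert x S))
    resize x S true  e = trans (cong (λ z → ofSize q S * (𝟙 (not z) * g (insert x S))) e) (trans (cong (ofSize q S *_) (*-zeroˡ (g (insert x S)))) (trans (*-zeroʳ (ofSize q S)) (sym (trans (cong (λ z → 𝟙 (not z) * (ofSize (suc q) (insert x S) * g (insert x S))) e) (*-zeroˡ (ofSize (suc q) (insert x S) * g (insert x S)))))))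
    resize x S false e = trans (lem (ofSize q S) (𝟙 (not (lookup S x))) (g (insert x S))) (cong (λ z → 𝟙 (not (lookup S x)) * (𝟙 (z ≡ᵇ suc q) * g (insert x S))) (sym (card-insert S x e)))
      where
      lem : ∀ a b c → a * (b * c) ≡ b * (a * c)
      lem = solve-∀ ℚ-ring
    pull : ∀ S → ∑ (allFin n) (λ x → 𝟙 (lookup S x) * (ofSize (suc q) S * g S)) ≡ ℕ→ℚ Sub.∣ S ∣ * (ofSize (suc q) S * g S)
    pull S = trans (∑-cong (allFin n) (λ x → *-comm (𝟙 (lookup S x)) (ofSize (suc q) S * g S))) (trans (∑-* (allFin n) (ofSize (suc q) S * g S) (λ x → 𝟙 (lookup S x))) (trans (cong (ofSize (suc q) S * g S *_) (trans (∑-trues S) (cong ℕ→ℚ (trues≡card S)))) (*-comm (ofSize (suc q) S * g S) (ℕ→ℚ Sub.∣ S ∣))))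
    sized : ∀ S b → (Sub.∣ S ∣ ≡ᵇ suc q) ≡ b → ℕ→ℚ Sub.∣ S ∣ * (ofSize (suc q) S * g S) ≡ ℕ→ℚ (suc q) * (ofSize (suc q) S * g S)
    sized S true  e = cong (λ z → ℕ→ℚ z * (ofSize (suc q) S * g S)) (ℕₚ.≡ᵇ⇒≡ Sub.∣ S ∣ (suc q) (subst Data.Bool.T (sym e) _))
    sized S false e = trans (vanish (ℕ→ℚ Sub.∣ S ∣)) (sym (vanish (ℕ→ℚ (suc q))))
      where
      vanish : ∀ z → z * (ofSize (suc q) S * g S) ≡ 0ℚ
      vanish z = trans (cong (λ b → z * (𝟙 b * g S)) e) (trans (cong (z *_) (*-zeroˡ (g S))) (*-zeroʳ z))

  -- Union bound: the first vertex hits one of the at most q others with probability at most q/n.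
  repeats-rare : ∀ q → 𝔼 (U q) (λ y → 𝟙 (not (distinct y))) ≤ ℕ→ℚ (q ℕ.* q) * 1/n
  repeats-rare zero = ≤-reflexive (trans (𝔼-Π[] _) (sym (*-zeroˡ 1/n)))
  repeats-rare (suc q) = begin
    𝔼 (U (suc q)) (λ y → 𝟙 (not (distinct y)))
      ≡⟨ 𝔼-Π∷ (uniformFin n′) _ _ ⟩
    𝔼 (uniformFin n′) (λ x → 𝔼 (U q) (λ y → 𝟙 (not (not (lookup (setOf y) x) ∧ distinct y))))
      ≤⟨ 𝔼-mono (uniformFin n′) (λ x → 𝔼-mono (U q) (λ y → split (lookup (setOf y) x) (distinct y))) ⟩
    𝔼 (uniformFin n′) (λ x → 𝔼 (U q) (λ y → 𝟙 (lookup (setOf y) x) + 𝟙 (not (distinct y))))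
      ≡⟨ 𝔼-swap (uniformFin n′) (U q) _ ⟩
    𝔼 (U q) (λ y → 𝔼 (uniformFin n′) (λ x → 𝟙 (lookup (setOf y) x) + 𝟙 (not (distinct y))))
      ≡⟨ trans (𝔼-cong (U q) (λ y → trans (𝔼-+ (uniformFin n′) _ _) (cong₂ _+_ (hits y) (𝔼-const (uniformFin n′) (𝟙 (not (distinct y))))))) (𝔼-+ (U q) _ _) ⟩
    𝔼 (U q) (λ y → 1/n * ℕ→ℚ Sub.∣ setOf y ∣) + 𝔼 (U q) (λ y → 𝟙 (not (distinct y)))
      ≤⟨ +-mono-≤ (𝔼-≤const (U q) (λ y → *-monoˡ 1/n 1/n-nonneg (ℕ→ℚ-mono (card-setOf≤ y)))) (repeats-rare q) ⟩
    1/n * ℕ→ℚ q + ℕ→ℚ (q ℕ.* q) * 1/n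
      ≡⟨ trans (cong (_+ ℕ→ℚ (q ℕ.* q) * 1/n) (*-comm 1/n (ℕ→ℚ q))) (trans (sym (*-distribʳ-+ 1/n (ℕ→ℚ q) (ℕ→ℚ (q ℕ.* q)))) (cong (_* 1/n) (sym (ℕ→ℚ-+ q (q ℕ.* q))))) ⟩
    ℕ→ℚ (q ℕ.+ q ℕ.* q) * 1/n
      ≤⟨ *-monoʳ 1/n 1/n-nonneg (ℕ→ℚ-mono (ℕₚ.+-mono-≤ (ℕₚ.n≤1+n q) (ℕₚ.*-monoʳ-≤ q (ℕₚ.n≤1+n q)))) ⟩
    ℕ→ℚ (suc q ℕ.+ q ℕ.* suc q) * 1/n ∎
    where
    open ≤-Reasoning
    split : ∀ a b → 𝟙 (not (not a ∧ b)) ≤ 𝟙 a + 𝟙 (not b)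
    split true  b     = x≤x+ (𝟙-nonneg (not b))
    split false true  = ≤-refl
    split false false = ≤-refl
    hits : ∀ y → 𝔼 (uniformFin n′) (λ x → 𝟙 (lookup (setOf y) x)) ≡ 1/n * ℕ→ℚ Sub.∣ setOf y ∣
    hits y = trans (𝔼-uniformFin n′ _) (cong (1/n *_) (trans (∑-trues (setOf y)) (cong ℕ→ℚ (trues≡card (setOf y)))))

-- Boolean encodings of subsets, counts and cliques

∈-allSubsets : ∀ {n} (S : Subset n) → S ∈ allSubsets n
∈-allSubsets []          = here refl
∈-allSubsets (true ∷ S)  = ∈ₚ.∈-++⁺ˡ (∈ₚ.∈-map⁺ (true ∷_) (∈-allSubsets S))
∈-allSubsets (false ∷ S) = ∈ₚ.∈-++⁺ʳ (List.map (true ∷_) (allSubsets _)) (∈ₚ.∈-map⁺ (false ∷_) (∈-allSubsets S))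

countTrue-∑ : ∀ {X : Set} (f : X → Bool) xs → ℕ→ℚ (countTrue (List.map f xs)) ≡ ∑ xs (𝟙 ∘ f)
countTrue-∑ f [] = refl
countTrue-∑ f (x ∷ xs) with f x
... | true  = trans (ℕ→ℚ-suc (countTrue (List.map f xs))) (cong (1ℚ +_) (countTrue-∑ f xs))
... | false = trans (countTrue-∑ f xs) (sym (+-identityˡ _))

allFinB-sound : ∀ {f} (P : Fin f → Bool) → allFinB P ≡ true → ∀ i → P i ≡ true
allFinB-sound P e zero    with P zero
... | true = refl
allFinB-sound P e (suc i) with P zero
... | true = allFinB-sound (P ∘ suc) e i

allFinB-complete : ∀ {f} (P : Fin f → Bool) → (∀ i → P i ≡ true) → allFinB P ≡ true
allFinB-complete {zero}  P h = refl
allFinB-complete {suc f} P h rewrite h zero = allFinB-complete (P ∘ suc) (h ∘ suc)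

infix 4 _⊑_
_⊑_ : ∀ {n} → Subset n → Subset n → Set
T ⊑ S = ∀ i → lookup T i ≡ true → lookup S i ≡ true

subB-sound : ∀ {n} (T S : Subset n) → subB T S ≡ true → T ⊑ S
subB-sound T S e i t with allFinB-sound (λ i → not (lookup T i) ∨ lookup S i) e i
... | p rewrite t = p

subB-complete : ∀ {n} (T S : Subset n) → T ⊑ S → subB T S ≡ true
subB-complete T S sub = allFinB-complete _ λ i → go (lookup T i) (lookup S i) (sub i)
  where
  go : ∀ a b → (a ≡ true → b ≡ true) → not a ∨ b ≡ true
  go true  b h = h refl
  go false b h = refl

module _ {n : ℕ} (k j : ℕ) (G : Subset n → Bool) (S : Subset n) where

  private
    -- inKB hides its auxiliary function; any function with the same equations will do.
    spec : (f : List (Subset n) → Bool) → f [] ≡ true → (∀ T Ts → f (T ∷ Ts) ≡ (not (subB T S ∧ (Sub.∣ T ∣ ≡ᵇ j)) ∨ G T) ∧ f Ts) → ∀ L →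
      ((Sub.∣ S ∣ ≡ᵇ k) ∧ f L ≡ true → Sub.∣ S ∣ ≡ k × (∀ {T} → T ∈ L → T ⊑ S → Sub.∣ T ∣ ≡ j → G T ≡ true)) ×
      (Sub.∣ S ∣ ≡ k → (∀ T → T ⊑ S → Sub.∣ T ∣ ≡ j → G T ≡ true) → (Sub.∣ S ∣ ≡ᵇ k) ∧ f L ≡ true)
    spec f f[] f∷ L = to , from
      where
      ∧-true : ∀ {a b} → a ∧ b ≡ true → a ≡ true × b ≡ true
      ∧-true {true} {true} _ = refl , refl
      T-to : ∀ {b} → b ≡ true → Data.Bool.T b
      T-to refl = _
      ≡ᵇ-refl : ∀ m → (m ≡ᵇ m) ≡ true
      ≡ᵇ-refl zero    = refl
      ≡ᵇ-refl (suc m) = ≡ᵇ-refl m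
      clause : ∀ T b → (subB T S ∧ (Sub.∣ T ∣ ≡ᵇ j)) ≡ b → not b ∨ G T ≡ true → T ⊑ S → Sub.∣ T ∣ ≡ j → G T ≡ true
      clause T true  e h sub sz = h
      clause T false e h sub sz = contradiction (trans (sym (trans (cong₂ _∧_ (subB-complete T S sub) (trans (cong (_≡ᵇ j) sz) (≡ᵇ-refl j))) refl)) e) λ ()
      all-to : ∀ L → f L ≡ true → ∀ {T} → T ∈ L → T ⊑ S → Sub.∣ T ∣ ≡ j → G T ≡ true
      all-to (T ∷ L) e (here refl) sub sz = clause T _ refl (proj₁ (∧-true (trans (sym (f∷ T L)) e))) sub sz
      all-to (T ∷ L) e (there m)   sub sz = all-to L (proj₂ (∧-true (trans (sym (f∷ T L)) e))) m sub sz
      all-from : ∀ L → (∀ T → T ⊑ S → Sub.∣ T ∣ ≡ j → G T ≡ true) → f L ≡ true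
      all-from [] h = f[]
      all-from (T ∷ L) h = trans (f∷ T L) (cong₂ _∧_ (go (subB T S) refl (Sub.∣ T ∣ ≡ᵇ j) refl) (all-from L h))
        where
        go : ∀ a → subB T S ≡ a → ∀ b → (Sub.∣ T ∣ ≡ᵇ j) ≡ b → not (a ∧ b) ∨ G T ≡ true
        go true  e true  e′ = h T (subB-sound T S e) (ℕₚ.≡ᵇ⇒≡ Sub.∣ T ∣ j (T-to e′))
        go true  e false e′ = refl
        go false e b     e′ = refl
      to : _
      to e = ℕₚ.≡ᵇ⇒≡ Sub.∣ S ∣ k (T-to (proj₁ (∧-true e))) , all-to L (proj₂ (∧-true e))
      from : _
      from sz h = cong₂ _∧_ (trans (cong (_≡ᵇ k) sz) (≡ᵇ-refl k)) (all-from L h)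

    both : (inKB k j G S ≡ true → Sub.∣ S ∣ ≡ k × (∀ {T} → T ∈ allSubsets n → T ⊑ S → Sub.∣ T ∣ ≡ j → G T ≡ true)) ×
      (Sub.∣ S ∣ ≡ k → (∀ T → T ⊑ S → Sub.∣ T ∣ ≡ j → G T ≡ true) → inKB k j G S ≡ true)
    both with allSubsets n | spec _ refl (λ _ _ → refl)
    ... | L | h = h L

  inKB-sound : inKB k j G S ≡ true → Sub.∣ S ∣ ≡ k × (∀ T → T ⊑ S → Sub.∣ T ∣ ≡ j → G T ≡ true)
  inKB-sound e = proj₁ (proj₁ both e) , λ T → proj₂ (proj₁ both e) (∈-allSubsets T)

  inKB-complete : Sub.∣ S ∣ ≡ k → (∀ T → T ⊑ S → Sub.∣ T ∣ ≡ j → G T ≡ true) → inKB k j G S ≡ true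
  inKB-complete = proj₂ both

𝟙-cong : ∀ {a b} → (a ≡ true → b ≡ true) → (b ≡ true → a ≡ true) → 𝟙 a ≡ 𝟙 b
𝟙-cong {true}  {true}  f g = refl
𝟙-cong {true}  {false} f g = contradiction (f refl) λ ()
𝟙-cong {false} {true}  f g = contradiction (g refl) λ ()
𝟙-cong {false} {false} f g = refl

does⇒ : ∀ {P : Set} (D : Dec P) → does D ≡ true → P
does⇒ (yes p) _ = p

𝟙-does-cong : ∀ {P Q : Set} (D : Dec P) (D′ : Dec Q) → (P → Q) → (Q → P) → 𝟙 (does D) ≡ 𝟙 (does D′)
𝟙-does-cong D D′ f g = 𝟙-cong (λ e → dec-true D′ (f (does⇒ D e))) (λ e → dec-true D (g (does⇒ D′ e)))

-- The density condition in terms of random tuples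

module DenseGraph (n′ i : ℕ) (EH : Subset (suc n′) → Bool) where

  open Vertices n′ hiding (n)

  H : Graph
  H = record { vn = suc n′ ; E = EH }

  abstract
    Hv : Vec (Fin (suc n′)) (suc (suc i)) → Bool
    Hv y = edgeB (suc (suc i)) H (setOf y)

    Hv-edgeB : ∀ y → Hv y ≡ edgeB (suc (suc i)) H (setOf y)
    Hv-edgeB y = refl

  private
    ≢⇒≡ᵇ-false : ∀ m q → m ≢ q → (m ≡ᵇ q) ≡ false
    ≢⇒≡ᵇ-false m q ne = Boolₚ.¬-not (λ e → ne (ℕₚ.≡ᵇ⇒≡ m q (subst Data.Bool.T (sym e) tt)))

  Hv-distinct : ∀ y → distinct y ≡ false → Hv y ≡ false
  Hv-distinct y e = trans (Hv-edgeB y) (trans (cong (EH (setOf y) ∧_) (≢⇒≡ᵇ-false _ _ (ℕₚ.<⇒≢ (card-repeat y e)))) (Boolₚ.∧-zeroʳ (EH (setOf y))))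

  Hv-repeat : ∀ y {p q} → p ≢ q → lookup y p ≡ lookup y q → Hv y ≡ false
  Hv-repeat y {p} {q} p≢q e = go (distinct y) refl
    where
    go : ∀ b → distinct y ≡ b → Hv y ≡ false
    go true  d = contradiction (distinct⇒injective y d e) p≢q
    go false d = Hv-distinct y d

  open Hybrid (suc i) Hv Hv-repeat (uniformFin n′) (uniformFin-charged n′) public

  -- The total error of the density condition for tuples: k! μ from passing from sets to ordered
  -- tuples, and k²/n for tuples with a repeated vertex.
  slack : ℚ → ℚ
  slack μ = factorial k * μ + ℕ→ℚ (k ℕ.* k) * 1/n

  module _ (d μ : ℚ) (dense : Dense k i d μ H) where

    dense-tuples : ∀ G → - (factorial k * μ) ≤ 𝔼 (U k) (λ y → 𝟙 (distinct y) * (𝟙 (inKB k i G (setOf y)) * (edge y - d)))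
    dense-tuples G = begin
      - (factorial k * μ)
        ≡⟨ trans (cong (λ z → - (z * μ)) (sym (orderings-power k))) (re (orderings k) (ℕ→ℚ (suc n′ ℕ.^ k)) μ) ⟩
      orderings k * (- (μ * ℕ→ℚ (suc n′ ℕ.^ k)))
        ≤⟨ *-monoˡ (orderings k) (orderings-nonneg k) (by-difference (re′ d (∑ L (𝟙 ∘ inKB k i G)) (μ * ℕ→ℚ (suc n′ ℕ.^ k)) (∑ L (λ S → 𝟙 (inKB k i G S) * 𝟙 (edgeB k H S)))) (≤⇒0≤- counted)) ⟩
      orderings k * (∑ L (λ S → 𝟙 (inKB k i G S) * 𝟙 (edgeB k H S)) - d * ∑ L (𝟙 ∘ inKB k i G))
        ≡⟨ cong (orderings k *_) (trans (sym (∑-combine L (λ S → 𝟙 (inKB k i G S)) (λ S → 𝟙 (edgeB k H S)))) (∑-cong L (λ S → sized S (inKB k i G S) refl))) ⟩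
      orderings k * ∑ L (λ S → ofSize k S * (𝟙 (inKB k i G S) * (𝟙 (edgeB k H S) - d)))
        ≡⟨ trans (sym (𝔼-tuples k (λ S → 𝟙 (inKB k i G S) * (𝟙 (edgeB k H S) - d)))) (𝔼-cong (U k) (λ y → cong (λ b → 𝟙 (distinct y) * (𝟙 (inKB k i G (setOf y)) * (𝟙 b - d))) (sym (Hv-edgeB y)))) ⟩
      𝔼 (U k) (λ y → 𝟙 (distinct y) * (𝟙 (inKB k i G (setOf y)) * (edge y - d))) ∎
      where
      open ≤-Reasoning
      L = allSubsets (suc n′)
      re : ∀ o p m → - (o * p * m) ≡ o * (- (m * p))
      re = solve-∀ ℚ-ring
      re′ : ∀ d s m e → (e - d * s) - (- m) ≡ e - (d * s - m)
      re′ = solve-∀ ℚ-ring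
      counted : d * ∑ L (𝟙 ∘ inKB k i G) - μ * ℕ→ℚ (suc n′ ℕ.^ k) ≤ ∑ L (λ S → 𝟙 (inKB k i G S) * 𝟙 (edgeB k H S))
      counted = subst₂ (λ a b → d * a - μ * ℕ→ℚ (suc n′ ℕ.^ k) ≤ b) (countTrue-∑ (inKB k i G) L) (trans (countTrue-∑ _ L) (∑-cong L (λ S → 𝟙-∧ (inKB k i G S) (edgeB k H S)))) (dense G)
      ∑-combine : ∀ {X : Set} (xs : List X) (a b : X → ℚ) → ∑ xs (λ x → a x * (b x - d)) ≡ ∑ xs (λ x → a x * b x) - d * ∑ xs a
      ∑-combine [] a b = lem d
        where
        lem : ∀ d → 0ℚ ≡ 0ℚ - d * 0ℚ
        lem = solve-∀ ℚ-ring
      ∑-combine (x ∷ xs) a b = trans (cong (a x * (b x - d) +_) (∑-combine xs a b)) (lem (a x) (b x) d (∑ xs (λ x → a x * b x)) (∑ xs a))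
        where
        lem : ∀ a b d s t → a * (b - d) + (s - d * t) ≡ (a * b + s) - d * (a + t)
        lem = solve-∀ ℚ-ring
      sized : ∀ S b → inKB k i G S ≡ b → 𝟙 (inKB k i G S) * (𝟙 (edgeB k H S) - d) ≡ ofSize k S * (𝟙 (inKB k i G S) * (𝟙 (edgeB k H S) - d))
      sized S true  e = sym (trans (cong (_* (𝟙 (inKB k i G S) * (𝟙 (edgeB k H S) - d))) (cong 𝟙 (trans (cong (_≡ᵇ k) (proj₁ (inKB-sound k i G S e))) (≡ᵇ-refl k)))) (*-identityˡ (𝟙 (inKB k i G S) * (𝟙 (edgeB k H S) - d))))
        where
        ≡ᵇ-refl : ∀ m → (m ≡ᵇ m) ≡ true
        ≡ᵇ-refl zero    = refl
        ≡ᵇ-refl (suc m) = ≡ᵇ-refl m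
      sized S false e = trans zero′ (sym (trans (cong (ofSize k S *_) zero′) (*-zeroʳ (ofSize k S))))
        where
        zero′ : 𝟙 (inKB k i G S) * (𝟙 (edgeB k H S) - d) ≡ 0ℚ
        zero′ = trans (cong (λ b → 𝟙 b * (𝟙 (edgeB k H S) - d)) e) (*-zeroˡ (𝟙 (edgeB k H S) - d))

    -- The density hypothesis averaged over a random (k-2)-graph, whose cliques are described by the weight W.
    dense-average : 0ℚ ≤ d → d ≤ 1ℚ → ∀ {X : Set} (𝒞 : Dist X) (G : X → Subset (suc n′) → Bool) (W : Vec V k → ℚ) → (∀ y → 0ℚ ≤ W y) → (∀ y → W y ≤ 1ℚ) →
      (∀ y → distinct y ≡ true → 𝔼 𝒞 (λ χ → 𝟙 (inKB k i (G χ) (setOf y))) ≡ W y) →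
      - slack μ ≤ 𝔼 (U k) (λ y → W y * (edge y - d))
    dense-average 0≤d d≤1 𝒞 G W nW W≤1 W≡ = by-difference (re (factorial k * μ) (ℕ→ℚ (k ℕ.* k) * 1/n) (𝔼 (U k) (λ y → W y * (edge y - d))) (𝔼 (U k) (λ y → 𝟙 (not (distinct y)))))
        (+-nonneg (≤⇒0≤- averaged) (≤⇒0≤- (repeats-rare k)))
      where
      re : ∀ f r e R → e - (- (f + r)) ≡ ((e + R) - (- f)) + (r - R)
      re = solve-∀ ℚ-ring
      pointwise : ∀ y b → distinct y ≡ b → 𝟙 b * (𝔼 𝒞 (λ χ → 𝟙 (inKB k i (G χ) (setOf y))) * (edge y - d)) ≤ W y * (edge y - d) + 𝟙 (not b)
      pointwise y true  e = ≤-reflexive (trans (*-identityˡ (𝔼 𝒞 (λ χ → 𝟙 (inKB k i (G χ) (setOf y))) * (edge y - d))) (trans (cong (_* (edge y - d)) (W≡ y e)) (sym (+-identityʳ (W y * (edge y - d))))))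
      pointwise y false e = ≤-trans (≤-reflexive (*-zeroˡ (𝔼 𝒞 (λ χ → 𝟙 (inKB k i (G χ) (setOf y))) * (edge y - d)))) (subst (λ z → 0ℚ ≤ W y * (𝟙 z - d) + 1ℚ) (sym (Hv-distinct y e)) (subst (0ℚ ≤_) (lem′ (W y) d) (≤⇒0≤- (*-≤1 (nW y) (W≤1 y) d≤1))))
        where
        lem′ : ∀ w d → 1ℚ - w * d ≡ w * (0ℚ - d) + 1ℚ
        lem′ = solve-∀ ℚ-ring
      averaged : - (factorial k * μ) ≤ 𝔼 (U k) (λ y → W y * (edge y - d)) + 𝔼 (U k) (λ y → 𝟙 (not (distinct y)))
      averaged = begin
        - (factorial k * μ)
          ≡⟨ sym (𝔼-const 𝒞 (- (factorial k * μ))) ⟩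
        𝔼 𝒞 (λ _ → - (factorial k * μ))
          ≤⟨ 𝔼-mono 𝒞 (λ χ → dense-tuples (G χ)) ⟩
        𝔼 𝒞 (λ χ → 𝔼 (U k) (λ y → 𝟙 (distinct y) * (𝟙 (inKB k i (G χ) (setOf y)) * (edge y - d))))
          ≡⟨ 𝔼-swap 𝒞 (U k) _ ⟩
        𝔼 (U k) (λ y → 𝔼 𝒞 (λ χ → 𝟙 (distinct y) * (𝟙 (inKB k i (G χ) (setOf y)) * (edge y - d))))
          ≡⟨ 𝔼-cong (U k) (λ y → trans (𝔼-* 𝒞 (𝟙 (distinct y)) _) (cong (𝟙 (distinct y) *_) (𝔼-*ʳ 𝒞 (edge y - d) _))) ⟩
        𝔼 (U k) (λ y → 𝟙 (distinct y) * (𝔼 𝒞 (λ χ → 𝟙 (inKB k i (G χ) (setOf y))) * (edge y - d)))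
          ≤⟨ 𝔼-mono (U k) (λ y → pointwise y (distinct y) refl) ⟩
        𝔼 (U k) (λ y → W y * (edge y - d) + 𝟙 (not (distinct y)))
          ≡⟨ 𝔼-+ (U k) _ _ ⟩
        𝔼 (U k) (λ y → W y * (edge y - d)) + 𝔼 (U k) (λ y → 𝟙 (not (distinct y))) ∎
        where open ≤-Reasoning

  module LowCells {a b : ℕ} (A : Vec V a) (B : Vec V b) where

    module L = Conditional (U k) (lowObs k A B)

    D : Vec V k → ℚ
    D x = L.CE edge x

    D≤1 : ∀ x → D x ≤ 1ℚ
    D≤1 x = L.cexp-≤1 {edge} (λ y → 𝟙-≤1 (Hv y)) (low A B x)

    mass-pos : ∀ x → 0ℚ < L.mass (low A B x)
    mass-pos x = L.mass-charged (U-charged (uniformFin-charged n′) x)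

    excess : ∀ d x → 𝔼 (U k) (λ y → L.at (low A B x) y * (edge y - d)) ≡ L.mass (low A B x) * (D x - d)
    excess d x = begin
      𝔼 (U k) (λ y → L.at ℓ y * (edge y - d))
        ≡⟨ trans (𝔼-cong (U k) (λ y → lem (L.at ℓ y) (edge y) d)) (trans (𝔼-- (U k) _ _) (cong (λ z → N - z) (𝔼-*ʳ (U k) d (L.at ℓ)))) ⟩
      N - L.mass ℓ * d
        ≡⟨ cong (_- L.mass ℓ * d) (sym (trans (sym (*-assoc (L.mass ℓ) (inv (L.mass ℓ)) N)) (trans (cong (_* N) (inv-inverse (mass-pos x))) (*-identityˡ N)))) ⟩
      L.mass ℓ * (inv (L.mass ℓ) * N) - L.mass ℓ * d
        ≡⟨ lem′ (L.mass ℓ) (inv (L.mass ℓ) * N) d ⟩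
      L.mass ℓ * (D x - d) ∎
      where
      open ≡-Reasoning
      ℓ = low A B x
      N = 𝔼 (U k) (λ y → L.at ℓ y * edge y)
      lem : ∀ a e d → a * (e - d) ≡ a * e - a * d
      lem = solve-∀ ℚ-ring
      lem′ : ∀ m e d → m * e - m * d ≡ m * (e - d)
      lem′ = solve-∀ ℚ-ring

    private
      low-⟦⟧ : ∀ {x y : Vec V k} (π : Vec (Fin k) k) → low A B x ≡ low A B y → low A B (x ⟦ π ⟧) ≡ low A B (y ⟦ π ⟧)
      low-⟦⟧ {x} {y} π e = low-complete {A = A} {B} {x ⟦ π ⟧} {y ⟦ π ⟧} (transfer₂ {y₂ = assign x (env A B)} {assign y (env A B)} IsEnv IsEnv re (λ { (inj₂ _) _ → tt }) (ev x) (ev y) (low-sound {A = A} {B} {x} {y} e))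
        where
        re : Fin k ⊎ (Fin a ⊎ Fin b) → Fin k ⊎ (Fin a ⊎ Fin b)
        re (inj₁ l) = inj₁ (lookup π l)
        re (inj₂ e) = inj₂ e
        ev : ∀ x l → assign x (env A B) (re l) ≡ assign (x ⟦ π ⟧) (env A B) l
        ev x (inj₁ l) = sym (lookup-⟦⟧ x π l)
        ev x (inj₂ e) = refl

    module _ (π : Vec (Fin k) k) (π-inj : Injectiveᵛ π) where

      private
        π⁻¹ : Vec (Fin k) k
        π⁻¹ = tabulate (λ l → proj₁ (injective⇒surjective (lookup π) π-inj l))
        undo : ∀ (x : Vec V k) → x ⟦ π ⟧ ⟦ π⁻¹ ⟧ ≡ x
        undo x = vec-ext (λ l → trans (lookup-⟦⟧ (x ⟦ π ⟧) π⁻¹ l) (trans (lookup-⟦⟧ x π (lookup π⁻¹ l)) (cong (lookup x) (trans (cong (lookup π) (Vecₚ.lookup∘tabulate (λ l → proj₁ (injective⇒surjective (lookup π) π-inj l)) l)) (proj₂ (injective⇒surjective (lookup π) π-inj l))))))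
        at-⟦⟧ : ∀ x y → L.at (low A B (x ⟦ π ⟧)) (y ⟦ π ⟧) ≡ L.at (low A B x) y
        at-⟦⟧ x y = 𝟙-does-cong (low A B (y ⟦ π ⟧) ≟ᵇ low A B (x ⟦ π ⟧)) (low A B y ≟ᵇ low A B x)
          (λ e → subst₂ (λ p q → low A B p ≡ low A B q) (undo y) (undo x) (low-⟦⟧ {y ⟦ π ⟧} {x ⟦ π ⟧} π⁻¹ e)) (low-⟦⟧ {y} {x} π)
        sum-⟦⟧ : ∀ (g : Vec V k → ℚ) → (∀ y → g (y ⟦ π ⟧) ≡ g y) → ∀ x → 𝔼 (U k) (λ y → L.at (low A B (x ⟦ π ⟧)) y * g y) ≡ 𝔼 (U k) (λ y → L.at (low A B x) y * g y)
        sum-⟦⟧ g ge x = trans (sym (U-⟦⟧ π π-inj (λ y → L.at (low A B (x ⟦ π ⟧)) y * g y))) (𝔼-cong (U k) (λ y → cong₂ _*_ (at-⟦⟧ x y) (ge y)))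
        edge-⟦⟧ : ∀ y → edge (y ⟦ π ⟧) ≡ edge y
        edge-⟦⟧ y = cong 𝟙 (trans (Hv-edgeB (y ⟦ π ⟧)) (trans (cong (edgeB k H) (subset-ext
          (setOf-⊆ (y ⟦ π ⟧) y (λ l → lookup π l , sym (lookup-⟦⟧ y π l)))
          (setOf-⊆ y (y ⟦ π ⟧) (λ l → let (l′ , e) = injective⇒surjective (lookup π) π-inj l in l′ , trans (lookup-⟦⟧ y π l′) (cong (lookup y) e))))) (sym (Hv-edgeB y))))

      mass-⟦⟧ : ∀ x → L.mass (low A B (x ⟦ π ⟧)) ≡ L.mass (low A B x)
      mass-⟦⟧ x = trans (𝔼-cong (U k) (λ y → sym (*-identityʳ (L.at (low A B (x ⟦ π ⟧)) y)))) (trans (sum-⟦⟧ (λ _ → 1ℚ) (λ _ → refl) x) (𝔼-cong (U k) (λ y → *-identityʳ (L.at (low A B x) y))))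

      -- Permuting coordinates preserves the uniform measure and the edges and maps classes of equal
      -- lower information onto such classes.
      D-⟦⟧ : ∀ x → D (x ⟦ π ⟧) ≡ D x
      D-⟦⟧ x = cong₂ (λ m z → inv m * z) (mass-⟦⟧ x) (sum-⟦⟧ edge edge-⟦⟧ x)

    -- Ramsey's theorem speaks of increasing index tuples, while random colourings produce them in
    -- any order. A distinct `θ` is a permutation of an increasing tuple, and `D` does not see the
    -- permutation.
    D-sorted : ∀ {s} (P : ℚ → Set) (v : Vec V s) → (∀ T → Increasing T → P (D (v ⟦ T ⟧))) → ∀ θ → distinct θ ≡ true → P (D (v ⟦ θ ⟧))
    D-sorted {s} P v h θ dθ = subst P (trans (sym (D-⟦⟧ π π-inj (v ⟦ T ⟧))) (cong D (trans (⟦⟧-assoc v T π) (cong (v ⟦_⟧) Tπ)))) (h T T-inc)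
      where
      card≡k : Sub.∣ setOf θ ∣ ≡ k
      card≡k = card-distinct θ dθ
      T′ : ∀ {q} → Sub.∣ setOf θ ∣ ≡ q → Vec (Fin s) q
      T′ refl = elems (setOf θ)
      T′-inc : ∀ {q} (e : Sub.∣ setOf θ ∣ ≡ q) → Increasing (T′ e)
      T′-inc refl = elems-increasing (setOf θ)
      T′-cover : ∀ {q} (e : Sub.∣ setOf θ ∣ ≡ q) i → lookup (setOf θ) i ≡ true → Covered (T′ e) i
      T′-cover refl = elems-complete (setOf θ)
      T = T′ card≡k
      T-inc : Increasing T
      T-inc = T′-inc card≡k
      cov : ∀ l → Covered T (lookup θ l)
      cov l = T′-cover card≡k (lookup θ l) (setOf-complete θ l)
      π : Vec (Fin k) k
      π = tabulate (λ l → proj₁ (cov l))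
      Tπ : T ⟦ π ⟧ ≡ θ
      Tπ = vec-ext (λ l → trans (lookup-⟦⟧ T π l) (trans (cong (lookup T) (Vecₚ.lookup∘tabulate (λ l → proj₁ (cov l)) l)) (proj₂ (cov l))))
      π-inj : Injectiveᵛ π
      π-inj {p} {q} e = distinct⇒injective θ dθ (trans (cong (λ z → lookup z p) (sym Tπ)) (trans (trans (lookup-⟦⟧ T π p) (trans (cong (lookup T) e) (sym (lookup-⟦⟧ T π q)))) (cong (λ z → lookup z q) Tπ)))

-- Good tuples

prod₃ : ∀ {X : Set} (d₀ d₁ d₂ : Dist X) (f₀ f₁ f₂ : X → ℚ) →
  𝔼 (ΠD (d₀ ∷ d₁ ∷ d₂ ∷ [])) (λ xs → f₀ (lookup xs zero) * (f₁ (lookup xs (suc zero)) * f₂ (lookup xs (suc (suc zero))))) ≡ 𝔼 d₀ f₀ * (𝔼 d₁ f₁ * 𝔼 d₂ f₂)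
prod₃ d₀ d₁ d₂ f₀ f₁ f₂ = trans (𝔼-Π∷ d₀ _ _) (trans (𝔼-cong d₀ (λ x → trans (𝔼-Π∷ d₁ _ _) (trans (𝔼-cong d₁ (λ y → trans (𝔼-Π∷ d₂ _ _) (trans (𝔼-cong d₂ (λ z → 𝔼-Π[] _))
    (trans (𝔼-* d₂ (f₀ x) _) (cong (f₀ x *_) (𝔼-* d₂ (f₁ y) f₂)))))) (trans (𝔼-* d₁ (f₀ x) _) (cong (f₀ x *_) (𝔼-*ʳ d₁ (𝔼 d₂ f₂) f₁)))))) (𝔼-*ʳ d₀ (𝔼 d₁ f₁ * 𝔼 d₂ f₂) f₀))

𝟙-∧₃ : ∀ {P Q R S : Set} (p : Dec P) (q : Dec Q) (r : Dec R) (s : Dec S) → (S → P × Q × R) → (P → Q → R → S) → 𝟙 (does p) * (𝟙 (does q) * 𝟙 (does r)) ≡ 𝟙 (does s)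
𝟙-∧₃ p q r s to from = trans (cong (𝟙 (does p) *_) (sym (𝟙-∧ (does q) (does r)))) (trans (sym (𝟙-∧ (does p) (does q ∧ does r)))
  (𝟙-does-cong (p ×-dec (q ×-dec r)) s (λ { (a , b , c) → from a b c }) to))

module GoodTuples (n′ i : ℕ) (EH : Subset (suc n′) → Bool) {a b : ℕ} (A : Vec (Fin (suc n′)) a) (B : Vec (Fin (suc n′)) b) where

  open DenseGraph n′ i EH
  open LowCells A B

  typeMass : V → ℚ
  typeMass x = 𝔼 (uniformFin n′) (λ z → 𝟙 (does (low A B (z ∷ []) ≟ᵇ low A B (x ∷ []))))

  -- The first clause serves the random colourings (k ≥ 4), where class masses multiply the defect
  -- `D - d`. The second serves the thinned vertex set (k = 3), which divides by the masses of
  -- vertex classes.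
  NonSmall : ∀ {s} → ℚ → Vec V s → Set
  NonSmall {s} κ v = (∀ (θ : Vec (Fin s) k) → distinct θ ≡ true → κ ≤ L.mass (low A B (v ⟦ θ ⟧))) × (∀ l → κ ≤ typeMass (lookup v l))

  module _ {d μ : ℚ} (dense : Dense k i d μ H) (0≤d : 0ℚ ≤ d) (d≤1 : d ≤ 1ℚ) where

    module Coloured (v : Vec V k) where

      open Uniform (uniformFin (suc i)) using () renaming (U to C; U-⟦⟧ to C-⟦⟧; U-charged to C-charged)

      E : Set
      E = Fin a ⊎ Fin b

      InS : Subset (suc n′) → V ⊎ E → Set
      InS S (inj₁ x) = lookup S x ≡ true
      InS S (inj₂ _) = ⊤

      inS? : ∀ S x → Dec (InS S x)
      inS? S (inj₁ x) = lookup S x Boolₚ.≟ true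
      inS? S (inj₂ _) = yes tt

      colour : Vec (Fin k) (suc n′) → V → V
      colour χ x = lookup v (lookup χ x)

      value : (V → V) → V ⊎ E → V
      value ρ = [ ρ , env A B ]′

      -- A colouring `χ` proposes that vertex `x` behaves like `v` at position `χ x`. An i-set is an
      -- edge of the test graph if its colours differ and it looks to the environment exactly as
      -- proposed. Its k-cliques are the tuples `y` that have the lower information of the
      -- permutation of `v` given by their colours.
      Rainbow Matching Clique : Vec (Fin k) (suc n′) → Subset (suc n′) → Set
      Rainbow χ S = ∀ x x′ → lookup S x ≡ true → lookup S x′ ≡ true → lookup χ x ≡ lookup χ x′ → x ≡ x′
      Matching χ S = ∀ (t : Vec (V ⊎ E) k) → Two IsEnv t → (∀ p → InS S (lookup t p)) → Hv (Vec.map (value id) t) ≡ Hv (Vec.map (value (colour χ)) t)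
      Clique χ S = Rainbow χ S × Matching χ S

      clique? : ∀ χ S → Dec (Clique χ S)
      clique? χ S = (Finₚ.all? λ x → Finₚ.all? λ x′ → (lookup S x Boolₚ.≟ true) →-dec ((lookup S x′ Boolₚ.≟ true) →-dec ((lookup χ x Finₚ.≟ lookup χ x′) →-dec (x Finₚ.≟ x′))))
        ×-dec map′ (λ all t → All.lookup all (∈-allVecs t (λ p → ∈-indices {K = suc n′} ∈-envs (lookup t p)))) (λ h → All.tabulate (λ {t} _ → h t))
          (All.all? (λ t → two? t →-dec ((Finₚ.all? λ p → inS? S (lookup t p)) →-dec (Hv (Vec.map (value id) t) Boolₚ.≟ Hv (Vec.map (value (colour χ)) t)))) (allVecs (indices (suc n′) (envs a b)) k))

      G : Vec (Fin k) (suc n′) → Subset (suc n′) → Bool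
      G χ S = does (clique? χ S)

      module _ (2≤i : 2 ℕ.≤ i) (y : Vec V k) (dy : distinct y ≡ true) (χ : Vec (Fin k) (suc n′)) where

        private
          y-inj : Injectiveᵛ y
          y-inj = distinct⇒injective y dy

          others : ∀ (p q : Fin k) → p ≢ q → Fin i → Fin k
          others p q p≢q l = punchIn p (punchIn (punchOut p≢q) l)

          others-inj : ∀ p q p≢q {l l′} → others p q p≢q l ≡ others p q p≢q l′ → l ≡ l′
          others-inj p q p≢q e = Finₚ.punchIn-injective (punchOut p≢q) _ _ (Finₚ.punchIn-injective p _ _ e)

          others-≢₁ : ∀ p q p≢q l → others p q p≢q l ≢ p
          others-≢₁ p q p≢q l = Finₚ.punchInᵢ≢i p _

          others-≢₂ : ∀ p q p≢q l → others p q p≢q l ≢ q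
          others-≢₂ p q p≢q l e = Finₚ.punchInᵢ≢i (punchOut p≢q) l (Finₚ.punchIn-injective p _ _ (trans e (sym (Finₚ.punchIn-punchOut p≢q))))

          others-hit : ∀ p q p≢q {r} → p ≢ r → q ≢ r → ∃[ l ] others p q p≢q l ≡ r
          others-hit p q p≢q {r} p≢r q≢r = punchOut {i = punchOut p≢q} {punchOut p≢r} ne , trans (cong (punchIn p) (Finₚ.punchIn-punchOut ne)) (Finₚ.punchIn-punchOut p≢r)
            where
            ne : punchOut p≢q ≢ punchOut p≢r
            ne e = q≢r (Finₚ.punchOut-injective p≢q p≢r e)

          rest : ∀ p q → p ≢ q → Vec V i
          rest p q p≢q = tabulate (λ l → lookup y (others p q p≢q l))

          lookup-rest : ∀ p q p≢q l → lookup (rest p q p≢q) l ≡ lookup y (others p q p≢q l)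
          lookup-rest p q p≢q l = Vecₚ.lookup∘tabulate (λ l → lookup y (others p q p≢q l)) l

          face : ∀ p q → p ≢ q → Subset (suc n′)
          face p q p≢q = setOf (rest p q p≢q)

          face-card : ∀ p q p≢q → Sub.∣ face p q p≢q ∣ ≡ i
          face-card p q p≢q = card-distinct (rest p q p≢q) (injective⇒distinct (rest p q p≢q)
            (λ {l} {l′} e → others-inj p q p≢q (y-inj (trans (sym (lookup-rest p q p≢q l)) (trans e (lookup-rest p q p≢q l′))))))

          face-⊑ : ∀ p q p≢q → face p q p≢q ⊑ setOf y
          face-⊑ p q p≢q = setOf-⊆ (rest p q p≢q) y (λ l → others p q p≢q l , sym (lookup-rest p q p≢q l))

          face-∋ : ∀ p q p≢q {r} → p ≢ r → q ≢ r → lookup (face p q p≢q) (lookup y r) ≡ true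
          face-∋ p q p≢q {r} p≢r q≢r = go (others-hit p q p≢q p≢r q≢r)
            where
            go : ∃[ l ] others p q p≢q l ≡ r → lookup (face p q p≢q) (lookup y r) ≡ true
            go (l , e) = trans (cong (lookup (face p q p≢q)) (trans (cong (lookup y) (sym e)) (sym (lookup-rest p q p≢q l)))) (setOf-complete (rest p q p≢q) l)

          -- This is where i ≥ 2 enters: two positions besides `p` and `q` are needed, since
          -- removing them leaves an i-set that contains both `y` at `p` and `y` at `q` and so
          -- forces their colours to differ.
          two-others : ∀ p q → p ≢ q → ∃[ r ] ∃[ r′ ] Σ[ ne ∈ r ≢ r′ ] (r ≢ p × r′ ≢ p × r ≢ q × r′ ≢ q)
          two-others p q p≢q = others p q p≢q l₀ , others p q p≢q l₁ , (λ e → l₀≢l₁ (others-inj p q p≢q e)) ,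
              others-≢₁ p q p≢q l₀ , others-≢₁ p q p≢q l₁ , others-≢₂ p q p≢q l₀ , others-≢₂ p q p≢q l₁
            where
            l₀ l₁ : Fin i
            l₀ = Fin.fromℕ< {0} (ℕₚ.≤-trans (s≤s z≤n) 2≤i)
            l₁ = Fin.fromℕ< {1} 2≤i
            l₀≢l₁ : l₀ ≢ l₁
            l₀≢l₁ e = ℕₚ.0≢1+n (trans (sym (Finₚ.toℕ-fromℕ< (ℕₚ.≤-trans (s≤s z≤n) 2≤i))) (trans (cong Fin.toℕ e) (Finₚ.toℕ-fromℕ< 2≤i)))

          spread : Fin k ⊎ E → V ⊎ E
          spread (inj₁ l) = inj₁ (lookup y l)
          spread (inj₂ e) = inj₂ e

          spread-id : ∀ s → value id (spread s) ≡ assign y (env A B) s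
          spread-id (inj₁ l) = refl
          spread-id (inj₂ e) = refl

          spread-colour : ∀ s → value (colour χ) (spread s) ≡ assign (v ⟦ χ ⟦ y ⟧ ⟧) (env A B) s
          spread-colour (inj₁ l) = sym (trans (lookup-⟦⟧ v (χ ⟦ y ⟧) l) (cong (lookup v) (lookup-⟦⟧ χ y l)))
          spread-colour (inj₂ e) = refl

          map-spread : ∀ {f : V ⊎ E → V} {g : Fin k ⊎ E → V} → (∀ s → f (spread s) ≡ g s) → ∀ t → Vec.map f (Vec.map spread t) ≡ Vec.map {n = k} g t
          map-spread {f} h t = trans (sym (Vecₚ.map-∘ f spread t)) (Vecₚ.map-cong h t)

          spread-env : ∀ s → IsEnv s → IsEnv (spread s)
          spread-env (inj₂ _) _ = tt

          -- `missing` is used twice. After the first use one environment entry is overwritten by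
          -- the coordinate found; the other environment entry still permits a second use, which
          -- must find a different coordinate.
          two-missing : ∀ (t : Vec (Fin k ⊎ E) k) → Two IsEnv t → ∃[ r ] ∃[ r′ ] Σ[ ne ∈ r ≢ r′ ] ((∀ p → lookup t p ≢ inj₁ r) × (∀ p → lookup t p ≢ inj₁ r′))
          two-missing t (p₀ , q₀ , p₀≢q₀ , ep , eq) = r , r′ , (λ e → proj₂ second p₀ (trans (Vecₚ.lookup∘update p₀ t (inj₁ r)) (cong inj₁ e))) , proj₂ first , miss′
            where
            first : ∃[ r ] (∀ p → lookup t p ≢ inj₁ r)
            first = missing t (p₀ , ep)
            r : Fin k
            r = proj₁ first
            t′ : Vec (Fin k ⊎ E) k
            t′ = t [ p₀ ]≔ inj₁ r
            second : ∃[ r′ ] (∀ p → lookup t′ p ≢ inj₁ r′)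
            second = missing t′ (q₀ , subst IsEnv (sym (Vecₚ.lookup∘update′ (p₀≢q₀ ∘ sym) t (inj₁ r))) eq)
            r′ : Fin k
            r′ = proj₁ second
            miss′ : ∀ p → lookup t p ≢ inj₁ r′
            miss′ p e = go (p Finₚ.≟ p₀)
              where
              go : Dec (p ≡ p₀) → ⊥
              go (yes refl)  = subst IsEnv e ep
              go (no p≢p₀) = proj₂ second p (trans (Vecₚ.lookup∘update′ p≢p₀ t (inj₁ r)) e)

        clique⇒ : (∀ T → T ⊑ setOf y → Sub.∣ T ∣ ≡ i → G χ T ≡ true) → distinct (χ ⟦ y ⟧) ≡ true × low A B y ≡ low A B (v ⟦ χ ⟦ y ⟧ ⟧)
        clique⇒ h = injective⇒distinct (χ ⟦ y ⟧) inj , low-complete {A = A} {B} {y} {v ⟦ χ ⟦ y ⟧ ⟧} same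
          where
          face-clique : ∀ p q p≢q → Clique χ (face p q p≢q)
          face-clique p q p≢q = does⇒ (clique? χ (face p q p≢q)) (h (face p q p≢q) (face-⊑ p q p≢q) (face-card p q p≢q))
          inj : Injectiveᵛ (χ ⟦ y ⟧)
          inj {p} {q} e = go (p Finₚ.≟ q)
            where
            apart : p ≢ q → ∃[ r ] ∃[ r′ ] Σ[ ne ∈ r ≢ r′ ] (r ≢ p × r′ ≢ p × r ≢ q × r′ ≢ q) → p ≡ q
            apart p≢q (r , r′ , r≢r′ , r≢p , r′≢p , r≢q , r′≢q) = y-inj (proj₁ (face-clique r r′ r≢r′) (lookup y p) (lookup y q) (face-∋ r r′ r≢r′ r≢p r′≢p) (face-∋ r r′ r≢r′ r≢q r′≢q)
                    (trans (sym (lookup-⟦⟧ χ y p)) (trans e (lookup-⟦⟧ χ y q))))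
            go : Dec (p ≡ q) → p ≡ q
            go (yes p≡q) = p≡q
            go (no p≢q)  = apart p≢q (two-others p q p≢q)
          same : Same₂ IsEnv (assign y (env A B)) (assign (v ⟦ χ ⟦ y ⟧ ⟧) (env A B))
          same t two@(p , q , p≢q , ep , eq) with two-missing t two
          ... | r , r′ , r≢r′ , miss , miss′ = trans (cong Hv (sym (map-spread spread-id t))) (trans
                (proj₂ (face-clique r r′ r≢r′) (Vec.map spread t) (p , q , p≢q , subst IsEnv (sym (Vecₚ.lookup-map p spread t)) (spread-env _ ep) , subst IsEnv (sym (Vecₚ.lookup-map q spread t)) (spread-env _ eq))
                  (λ l → subst (InS (face r r′ r≢r′)) (sym (Vecₚ.lookup-map l spread t)) (inside (lookup t l) (miss l) (miss′ l))))
                (cong Hv (map-spread spread-colour t)))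
            where
            inside : ∀ s → s ≢ inj₁ r → s ≢ inj₁ r′ → InS (face r r′ r≢r′) (spread s)
            inside (inj₁ l) ne ne′ = face-∋ r r′ r≢r′ (λ e → ne (cong inj₁ (sym e))) (λ e → ne′ (cong inj₁ (sym e)))
            inside (inj₂ e) ne ne′ = tt

        ⇒clique : distinct (χ ⟦ y ⟧) ≡ true → low A B y ≡ low A B (v ⟦ χ ⟦ y ⟧ ⟧) → ∀ T → T ⊑ setOf y → G χ T ≡ true
        ⇒clique dχ e T T⊑ = dec-true (clique? χ T) (rainbow , matching)
          where
          find : ∀ x → lookup T x ≡ true → Covered y x
          find x t = setOf-sound y x (T⊑ x t)
          rainbow : Rainbow χ T
          rainbow x x′ t t′ eq with find x t | find x′ t′
          ... | l , refl | l′ , refl = cong (lookup y) (distinct⇒injective (χ ⟦ y ⟧) dχ (trans (lookup-⟦⟧ χ y l) (trans eq (sym (lookup-⟦⟧ χ y l′)))))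
          pull : ∀ s → InS T s → Fin k ⊎ E
          pull (inj₁ x) t = inj₁ (proj₁ (find x t))
          pull (inj₂ e) _ = inj₂ e
          spread-pull : ∀ s t → spread (pull s t) ≡ s
          spread-pull (inj₁ x) t = cong inj₁ (proj₂ (find x t))
          spread-pull (inj₂ e) _ = refl
          pull-env : ∀ s t → IsEnv s → IsEnv (pull s t)
          pull-env (inj₂ e) _ _ = tt
          matching : Matching χ T
          matching t (p , q , p≢q , ep , eq) ins = trans (cong Hv (trans (cong (Vec.map (value id)) (sym back)) (map-spread spread-id t′))) (trans
              (low-sound {A = A} {B} {y} {v ⟦ χ ⟦ y ⟧ ⟧} e t′ (p , q , p≢q , env-at p ep , env-at q eq))
              (cong Hv (trans (sym (map-spread spread-colour t′)) (cong (Vec.map (value (colour χ))) back))))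
            where
            t′ : Vec (Fin k ⊎ E) k
            t′ = tabulate (λ p → pull (lookup t p) (ins p))
            back : Vec.map spread t′ ≡ t
            back = vec-ext (λ p → trans (Vecₚ.lookup-map p spread t′) (trans (cong spread (Vecₚ.lookup∘tabulate (λ p → pull (lookup t p) (ins p)) p)) (spread-pull (lookup t p) (ins p))))
            env-at : ∀ p → IsEnv (lookup t p) → IsEnv (lookup t′ p)
            env-at p ev = subst IsEnv (sym (Vecₚ.lookup∘tabulate (λ p → pull (lookup t p) (ins p)) p)) (pull-env (lookup t p) (ins p) ev)

        clique-indicator : 𝟙 (inKB k i (G χ) (setOf y)) ≡ 𝟙 (distinct (χ ⟦ y ⟧)) * L.at (low A B (v ⟦ χ ⟦ y ⟧ ⟧)) y
        clique-indicator = trans (𝟙-cong to from) (𝟙-∧ (distinct (χ ⟦ y ⟧)) (does (low A B y ≟ᵇ low A B (v ⟦ χ ⟦ y ⟧ ⟧))))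
          where
          ∧-true : ∀ {p q} → p ∧ q ≡ true → p ≡ true × q ≡ true
          ∧-true {true} {true} _ = refl , refl
          to : inKB k i (G χ) (setOf y) ≡ true → distinct (χ ⟦ y ⟧) ∧ does (low A B y ≟ᵇ low A B (v ⟦ χ ⟦ y ⟧ ⟧)) ≡ true
          to e = let (dχ , le) = clique⇒ (proj₂ (inKB-sound k i (G χ) (setOf y) e)) in cong₂ _∧_ dχ (dec-true (low A B y ≟ᵇ low A B (v ⟦ χ ⟦ y ⟧ ⟧)) le)
          from : distinct (χ ⟦ y ⟧) ∧ does (low A B y ≟ᵇ low A B (v ⟦ χ ⟦ y ⟧ ⟧)) ≡ true → inKB k i (G χ) (setOf y) ≡ true
          from e = inKB-complete k i (G χ) (setOf y) (card-distinct y dy) (λ T T⊑ _ → ⇒clique (proj₁ (∧-true e)) (does⇒ (low A B y ≟ᵇ low A B (v ⟦ χ ⟦ y ⟧ ⟧)) (proj₂ (∧-true e))) T T⊑)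

      rainbow-rate : ℚ
      rainbow-rate = 𝔼 (C k) (𝟙 ∘ distinct)

      -- Averaged over all colourings, the density condition becomes a sum over the permutations `θ`
      -- of class mass times `D - d`. If `D` were below `d - ε` throughout, every term would be at
      -- most `-(κ * ε)`.
      coloured-bound : 2 ℕ.≤ i → ∀ {κ ε} → 0ℚ ≤ κ → 0ℚ ≤ ε → NonSmall κ v → (∀ T → Increasing T → D (v ⟦ T ⟧) < d - ε) → κ * ε * rainbow-rate ≤ slack μ
      coloured-bound 2≤i {κ} {ε} 0≤κ 0≤ε (big , _) bad = by-difference (re (slack μ) (κ * ε * rainbow-rate)) (≤⇒0≤- (begin
        - slack μ
          ≤⟨ dense-average d μ dense 0≤d d≤1 (C (suc n′)) G W (λ y → 𝔼-nonneg (C k) (λ θ → *-nonneg (𝟙-nonneg (distinct θ)) (L.at-nonneg _ y))) (λ y → 𝔼-≤const (C k) (λ θ → *-≤1 (𝟙-nonneg (distinct θ)) (𝟙-≤1 (distinct θ)) (𝟙-≤1 (does (low A B y ≟ᵇ low A B (v ⟦ θ ⟧))))))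
               (λ y dy → trans (𝔼-cong (C (suc n′)) (λ χ → clique-indicator 2≤i y dy χ)) (C-⟦⟧ y (distinct⇒injective y dy) (λ θ → 𝟙 (distinct θ) * L.at (low A B (v ⟦ θ ⟧)) y))) ⟩
        𝔼 (U k) (λ y → W y * (edge y - d))
          ≡⟨ 𝔼-cong (U k) (λ y → trans (sym (𝔼-*ʳ (C k) (edge y - d) _)) (𝔼-cong (C k) (λ θ → *-assoc (𝟙 (distinct θ)) (L.at (low A B (v ⟦ θ ⟧)) y) (edge y - d)))) ⟩
        𝔼 (U k) (λ y → 𝔼 (C k) (λ θ → 𝟙 (distinct θ) * (L.at (low A B (v ⟦ θ ⟧)) y * (edge y - d))))
          ≡⟨ trans (𝔼-swap (U k) (C k) _) (𝔼-cong (C k) (λ θ → trans (𝔼-* (U k) (𝟙 (distinct θ)) _) (cong (𝟙 (distinct θ) *_) (excess d (v ⟦ θ ⟧))))) ⟩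
        𝔼 (C k) (λ θ → 𝟙 (distinct θ) * (L.mass (low A B (v ⟦ θ ⟧)) * (D (v ⟦ θ ⟧) - d)))
          ≤⟨ 𝔼-mono (C k) (λ θ → pointwise θ (distinct θ) refl) ⟩
        𝔼 (C k) (λ θ → (- (κ * ε)) * 𝟙 (distinct θ))
          ≡⟨ trans (𝔼-* (C k) (- (κ * ε)) _) (sym (neg-distribˡ-* (κ * ε) rainbow-rate)) ⟩
        - (κ * ε * rainbow-rate) ∎))
        where
        open ≤-Reasoning
        re : ∀ s x → s - x ≡ (- x) - (- s)
        re = solve-∀ ℚ-ring
        W : Vec V k → ℚ
        W y = 𝔼 (C k) (λ θ → 𝟙 (distinct θ) * L.at (low A B (v ⟦ θ ⟧)) y)
        pointwise : ∀ θ b → distinct θ ≡ b → 𝟙 b * (L.mass (low A B (v ⟦ θ ⟧)) * (D (v ⟦ θ ⟧) - d)) ≤ (- (κ * ε)) * 𝟙 b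
        pointwise θ false e = ≤-reflexive (trans (*-zeroˡ (L.mass (low A B (v ⟦ θ ⟧)) * (D (v ⟦ θ ⟧) - d))) (sym (*-zeroʳ (- (κ * ε)))))
        pointwise θ true e = subst₂ _≤_ (sym (*-identityˡ (m * (D (v ⟦ θ ⟧) - d)))) (sym (*-identityʳ (- (κ * ε))))
            (by-difference (lem m (D (v ⟦ θ ⟧)) d κ ε) (+-nonneg (*-nonneg (≤-trans 0≤κ (big θ e)) (≤⇒0≤- (<⇒≤ (D-sorted (_< d - ε) v bad θ e)))) (*-nonneg 0≤ε (≤⇒0≤- (big θ e)))))
          where
          m = L.mass (low A B (v ⟦ θ ⟧))
          lem : ∀ m D d κ ε → (- (κ * ε)) - m * (D - d) ≡ m * ((d - ε) - D) + ε * (m - κ)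
          lem = solve-∀ ℚ-ring

-- For k = 3 a random subset is used instead, thinned so that the classes of v₁, …, v_s get equal weight.
module Thinned (n′ : ℕ) (EH : Subset (suc n′) → Bool) {a b : ℕ} (A : Vec (Fin (suc n′)) a) (B : Vec (Fin (suc n′)) b)
               {d μ : ℚ} (dense : Dense 3 1 d μ (DenseGraph.H n′ 1 EH)) (0≤d : 0ℚ ≤ d) (d≤1 : d ≤ 1ℚ) where

  open DenseGraph n′ 1 EH
  open LowCells A B
  open GoodTuples n′ 1 EH A B using (typeMass; NonSmall)

  low₁ : V → Vec Bool (LowInfo.width 1 a b)
  low₁ x = low A B (x ∷ [])

  private
    E : Set
    E = Fin a ⊎ Fin b

    only : Fin 3 → Fin 1 ⊎ E → Fin 3 ⊎ E
    only l (inj₁ _) = inj₁ l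
    only l (inj₂ e) = inj₂ e

    split : ∀ {x y : Vec V 3} → low A B x ≡ low A B y → ∀ l → low₁ (lookup x l) ≡ low₁ (lookup y l)
    split {x} {y} e l = low-complete {A = A} {B} {lookup x l ∷ []} {lookup y l ∷ []} (transfer₂ {y₂ = assign x (env A B)} {assign y (env A B)} IsEnv IsEnv (only l) (λ { (inj₂ _) _ → tt }) (ev x) (ev y) (low-sound {A = A} {B} {x} {y} e))
      where
      ev : ∀ x i → assign x (env A B) (only l i) ≡ assign (lookup x l ∷ []) (env A B) i
      ev x (inj₁ zero) = refl
      ev x (inj₂ e)    = refl

    squeeze : Fin 3 ⊎ E → Fin 1 ⊎ E
    squeeze (inj₁ _) = inj₁ zero
    squeeze (inj₂ e) = inj₂ e

    -- among three entries, two of them in the environment, at most one is a coordinate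
    fourth : ∀ (p q r r′ : Fin 3) → p ≢ q → r ≢ p → r ≢ q → r′ ≢ p → r′ ≢ q → r ≡ r′
    fourth p q r r′ p≢q r≢p r≢q r′≢p r′≢q = go (r Finₚ.≟ r′)
      where
      f : r ≢ r′ → Fin 4 → Fin 3
      f _ zero = p
      f _ (suc zero) = q
      f _ (suc (suc zero)) = r
      f _ (suc (suc (suc zero))) = r′
      f-inj : ∀ ne {i j} → f ne i ≡ f ne j → i ≡ j
      f-inj ne {zero} {zero} e = refl
      f-inj ne {zero} {suc zero} e = contradiction e p≢q
      f-inj ne {zero} {suc (suc zero)} e = contradiction (sym e) r≢p
      f-inj ne {zero} {suc (suc (suc zero))} e = contradiction (sym e) r′≢p
      f-inj ne {suc zero} {zero} e = contradiction (sym e) p≢q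
      f-inj ne {suc zero} {suc zero} e = refl
      f-inj ne {suc zero} {suc (suc zero)} e = contradiction (sym e) r≢q
      f-inj ne {suc zero} {suc (suc (suc zero))} e = contradiction (sym e) r′≢q
      f-inj ne {suc (suc zero)} {zero} e = contradiction e r≢p
      f-inj ne {suc (suc zero)} {suc zero} e = contradiction e r≢q
      f-inj ne {suc (suc zero)} {suc (suc zero)} e = refl
      f-inj ne {suc (suc zero)} {suc (suc (suc zero))} e = contradiction e ne
      f-inj ne {suc (suc (suc zero))} {zero} e = contradiction e r′≢p
      f-inj ne {suc (suc (suc zero))} {suc zero} e = contradiction e r′≢q
      f-inj ne {suc (suc (suc zero))} {suc (suc zero)} e = contradiction (sym e) ne
      f-inj ne {suc (suc (suc zero))} {suc (suc (suc zero))} e = refl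
      go : Dec (r ≡ r′) → r ≡ r′
      go (yes e) = e
      go (no ne) = contradiction (Finₚ.injective⇒≤ {f = f ne} (f-inj ne)) λ { (s≤s (s≤s (s≤s ()))) }

    -- For k = 3 a tuple with two environment entries has at most one free entry. Lower information
    -- of a triple is therefore just that of its three vertices, and class masses are products.
    join₃ : ∀ {x y : Vec V 3} → (∀ l → low₁ (lookup x l) ≡ low₁ (lookup y l)) → low A B x ≡ low A B y
    join₃ {x} {y} h = low-complete {A = A} {B} {x} {y} same
      where
      same : Same₂ IsEnv (assign x (env A B)) (assign y (env A B))
      same t (p , q , p≢q , ep , eq) = go (Finₚ.any? (λ r → coordinate? (lookup t r)))
        where
        Coordinate : Fin 3 ⊎ E → Set
        Coordinate s = ∃[ l ] s ≡ inj₁ l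
        coordinate? : ∀ s → Dec (Coordinate s)
        coordinate? (inj₁ l) = yes (l , refl)
        coordinate? (inj₂ e) = no λ ()
        not-env : ∀ {s} → Coordinate s → ¬ IsEnv s
        not-env (l , refl) ()
        via : ∀ l → (∀ r {l′} → lookup t r ≡ inj₁ l′ → l′ ≡ l) → Hv (Vec.map (assign x (env A B)) t) ≡ Hv (Vec.map (assign y (env A B)) t)
        via l uniq = trans (cong Hv (agree x)) (trans (low-sound {A = A} {B} {lookup x l ∷ []} {lookup y l ∷ []} (h l) (Vec.map squeeze t) (p , q , p≢q , keep p ep , keep q eq)) (cong Hv (sym (agree y))))
          where
          keep : ∀ r → IsEnv (lookup t r) → IsEnv (lookup (Vec.map squeeze t) r)
          keep r ev = subst IsEnv (sym (Vecₚ.lookup-map r squeeze t)) (lem (lookup t r) ev)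
            where
            lem : ∀ s → IsEnv s → IsEnv (squeeze s)
            lem (inj₂ _) _ = tt
          agree : ∀ z → Vec.map (assign z (env A B)) t ≡ Vec.map (assign (lookup z l ∷ []) (env A B)) (Vec.map squeeze t)
          agree z = vec-ext (λ r → trans (Vecₚ.lookup-map r _ t) (trans (lem (lookup t r) refl) (sym (trans (Vecₚ.lookup-map r _ (Vec.map squeeze t)) (cong (assign (lookup z l ∷ []) (env A B)) (Vecₚ.lookup-map r squeeze t))))))
            where
            lem : ∀ {r} s → lookup t r ≡ s → assign z (env A B) s ≡ assign (lookup z l ∷ []) (env A B) (squeeze s)
            lem {r} (inj₁ l′) e = cong (lookup z) (uniq r e)
            lem (inj₂ _) _ = refl
        go : Dec (∃[ r ] Coordinate (lookup t r)) → Hv (Vec.map (assign x (env A B)) t) ≡ Hv (Vec.map (assign y (env A B)) t)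
        go (no none) = via zero (λ r {l′} e → contradiction (r , l′ , e) none)
        go (yes (r , l , e)) = via l (λ r′ {l′} e′ → inj₁-inj (trans (sym e′) (trans (cong (lookup t) (fourth p q r′ r p≢q (ne r′ (l′ , e′) ep) (ne r′ (l′ , e′) eq) (ne r (l , e) ep) (ne r (l , e) eq))) e)))
          where
          ne : ∀ r {p} → Coordinate (lookup t r) → IsEnv (lookup t p) → r ≢ p
          ne r c ev refl = not-env c ev
          inj₁-inj : ∀ {l l′ : Fin 3} → _≡_ {A = Fin 3 ⊎ E} (inj₁ l) (inj₁ l′) → l ≡ l′
          inj₁-inj refl = refl

  private
    0₃ 1₃ 2₃ : Fin 3
    0₃ = zero
    1₃ = suc zero
    2₃ = suc (suc zero)

  hit : V → V → ℚ
  hit x z = 𝟙 (does (low₁ z ≟ᵇ low₁ x))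

  at-product : ∀ x y → hit (lookup x 0₃) (lookup y 0₃) * (hit (lookup x 1₃) (lookup y 1₃) * hit (lookup x 2₃) (lookup y 2₃)) ≡ L.at (low A B x) y
  at-product x y = 𝟙-∧₃ (low₁ (lookup y 0₃) ≟ᵇ _) (low₁ (lookup y 1₃) ≟ᵇ _) (low₁ (lookup y 2₃) ≟ᵇ _) (low A B y ≟ᵇ low A B x)
    (λ e → split {y} {x} e 0₃ , split {y} {x} e 1₃ , split {y} {x} e 2₃)
    (λ e₀ e₁ e₂ → join₃ {y} {x} λ { zero → e₀ ; (suc zero) → e₁ ; (suc (suc zero)) → e₂ })

  mass-product : ∀ x → L.mass (low A B x) ≡ typeMass (lookup x 0₃) * (typeMass (lookup x 1₃) * typeMass (lookup x 2₃))
  mass-product x = trans (𝔼-cong (U 3) (λ y → sym (at-product x y))) (prod₃ (uniformFin n′) (uniformFin n′) (uniformFin n′) (hit (lookup x 0₃)) (hit (lookup x 1₃)) (hit (lookup x 2₃)))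

  module _ {s′ : ℕ} (v : Vec V (suc s′)) {κ ε : ℚ} (0<κ : 0ℚ < κ) (0≤ε : 0ℚ ≤ ε) (ε≤1 : ε ≤ 1ℚ) (nonSmall : NonSmall κ v)
           (bad : ∀ T → Increasing T → D (v ⟦ T ⟧) < d - ε) where

    open Uniform (uniformFin s′) using () renaming (U to S)

    private
      m : Fin (suc s′) → ℚ
      m l = typeMass (lookup v l)

      0<m : ∀ l → 0ℚ < m l
      0<m l = <-≤-trans 0<κ (proj₂ nonSmall l)

      term : V → Fin (suc s′) → ℚ
      term x l = hit (lookup v l) x * inv (m l)

      -- The factor `κ`, a lower bound for all the masses `m l`, keeps the average of the reciprocal
      -- masses below 1, so that it is a probability.
      rate : V → ℚ
      rate x = κ * 𝔼 (uniformFin s′) (term x)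

      term-nonneg : ∀ x l → 0ℚ ≤ term x l
      term-nonneg x l = *-nonneg (𝟙-nonneg (does (low₁ x ≟ᵇ low₁ (lookup v l)))) (<⇒≤ (inv-pos (0<m l)))

      rate-nonneg : ∀ x → 0ℚ ≤ rate x
      rate-nonneg x = *-nonneg (<⇒≤ 0<κ) (𝔼-nonneg (uniformFin s′) (term-nonneg x))

      rate≤1 : ∀ x → rate x ≤ 1ℚ
      rate≤1 x = subst (_≤ 1ℚ) (𝔼-* (uniformFin s′) κ (term x)) (𝔼-≤const (uniformFin s′) bound)
        where
        bound : ∀ l → κ * term x l ≤ 1ℚ
        bound l = ≤-trans (*-monoˡ κ (<⇒≤ 0<κ) (𝟙-*-≤ (does (low₁ x ≟ᵇ low₁ (lookup v l))) (<⇒≤ (inv-pos (0<m l))))) (≤-trans (*-monoʳ (inv (m l)) (<⇒≤ (inv-pos (0<m l))) (proj₂ nonSmall l)) (≤-reflexive (inv-inverse (0<m l))))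

      𝒞 : Dist (Vec Bool (suc n′))
      𝒞 = ΠD (tabulate (λ x → bernoulliD (rate x) (rate-nonneg x) (rate≤1 x)))

      W : Vec V 3 → ℚ
      W y = rate (lookup y 0₃) * (rate (lookup y 1₃) * rate (lookup y 2₃))

      G : Vec Bool (suc n′) → Subset (suc n′) → Bool
      G χ T = subB T χ

      member-indicator : ∀ y → distinct y ≡ true → ∀ χ → 𝟙 (inKB 3 1 (G χ) (setOf y)) ≡ 𝟙 (lookup χ (lookup y 0₃)) * (𝟙 (lookup χ (lookup y 1₃)) * 𝟙 (lookup χ (lookup y 2₃)))
      member-indicator y dy χ = trans (𝟙-cong to from) (trans (𝟙-∧ (lookup χ (lookup y 0₃)) (lookup χ (lookup y 1₃) ∧ lookup χ (lookup y 2₃))) (cong (𝟙 (lookup χ (lookup y 0₃)) *_) (𝟙-∧ (lookup χ (lookup y 1₃)) (lookup χ (lookup y 2₃)))))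
        where
        ∧-true : ∀ {p q} → p ∧ q ≡ true → p ≡ true × q ≡ true
        ∧-true {true} {true} _ = refl , refl
        to : inKB 3 1 (G χ) (setOf y) ≡ true → lookup χ (lookup y 0₃) ∧ (lookup χ (lookup y 1₃) ∧ lookup χ (lookup y 2₃)) ≡ true
        to e = cong₂ _∧_ (ok 0₃) (cong₂ _∧_ (ok 1₃) (ok 2₃))
          where
          ok : ∀ l → lookup χ (lookup y l) ≡ true
          ok l = subB-sound (setOf (lookup y l ∷ [])) χ (proj₂ (inKB-sound 3 1 (G χ) (setOf y) e) (setOf (lookup y l ∷ [])) (setOf-⊆ (lookup y l ∷ []) y (λ { zero → l , refl }))
            (card-distinct (lookup y l ∷ []) (cong (λ b → not b ∧ true) (Vecₚ.lookup-replicate (lookup y l) false)))) (lookup y l) (setOf-complete (lookup y l ∷ []) zero)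
        from : lookup χ (lookup y 0₃) ∧ (lookup χ (lookup y 1₃) ∧ lookup χ (lookup y 2₃)) ≡ true → inKB 3 1 (G χ) (setOf y) ≡ true
        from e = inKB-complete 3 1 (G χ) (setOf y) (card-distinct y dy) (λ T T⊑ _ → subB-complete T χ (λ x t → in-χ (setOf-sound y x (T⊑ x t))))
          where
          ok : ∀ l → lookup χ (lookup y l) ≡ true
          ok zero = proj₁ (∧-true e)
          ok (suc zero) = proj₁ (∧-true (proj₂ (∧-true {lookup χ (lookup y 0₃)} e)))
          ok (suc (suc zero)) = proj₂ (∧-true {lookup χ (lookup y 1₃)} (proj₂ (∧-true {lookup χ (lookup y 0₃)} e)))
          in-χ : ∀ {x} → Covered y x → lookup χ x ≡ true
          in-χ (l , refl) = ok l

      W-clique : ∀ y → distinct y ≡ true → 𝔼 𝒞 (λ χ → 𝟙 (inKB 3 1 (G χ) (setOf y))) ≡ W y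
      W-clique y dy = begin
        𝔼 𝒞 (λ χ → 𝟙 (inKB 3 1 (G χ) (setOf y)))
          ≡⟨ 𝔼-cong 𝒞 (member-indicator y dy) ⟩
        𝔼 𝒞 (λ χ → 𝟙 (lookup χ (lookup y 0₃)) * (𝟙 (lookup χ (lookup y 1₃)) * 𝟙 (lookup χ (lookup y 2₃))))
          ≡⟨ 𝔼-marginal bs (lookup y) (distinct⇒injective y dy) (λ c → 𝟙 (lookup c 0₃) * (𝟙 (lookup c 1₃) * 𝟙 (lookup c 2₃))) ⟩
        𝔼 (ΠD (tabulate (λ l → lookup bs (lookup y l)))) (λ c → 𝟙 (lookup c 0₃) * (𝟙 (lookup c 1₃) * 𝟙 (lookup c 2₃)))
          ≡⟨ prod₃ (lookup bs (lookup y 0₃)) (lookup bs (lookup y 1₃)) (lookup bs (lookup y 2₃)) 𝟙 𝟙 𝟙 ⟩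
        𝔼 (lookup bs (lookup y 0₃)) 𝟙 * (𝔼 (lookup bs (lookup y 1₃)) 𝟙 * 𝔼 (lookup bs (lookup y 2₃)) 𝟙)
          ≡⟨ cong₂ _*_ (one (lookup y 0₃)) (cong₂ _*_ (one (lookup y 1₃)) (one (lookup y 2₃))) ⟩
        W y ∎
        where
        open ≡-Reasoning
        bs : Vec (Dist Bool) (suc n′)
        bs = tabulate (λ x → bernoulliD (rate x) (rate-nonneg x) (rate≤1 x))
        one : ∀ x → 𝔼 (lookup bs x) 𝟙 ≡ rate x
        one x = trans (cong (λ d → 𝔼 d 𝟙) (Vecₚ.lookup∘tabulate (λ x → bernoulliD (rate x) (rate-nonneg x) (rate≤1 x)) x)) (𝔼-bernoulli (rate x) (rate-nonneg x) (rate≤1 x))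

      imass : Vec (Fin (suc s′)) 3 → ℚ
      imass θ = inv (m (lookup θ 0₃)) * (inv (m (lookup θ 1₃)) * inv (m (lookup θ 2₃)))

      W-expand : ∀ y → W y ≡ 𝔼 (S 3) (λ θ → κ * κ * κ * imass θ * L.at (low A B (v ⟦ θ ⟧)) y)
      W-expand y = begin
        W y
          ≡⟨ re κ (𝔼 (uniformFin s′) (term (lookup y 0₃))) (𝔼 (uniformFin s′) (term (lookup y 1₃))) (𝔼 (uniformFin s′) (term (lookup y 2₃))) ⟩
        κ * κ * κ * (𝔼 (uniformFin s′) (term (lookup y 0₃)) * (𝔼 (uniformFin s′) (term (lookup y 1₃)) * 𝔼 (uniformFin s′) (term (lookup y 2₃))))
          ≡⟨ cong (κ * κ * κ *_) (sym (prod₃ (uniformFin s′) (uniformFin s′) (uniformFin s′) (term (lookup y 0₃)) (term (lookup y 1₃)) (term (lookup y 2₃)))) ⟩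
        κ * κ * κ * 𝔼 (S 3) (λ θ → term (lookup y 0₃) (lookup θ 0₃) * (term (lookup y 1₃) (lookup θ 1₃) * term (lookup y 2₃) (lookup θ 2₃)))
          ≡⟨ sym (𝔼-* (S 3) (κ * κ * κ) _) ⟩
        𝔼 (S 3) (λ θ → κ * κ * κ * (term (lookup y 0₃) (lookup θ 0₃) * (term (lookup y 1₃) (lookup θ 1₃) * term (lookup y 2₃) (lookup θ 2₃))))
          ≡⟨ 𝔼-cong (S 3) (λ θ → trans (re′ (κ * κ * κ) (hit (lookup v (lookup θ 0₃)) (lookup y 0₃)) (hit (lookup v (lookup θ 1₃)) (lookup y 1₃)) (hit (lookup v (lookup θ 2₃)) (lookup y 2₃)) (inv (m (lookup θ 0₃))) (inv (m (lookup θ 1₃))) (inv (m (lookup θ 2₃))))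
               (cong (κ * κ * κ * imass θ *_) (collapse θ))) ⟩
        𝔼 (S 3) (λ θ → κ * κ * κ * imass θ * L.at (low A B (v ⟦ θ ⟧)) y) ∎
        where
        open ≡-Reasoning
        re : ∀ κ a b c → κ * a * (κ * b * (κ * c)) ≡ κ * κ * κ * (a * (b * c))
        re = solve-∀ ℚ-ring
        re′ : ∀ κ a b c x y z → κ * (a * x * (b * y * (c * z))) ≡ κ * (x * (y * z)) * (a * (b * c))
        re′ = solve-∀ ℚ-ring
        collapse : ∀ θ → hit (lookup v (lookup θ 0₃)) (lookup y 0₃) * (hit (lookup v (lookup θ 1₃)) (lookup y 1₃) * hit (lookup v (lookup θ 2₃)) (lookup y 2₃)) ≡ L.at (low A B (v ⟦ θ ⟧)) y
        collapse θ = trans (cong₂ (λ p q → hit p (lookup y 0₃) * q) (sym (lookup-⟦⟧ v θ 0₃)) (cong₂ (λ p q → hit p (lookup y 1₃) * hit q (lookup y 2₃)) (sym (lookup-⟦⟧ v θ 1₃)) (sym (lookup-⟦⟧ v θ 2₃)))) (at-product (v ⟦ θ ⟧) y)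

      imass-mass : ∀ θ → imass θ * L.mass (low A B (v ⟦ θ ⟧)) ≡ 1ℚ
      imass-mass θ = trans (cong (imass θ *_) (trans (mass-product (v ⟦ θ ⟧)) (cong₂ (λ p q → typeMass p * q) (lookup-⟦⟧ v θ 0₃) (cong₂ (λ p q → typeMass p * typeMass q) (lookup-⟦⟧ v θ 1₃) (lookup-⟦⟧ v θ 2₃)))))
        (trans (re (inv (m (lookup θ 0₃))) (inv (m (lookup θ 1₃))) (inv (m (lookup θ 2₃))) (m (lookup θ 0₃)) (m (lookup θ 1₃)) (m (lookup θ 2₃)))
        (cong₂ _*_ (inv-inverse (0<m (lookup θ 0₃))) (cong₂ _*_ (inv-inverse (0<m (lookup θ 1₃))) (inv-inverse (0<m (lookup θ 2₃))))))
        where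
        re : ∀ a b c x y z → a * (b * c) * (x * (y * z)) ≡ (x * a) * ((y * b) * (z * c))
        re = solve-∀ ℚ-ring

    -- Every index triple `θ` enters with equal weight, also those with repetitions, where `D - d`
    -- is only known to be at most 1 and hence at most 2 - ε. Repetitions have probability at most
    -- 9/(s′ + 1), so for large s′ they use up only half of the defect `ε`.
    thinned-bound : (1ℚ + 1ℚ) * (ℕ→ℚ 9 * inv (ℕ→ℚ (suc s′))) ≤ ε * half → κ * κ * κ * (ε * half) ≤ slack μ
    thinned-bound large = by-difference (re (slack μ) (κ * κ * κ * (ε * half))) (≤⇒0≤- (begin
      - slack μ
        ≤⟨ dense-average d μ dense 0≤d d≤1 𝒞 G W (λ y → *-nonneg (rate-nonneg (lookup y 0₃)) (*-nonneg (rate-nonneg (lookup y 1₃)) (rate-nonneg (lookup y 2₃))))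
             (λ y → *-≤1 (rate-nonneg (lookup y 0₃)) (rate≤1 (lookup y 0₃)) (*-≤1 (rate-nonneg (lookup y 1₃)) (rate≤1 (lookup y 1₃)) (rate≤1 (lookup y 2₃)))) W-clique ⟩
      𝔼 (U 3) (λ y → W y * (edge y - d))
        ≡⟨ 𝔼-cong (U 3) (λ y → trans (cong (_* (edge y - d)) (W-expand y)) (trans (sym (𝔼-*ʳ (S 3) (edge y - d) _)) (𝔼-cong (S 3) (λ θ → *-assoc (κ * κ * κ * imass θ) (L.at (low A B (v ⟦ θ ⟧)) y) (edge y - d))))) ⟩
      𝔼 (U 3) (λ y → 𝔼 (S 3) (λ θ → κ * κ * κ * imass θ * (L.at (low A B (v ⟦ θ ⟧)) y * (edge y - d))))
        ≡⟨ trans (𝔼-swap (U 3) (S 3) _) (𝔼-cong (S 3) (λ θ → trans (𝔼-* (U 3) (κ * κ * κ * imass θ) _) (trans (cong (κ * κ * κ * imass θ *_) (excess d (v ⟦ θ ⟧))) (simplify θ)))) ⟩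
      𝔼 (S 3) (λ θ → κ * κ * κ * (D (v ⟦ θ ⟧) - d))
        ≤⟨ 𝔼-mono (S 3) (λ θ → *-monoˡ (κ * κ * κ) 0≤κ³ (pointwise θ (distinct θ) refl)) ⟩
      𝔼 (S 3) (λ θ → κ * κ * κ * ((1ℚ + 1ℚ) * 𝟙 (not (distinct θ)) + (- ε)))
        ≡⟨ trans (𝔼-* (S 3) (κ * κ * κ) _) (cong (κ * κ * κ *_) (trans (𝔼-+ (S 3) _ _) (cong₂ _+_ (𝔼-* (S 3) (1ℚ + 1ℚ) _) (𝔼-const (S 3) (- ε))))) ⟩
      κ * κ * κ * ((1ℚ + 1ℚ) * 𝔼 (S 3) (λ θ → 𝟙 (not (distinct θ))) + (- ε))
        ≤⟨ *-monoˡ (κ * κ * κ) 0≤κ³ (+-monoˡ-≤ (- ε) (≤-trans (*-monoˡ (1ℚ + 1ℚ) (nonNegative⁻¹ (1ℚ + 1ℚ)) (Vertices.repeats-rare s′ 3)) large)) ⟩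
      κ * κ * κ * (ε * half + (- ε))
        ≡⟨ trans (cong (λ z → κ * κ * κ * (ε * half + (- z))) (sym (half-half ε))) (re′ (κ * κ * κ) (ε * half)) ⟩
      - (κ * κ * κ * (ε * half)) ∎))
      where
      open ≤-Reasoning
      re : ∀ s x → s - x ≡ (- x) - (- s)
      re = solve-∀ ℚ-ring
      re′ : ∀ k e → k * (e + (- (e + e))) ≡ - (k * e)
      re′ = solve-∀ ℚ-ring
      0≤κ³ : 0ℚ ≤ κ * κ * κ
      0≤κ³ = *-nonneg (*-nonneg (<⇒≤ 0<κ) (<⇒≤ 0<κ)) (<⇒≤ 0<κ)
      simplify : ∀ θ → κ * κ * κ * imass θ * (L.mass (low A B (v ⟦ θ ⟧)) * (D (v ⟦ θ ⟧) - d)) ≡ κ * κ * κ * (D (v ⟦ θ ⟧) - d)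
      simplify θ = trans (lem (κ * κ * κ) (imass θ) (L.mass (low A B (v ⟦ θ ⟧))) (D (v ⟦ θ ⟧) - d)) (trans (cong (λ z → κ * κ * κ * (z * (D (v ⟦ θ ⟧) - d))) (imass-mass θ)) (cong (κ * κ * κ *_) (*-identityˡ (D (v ⟦ θ ⟧) - d))))
        where
        lem : ∀ k i m e → k * i * (m * e) ≡ k * (i * m * e)
        lem = solve-∀ ℚ-ring
      pointwise : ∀ θ b → distinct θ ≡ b → D (v ⟦ θ ⟧) - d ≤ (1ℚ + 1ℚ) * 𝟙 (not b) + (- ε)
      pointwise θ true  e = by-difference (lem (D (v ⟦ θ ⟧)) d ε) (≤⇒0≤- (<⇒≤ (D-sorted (_< d - ε) v bad θ e)))
        where
        lem : ∀ D d ε → ((1ℚ + 1ℚ) * 0ℚ + (- ε)) - (D - d) ≡ (d - ε) - D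
        lem = solve-∀ ℚ-ring
      pointwise θ false e = by-difference (lem (D (v ⟦ θ ⟧)) d ε) (+-nonneg (+-nonneg (≤⇒0≤- (D≤1 (v ⟦ θ ⟧))) 0≤d) (≤⇒0≤- ε≤1))
        where
        lem : ∀ D d ε → ((1ℚ + 1ℚ) * 1ℚ + (- ε)) - (D - d) ≡ ((1ℚ - D) + d) + (1ℚ - ε)
        lem = solve-∀ ℚ-ring

-- Frequency of good tuples

𝟙-≤-∑ : ∀ {X : Set} (b : Bool) (xs : List X) (f : X → ℚ) → (∀ x → 0ℚ ≤ f x) → (b ≡ true → ∃[ x ] (x ∈ xs × 1ℚ ≤ f x)) → 𝟙 b ≤ ∑ xs f
𝟙-≤-∑ false xs f nf h = ∑-nonneg xs nf
𝟙-≤-∑ true  xs f nf h with h refl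
... | x , x∈ , le = ≤-trans le (∑-member nf x∈)

-- κ stands for the least mass of a class of tuples with the same lower information.
module Threshold (i : ℕ) (1≤i : 1 ℕ.≤ i) {ε : ℚ} (0<ε : 0ℚ < ε) (ε≤1 : ε ≤ 1ℚ) where

  private
    k : ℕ
    k = suc (suc i)

    -- 36 is 2 · 2 · 9: it makes 2 · 9/(s + 1) at most ε/2, as `thinned-bound` requires.
    room : ∃[ s ] (ℕ→ℚ 36 ≤ ℕ→ℚ s * ε)
    room = archimedean′ (ℕ→ℚ 36) 0<ε

    split : i ≡ 1 ⊎ 2 ℕ.≤ i
    split = go i 1≤i
      where
      go : ∀ i → 1 ℕ.≤ i → i ≡ 1 ⊎ 2 ℕ.≤ i
      go (suc zero)    _ = inj₁ refl
      go (suc (suc i)) _ = inj₂ (s≤s (s≤s z≤n))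

    rainbow : ℚ
    rainbow = 𝔼 (Uniform.U (uniformFin (suc i)) k) (𝟙 ∘ distinct)

    rainbow-pos : 0ℚ < rainbow
    rainbow-pos = charged⇒positive (Uniform.U (uniformFin (suc i)) k) (𝟙 ∘ distinct) (Uniform.U-charged (uniformFin (suc i)) (uniformFin-charged (suc i)) (Vec.allFin k)) (λ θ → 𝟙-nonneg (distinct θ))
      (subst (0ℚ <_) (sym (cong 𝟙 (injective⇒distinct (Vec.allFin k) (increasing⇒injective {s = Vec.allFin k} (increasing-allFin k))))) 0<1)

    samples′ : i ≡ 1 ⊎ 2 ℕ.≤ i → ℕ
    samples′ (inj₁ _) = suc (proj₁ room)
    samples′ (inj₂ _) = k

    threshold′ : i ≡ 1 ⊎ 2 ℕ.≤ i → ℚ → ℚ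
    threshold′ (inj₁ _) κ = κ * κ * κ * (ε * half)
    threshold′ (inj₂ _) κ = κ * ε * rainbow

    large : (1ℚ + 1ℚ) * (ℕ→ℚ 9 * inv (ℕ→ℚ (suc (proj₁ room)))) ≤ ε * half
    large = *-cancelˡ (ℕ→ℚ (suc s)) (ℕ→ℚ-pos s) (*-cancelˡ (1ℚ + 1ℚ) (positive⁻¹ (1ℚ + 1ℚ)) (begin
      (1ℚ + 1ℚ) * (ℕ→ℚ (suc s) * ((1ℚ + 1ℚ) * (ℕ→ℚ 9 * inv (ℕ→ℚ (suc s)))))
        ≡⟨ re (ℕ→ℚ (suc s)) (ℕ→ℚ 9) (inv (ℕ→ℚ (suc s))) ⟩
      ((1ℚ + 1ℚ) * (1ℚ + 1ℚ) * ℕ→ℚ 9) * (ℕ→ℚ (suc s) * inv (ℕ→ℚ (suc s)))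
        ≡⟨ trans (cong (((1ℚ + 1ℚ) * (1ℚ + 1ℚ) * ℕ→ℚ 9) *_) (inv-inverse (ℕ→ℚ-pos s))) (*-identityʳ ((1ℚ + 1ℚ) * (1ℚ + 1ℚ) * ℕ→ℚ 9)) ⟩
      ℕ→ℚ 36
        ≤⟨ proj₂ room ⟩
      ℕ→ℚ s * ε
        ≤⟨ *-monoʳ ε (<⇒≤ 0<ε) (ℕ→ℚ-mono (ℕₚ.n≤1+n s)) ⟩
      ℕ→ℚ (suc s) * ε
        ≡⟨ trans (cong (ℕ→ℚ (suc s) *_) (sym (half-half ε))) (re′ (ℕ→ℚ (suc s)) (ε * half)) ⟩
      (1ℚ + 1ℚ) * (ℕ→ℚ (suc s) * (ε * half)) ∎))
      where
      open ≤-Reasoning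
      s = proj₁ room
      re : ∀ s n i → (1ℚ + 1ℚ) * (s * ((1ℚ + 1ℚ) * (n * i))) ≡ ((1ℚ + 1ℚ) * (1ℚ + 1ℚ) * n) * (s * i)
      re = solve-∀ ℚ-ring
      re′ : ∀ s e → s * (e + e) ≡ (1ℚ + 1ℚ) * (s * e)
      re′ = solve-∀ ℚ-ring

  samples : ℕ
  samples = samples′ split

  threshold : ℚ → ℚ
  threshold = threshold′ split

  ramseySize : ℕ → ℕ
  ramseySize m = proj₁ (ramsey k (m ℕ.⊔ samples))

  -- The number of possible values of the lower information of a K-tuple, written without reference
  -- to a hypergraph.
  types : ℕ → ℕ → ℕ → ℚ
  types K a b = ℕ→ℚ (length (allSubsets (length (allVecs (indices K (envs a b)) k))))

  smallness : ℕ → ℕ → ℕ → ℚ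
  smallness m a b = ℕ→ℚ (length (allVecs (allFin (ramseySize m)) k)) * types k a b + ℕ→ℚ (length (allFin (ramseySize m))) * types 1 a b

  -- Chosen so that the union bound in `rare` loses at most 1/2; the summand 1 keeps the reciprocal
  -- harmless when `smallness` vanishes.
  classMass : ℕ → ℕ → ℕ → ℚ
  classMass m a b = half * inv (1ℚ + smallness m a b)

  goodRate : ℕ → ℚ
  goodRate m = half * inv (ℕ→ℚ (suc (length (allVecs (allFin (ramseySize m)) m))))

  private
    half⁺ : 0ℚ < half
    half⁺ = inv-pos (positive⁻¹ (1ℚ + 1ℚ))

    types≥0 : ∀ K a b → 0ℚ ≤ types K a b
    types≥0 K a b = ℕ→ℚ-nonneg (length (allSubsets (length (allVecs (indices K (envs a b)) k))))

    smallness-nonneg : ∀ m a b → 0ℚ ≤ smallness m a b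
    smallness-nonneg m a b = +-nonneg (*-nonneg (ℕ→ℚ-nonneg (length (allVecs (allFin (ramseySize m)) k))) (types≥0 k a b)) (*-nonneg (ℕ→ℚ-nonneg (length (allFin (ramseySize m)))) (types≥0 1 a b))

    1+smallness-pos : ∀ m a b → 0ℚ < 1ℚ + smallness m a b
    1+smallness-pos m a b = +-pos-nonneg 0<1 (smallness-nonneg m a b)

  classMass-pos : ∀ m a b → 0ℚ < classMass m a b
  classMass-pos m a b = *-pos half⁺ (inv-pos (1+smallness-pos m a b))

  goodRate-pos : ∀ m → 0ℚ < goodRate m
  goodRate-pos m = *-pos half⁺ (inv-pos (ℕ→ℚ-pos (length (allVecs (allFin (ramseySize m)) m))))

  private
    smallness-classMass : ∀ m a b → smallness m a b * classMass m a b ≤ half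
    smallness-classMass m a b = subst (smallness m a b * classMass m a b ≤_) (trans (re (1ℚ + smallness m a b) half (inv (1ℚ + smallness m a b))) (trans (cong (half *_) (inv-inverse (1+smallness-pos m a b))) (*-identityʳ half)))
      (*-monoʳ (classMass m a b) (<⇒≤ (classMass-pos m a b)) (subst (_≤ 1ℚ + smallness m a b) (+-identityˡ (smallness m a b)) (+-monoˡ-≤ (smallness m a b) 0≤1)))
      where
      re : ∀ s h i → s * (h * i) ≡ h * (s * i)
      re = solve-∀ ℚ-ring

  threshold-pos : ∀ {κ} → 0ℚ < κ → 0ℚ < threshold κ
  threshold-pos {κ} 0<κ = go split
    where
    go : ∀ c → 0ℚ < threshold′ c κ
    go (inj₁ _) = *-pos (*-pos (*-pos 0<κ 0<κ) 0<κ) (half-pos 0<ε)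
    go (inj₂ _) = *-pos (*-pos 0<κ 0<ε) rainbow-pos

  module _ (n′ : ℕ) (EH : Subset (suc n′) → Bool) {d μ : ℚ} (dense : Dense k i d μ (DenseGraph.H n′ i EH)) (0≤d : 0ℚ ≤ d) (d≤1 : d ≤ 1ℚ)
           {a b : ℕ} (A : Vec (Fin (suc n′)) a) (B : Vec (Fin (suc n′)) b) where

    open DenseGraph n′ i EH hiding (k)
    open LowCells A B
    open GoodTuples n′ i EH A B

    not-all-bad : ∀ {κ} → 0ℚ < κ → slack μ < threshold κ → (v : Vec V samples) → NonSmall κ v → ¬ (∀ T → Increasing T → D (v ⟦ T ⟧) < d - ε)
    not-all-bad {κ} 0<κ small = go split small
      where
      go : ∀ c → slack μ < threshold′ c κ → (v : Vec V (samples′ c)) → NonSmall κ v → ¬ (∀ T → Increasing T → D (v ⟦ T ⟧) < d - ε)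
      go (inj₁ refl) small v ns bad = <-irrefl refl (<-≤-trans small (Thinned.thinned-bound n′ EH A B {d} {μ} dense 0≤d d≤1 v 0<κ (<⇒≤ 0<ε) ε≤1 ns bad large))
      go (inj₂ 2≤i)  small v ns bad = <-irrefl refl (<-≤-trans small (Coloured.coloured-bound {d} {μ} dense 0≤d d≤1 v 2≤i (<⇒≤ 0<κ) (<⇒≤ 0<ε) ns bad))

    AllGood : ∀ {m} → Vec V m → Set
    AllGood v = ∀ T → Increasing T → d - ε ≤ D (v ⟦ T ⟧)

    allGood? : ∀ {m} (v : Vec V m) → Dec (AllGood v)
    allGood? {m} v = map′ (λ all T → All.lookup all (∈-allVecs T (λ p → ∈ₚ.∈-allFin (lookup T p)))) (λ h → All.tabulate (λ {T} _ → h T))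
      (All.all? (λ T → increasing? T →-dec (d - ε ≤? D (v ⟦ T ⟧))) (allVecs (allFin m) k))

    nonSmall? : ∀ {s} κ (v : Vec V s) → Dec (NonSmall κ v)
    nonSmall? {s} κ v = map′ (λ all θ → All.lookup all (∈-allVecs θ (λ p → ∈ₚ.∈-allFin (lookup θ p)))) (λ h → All.tabulate (λ {θ} _ → h θ))
        (All.all? (λ θ → (distinct θ Boolₚ.≟ true) →-dec (κ ≤? L.mass (low A B (v ⟦ θ ⟧)))) (allVecs (allFin s) k))
      ×-dec Finₚ.all? (λ l → κ ≤? typeMass (lookup v l))

    nonSmall-⟦⟧ : ∀ {s t κ} (v : Vec V s) (ι : Vec (Fin s) t) → Increasing ι → NonSmall κ v → NonSmall κ (v ⟦ ι ⟧)
    nonSmall-⟦⟧ {κ = κ} v ι inc (big , big₁) =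
        (λ θ dθ → subst (λ z → κ ≤ L.mass (low A B z)) (sym (⟦⟧-assoc v ι θ)) (big (ι ⟦ θ ⟧) (injective⇒distinct (ι ⟦ θ ⟧)
           (λ {p} {q} e → distinct⇒injective θ dθ (increasing⇒injective {s = ι} inc (trans (sym (lookup-⟦⟧ ι θ p)) (trans e (lookup-⟦⟧ ι θ q))))))))
      , (λ l → subst (λ z → κ ≤ typeMass z) (sym (lookup-⟦⟧ v ι l)) (big₁ (lookup ι l)))

    module _ (m : ℕ) where

      private
        t : ℕ
        t = m ℕ.⊔ samples

        R : ℕ
        R = ramseySize m

        initial : ∀ {q} → q ℕ.≤ t → Vec (Fin t) q
        initial le = tabulate (λ l → Fin.inject≤ l le)

        initial-increasing : ∀ {q} (le : q ℕ.≤ t) → Increasing (initial le)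
        initial-increasing le p q p<q = subst₂ Fin._<_ (sym (Vecₚ.lookup∘tabulate (λ l → Fin.inject≤ l le) p)) (sym (Vecₚ.lookup∘tabulate (λ l → Fin.inject≤ l le) q))
          (subst₂ ℕ._<_ (sym (Finₚ.toℕ-inject≤ p le)) (sym (Finₚ.toℕ-inject≤ q le)) p<q)

      -- Colour k-tuples by whether `D` reaches `d - ε` and take a homogeneous subsequence of length
      -- `m ⊔ samples`. The bad colour contradicts `not-all-bad` on its first `samples` entries; the
      -- good colour yields the required `m` entries.
      good-subsequence : ∀ {κ} → 0ℚ < κ → slack μ < threshold κ → (v : Vec V R) → NonSmall κ v → ∃[ ι ] (Increasing ι × AllGood {m} (v ⟦ ι ⟧))
      good-subsequence {κ} 0<κ small v ns = go (proj₂ (ramsey k t) (λ x → does (d - ε ≤? D x)) v)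
        where
        sub : ∀ {q} (ι : Vec (Fin R) t) (le : q ℕ.≤ t) T → v ⟦ ι ⟧ ⟦ initial le ⟦ T ⟧ ⟧ ≡ v ⟦ ι ⟦ initial le ⟧ ⟧ ⟦ T ⟧
        sub ι le T = trans (sym (⟦⟧-assoc (v ⟦ ι ⟧) (initial le) T)) (cong (_⟦ T ⟧) (⟦⟧-assoc v ι (initial le)))
        go : Σ[ ι ∈ Vec (Fin R) t ] (Increasing ι × ∃[ c ] (∀ T → Increasing T → does (d - ε ≤? D (v ⟦ ι ⟧ ⟦ T ⟧)) ≡ c)) → ∃[ ι ] (Increasing ι × AllGood {m} (v ⟦ ι ⟧))
        go (ι , inc , true , hom) = ι ⟦ initial le ⟧ , increasing-⟦⟧ {s = ι} {initial le} inc (initial-increasing le) , good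
          where
          le = ℕₚ.m≤m⊔n m samples
          good : AllGood (v ⟦ ι ⟦ initial le ⟧ ⟧)
          good T incT = subst (λ z → d - ε ≤ D z) (sub ι le T) (does⇒ (d - ε ≤? D (v ⟦ ι ⟧ ⟦ initial le ⟦ T ⟧ ⟧)) (hom (initial le ⟦ T ⟧) (increasing-⟦⟧ {s = initial le} {T} (initial-increasing le) incT)))
        go (ι , inc , false , hom) = contradiction bad (not-all-bad 0<κ small (v ⟦ ι ⟦ initial le ⟧ ⟧) (nonSmall-⟦⟧ v (ι ⟦ initial le ⟧) (increasing-⟦⟧ {s = ι} {initial le} inc (initial-increasing le)) ns))
          where
          le = ℕₚ.m≤n⊔m m samples
          ¬does : ∀ {P : Set} (p : Dec P) → does p ≡ false → ¬ P
          ¬does (no ¬p) _ = ¬p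
          bad : ∀ T → Increasing T → D (v ⟦ ι ⟦ initial le ⟧ ⟧ ⟦ T ⟧) < d - ε
          bad T incT = subst (λ z → D z < d - ε) (sub ι le T) (≰⇒> (¬does (d - ε ≤? D (v ⟦ ι ⟧ ⟦ initial le ⟦ T ⟧ ⟧)) (hom (initial le ⟦ T ⟧) (increasing-⟦⟧ {s = initial le} {T} (initial-increasing le) incT))))

      private
        typesₖ types₁ : ℚ
        typesₖ = types k a b
        types₁ = types 1 a b

        width-types : ∀ K → ℕ→ℚ (length (allSubsets (LowInfo.width K a b))) ≡ types K a b
        width-types K = cong (λ w → ℕ→ℚ (length (allSubsets w))) (LowInfo.width≡ K a b)

      -- Union bound over k-tuples of positions and over single positions: each falls into a class
      -- of mass below `κ` with probability at most the number of classes times `κ`, by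
      -- `small-mass`.
      rare : ∀ {κ} → 0ℚ ≤ κ → 1ℚ - smallness m a b * κ ≤ 𝔼 (U R) (λ v → 𝟙 (does (nonSmall? κ v)))
      rare {κ} 0≤κ = by-difference (re (𝔼 (U R) (λ v → 𝟙 (does (nonSmall? κ v)))) (ℕ→ℚ (length (allVecs (allFin R) k))) typesₖ (ℕ→ℚ (length (allFin R))) types₁ κ) (≤⇒0≤- (begin
        1ℚ ≡⟨ sym (𝔼-const (U R) 1ℚ) ⟩
        𝔼 (U R) (λ _ → 1ℚ)
          ≤⟨ 𝔼-mono (U R) (λ v → cover v (nonSmall? κ v)) ⟩
        𝔼 (U R) (λ v → 𝟙 (does (nonSmall? κ v)) + (∑ Θ (λ θ → small θ v) + ∑ (allFin R) (λ l → small₁ (lookup v l))))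
          ≡⟨ trans (𝔼-+ (U R) _ _) (cong (P +_) (trans (𝔼-+ (U R) _ _) (cong₂ _+_ (𝔼-∑ (U R) Θ _) (𝔼-∑ (U R) (allFin R) _)))) ⟩
        P + (∑ Θ (λ θ → 𝔼 (U R) (small θ)) + ∑ (allFin R) (λ l → 𝔼 (U R) (λ v → small₁ (lookup v l))))
          ≤⟨ +-monoʳ-≤ P (+-mono-≤ (∑-mono Θ (λ θ → each θ (distinct θ) refl)) (∑-mono (allFin R) each₁)) ⟩
        P + (∑ Θ (λ θ → typesₖ * κ) + ∑ (allFin R) (λ l → types₁ * κ))
          ≡⟨ cong (P +_) (cong₂ _+_ (∑-const Θ (typesₖ * κ)) (∑-const (allFin R) (types₁ * κ))) ⟩
        P + (ℕ→ℚ (length Θ) * (typesₖ * κ) + ℕ→ℚ (length (allFin R)) * (types₁ * κ)) ∎))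
        where
        open ≤-Reasoning
        Θ = allVecs (allFin R) k
        P = 𝔼 (U R) (λ v → 𝟙 (does (nonSmall? κ v)))
        re : ∀ p l t r u κ → p - (1ℚ - (l * t + r * u) * κ) ≡ (p + (l * (t * κ) + r * (u * κ))) - 1ℚ
        re = solve-∀ ℚ-ring
        tiny : Vec V k → ℚ
        tiny x = 𝟙 (does (L.mass (low A B x) <? κ))
        small : Vec (Fin R) k → Vec V R → ℚ
        small θ v = 𝟙 (distinct θ) * tiny (v ⟦ θ ⟧)
        small₁ : V → ℚ
        small₁ x = 𝟙 (does (typeMass x <? κ))
        small-nonneg : ∀ v θ → 0ℚ ≤ small θ v
        small-nonneg v θ = *-nonneg (𝟙-nonneg (distinct θ)) (𝟙-nonneg (does (L.mass (low A B (v ⟦ θ ⟧)) <? κ)))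
        small₁-nonneg : ∀ v l → 0ℚ ≤ small₁ (lookup v l)
        small₁-nonneg v l = 𝟙-nonneg (does (typeMass (lookup v l) <? κ))
        each : ∀ θ b → distinct θ ≡ b → 𝔼 (U R) (small θ) ≤ typesₖ * κ
        each θ true  e = ≤-trans (𝔼-mono (U R) (λ v → 𝟙-*-≤ (distinct θ) (𝟙-nonneg (does (L.mass (low A B (v ⟦ θ ⟧)) <? κ))))) (≤-trans (≤-reflexive (U-⟦⟧ θ (distinct⇒injective θ e) tiny)) (subst (λ z → 𝔼 (U k) tiny ≤ z * κ) (width-types k) (small-mass (U k) (low A B) κ 0≤κ)))
        each θ false e = ≤-trans (≤-reflexive (trans (𝔼-cong (U R) (λ v → trans (cong (λ b → 𝟙 b * tiny (v ⟦ θ ⟧)) e) (*-zeroˡ (tiny (v ⟦ θ ⟧))))) (𝔼-const (U R) 0ℚ))) (*-nonneg (types≥0 k a b) 0≤κ)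
        each₁ : ∀ l → 𝔼 (U R) (λ v → small₁ (lookup v l)) ≤ types₁ * κ
        each₁ l = ≤-trans (≤-reflexive (trans (U-⟦⟧ (l ∷ []) (λ { {zero} {zero} _ → refl }) (λ x → small₁ (lookup x zero))) (trans (𝔼-Π∷ (uniformFin n′) _ _) (𝔼-cong (uniformFin n′) (λ x → 𝔼-Π[] _))))) (subst (λ z → 𝔼 (uniformFin n′) small₁ ≤ z * κ) (width-types 1) (small-mass (uniformFin n′) (λ x → low A B (x ∷ [])) κ 0≤κ))
        cover : ∀ v (D : Dec (NonSmall κ v)) → 1ℚ ≤ 𝟙 (does D) + (∑ Θ (λ θ → small θ v) + ∑ (allFin R) (λ l → small₁ (lookup v l)))
        cover v (yes _) = x≤x+ (+-nonneg (∑-nonneg Θ (small-nonneg v)) (∑-nonneg (allFin R) (small₁-nonneg v)))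
        cover v (no ¬ns) = subst (1ℚ ≤_) (sym (+-identityˡ _)) (find (Any.any? (λ θ → (distinct θ Boolₚ.≟ true) ×-dec (L.mass (low A B (v ⟦ θ ⟧)) <? κ)) Θ) (Finₚ.any? (λ l → typeMass (lookup v l) <? κ)))
          where
          find : Dec (Any (λ θ → distinct θ ≡ true × L.mass (low A B (v ⟦ θ ⟧)) < κ) Θ) → Dec (∃[ l ] typeMass (lookup v l) < κ) → 1ℚ ≤ ∑ Θ (λ θ → small θ v) + ∑ (allFin R) (λ l → small₁ (lookup v l))
          find (yes any) _ = ≤-trans (subst (_≤ ∑ Θ (λ θ → small θ v)) (cong₂ _*_ (cong 𝟙 (proj₁ (proj₂ found))) (cong 𝟙 (dec-true (L.mass (low A B (v ⟦ proj₁ found ⟧)) <? κ) (proj₂ (proj₂ found))))) (∑-member (small-nonneg v) (∈-allVecs (proj₁ found) (λ p → ∈ₚ.∈-allFin (lookup (proj₁ found) p))))) (x≤x+ (∑-nonneg (allFin R) (small₁-nonneg v)))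
            where found = Any.satisfied any
          find (no _) (yes (l , lt)) = ≤-trans (subst (_≤ ∑ (allFin R) (λ l → small₁ (lookup v l))) (cong 𝟙 (dec-true (typeMass (lookup v l) <? κ) lt)) (∑-member (small₁-nonneg v) (∈ₚ.∈-allFin l)))
            (subst (_≤ ∑ Θ (λ θ → small θ v) + ∑ (allFin R) (λ l → small₁ (lookup v l))) (+-identityˡ (∑ (allFin R) (λ l → small₁ (lookup v l)))) (+-monoˡ-≤ (∑ (allFin R) (λ l → small₁ (lookup v l))) (∑-nonneg Θ (small-nonneg v))))
          find (no ¬any) (no ¬l) = contradiction ((λ θ dθ → ≮⇒≥ λ lt → ¬any (lose (∈-allVecs θ (λ p → ∈ₚ.∈-allFin (lookup θ p))) (dθ , lt))) , (λ l → ≮⇒≥ λ lt → ¬l (l , lt))) ¬ns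

      -- Which subsequence is good depends on `v`. A pigeonhole over the finitely many index tuples
      -- fixes one `ι`, and `v ⟦ ι ⟧` is again a uniform m-tuple.
      good-often : slack μ < threshold (classMass m a b) → goodRate m ≤ 𝔼 (U m) (λ v → 𝟙 (does (allGood? v)))
      good-often small = finish (∑-pigeonhole I (λ ι → 𝔼 (U R) (good ι)) half⁺ (begin
        half
          ≤⟨ by-difference (trans (cong (λ z → (z - smallness m a b * κ) - half) (trans (sym (half-half 1ℚ)) (cong₂ _+_ (*-identityˡ half) (*-identityˡ half)))) (re half (smallness m a b * κ))) (≤⇒0≤- (smallness-classMass m a b)) ⟩
        1ℚ - smallness m a b * κ
          ≤⟨ rare (<⇒≤ (classMass-pos m a b)) ⟩
        𝔼 (U R) (λ v → 𝟙 (does (nonSmall? κ v)))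
          ≤⟨ 𝔼-mono (U R) (λ v → 𝟙-≤-∑ (does (nonSmall? κ v)) I (λ ι → good ι v) (good-nonneg v) (λ e → witness v (good-subsequence (classMass-pos m a b) small v (does⇒ (nonSmall? κ v) e)))) ⟩
        𝔼 (U R) (λ v → ∑ I (λ ι → good ι v))
          ≡⟨ 𝔼-∑ (U R) I (λ v ι → good ι v) ⟩
        ∑ I (λ ι → 𝔼 (U R) (good ι)) ∎))
        where
        open ≤-Reasoning
        κ : ℚ
        κ = classMass m a b
        I : List (Vec (Fin R) m)
        I = allVecs (allFin R) m
        re : ∀ h s → ((h + h) - s) - h ≡ h - s
        re = solve-∀ ℚ-ring
        good : Vec (Fin R) m → Vec V R → ℚ
        good ι v = 𝟙 (does (increasing? ι)) * 𝟙 (does (allGood? (v ⟦ ι ⟧)))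
        good-nonneg : ∀ v ι → 0ℚ ≤ good ι v
        good-nonneg v ι = *-nonneg (𝟙-nonneg (does (increasing? ι))) (𝟙-nonneg (does (allGood? (v ⟦ ι ⟧))))
        witness : ∀ v → ∃[ ι ] (Increasing ι × AllGood {m} (v ⟦ ι ⟧)) → ∃[ ι ] (ι ∈ I × 1ℚ ≤ good ι v)
        witness v (ι , inc , ok) = ι , ∈-allVecs ι (λ p → ∈ₚ.∈-allFin (lookup ι p)) , ≤-reflexive (sym (cong₂ _*_ (cong 𝟙 (dec-true (increasing? ι) inc)) (cong 𝟙 (dec-true (allGood? (v ⟦ ι ⟧)) ok))))
        finish : ∃[ ι ] (goodRate m ≤ 𝔼 (U R) (good ι)) → goodRate m ≤ 𝔼 (U m) (λ v → 𝟙 (does (allGood? v)))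
        finish (ι , le) = go (increasing? ι) le
          where
          go : (D : Dec (Increasing ι)) → goodRate m ≤ 𝔼 (U R) (λ v → 𝟙 (does D) * 𝟙 (does (allGood? (v ⟦ ι ⟧)))) → goodRate m ≤ 𝔼 (U m) (λ v → 𝟙 (does (allGood? v)))
          go (yes inc) le = ≤-trans le (≤-reflexive (trans (𝔼-cong (U R) (λ v → *-identityˡ (𝟙 (does (allGood? (v ⟦ ι ⟧)))))) (U-⟦⟧ ι (increasing⇒injective {s = ι} inc) (λ v → 𝟙 (does (allGood? v))))))
          go (no _) le = ≤-trans le (≤-trans (≤-reflexive (trans (𝔼-cong (U R) (λ v → *-zeroˡ (𝟙 (does (allGood? (v ⟦ ι ⟧)))))) (𝔼-const (U R) 0ℚ))) (𝔼-nonneg (U m) (λ v → 𝟙-nonneg (does (allGood? v)))))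

-- Sampling a reduced hypergraph

sumᵛ : ∀ {X : Set} {q} → (X → ℚ) → Vec X q → ℚ
sumᵛ g []      = 0ℚ
sumᵛ g (x ∷ F) = g x + sumᵛ g F

∑-lookup : ∀ {X : Set} {q} (g : X → ℚ) (F : Vec X q) → ∑ (allFin q) (g ∘ lookup F) ≡ sumᵛ g F
∑-lookup g []      = refl
∑-lookup g (x ∷ F) = cong (g x +_) (trans (∑-tabulate suc (g ∘ lookup (x ∷ F))) (∑-lookup g F))

∑-applyUpTo : ∀ (h : ℕ → ℕ) q (f : ℕ → ℚ) → ∑ (List.applyUpTo h q) f ≡ ∑ (allFin q) (λ x → f (h (toℕ x)))
∑-applyUpTo h zero    f = refl
∑-applyUpTo h (suc q) f = cong (f (h 0) +_) (trans (∑-applyUpTo (h ∘ suc) q f) (sym (∑-tabulate {q = q} suc (λ x → f (h (toℕ x))))))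

module _ {X : Set} (d : Dist X) (g : X → ℚ) (centred : 𝔼 d g ≡ 0ℚ) where

  sumᵛ-mean : ∀ q → 𝔼 (ΠD (replicate q d)) (sumᵛ g) ≡ 0ℚ
  sumᵛ-mean zero    = 𝔼-Π[] (sumᵛ g)
  sumᵛ-mean (suc q) = trans (𝔼-Π∷ d _ _) (trans (𝔼-cong d (λ x → trans (𝔼-+ (ΠD (replicate q d)) (λ _ → g x) (sumᵛ g)) (cong₂ _+_ (𝔼-const (ΠD (replicate q d)) (g x)) (sumᵛ-mean q))))
    (trans (𝔼-+ d g (λ _ → 0ℚ)) (cong₂ _+_ centred (𝔼-const d 0ℚ))))

  sumᵛ-variance : ∀ q → 𝔼 (ΠD (replicate q d)) (λ F → sumᵛ g F * sumᵛ g F) ≡ ℕ→ℚ q * 𝔼 d (λ x → g x * g x)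
  sumᵛ-variance zero    = trans (𝔼-Π[] {A = X} (λ F → sumᵛ g F * sumᵛ g F)) (sym (*-zeroˡ (𝔼 d (λ x → g x * g x))))
  sumᵛ-variance (suc q) = begin
    𝔼 (ΠD (replicate (suc q) d)) (λ F → sumᵛ g F * sumᵛ g F)
      ≡⟨ 𝔼-Π∷ d _ _ ⟩
    𝔼 d (λ x → 𝔼 Π (λ F → (g x + sumᵛ g F) * (g x + sumᵛ g F)))
      ≡⟨ 𝔼-cong d (λ x → trans (𝔼-cong Π (λ F → sq (g x) (sumᵛ g F))) (trans (𝔼-+ Π _ _) (cong₂ _+_ (trans (𝔼-+ Π _ _) (cong₂ _+_ (𝔼-const Π (g x * g x)) (trans (𝔼-* Π ((1ℚ + 1ℚ) * g x) (sumᵛ g)) (cong ((1ℚ + 1ℚ) * g x *_) (sumᵛ-mean q))))) (sumᵛ-variance q)))) ⟩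
    𝔼 d (λ x → (g x * g x + (1ℚ + 1ℚ) * g x * 0ℚ) + ℕ→ℚ q * v)
      ≡⟨ trans (𝔼-cong d (λ x → lem (g x) (ℕ→ℚ q * v))) (trans (𝔼-+ d _ _) (cong (v +_) (𝔼-const d (ℕ→ℚ q * v)))) ⟩
    v + ℕ→ℚ q * v
      ≡⟨ suc-bound q v ⟩
    ℕ→ℚ (suc q) * v ∎
    where
    open ≡-Reasoning
    Π = ΠD (replicate q d)
    v = 𝔼 d (λ x → g x * g x)
    sq : ∀ a s → (a + s) * (a + s) ≡ (a * a + (1ℚ + 1ℚ) * a * s) + s * s
    sq = solve-∀ ℚ-ring
    lem : ∀ a c → (a * a + (1ℚ + 1ℚ) * a * 0ℚ) + c ≡ a * a + c
    lem = solve-∀ ℚ-ring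

elemsₖ : ∀ {m k} (Y : Subset m) → Sub.∣ Y ∣ ≡ k → Vec (Fin m) k
elemsₖ Y refl = elems Y

elemsₖ-increasing : ∀ {m k} (Y : Subset m) (e : Sub.∣ Y ∣ ≡ k) → Increasing (elemsₖ Y e)
elemsₖ-increasing Y refl = elems-increasing Y

elemsₖ-sound : ∀ {m k} (Y : Subset m) (e : Sub.∣ Y ∣ ≡ k) l → lookup Y (lookup (elemsₖ Y e) l) ≡ true
elemsₖ-sound Y refl = elems-sound Y

elemsₖ-complete : ∀ {m k} (Y : Subset m) (e : Sub.∣ Y ∣ ≡ k) i → lookup Y i ≡ true → Covered (elemsₖ Y e) i
elemsₖ-complete Y refl = elems-complete Y

module _ (N′ : ℕ) {k m : ℕ} (test : Vec (Fin m) k → Vec ℕ k → Bool) where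

  private
    edgeDec : ∀ Y → Dec (Sub.∣ Y ∣ ≡ k) → (Fin m → ℕ) → Bool
    edgeDec Y (yes e) t = test (elemsₖ Y e) (Vec.map t (elemsₖ Y e))
    edgeDec Y (no _)  t = false

  -- An edge is tested on the increasing listing of `Y`; the label at position l belongs to the face
  -- that omits the l-th element.
  reduced : Reduced k m
  reduced = record { size = λ _ → suc N′ ; nonempty = λ _ _ → s≤s z≤n ; edgeA = λ Y t → edgeDec Y (Sub.∣ Y ∣ ℕₚ.≟ k) t }

  private
    edge-yes : ∀ Y (D : Dec (Sub.∣ Y ∣ ≡ k)) (e : Sub.∣ Y ∣ ≡ k) t → edgeDec Y D t ≡ test (elemsₖ Y e) (Vec.map t (elemsₖ Y e))
    edge-yes Y (yes e′) e t = cong (λ z → test (elemsₖ Y z) (Vec.map t (elemsₖ Y z))) (ℕₚ.≡-irrelevant e′ e)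
    edge-yes Y (no ¬e)  e t = contradiction e ¬e

  edgeA-reduced : ∀ Y (e : Sub.∣ Y ∣ ≡ k) t → edgeA reduced Y t ≡ test (elemsₖ Y e) (Vec.map t (elemsₖ Y e))
  edgeA-reduced Y e t = edge-yes Y (Sub.∣ Y ∣ ℕₚ.≟ k) e t

module Sampling (N′ : ℕ) {σ : ℚ} (0<σ : 0ℚ < σ) (enough : 1ℚ ≤ ℕ→ℚ (suc N′) * (σ * σ)) where

  N : ℕ
  N = suc N′

  private
    1/N : ℚ
    1/N = inv (ℕ→ℚ N)

    0<1/N : 0ℚ < 1/N
    0<1/N = inv-pos (ℕ→ℚ-pos N′)

  -- Second moment method: the mean of N independent values in [0,1] has variance at most 1/N, which
  -- is at most σ² by `enough`.
  sample-error : ∀ {X : Set} (d : Dist X) (g : X → ℚ) → (∀ x → 0ℚ ≤ g x) → (∀ x → g x ≤ 1ℚ) →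
    𝔼 (ΠD (replicate N d)) (λ F → ∣ 𝔼 (uniformFin N′) (g ∘ lookup F) - 𝔼 d g ∣) ≤ σ
  sample-error d g ng g≤1 = subst (_≤ σ) (𝔼-cong Π (λ F → cong ∣_∣ (sym (recentre F)))) (𝔼-abs-by-square Π (λ F → 1/N * sumᵛ c F) 0<σ (begin
    𝔼 Π (λ F → (1/N * sumᵛ c F) * (1/N * sumᵛ c F))
      ≡⟨ trans (𝔼-cong Π (λ F → sq 1/N (sumᵛ c F))) (trans (𝔼-* Π (1/N * 1/N) _) (cong (1/N * 1/N *_) (sumᵛ-variance d c centred N))) ⟩
    1/N * 1/N * (ℕ→ℚ N * 𝔼 d (λ x → c x * c x))
      ≡⟨ trans (re 1/N (ℕ→ℚ N) (𝔼 d (λ x → c x * c x))) (trans (cong (λ z → 1/N * (z * 𝔼 d (λ x → c x * c x))) (inv-inverse (ℕ→ℚ-pos N′))) (cong (1/N *_) (*-identityˡ (𝔼 d (λ x → c x * c x))))) ⟩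
    1/N * 𝔼 d (λ x → c x * c x)
      ≤⟨ *≤ˡ (<⇒≤ 0<1/N) (𝔼-≤const d (λ x → bounded (g x) (ng x) (g≤1 x))) ⟩
    1/N
      ≡⟨ sym (*-identityʳ 1/N) ⟩
    1/N * 1ℚ
      ≤⟨ *-monoˡ 1/N (<⇒≤ 0<1/N) enough ⟩
    1/N * (ℕ→ℚ N * (σ * σ))
      ≡⟨ trans (re′ 1/N (ℕ→ℚ N) (σ * σ)) (trans (cong (_* (σ * σ)) (inv-inverse (ℕ→ℚ-pos N′))) (*-identityˡ (σ * σ))) ⟩
    σ * σ ∎))
    where
    open ≤-Reasoning
    Π = ΠD (replicate N d)
    e = 𝔼 d g
    c : _ → ℚ
    c x = g x - e
    sq : ∀ i s → (i * s) * (i * s) ≡ i * i * (s * s)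
    sq = solve-∀ ℚ-ring
    re : ∀ i n v → i * i * (n * v) ≡ i * (n * i * v)
    re = solve-∀ ℚ-ring
    re′ : ∀ i n s → i * (n * s) ≡ n * i * s
    re′ = solve-∀ ℚ-ring
    centred : 𝔼 d c ≡ 0ℚ
    centred = trans (𝔼-- d g (λ _ → e)) (trans (cong (λ z → e - z) (𝔼-const d e)) (+-inverseʳ e))
    bounded : ∀ x → 0ℚ ≤ x → x ≤ 1ℚ → (x - e) * (x - e) ≤ 1ℚ
    bounded x 0≤x x≤1 = by-difference (lem x e) (*-nonneg (+-nonneg (≤⇒0≤- x≤1) (𝔼-nonneg d ng)) (+-nonneg 0≤x (≤⇒0≤- (𝔼-≤const d g≤1))))
      where
      lem : ∀ x e → 1ℚ - (x - e) * (x - e) ≡ ((1ℚ - x) + e) * (x + (1ℚ - e))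
      lem = solve-∀ ℚ-ring
    sum-c : ∀ {q} (F : Vec _ q) → sumᵛ c F ≡ sumᵛ g F - ℕ→ℚ q * e
    sum-c []      = lem e
      where
      lem : ∀ e → 0ℚ ≡ 0ℚ - 0ℚ * e
      lem = solve-∀ ℚ-ring
    sum-c {suc q} (x ∷ F) = trans (cong (c x +_) (sum-c F)) (trans (lem (g x) e (sumᵛ g F) (ℕ→ℚ q * e)) (cong (λ z → (g x + sumᵛ g F) - z) (suc-bound q e)))
      where
      lem : ∀ x e s t → (x - e) + (s - t) ≡ (x + s) - (e + t)
      lem = solve-∀ ℚ-ring
    recentre : ∀ F → 𝔼 (uniformFin N′) (g ∘ lookup F) - e ≡ 1/N * sumᵛ c F
    recentre F = trans (cong (_- e) (trans (𝔼-uniformFin N′ (g ∘ lookup F)) (cong (1/N *_) (∑-lookup g F)))) (sym (trans (cong (1/N *_) (sum-c F)) (trans (lem 1/N (sumᵛ g F) (ℕ→ℚ N) e) (trans (cong (λ z → 1/N * sumᵛ g F - z * e) (inv-inverse (ℕ→ℚ-pos N′))) (cong (λ z → 1/N * sumᵛ g F - z) (*-identityˡ e))))))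
      where
      lem : ∀ i s n e → i * (s - n * e) ≡ i * s - n * i * e
      lem = solve-∀ ℚ-ring

  families : ∀ {X : Set} {q} → Vec (Dist X) q → Dist (Vec (Vec X N) q)
  families ds = ΠD (Vec.map (λ d → ΠD (replicate N d)) ds)

  choices : ∀ q → Dist (Vec (Fin N) q)
  choices = Uniform.U (uniformFin N′)

  -- The tuples of samples are not independent, as each sample is used in many of them, so the
  -- factors are treated one at a time. For each sampled first entry the other factors are handled
  -- by induction; the remaining average over first entries is a `sample-error` for the conditional
  -- mean `g`.
  sampling : ∀ {X : Set} {q} (ds : Vec (Dist X) q) (f : Vec X q → ℚ) → (∀ x → 0ℚ ≤ f x) → (∀ x → f x ≤ 1ℚ) →
    𝔼 (families ds) (λ Fs → ∣ 𝔼 (choices q) (λ τ → f (pick Fs τ)) - 𝔼 (ΠD ds) f ∣) ≤ ℕ→ℚ q * σ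
  sampling [] f nf f≤1 = ≤-reflexive (trans (𝔼-Π[] _) (trans (cong₂ (λ x y → ∣ x - y ∣) (𝔼-Π[] _) (𝔼-Π[] f)) (trans (∣x-x∣≡0 (f [])) (sym (*-zeroˡ σ)))))
  sampling {X} {suc q} (d ∷ ds) f nf f≤1 = begin
    𝔼 (families (d ∷ ds)) (λ Fs → ∣ 𝔼 (choices (suc q)) (λ τ → f (pick Fs τ)) - 𝔼 (ΠD (d ∷ ds)) f ∣)
      ≡⟨ trans (𝔼-Π∷ Π _ _) (𝔼-cong Π (λ F → 𝔼-cong (families ds) (λ Fs → cong₂ (λ x y → ∣ x - y ∣) (𝔼-Π∷ (uniformFin N′) _ _) (𝔼-Π∷ d ds f)))) ⟩
    𝔼 Π (λ F → 𝔼 (families ds) (λ Fs → ∣ 𝔼 (uniformFin N′) (λ t → S (lookup F t) Fs) - 𝔼 d g ∣))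
      ≤⟨ 𝔼-mono Π (λ F → 𝔼-mono (families ds) (λ Fs → ≤-trans (triangle (𝔼 (uniformFin N′) (λ t → S (lookup F t) Fs)) (𝔼 (uniformFin N′) (g ∘ lookup F)) (𝔼 d g))
           (+-monoˡ-≤ ∣ 𝔼 (uniformFin N′) (g ∘ lookup F) - 𝔼 d g ∣ (≤-trans (≤-reflexive (cong ∣_∣ (sym (𝔼-- (uniformFin N′) _ _)))) (𝔼-abs (uniformFin N′) _))))) ⟩
    𝔼 Π (λ F → 𝔼 (families ds) (λ Fs → 𝔼 (uniformFin N′) (λ t → ∣ S (lookup F t) Fs - g (lookup F t) ∣) + ∣ 𝔼 (uniformFin N′) (g ∘ lookup F) - 𝔼 d g ∣))
      ≡⟨ trans (𝔼-cong Π (λ F → trans (𝔼-+ (families ds) _ _) (cong₂ _+_ (𝔼-swap (families ds) (uniformFin N′) _) (𝔼-const (families ds) _)))) (𝔼-+ Π _ _) ⟩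
    𝔼 Π (λ F → 𝔼 (uniformFin N′) (λ t → 𝔼 (families ds) (λ Fs → ∣ S (lookup F t) Fs - g (lookup F t) ∣))) + 𝔼 Π (λ F → ∣ 𝔼 (uniformFin N′) (g ∘ lookup F) - 𝔼 d g ∣)
      ≤⟨ +-mono-≤ (𝔼-≤const Π (λ F → 𝔼-≤const (uniformFin N′) (λ t → sampling ds (λ xs → f (lookup F t ∷ xs)) (λ xs → nf _) (λ xs → f≤1 _))))
           (sample-error d g (λ x → 𝔼-nonneg (ΠD ds) (λ xs → nf (x ∷ xs))) (λ x → 𝔼-≤const (ΠD ds) (λ xs → f≤1 (x ∷ xs)))) ⟩
    ℕ→ℚ q * σ + σ
      ≡⟨ trans (+-comm (ℕ→ℚ q * σ) σ) (suc-bound q σ) ⟩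
    ℕ→ℚ (suc q) * σ ∎
    where
    open ≤-Reasoning
    Π = ΠD (replicate N d)
    g : X → ℚ
    g x = 𝔼 (ΠD ds) (λ xs → f (x ∷ xs))
    S : X → Vec (Vec X N) q → ℚ
    S x Fs = 𝔼 (choices q) (λ τ → f (x ∷ pick Fs τ))

  -- A fixed pattern uses one fixed sample number per slot, so for counting it the families amount
  -- to a single independent top per slot.
  pick-one : ∀ {X : Set} {q} (ds : Vec (Dist X) q) (α : Vec (Fin N) q) (G : Vec X q → ℚ) → 𝔼 (families ds) (λ ζ → G (pick ζ α)) ≡ 𝔼 (ΠD ds) G
  pick-one []       []      G = trans (𝔼-Π[] _) (sym (𝔼-Π[] G))
  pick-one (d ∷ ds) (t ∷ α) G = trans (𝔼-Π∷ (ΠD (replicate N d)) _ _) (trans (𝔼-cong (ΠD (replicate N d)) (λ F → pick-one ds α (λ xs → G (lookup F t ∷ xs))))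
    (trans (Uniform.U-⟦⟧ d (t ∷ []) (λ { {zero} {zero} _ → refl }) (λ x → 𝔼 (ΠD ds) (λ xs → G (lookup x zero ∷ xs)))) (trans (𝔼-Π∷ d [] _) (trans (𝔼-cong d (λ x → 𝔼-Π[] _)) (sym (𝔼-Π∷ d ds G))))))

  ∑-upTo : ∀ (f : ℕ → ℚ) → ∑ (upTo N) f ≡ ℕ→ℚ N * 𝔼 (uniformFin N′) (f ∘ toℕ)
  ∑-upTo f = trans (∑-applyUpTo id N f) (sym (trans (cong (ℕ→ℚ N *_) (𝔼-uniformFin N′ (f ∘ toℕ)))
    (trans (sym (*-assoc (ℕ→ℚ N) 1/N _)) (trans (cong (_* ∑ (allFin N) (f ∘ toℕ)) (inv-inverse (ℕ→ℚ-pos N′))) (*-identityˡ (∑ (allFin N) (f ∘ toℕ)))))))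

  ∑-tuples : ∀ {m} (Y : Subset m) (b : Fin m → ℕ) → (∀ i → b i ≡ (if lookup Y i then N else 1)) → (g : Vec ℕ Sub.∣ Y ∣ → ℚ) →
    ∑ (tuples b) (λ t → g (Vec.map t (elems Y))) ≡ ℕ→ℚ (N ℕ.^ Sub.∣ Y ∣) * 𝔼 (choices Sub.∣ Y ∣) (λ τ → g (Vec.map toℕ τ))
  ∑-tuples [] b hb g = trans (+-identityʳ (g [])) (sym (trans (*-identityˡ _) (𝔼-Π[] _)))
  ∑-tuples (true ∷ Y) b hb g = begin
    ∑ (tuples b) (λ t → g (Vec.map t (elems (true ∷ Y))))
      ≡⟨ trans (∑-concatMap (λ v → List.map (consF v) (tuples (b ∘ suc))) (upTo (b zero)) _) (∑-cong (upTo (b zero)) (λ v → trans (∑-map (consF v) (tuples (b ∘ suc)) _) (∑-cong (tuples (b ∘ suc)) (λ t → cong (λ z → g (v ∷ z)) (sym (Vecₚ.map-∘ (consF v t) suc (elems Y))))))) ⟩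
    ∑ (upTo (b zero)) (λ v → ∑ (tuples (b ∘ suc)) (λ t → g (v ∷ Vec.map t (elems Y))))
      ≡⟨ trans (cong (λ z → ∑ (upTo z) (λ v → ∑ (tuples (b ∘ suc)) (λ t → g (v ∷ Vec.map t (elems Y))))) (hb zero)) (∑-upTo (λ v → ∑ (tuples (b ∘ suc)) (λ t → g (v ∷ Vec.map t (elems Y))))) ⟩
    ℕ→ℚ N * 𝔼 (uniformFin N′) (λ v → ∑ (tuples (b ∘ suc)) (λ t → g (toℕ v ∷ Vec.map t (elems Y))))
      ≡⟨ cong (ℕ→ℚ N *_) (trans (𝔼-cong (uniformFin N′) (λ v → ∑-tuples Y (b ∘ suc) (hb ∘ suc) (λ z → g (toℕ v ∷ z)))) (𝔼-* (uniformFin N′) (ℕ→ℚ (N ℕ.^ Sub.∣ Y ∣)) _)) ⟩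
    ℕ→ℚ N * (ℕ→ℚ (N ℕ.^ Sub.∣ Y ∣) * 𝔼 (uniformFin N′) (λ v → 𝔼 (choices Sub.∣ Y ∣) (λ τ → g (toℕ v ∷ Vec.map toℕ τ))))
      ≡⟨ trans (sym (*-assoc (ℕ→ℚ N) (ℕ→ℚ (N ℕ.^ Sub.∣ Y ∣)) _)) (cong₂ _*_ (sym (ℕ→ℚ-* N (N ℕ.^ Sub.∣ Y ∣))) (sym (𝔼-Π∷ (uniformFin N′) _ _))) ⟩
    ℕ→ℚ (N ℕ.* N ℕ.^ Sub.∣ Y ∣) * 𝔼 (choices (suc Sub.∣ Y ∣)) (λ τ → g (Vec.map toℕ τ)) ∎
    where open ≡-Reasoning
  ∑-tuples (false ∷ Y) b hb g = begin
    ∑ (tuples b) (λ t → g (Vec.map t (elems (false ∷ Y))))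
      ≡⟨ trans (∑-concatMap (λ v → List.map (consF v) (tuples (b ∘ suc))) (upTo (b zero)) _) (∑-cong (upTo (b zero)) (λ v → trans (∑-map (consF v) (tuples (b ∘ suc)) _) (∑-cong (tuples (b ∘ suc)) (λ t → cong g (sym (Vecₚ.map-∘ (consF v t) suc (elems Y))))))) ⟩
    ∑ (upTo (b zero)) (λ v → ∑ (tuples (b ∘ suc)) (λ t → g (Vec.map t (elems Y))))
      ≡⟨ trans (cong (λ z → ∑ (upTo z) (λ v → ∑ (tuples (b ∘ suc)) (λ t → g (Vec.map t (elems Y))))) (hb zero)) (+-identityʳ _) ⟩
    ∑ (tuples (b ∘ suc)) (λ t → g (Vec.map t (elems Y)))
      ≡⟨ ∑-tuples Y (b ∘ suc) (hb ∘ suc) g ⟩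
    ℕ→ℚ (N ℕ.^ Sub.∣ Y ∣) * 𝔼 (choices Sub.∣ Y ∣) (λ τ → g (Vec.map toℕ τ)) ∎
    where open ≡-Reasoning

  module _ {k m : ℕ} (test : Vec (Fin m) k → Vec ℕ k → Bool) where

    edgeCount-reduced : ∀ Y (e : Sub.∣ Y ∣ ≡ k) → ℕ→ℚ (edgeCount (reduced N′ test) Y) ≡ ℕ→ℚ (N ℕ.^ k) * 𝔼 (choices k) (λ τ → 𝟙 (test (elemsₖ Y e) (Vec.map toℕ τ)))
    edgeCount-reduced Y e = trans (countTrue-∑ (edgeA (reduced N′ test) Y) (tuples (Defs.bound (reduced N′ test) Y))) (trans (∑-cong (tuples (Defs.bound (reduced N′ test) Y)) (λ t → cong 𝟙 (edgeA-reduced N′ test Y e t))) (go test Y e))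
      where
      go : ∀ {k} (test : Vec (Fin m) k → Vec ℕ k → Bool) Y (e : Sub.∣ Y ∣ ≡ k) →
        ∑ (tuples (λ i → if lookup Y i then N else 1)) (λ t → 𝟙 (test (elemsₖ Y e) (Vec.map t (elemsₖ Y e)))) ≡ ℕ→ℚ (N ℕ.^ k) * 𝔼 (choices k) (λ τ → 𝟙 (test (elemsₖ Y e) (Vec.map toℕ τ)))
      go test Y refl = ∑-tuples Y (λ i → if lookup Y i then N else 1) (λ _ → refl) (λ z → 𝟙 (test (elems Y) z))

  -- prodSizes ignores everything but the sizes, so the induction may change the edges.
  prodSizes-reduced : ∀ {k m} (test : Vec (Fin m) k → Vec ℕ k → Bool) (Y : Subset m) → prodSizes (reduced N′ test) Y ≡ N ℕ.^ Sub.∣ Y ∣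
  prodSizes-reduced test []          = refl
  prodSizes-reduced {k} test (true ∷ Y)  = cong (N ℕ.*_) (prodSizes-reduced {k} (λ _ _ → true) Y)
  prodSizes-reduced {k} test (false ∷ Y) = trans (ℕₚ.*-identityˡ _) (prodSizes-reduced {k} (λ _ _ → true) Y)

  denseR-reduced : ∀ {k m c} (test : Vec (Fin m) k → Vec ℕ k → Bool) → (∀ T → Increasing T → c ≤ 𝔼 (choices k) (λ τ → 𝟙 (test T (Vec.map toℕ τ)))) → DenseR c (reduced N′ test)
  denseR-reduced {k} {m} {c} test h Y e = subst₂ _≤_ (trans (*-comm (ℕ→ℚ (N ℕ.^ k)) c) (cong (λ z → c * ℕ→ℚ z) (sym (trans (prodSizes-reduced test Y) (cong (N ℕ.^_) e))))) (sym (edgeCount-reduced test Y e))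
    (*-monoˡ (ℕ→ℚ (N ℕ.^ k)) (ℕ→ℚ-nonneg (N ℕ.^ k)) (h (elemsₖ Y e) (elemsₖ-increasing Y e)))

-- Embeddings that are injective on vertices

anyFin-sound : ∀ {f} (P : Fin f → Bool) → anyFin P ≡ true → ∃[ x ] P x ≡ true
anyFin-sound {suc f} P e = go (P zero) refl e
  where
  go : ∀ b → P zero ≡ b → b ∨ anyFin (P ∘ suc) ≡ true → ∃[ x ] P x ≡ true
  go true  p _ = zero , p
  go false p e = let (x , q) = anyFin-sound (P ∘ suc) e in suc x , q

anyFin-complete : ∀ {f} (P : Fin f → Bool) x → P x ≡ true → anyFin P ≡ true
anyFin-complete P zero    p = cong (_∨ anyFin (P ∘ suc)) p
anyFin-complete P (suc x) p = trans (cong (P zero ∨_) (anyFin-complete (P ∘ suc) x p)) (Boolₚ.∨-zeroʳ (P zero))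

image-sound : ∀ {f n} (φ : Fin f → Fin n) S i → lookup (image φ S) i ≡ true → ∃[ x ] (lookup S x ≡ true × φ x ≡ i)
image-sound φ S i e = let (x , p) = anyFin-sound (λ x → lookup S x ∧ does (φ x Finₚ.≟ i)) (trans (sym (Vecₚ.lookup∘tabulate _ i)) e) in
  x , ∧-left p , does⇒ (φ x Finₚ.≟ i) (∧-right {lookup S x} p)
  where
  ∧-left : ∀ {a b} → a ∧ b ≡ true → a ≡ true
  ∧-left {true} _ = refl
  ∧-right : ∀ {a b} → a ∧ b ≡ true → b ≡ true
  ∧-right {true} e = e

image-complete : ∀ {f n} (φ : Fin f → Fin n) S x → lookup S x ≡ true → lookup (image φ S) (φ x) ≡ true
image-complete φ S x e = trans (Vecₚ.lookup∘tabulate _ (φ x)) (anyFin-complete (λ y → lookup S y ∧ does (φ y Finₚ.≟ φ x)) x (cong₂ _∧_ e (dec-true (φ x Finₚ.≟ φ x) refl)))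

image-cong : ∀ {f n} {φ φ′ : Fin f → Fin n} → (∀ x → φ x ≡ φ′ x) → ∀ S → image φ S ≡ image φ′ S
image-cong {φ = φ} {φ′} h S = subset-ext (λ i e → let (x , s , p) = image-sound φ S i e in subst (λ z → lookup (image φ′ S) z ≡ true) (trans (sym (h x)) p) (image-complete φ′ S x s))
  (λ i e → let (x , s , p) = image-sound φ′ S i e in subst (λ z → lookup (image φ S) z ≡ true) (trans (h x) p) (image-complete φ S x s))

delete-sound : ∀ {f} (e : Subset f) x y → lookup (e ─ ⁅ x ⁆) y ≡ true → lookup e y ≡ true × x ≢ y
delete-sound (true ∷ e)  zero    zero    ()
delete-sound (false ∷ e) zero    zero    ()
delete-sound (b ∷ e) zero    (suc y) p = trans (cong (λ z → lookup z y) (sym (Subₚ.p─⊥≡p e))) p , λ ()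
delete-sound (true ∷ e)  (suc x) zero p = refl , λ ()
delete-sound (false ∷ e) (suc x) zero p = contradiction p λ ()
delete-sound (b ∷ e) (suc x) (suc y) p = let (q , ne) = delete-sound e x y p in q , λ eq → ne (Finₚ.suc-injective eq)

delete-complete : ∀ {f} (e : Subset f) x y → lookup e y ≡ true → x ≢ y → lookup (e ─ ⁅ x ⁆) y ≡ true
delete-complete (b ∷ e) zero    zero    p ne = contradiction refl ne
delete-complete (b ∷ e) zero    (suc y) p ne = trans (cong (λ z → lookup z y) (Subₚ.p─⊥≡p e)) p
delete-complete (true ∷ e)  (suc x) zero p ne = refl
delete-complete (b ∷ e) (suc x) (suc y) p ne = delete-complete e x y p (ne ∘ cong suc)

lookup-index : ∀ {X Y : Set} (h : X → Y) {xs : List X} {x} (m : x ∈ xs) → lookup (Vec.map h (Vec.fromList xs)) (Any.index m) ≡ h x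
lookup-index h (here refl) = refl
lookup-index h (there m)   = lookup-index h m

preimage : ∀ {f M q} → (Fin f → Fin M) → Vec (Fin M) q → Subset f
preimage φ s = tabulate (λ x → does (covered? s (φ x)))

abstract
 denseR? : ∀ {k m} c (A : Reduced k m) → Dec (DenseR c A)
 denseR? {k} {m} c A = map′ (λ all Y → All.lookup all (∈-allSubsets Y)) (λ h → All.tabulate (λ {Y} _ → h Y))
   (All.all? (λ Y → (Sub.∣ Y ∣ ℕₚ.≟ k) →-dec (c * ℕ→ℚ (prodSizes A Y) ≤? ℕ→ℚ (edgeCount A Y))) (allSubsets m))

-- Labels are attached to sets of vertices of `F`: since `φ*` is injective, a face of the image of
-- an edge is recognised by its preimage, the edge without one vertex.
record Pattern {j M N : ℕ} (F : Graph) (oracle : Vec (Fin M) (suc j) → Vec (Fin N) (suc j) → Bool) : Set where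
  field
    φ*   : Fin (vn F) → Fin M
    φ*-injective : ∀ {x y} → φ* x ≡ φ* y → x ≡ y
    ψ*   : Subset (vn F) → Fin N
    edges : ∀ e → IsEdge (suc j) F e → Σ[ T ∈ Vec (Fin M) (suc j) ] (Increasing T × setOf T ≡ image φ* e × oracle T (tabulate (λ l → ψ* (preimage φ* (removeAt T l)))) ≡ true)

-- In a blow-up of the index set, many dense transversals force an embedding that is injective on vertices.
module InjectiveEmbedding (j : ℕ) (F : Graph) (m N′ : ℕ) {c : ℚ} (hyp : ∀ (A : Reduced (suc j) m) → DenseR c A → Embeds F A) {ρ : ℚ} (0<ρ : 0ℚ < ρ) where

  k N f : ℕ
  k = suc j
  N = suc N′
  f = vn F

  -- All possible codes of an embedding. Embeddings found in different transversals can be combined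
  -- into one only if they have the same `φ` and `ψ`, so these serve as the colour of a transversal.
  colours : List (Vec (Fin m) f × Vec (Fin N) (length (allSubsets f)))
  colours = List.cartesianProduct (allVecs (allFin m) f) (allVecs (allFin N) (length (allSubsets f)))

  private
    boxes = box m f {ρ * inv (ℕ→ℚ (suc (length colours)))} (*-pos 0<ρ (inv-pos (ℕ→ℚ-pos (length colours))))

  r : ℕ
  r = proj₁ boxes

  M : ℕ
  M = m ℕ.* suc r

  transversals : Dist (Vec (Fin (suc r)) m)
  transversals = ΠD (proj₁ (proj₂ boxes))

  transversal : Vec (Fin (suc r)) m → Vec (Fin M) m
  transversal σ = tabulate (λ i → combine i (lookup σ i))

  transversal-increasing : ∀ σ → Increasing (transversal σ)
  transversal-increasing σ p q p<q = subst₂ Fin._<_ (sym (Vecₚ.lookup∘tabulate _ p)) (sym (Vecₚ.lookup∘tabulate _ q)) (Finₚ.combine-monoˡ-< (lookup σ p) (lookup σ q) p<q)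

  private
    clampDec : ∀ x → Dec (x ℕ.< N) → Fin N
    clampDec x (yes lt) = Fin.fromℕ< lt
    clampDec x (no _)   = zero

  abstract
    -- A reduced map controls `ψ` on the shadow only. Elsewhere its values are arbitrary, and the
    -- default `zero` keeps the number of codes finite.
    clamp : ℕ → Fin N
    clamp x = clampDec x (x ℕₚ.<? N)

    clamp-toℕ : ∀ x → clamp (toℕ x) ≡ x
    clamp-toℕ x = go (toℕ x ℕₚ.<? N)
      where
      go : ∀ D → clampDec (toℕ x) D ≡ x
      go (yes lt) = Finₚ.fromℕ<-toℕ x lt
      go (no ¬lt) = contradiction (Finₚ.toℕ<n x) ¬lt

  module _ (oracle : Vec (Fin M) k → Vec (Fin N) k → Bool) where

    test : Vec (Fin (suc r)) m → Vec (Fin m) k → Vec ℕ k → Bool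
    test σ T ns = oracle (transversal σ ⟦ T ⟧) (Vec.map clamp ns)

    graph : Vec (Fin (suc r)) m → Reduced k m
    graph σ = reduced N′ (test σ)

    dense? : ∀ σ → Dec (DenseR c (graph σ))
    dense? σ = denseR? c (graph σ)

    private
      code : ∀ (A : Reduced k m) → Embeds F A → Vec (Fin m) f × Vec (Fin N) (length (allSubsets f))
      code A (φ , ψ , _) = tabulate φ , Vec.map (clamp ∘ ψ) (Vec.fromList (allSubsets f))

      Colour = Vec (Fin m) f × Vec (Fin N) (length (allSubsets f))

      _≟ᶜ_ : (x y : Colour) → Dec (x ≡ y)
      _≟ᶜ_ = Productₚ.≡-dec (Vecₚ.≡-dec Finₚ._≟_) (Vecₚ.≡-dec Finₚ._≟_)

      colouredDec : ∀ σ → Dec (DenseR c (graph σ)) → Colour → Bool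
      colouredDec σ (yes p) col = does (code (graph σ) (hyp (graph σ) p) ≟ᶜ col)
      colouredDec σ (no _)  col = false

      coloured : Colour → Vec (Fin (suc r)) m → Bool
      coloured col σ = colouredDec σ (dense? σ) col

      extract : ∀ σ D col → colouredDec σ D col ≡ true → Σ[ E ∈ Embeds F (graph σ) ] code (graph σ) E ≡ col
      extract σ (yes p) col e = hyp (graph σ) p , does⇒ (code (graph σ) (hyp (graph σ) p) ≟ᶜ col) e

      some-colour : ∀ σ (D : Dec (DenseR c (graph σ))) → does D ≡ true → ∃[ col ] (col ∈ colours × 1ℚ ≤ 𝟙 (colouredDec σ D col))
      some-colour σ (yes p) _ = code (graph σ) E , ∈ₚ.∈-cartesianProduct⁺ (∈-allVecs (proj₁ (code (graph σ) E)) (λ l → ∈ₚ.∈-allFin (lookup (proj₁ (code (graph σ) E)) l))) (∈-allVecs (proj₂ (code (graph σ) E)) (λ l → ∈ₚ.∈-allFin (lookup (proj₂ (code (graph σ) E)) l))) ,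
          ≤-reflexive (sym (cong 𝟙 (dec-true (code (graph σ) E ≟ᶜ code (graph σ) E) refl)))
        where
        E : Embeds F (graph σ)
        E = hyp (graph σ) p

    -- All transversals in a box of one colour share `φ` and `ψ`. Each vertex `x` of `F` can thus
    -- use its own, the x-th, copy of the index `φ x`, which makes `φ*` injective. Since `φ` is
    -- injective on an edge `e`, some transversal in the box passes through the copies of all
    -- vertices of `e`, and the embedding found there certifies the edge.
    pattern-exists : ρ ≤ 𝔼 transversals (λ σ → 𝟙 (does (dense? σ))) → Pattern F oracle
    pattern-exists le = record { φ* = φ* ; φ*-injective = φ*-inj ; ψ* = ψ ; edges = edges }
      where
      covered-by : ∀ σ → 𝟙 (does (dense? σ)) ≤ ∑ colours (λ col → 𝟙 (coloured col σ))
      covered-by σ = 𝟙-≤-∑ (does (dense? σ)) colours (λ col → 𝟙 (coloured col σ)) (λ col → 𝟙-nonneg (coloured col σ)) (some-colour σ (dense? σ))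
      total : ρ ≤ ∑ colours (λ col → 𝔼 transversals (λ σ → 𝟙 (coloured col σ)))
      total = ≤-trans le (≤-trans (𝔼-mono transversals covered-by) (≤-reflexive (𝔼-∑ transversals colours (λ σ col → 𝟙 (coloured col σ)))))
      chosen : ∃[ col ] ρ * inv (ℕ→ℚ (suc (length colours))) ≤ 𝔼 transversals (λ σ → 𝟙 (coloured col σ))
      chosen = ∑-pigeonhole colours (λ col → 𝔼 transversals (λ σ → 𝟙 (coloured col σ))) 0<ρ total
      col : Colour
      col = proj₁ chosen
      found : ∃[ g ] IsBox {suc r} {m} {f} (coloured col) g
      found = proj₂ (proj₂ boxes) (coloured col) (proj₂ chosen)
      g : Vec (Vec (Fin (suc r)) f) m
      g = proj₁ found
      g-inj : ∀ i → Injectiveᵛ (lookup g i)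
      g-inj = proj₁ (proj₂ found)
      embedding : ∀ τ → Σ[ E ∈ Embeds F (graph (pick g τ)) ] code (graph (pick g τ)) E ≡ col
      embedding τ = extract (pick g τ) (dense? (pick g τ)) col (proj₂ (proj₂ found) τ)
      φ : Fin f → Fin m
      φ x = lookup (proj₁ col) x
      ψ : Subset f → Fin N
      ψ S = lookup (proj₂ col) (Any.index (∈-allSubsets S))
      φ* : Fin f → Fin M
      φ* x = combine (φ x) (lookup (lookup g (φ x)) x)
      φ*-inj : ∀ {x y} → φ* x ≡ φ* y → x ≡ y
      φ*-inj {x} {y} e = g-inj (φ x) (trans (Finₚ.combine-injectiveʳ (φ x) _ (φ y) _ e) (cong (λ i → lookup (lookup g i) y) (sym (Finₚ.combine-injectiveˡ (φ x) _ (φ y) _ e))))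
      edges : ∀ e → IsEdge k F e → ∃[ T ] (Increasing T × setOf T ≡ image φ* e × oracle T (tabulate (λ l → ψ (preimage φ* (removeAt T l)))) ≡ true)
      edges e isE = T̂ , T̂-inc , T̂-set , trans (cong (oracle T̂) labels) test-true
        where
        card-e : Sub.∣ e ∣ ≡ k
        card-e = ℕₚ.≡ᵇ⇒≡ Sub.∣ e ∣ k (subst Data.Bool.T (sym (∧-right {Graph.E F e} isE)) tt)
          where
          ∧-right : ∀ {a b} → a ∧ b ≡ true → b ≡ true
          ∧-right {true} e = e
        members : Vec (Fin f) k
        members = elemsₖ e card-e
        -- A default that selects some copy of the indices outside the image of `e`.
        x₀ : Fin f
        x₀ = lookup members zero
        member-of : ∀ i → Dec (∃[ x ] (lookup e x ≡ true × φ x ≡ i)) → Fin f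
        member-of i (yes (x , _)) = x
        member-of i (no _)        = x₀
        member? : ∀ i → Dec (∃[ x ] (lookup e x ≡ true × φ x ≡ i))
        member? i = Finₚ.any? (λ x → (lookup e x Boolₚ.≟ true) ×-dec (φ x Finₚ.≟ i))
        τ : Vec (Fin f) m
        τ = tabulate (λ i → member-of i (member? i))
        σ : Vec (Fin (suc r)) m
        σ = pick g τ
        E : Embeds F (graph σ)
        E = proj₁ (embedding τ)
        φσ : Fin f → Fin m
        φσ = proj₁ E
        ψσ : Subset f → ℕ
        ψσ = proj₁ (proj₂ E)
        φσ≡ : ∀ x → φσ x ≡ φ x
        φσ≡ x = trans (sym (Vecₚ.lookup∘tabulate φσ x)) (cong (λ c → lookup (proj₁ c) x) (proj₂ (embedding τ)))
        ψσ≡ : ∀ S → clamp (ψσ S) ≡ ψ S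
        ψσ≡ S = trans (sym (lookup-index (clamp ∘ ψσ) (∈-allSubsets S))) (cong (λ c → lookup (proj₂ c) (Any.index (∈-allSubsets S))) (proj₂ (embedding τ)))
        Y : Subset m
        Y = image φσ e
        onE = proj₂ (proj₂ (proj₂ E)) e isE
        card-Y : Sub.∣ Y ∣ ≡ k
        card-Y = proj₁ onE
        t : Fin m → ℕ
        t = proj₁ (proj₂ onE)
        t-edge : edgeA (graph σ) Y (canon Y t) ≡ true
        t-edge = proj₂ (proj₁ (proj₂ (proj₂ onE)))
        t-ψ : ∀ x → lookup e x ≡ true → t (φσ x) ≡ ψσ (e ─ ⁅ x ⁆)
        t-ψ x p = proj₂ (proj₂ (proj₂ onE)) x (Vecₚ.lookup⇒[]= x e p)
        -- The image of `e` has `k` elements, as many as `e` itself; a collision would make it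
        -- smaller.
        φ-inj-on : ∀ {x y} → lookup e x ≡ true → lookup e y ≡ true → φ x ≡ φ y → x ≡ y
        φ-inj-on {x} {y} px py eq = trans (sym (proj₂ cx)) (trans (cong (lookup members) same) (proj₂ cy))
          where
          cx = elemsₖ-complete e card-e x px
          cy = elemsₖ-complete e card-e y py
          w : Vec (Fin m) k
          w = Vec.map φσ members
          setOf-w : setOf w ≡ Y
          setOf-w = subset-ext
            (λ i p → let (l , q) = setOf-sound w i p in subst (λ z → lookup Y z ≡ true) (trans (sym (Vecₚ.lookup-map l φσ members)) q) (image-complete φσ e (lookup members l) (elemsₖ-sound e card-e l)))
            (λ i p → let (x , q , h) = image-sound φσ e i p in let (l , u) = elemsₖ-complete e card-e x q in subst (λ z → lookup (setOf w) z ≡ true) (trans (Vecₚ.lookup-map l φσ members) (trans (cong φσ u) h)) (setOf-complete w l))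
          distinct-w : ∀ b → distinct w ≡ b → b ≡ true
          distinct-w true  _ = refl
          distinct-w false d = contradiction (trans (sym (trans (cong Sub.∣_∣ setOf-w) card-Y)) refl) (λ e′ → ℕₚ.<-irrefl (sym e′) (card-repeat w d))
          same : proj₁ cx ≡ proj₁ cy
          same = distinct⇒injective w (trans refl (distinct-w (distinct w) refl)) (trans (Vecₚ.lookup-map (proj₁ cx) φσ members) (trans (trans (cong φσ (proj₂ cx)) (trans (φσ≡ x) (trans eq (sym (trans (cong φσ (proj₂ cy)) (φσ≡ y)))))) (sym (Vecₚ.lookup-map (proj₁ cy) φσ members))))
        τ-φ : ∀ x → lookup e x ≡ true → lookup τ (φ x) ≡ x
        τ-φ x p = trans (Vecₚ.lookup∘tabulate _ (φ x)) (go (member? (φ x)))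
          where
          go : ∀ D → member-of (φ x) D ≡ x
          go (yes (y , q , h)) = φ-inj-on q p h
          go (no none)         = contradiction (x , p , refl) none
        lookup-pick : ∀ {m} (g : Vec (Vec (Fin (suc r)) f) m) (τ : Vec (Fin f) m) i → lookup (pick g τ) i ≡ lookup (lookup g i) (lookup τ i)
        lookup-pick g τ i = Vecₚ.lookup-zipWith lookup i g τ
        T : Vec (Fin m) k
        T = elemsₖ Y card-Y
        T̂ : Vec (Fin M) k
        T̂ = transversal σ ⟦ T ⟧
        T̂-inc : Increasing T̂
        T̂-inc = increasing-⟦⟧ {s = transversal σ} {T} (transversal-increasing σ) (elemsₖ-increasing Y card-Y)
        at-member : ∀ l x → lookup e x ≡ true → lookup T l ≡ φ x → lookup T̂ l ≡ φ* x
        at-member l x p eq = trans (lookup-⟦⟧ (transversal σ) T l) (trans (cong (lookup (transversal σ)) eq) (trans (Vecₚ.lookup∘tabulate _ (φ x)) (cong (combine (φ x)) (trans (lookup-pick g τ (φ x)) (cong (lookup (lookup g (φ x))) (τ-φ x p))))))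
        vertex : ∀ l → ∃[ x ] (lookup e x ≡ true × φ x ≡ lookup T l)
        vertex l = let (x , p , h) = image-sound φσ e (lookup T l) (elemsₖ-sound Y card-Y l) in x , p , trans (sym (φσ≡ x)) h
        T̂-vertex : ∀ l → lookup T̂ l ≡ φ* (proj₁ (vertex l))
        T̂-vertex l = at-member l (proj₁ (vertex l)) (proj₁ (proj₂ (vertex l))) (sym (proj₂ (proj₂ (vertex l))))
        locate : ∀ x → lookup e x ≡ true → ∃[ l ] lookup T̂ l ≡ φ* x
        locate x p = let (l , q) = elemsₖ-complete Y card-Y (φσ x) (image-complete φσ e x p) in l , at-member l x p (trans q (φσ≡ x))
        T̂-set : setOf T̂ ≡ image φ* e
        T̂-set = subset-ext
          (λ i p → let (l , q) = setOf-sound T̂ i p in subst (λ z → lookup (image φ* e) z ≡ true) (trans (sym (T̂-vertex l)) q) (image-complete φ* e (proj₁ (vertex l)) (proj₁ (proj₂ (vertex l)))))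
          (λ i p → let (x , q , h) = image-sound φ* e i p in let (l , u) = locate x q in subst (λ z → lookup (setOf T̂) z ≡ true) (trans u h) (setOf-complete T̂ l))
        T̂-inj : Injectiveᵛ T̂
        T̂-inj = increasing⇒injective {s = T̂} T̂-inc
        pre : ∀ l → preimage φ* (removeAt T̂ l) ≡ e ─ ⁅ proj₁ (vertex l) ⁆
        pre l = subset-ext to from
          where
          to : ∀ y → lookup (preimage φ* (removeAt T̂ l)) y ≡ true → lookup (e ─ ⁅ proj₁ (vertex l) ⁆) y ≡ true
          to y p = let (l′ , q) = does⇒ (covered? (removeAt T̂ l) (φ* y)) (trans (sym (Vecₚ.lookup∘tabulate _ y)) p) in
            let here-is = trans (sym (T̂-vertex (punchIn l l′))) (trans (sym (lookup-removeAt-punchIn T̂ l l′)) q) in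
            let y≡ = φ*-inj here-is in
            delete-complete e (proj₁ (vertex l)) y (subst (λ z → lookup e z ≡ true) y≡ (proj₁ (proj₂ (vertex (punchIn l l′)))))
              (λ eq → Finₚ.punchInᵢ≢i l l′ (T̂-inj (trans (T̂-vertex (punchIn l l′)) (trans (cong φ* (trans y≡ (sym eq))) (sym (T̂-vertex l))))))
          from : ∀ y → lookup (e ─ ⁅ proj₁ (vertex l) ⁆) y ≡ true → lookup (preimage φ* (removeAt T̂ l)) y ≡ true
          from y p = let (q , ne) = delete-sound e (proj₁ (vertex l)) y p in let (l′ , u) = locate y q in
            let l≢l′ = λ (eq : l ≡ l′) → ne (φ*-inj (trans (sym (T̂-vertex l)) (trans (cong (lookup T̂) eq) u))) in
            trans (Vecₚ.lookup∘tabulate _ y) (dec-true (covered? (removeAt T̂ l) (φ* y)) (punchOut l≢l′ , trans (Vecₚ.removeAt-punchOut T̂ l≢l′) u))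
        canon-on : ∀ l → canon Y t (lookup T l) ≡ t (lookup T l)
        canon-on l = cong (λ b → if b then t (lookup T l) else 0) (elemsₖ-sound Y card-Y l)
        labels : tabulate (λ l → ψ (preimage φ* (removeAt T̂ l))) ≡ Vec.map clamp (Vec.map (canon Y t) T)
        labels = vec-ext (λ l → trans (Vecₚ.lookup∘tabulate (λ l → ψ (preimage φ* (removeAt T̂ l))) l) (trans (cong ψ (pre l)) (trans (sym (ψσ≡ _)) (trans (cong clamp (trans (sym (t-ψ (proj₁ (vertex l)) (proj₁ (proj₂ (vertex l))))) (trans (cong t (trans (φσ≡ _) (proj₂ (proj₂ (vertex l))))) (sym (canon-on l)))))
          (sym (trans (Vecₚ.lookup-map l clamp (Vec.map (canon Y t) T)) (cong clamp (Vecₚ.lookup-map l (canon Y t) T))))))))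
        test-true : oracle T̂ (Vec.map clamp (Vec.map (canon Y t) T)) ≡ true
        test-true = trans (sym (edgeA-reduced N′ (test σ) Y card-Y (canon Y t))) t-edge

-- From samples back to the hypergraph

code : ∀ {M j} → Vec (Fin M) j → Fin (M ℕ.^ j)
code []      = zero
code (x ∷ s) = combine x (code s)

decode : ∀ {M} j → Fin (M ℕ.^ j) → Vec (Fin M) j
decode zero    _ = []
decode {M} (suc j) q = proj₁ (remQuot {M} (M ℕ.^ j) q) ∷ decode j (proj₂ (remQuot {M} (M ℕ.^ j) q))

decode-code : ∀ {M j} (s : Vec (Fin M) j) → decode j (code s) ≡ s
decode-code []      = refl
decode-code {M} {suc j} (x ∷ s) = cong₂ _∷_ (cong proj₁ (Finₚ.remQuot-combine {M} x (code s))) (trans (cong (decode j ∘ proj₂) (Finₚ.remQuot-combine {M} x (code s))) (decode-code s))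

code-decode : ∀ {M} j (q : Fin (M ℕ.^ j)) → code (decode {M} j q) ≡ q
code-decode zero zero = refl
code-decode {M} (suc j) q = trans (cong (combine (proj₁ (remQuot {M} (M ℕ.^ j) q))) (code-decode j (proj₂ (remQuot {M} (M ℕ.^ j) q)))) (Finₚ.combine-remQuot {M} (M ℕ.^ j) q)

slots : ∀ M j → Vec (Vec (Fin M) j) (M ℕ.^ j)
slots M j = tabulate (decode j)

slots-injective : ∀ M j → Injectiveᵛ (slots M j)
slots-injective M j {p} {q} e = trans (sym (code-decode j p)) (trans (cong code (trans (sym (Vecₚ.lookup∘tabulate (decode j) p)) (trans e (Vecₚ.lookup∘tabulate (decode j) q)))) (code-decode j q))

lookup-slots : ∀ {M j} (s : Vec (Fin M) j) → lookup (slots M j) (code s) ≡ s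
lookup-slots {M} {j} s = trans (Vecₚ.lookup∘tabulate (decode j) (code s)) (decode-code s)

removeAt-injective : ∀ {M q} (T : Vec (Fin M) (suc q)) → Injectiveᵛ T → ∀ {l l′} → removeAt T l ≡ removeAt T l′ → l ≡ l′
removeAt-injective T inj {l} {l′} e = go (l Finₚ.≟ l′)
  where
  go : Dec (l ≡ l′) → l ≡ l′
  go (yes p) = p
  go (no l≢l′) = contradiction (inj (trans (sym (lookup-removeAt-punchIn T l′ (punchOut (l≢l′ ∘ sym)))) (trans (cong (λ z → lookup z (punchOut (l≢l′ ∘ sym))) (sym e)) (lookup-removeAt-punchIn T l (punchOut (l≢l′ ∘ sym))))))
    λ eq → Finₚ.punchInᵢ≢i l (punchOut (l≢l′ ∘ sym)) (sym (trans (sym (Finₚ.punchIn-punchOut (l≢l′ ∘ sym))) eq))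

split-absolute : ∀ {x y e} → ¬ (e ≤ ∣ x - y ∣) → y - e ≤ x
split-absolute {x} {y} {e} ne = by-difference (lem x y e) (≤⇒0≤- (≤-trans (-x≤∣x∣ (x - y)) (<⇒≤ (≰⇒> ne))))
  where
  lem : ∀ x y e → x - (y - e) ≡ e - (- (x - y))
  lem = solve-∀ ℚ-ring

module Transfer (n′ i : ℕ) (EH : Subset (suc n′) → Bool) (M N′ : ℕ) {σ : ℚ} (0<σ : 0ℚ < σ) (enough : 1ℚ ≤ ℕ→ℚ (suc N′) * (σ * σ)) {ε : ℚ} (0<ε : 0ℚ < ε)
                {a b : ℕ} (A : Vec (Fin (suc n′)) a) (B : Vec (Fin (suc n′)) b) where

  open DenseGraph n′ i EH
  open LowCells A B
  open Gaps {M} A B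
  open Sampling N′ 0<σ enough

  private
    j : ℕ
    j = suc i

  Q : ℕ
  Q = M ℕ.^ j

  slotLaws : Vec V M → Vec (Dist (Top a)) Q
  slotLaws v = Vec.map (λ s → law s v) (slots M j)

  lookup-slotLaws : ∀ v s → lookup (slotLaws v) (code s) ≡ law s v
  lookup-slotLaws v s = trans (Vecₚ.lookup-map (code s) (λ s → law s v) (slots M j)) (cong (λ s → law s v) (lookup-slots s))

  samplesAt : Vec V M → Dist (Vec (Vec (Top a) N) Q)
  samplesAt v = families (slotLaws v)

  faceSlots : Vec (Fin M) k → Fin k → Fin Q
  faceSlots T l = code (removeAt T l)

  faceSlots-injective : ∀ T → Increasing T → ∀ {l l′} → faceSlots T l ≡ faceSlots T l′ → l ≡ l′
  faceSlots-injective T inc e = removeAt-injective T (increasing⇒injective {s = T} inc) (trans (sym (decode-code _)) (trans (cong (decode j) e) (decode-code _)))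

  faceLaws : Vec (Fin M) k → Vec V M → Dist (Vec (Top a) k)
  faceLaws T v = ΠD (tabulate (λ l → law (removeAt T l) v))

  -- Accepting only conditional edge probabilities of at least `ε` costs `ε` in density, but
  -- guarantees a factor `ε` for every edge when copies are counted.
  oracle : Vec V M → Vec (Vec (Top a) N) Q → Vec (Fin M) k → Vec (Fin N) k → Bool
  oracle v ζ T τ = does (ε ≤? hat A B (low A B (v ⟦ T ⟧)) (tabulate (λ l → lookup (lookup ζ (faceSlots T l)) (lookup τ l))))

  sampled : Vec V M → Vec (Vec (Top a) N) Q → Vec (Fin M) k → ℚ
  sampled v ζ T = 𝔼 (choices k) (λ τ → 𝟙 (oracle v ζ T τ))

  heavy : Vec V M → Vec (Fin M) k → Vec (Top a) k → ℚ
  heavy v T ps = 𝟙 (does (ε ≤? hat A B (low A B (v ⟦ T ⟧)) ps))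

  expected : Vec V M → Vec (Fin M) k → ℚ
  expected v T = 𝔼 (faceLaws T v) (heavy v T)

  -- The faces of an increasing `T` occupy different slots, so their families of samples are
  -- independent and `sampling` applies.
  concentration : ∀ v T → Increasing T → 𝔼 (samplesAt v) (λ ζ → ∣ sampled v ζ T - expected v T ∣) ≤ ℕ→ℚ k * σ
  concentration v T inc = begin
    𝔼 (samplesAt v) (λ ζ → ∣ sampled v ζ T - expected v T ∣)
      ≡⟨ 𝔼-cong (samplesAt v) (λ ζ → cong (λ z → ∣ z - expected v T ∣) (𝔼-cong (choices k) (λ τ → cong (heavy v T) (as-pick ζ τ)))) ⟩
    𝔼 (samplesAt v) (λ ζ → g (tabulate (λ l → lookup ζ (faceSlots T l))))
      ≡⟨ 𝔼-marginal fams (faceSlots T) (faceSlots-injective T inc) g ⟩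
    𝔼 (ΠD (tabulate (λ l → lookup fams (faceSlots T l)))) g
      ≡⟨ cong (λ ds → 𝔼 (ΠD ds) g) (vec-ext laws≡) ⟩
    𝔼 (families (tabulate (λ l → law (removeAt T l) v))) g
      ≤⟨ sampling (tabulate (λ l → law (removeAt T l) v)) (heavy v T) (λ ps → 𝟙-nonneg (does (ε ≤? hat A B (low A B (v ⟦ T ⟧)) ps))) (λ ps → 𝟙-≤1 (does (ε ≤? hat A B (low A B (v ⟦ T ⟧)) ps))) ⟩
    ℕ→ℚ k * σ ∎
    where
    open ≤-Reasoning
    fams : Vec (Dist (Vec (Top a) N)) Q
    fams = Vec.map (λ d → ΠD (replicate N d)) (slotLaws v)
    g : Vec (Vec (Top a) N) k → ℚ
    g Fs = ∣ 𝔼 (choices k) (λ τ → heavy v T (pick Fs τ)) - expected v T ∣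
    as-pick : ∀ ζ τ → tabulate (λ l → lookup (lookup ζ (faceSlots T l)) (lookup τ l)) ≡ pick (tabulate (λ l → lookup ζ (faceSlots T l))) τ
    as-pick ζ τ = vec-ext (λ l → trans (Vecₚ.lookup∘tabulate (λ l → lookup (lookup ζ (faceSlots T l)) (lookup τ l)) l) (sym (trans (Vecₚ.lookup-zipWith lookup l (tabulate (λ l → lookup ζ (faceSlots T l))) τ) (cong (λ F → lookup F (lookup τ l)) (Vecₚ.lookup∘tabulate (λ l → lookup ζ (faceSlots T l)) l)))))
    laws≡ : ∀ l → lookup (tabulate (λ l → lookup fams (faceSlots T l))) l ≡ lookup (Vec.map (λ d → ΠD (replicate N d)) (tabulate (λ l → law (removeAt T l) v))) l
    laws≡ l = trans (Vecₚ.lookup∘tabulate (λ l → lookup fams (faceSlots T l)) l) (trans (Vecₚ.lookup-map (faceSlots T l) (λ d → ΠD (replicate N d)) (slotLaws v)) (trans (cong (λ d → ΠD (replicate N d)) (lookup-slotLaws v (removeAt T l)))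
      (sym (trans (Vecₚ.lookup-map l (λ d → ΠD (replicate N d)) (tabulate (λ l → law (removeAt T l) v))) (cong (λ d → ΠD (replicate N d)) (Vecₚ.lookup∘tabulate (λ l → law (removeAt T l) v) l))))))

  𝔼-faces : ∀ v T → Increasing T → (G : Vec (Top a) k → ℚ) → 𝔼 (laws (slots M j) v) (λ ζ → G (tabulate (λ l → lookup ζ (faceSlots T l)))) ≡ 𝔼 (faceLaws T v) G
  𝔼-faces v T inc G = trans (𝔼-marginal (slotLaws v) (faceSlots T) (faceSlots-injective T inc) G) (cong (λ ds → 𝔼 (ΠD ds) G) (Vecₚ.tabulate-cong (λ l → lookup-slotLaws v (removeAt T l))))

  faces-real : ∀ v T → Increasing T → tabulate (λ l → lookup (reals (slots M j) v) (faceSlots T l)) ≡ faces A (v ⟦ T ⟧)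
  faces-real v T inc = Vecₚ.tabulate-cong (λ l → trans (Vecₚ.lookup-map (faceSlots T l) (λ s → real s v) (slots M j)) (trans (cong (λ s → real s v) (lookup-slots (removeAt T l)))
    (trans (real-increasing {removeAt T l} v (increasing-removeAt {s = T} inc l)) (cong (full A) (sym (removeAt-map (lookup v) T l))))))

  -- The mean edge probability once the tops of the faces are drawn independently given lower
  -- information, to be compared with the true conditional density `D`.
  predicted : Vec V k → ℚ
  predicted x = 𝔼 (ΠD (tabulate (λ l → lawOf (removeAt x l)))) (hat A B (low A B x))
    where
    lawOf : Vec V j → Dist (Top a)
    lawOf z = lawAt (low A B z) (0ℚ <? Conditional.mass (U j) (lowObs j A B) (low A B z))

  predicted-faces : ∀ v T → Increasing T → 𝔼 (faceLaws T v) (hat A B (low A B (v ⟦ T ⟧))) ≡ predicted (v ⟦ T ⟧)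
  predicted-faces v T inc = cong (λ ds → 𝔼 (ΠD ds) (hat A B (low A B (v ⟦ T ⟧)))) (Vecₚ.tabulate-cong (λ l → trans (law-increasing (removeAt T l) v (increasing-removeAt {s = T} inc l))
    (cong (λ z → lawAt (low A B z) (0ℚ <? Conditional.mass (U j) (lowObs j A B) (low A B z))) (sym (removeAt-map (lookup v) T l)))))

  predicted-measurable : ∀ {x y : Vec V k} → low A B x ≡ low A B y → predicted x ≡ predicted y
  predicted-measurable {x} {y} e = cong₂ (λ ds ℓ → 𝔼 (ΠD ds) (hat A B ℓ)) (Vecₚ.tabulate-cong (λ l → cong (λ ℓ → lawAt ℓ (0ℚ <? Conditional.mass (U j) (lowObs j A B) ℓ)) (low-removeAt l))) e
    where
    grow : Fin k → Fin j ⊎ (Fin a ⊎ Fin b) → Fin k ⊎ (Fin a ⊎ Fin b)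
    grow l (inj₁ p) = inj₁ (punchIn l p)
    grow l (inj₂ e) = inj₂ e
    ok : ∀ x l s → assign x (env A B) (grow l s) ≡ assign (removeAt x l) (env A B) s
    ok x l (inj₁ p) = sym (lookup-removeAt-punchIn x l p)
    ok x l (inj₂ e) = refl
    low-removeAt : ∀ l → low A B (removeAt x l) ≡ low A B (removeAt y l)
    low-removeAt l = low-complete {A = A} {B} {removeAt x l} {removeAt y l} (transfer₂ {y₂ = assign x (env A B)} {assign y (env A B)} IsEnv IsEnv (grow l) (λ { (inj₂ _) _ → tt }) (ok x l) (ok y l) (low-sound {A = A} {B} {x} {y} e))

  off : Vec V k → Bool
  off x = does (predicted x <? D x - ε)

  -- `off` is a function of lower information. On this event the conditional edge probability
  -- averages to `D` with the real tops, by the tower property, and to `predicted` with resampled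
  -- tops. The averages differ by at most `ℕ→ℚ Q * gap₂` by `slots-hybrid`, while every point of the
  -- event contributes at least `ε`.
  off-rare : ∀ T → Increasing T → ε * 𝔼 (U M) (λ v → 𝟙 (off (v ⟦ T ⟧))) ≤ ℕ→ℚ Q * gap₂
  off-rare T inc = begin
    ε * 𝔼 (U M) (λ v → 𝟙 (off (v ⟦ T ⟧)))
      ≡⟨ trans (cong (ε *_) (U-⟦⟧ T T-inj (𝟙 ∘ off))) (sym (𝔼-* (U k) ε (𝟙 ∘ off))) ⟩
    𝔼 (U k) (λ x → ε * 𝟙 (off x))
      ≤⟨ 𝔼-mono (U k) (λ x → pointwise x (predicted x <? D x - ε)) ⟩
    𝔼 (U k) (λ x → D x * 𝟙 (off x) - 𝟙 (off x) * predicted x)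
      ≡⟨ 𝔼-- (U k) _ _ ⟩
    𝔼 (U k) (λ x → D x * 𝟙 (off x)) - 𝔼 (U k) (λ x → 𝟙 (off x) * predicted x)
      ≡⟨ cong₂ _-_ tower (sym (U-⟦⟧ T T-inj (λ x → 𝟙 (off x) * predicted x))) ⟩
    𝔼 (U M) (λ v → 𝟙 (off (v ⟦ T ⟧)) * h A B (v ⟦ T ⟧)) - 𝔼 (U M) (λ v → 𝟙 (off (v ⟦ T ⟧)) * predicted (v ⟦ T ⟧))
      ≡⟨ cong₂ _-_ (𝔼-cong (U M) (λ v → cong (λ ps → 𝟙 (off (v ⟦ T ⟧)) * hat A B (low A B (v ⟦ T ⟧)) ps) (sym (faces-real v T inc))))
           (𝔼-cong (U M) (λ v → sym (trans (𝔼-* (laws (slots M j) v) (𝟙 (off (v ⟦ T ⟧))) _) (cong (𝟙 (off (v ⟦ T ⟧)) *_) (trans (𝔼-faces v T inc (hat A B (low A B (v ⟦ T ⟧)))) (predicted-faces v T inc)))))) ⟩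
    𝔼 (U M) (λ v → Ψ v (reals (slots M j) v)) - 𝔼 (U M) (λ v → 𝔼 (laws (slots M j) v) (Ψ v))
      ≤⟨ ≤-trans (≤-reflexive (neg-sub (𝔼 (U M) (λ v → Ψ v (reals (slots M j) v))) (𝔼 (U M) (λ v → 𝔼 (laws (slots M j) v) (Ψ v))))) (-x≤∣x∣ _) ⟩
    ∣ 𝔼 (U M) (λ v → 𝔼 (laws (slots M j) v) (Ψ v)) - 𝔼 (U M) (λ v → Ψ v (reals (slots M j) v)) ∣
      ≤⟨ slots-hybrid (slots M j) (slots-injective M j) Ψ (λ v ζ → *-nonneg (𝟙-nonneg (off (v ⟦ T ⟧))) (hat-nonneg A B _ _)) (λ v ζ → *-≤1 (𝟙-nonneg (off (v ⟦ T ⟧))) (𝟙-≤1 (off (v ⟦ T ⟧))) (hat-≤1 A B _ _)) Ψ-inv ⟩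
    ℕ→ℚ Q * gap₂ ∎
    where
    open ≤-Reasoning
    T-inj : Injectiveᵛ T
    T-inj = increasing⇒injective {s = T} inc
    neg-sub : ∀ x y → x - y ≡ - (y - x)
    neg-sub = solve-∀ ℚ-ring
    Ψ : Vec V M → Vec (Top a) Q → ℚ
    Ψ v ζ = 𝟙 (off (v ⟦ T ⟧)) * hat A B (low A B (v ⟦ T ⟧)) (tabulate (λ l → lookup ζ (faceSlots T l)))
    off-measurable : ∀ {x y : Vec V k} → low A B x ≡ low A B y → 𝟙 (off x) ≡ 𝟙 (off y)
    off-measurable {x} {y} e = cong₂ (λ p q → 𝟙 (does (p <? q - ε))) (predicted-measurable {x} {y} e) (L.CE-measurable edge {x} {y} e)
    Ψ-inv : ∀ l → Increasing (lookup (slots M j) l) → ∀ {v v′} → Rel₂ A B (lookup (slots M j) l) v v′ → ∀ ζ → Ψ v ζ ≡ Ψ v′ ζ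
    Ψ-inv l _ {v} {v′} rel ζ = cong₂ _*_ (off-measurable {v ⟦ T ⟧} {v′ ⟦ T ⟧} e) (cong (λ ℓ → hat A B ℓ (tabulate (λ l → lookup ζ (faceSlots T l)))) e)
      where
      e : low A B (v ⟦ T ⟧) ≡ low A B (v′ ⟦ T ⟧)
      e = low-invariant A B T (lookup (slots M j) l) {v} {v′} rel
    tower : 𝔼 (U k) (λ x → D x * 𝟙 (off x)) ≡ 𝔼 (U M) (λ v → 𝟙 (off (v ⟦ T ⟧)) * h A B (v ⟦ T ⟧))
    tower = trans (L.CE-projection edge (𝟙 ∘ off) (λ {x} {y} → off-measurable {x} {y})) (trans (sym (Conditional.CE-projection (U k) (cellObs A B) edge (𝟙 ∘ off) (λ {x} {y} e → off-measurable {x} {y} (cong proj₁ e))))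
      (trans (𝔼-cong (U k) (λ x → *-comm (h A B x) (𝟙 (off x)))) (sym (U-⟦⟧ T T-inj (λ x → 𝟙 (off x) * h A B x)))))
    pointwise : ∀ x (Δ : Dec (predicted x < D x - ε)) → ε * 𝟙 (does Δ) ≤ D x * 𝟙 (does Δ) - 𝟙 (does Δ) * predicted x
    pointwise x (yes lt) = by-difference (lem ε (D x) (predicted x)) (≤⇒0≤- (<⇒≤ lt))
      where
      lem : ∀ e d p → (d * 1ℚ - 1ℚ * p) - e * 1ℚ ≡ (d - e) - p
      lem = solve-∀ ℚ-ring
    pointwise x (no _) = ≤-reflexive (lem ε (D x) (predicted x))
      where
      lem : ∀ e d p → e * 0ℚ ≡ d * 0ℚ - 0ℚ * p
      lem = solve-∀ ℚ-ring

  fluctuates : Vec V M → Vec (Vec (Top a) N) Q → Vec (Fin M) k → Bool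
  fluctuates v ζ T = does (ε ≤? ∣ sampled v ζ T - expected v T ∣)

  fluctuates-rare : ∀ v T → Increasing T → ε * 𝔼 (samplesAt v) (λ ζ → 𝟙 (fluctuates v ζ T)) ≤ ℕ→ℚ k * σ
  fluctuates-rare v T inc = ≤-trans (markov (samplesAt v) (λ ζ → ∣ sampled v ζ T - expected v T ∣) ε (λ ζ → 0≤∣p∣ (sampled v ζ T - expected v T)) (<⇒≤ 0<ε)) (concentration v T inc)

  -- Four losses of `ε`: in the goodness of the tuple, in resampling the tops, in the threshold of
  -- the oracle, and in sampling finitely many tops.
  sampled-large : ∀ {d} v ζ T → Increasing T → d - ε ≤ D (v ⟦ T ⟧) → off (v ⟦ T ⟧) ≡ false → fluctuates v ζ T ≡ false → d - (ε + ε + ε + ε) ≤ sampled v ζ T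
  sampled-large {d} v ζ T inc good on calm = begin
    d - (ε + ε + ε + ε)
      ≡⟨ lem d ε ⟩
    (((d - ε) - ε) - ε) - ε
      ≤⟨ +-monoˡ-≤ (- ε) (+-monoˡ-≤ (- ε) (≤-trans (+-monoˡ-≤ (- ε) good) (≮⇒≥ (¬does (predicted (v ⟦ T ⟧) <? D (v ⟦ T ⟧) - ε) on)))) ⟩
    (predicted (v ⟦ T ⟧) - ε) - ε
      ≤⟨ +-monoˡ-≤ (- ε) heavy-part ⟩
    expected v T - ε
      ≤⟨ split-absolute {sampled v ζ T} (¬does (ε ≤? ∣ sampled v ζ T - expected v T ∣) calm) ⟩
    sampled v ζ T ∎
    where
    open ≤-Reasoning
    lem : ∀ d e → d - (e + e + e + e) ≡ (((d - e) - e) - e) - e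
    lem = solve-∀ ℚ-ring
    ¬does : ∀ {P : Set} (p : Dec P) → does p ≡ false → ¬ P
    ¬does (no ¬p) _ = ¬p
    split : ∀ {x} → x ≤ 1ℚ → (Δ : Dec (ε ≤ x)) → x - ε ≤ 𝟙 (does Δ)
    split {x} x≤1 (yes _) = ≤-trans (by-difference (lem′ x ε) (<⇒≤ 0<ε)) x≤1
      where
      lem′ : ∀ x e → x - (x - e) ≡ e
      lem′ = solve-∀ ℚ-ring
    split {x} x≤1 (no ne) = by-difference (lem′ x ε) (≤⇒0≤- (<⇒≤ (≰⇒> ne)))
      where
      lem′ : ∀ x e → 0ℚ - (x - e) ≡ e - x
      lem′ = solve-∀ ℚ-ring
    heavy-part : predicted (v ⟦ T ⟧) - ε ≤ expected v T
    heavy-part = subst (_≤ expected v T) (trans (𝔼-- (faceLaws T v) _ _) (cong₂ _-_ (predicted-faces v T inc) (𝔼-const (faceLaws T v) ε))) (𝔼-mono (faceLaws T v) (λ ps → split (hat-≤1 A B (low A B (v ⟦ T ⟧)) ps) (ε ≤? hat A B (low A B (v ⟦ T ⟧)) ps)))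

  hats : List (Vec (Fin M) k) → Vec V M → Vec (Top a) Q → ℚ
  hats Ts v ζ = ∏ Ts (λ T → hat A B (low A B (v ⟦ T ⟧)) (tabulate (λ l → lookup ζ (faceSlots T l))))

  -- The two hybrid arguments: sampled tops may be replaced by the real ones, and then conditional densities by edges.
  counting : ∀ Ts → All Increasing Ts → AllPairs _≢_ Ts → (α : Vec (Fin N) Q) →
    𝔼 (U M) (λ v → 𝔼 (samplesAt v) (λ ζ → hats Ts v (pick ζ α))) - (ℕ→ℚ Q * gap₂ + ℕ→ℚ (length Ts) * gap₁) ≤ 𝔼 (U M) (λ v → ∏ Ts (λ T → edge (v ⟦ T ⟧)))
  counting Ts incs distinctTs α = by-difference (lem X Y Z (ℕ→ℚ Q * gap₂) (ℕ→ℚ (length Ts) * gap₁)) (+-nonneg (≤⇒0≤- (≤-trans (x≤∣x∣ (X - Y)) slot-bound)) (≤⇒0≤- (≤-trans (-x≤∣x∣ (Z - Y)) edge-bound)))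
    where
    X = 𝔼 (U M) (λ v → 𝔼 (samplesAt v) (λ ζ → hats Ts v (pick ζ α)))
    Y = 𝔼 (U M) (λ v → ∏ Ts (λ T → h A B (v ⟦ T ⟧)))
    Z = 𝔼 (U M) (λ v → ∏ Ts (λ T → edge (v ⟦ T ⟧)))
    lem : ∀ x y z p q → z - (x - (p + q)) ≡ (p - (x - y)) + (q - (- (z - y)))
    lem = solve-∀ ℚ-ring
    hats-inv : ∀ Ts {r} (s : Vec (Fin M) r) {v v′} → Same₂ (Outside s) (assign v (env A B)) (assign v′ (env A B)) → ∀ ζ → hats Ts v ζ ≡ hats Ts v′ ζ
    hats-inv Ts s {v} {v′} same ζ = ∏-cong-∈ Ts (λ {T} _ → cong (λ ℓ → hat A B ℓ (tabulate (λ l → lookup ζ (faceSlots T l)))) (low-invariant A B T s {v} {v′} same))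
    slot-bound : ∣ X - Y ∣ ≤ ℕ→ℚ Q * gap₂
    slot-bound = subst₂ (λ p q → ∣ p - q ∣ ≤ ℕ→ℚ Q * gap₂) (𝔼-cong (U M) (λ v → sym (pick-one (slotLaws v) α (hats Ts v)))) (𝔼-cong (U M) (λ v → ∏-cong-∈ Ts (λ {T} T∈ → cong (hat A B (low A B (v ⟦ T ⟧))) (faces-real v T (All.lookup incs T∈)))))
      (slots-hybrid (slots M j) (slots-injective M j) (hats Ts) (λ v ζ → ∏-nonneg Ts (λ T → hat-nonneg A B _ _)) (λ v ζ → ∏-≤1 Ts (λ T → hat-nonneg A B _ _) (λ T → hat-≤1 A B _ _)) (λ l _ {v} {v′} rel ζ → hats-inv Ts (lookup (slots M j) l) {v} {v′} rel ζ))
    edge-bound : ∣ Z - Y ∣ ≤ ℕ→ℚ (length Ts) * gap₁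
    edge-bound = subst₂ (λ p q → ∣ p - q ∣ ≤ ℕ→ℚ (length Ts) * gap₁) (𝔼-cong (U M) (λ v → *-identityˡ (∏ Ts (λ T → edge (v ⟦ T ⟧))))) (𝔼-cong (U M) (λ v → *-identityˡ (∏ Ts (λ T → h A B (v ⟦ T ⟧)))))
      (edges-hybrid Ts incs distinctTs (λ _ → 1ℚ) (λ _ → 0≤1) (λ _ → ≤-refl) (λ _ _ → refl))

-- Counting copies of one fixed pattern

∏-mono-∈ : ∀ {X : Set} (xs : List X) {f g : X → ℚ} → (∀ x → 0ℚ ≤ f x) → (∀ x → 0ℚ ≤ g x) → (∀ {x} → x ∈ xs → f x ≤ g x) → ∏ xs f ≤ ∏ xs g
∏-mono-∈ []       nf ng le = ≤-refl
∏-mono-∈ (x ∷ xs) nf ng le = *-mono (nf x) (∏-nonneg xs ng) (le (here refl)) (∏-mono-∈ xs nf ng (le ∘ there))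

∏-filter : ∀ {X : Set} {P : X → Set} (P? : ∀ x → Dec (P x)) xs {c} → 0ℚ ≤ c → c ≤ 1ℚ → ∏ xs (λ _ → c) ≤ ∏ (List.filter P? xs) (λ _ → c)
∏-filter P? []       0≤c c≤1 = ≤-refl
∏-filter P? (x ∷ xs) {c} 0≤c c≤1 with does (P? x)
... | true  = *-monoˡ c 0≤c (∏-filter P? xs 0≤c c≤1)
... | false = ≤-trans (*≤ʳ (∏-nonneg xs (λ _ → 0≤c)) c≤1) (∏-filter P? xs 0≤c c≤1)

∏-positive⇒All : ∀ {X : Set} (xs : List X) (b : X → Bool) → 0ℚ < ∏ xs (𝟙 ∘ b) → All (λ x → b x ≡ true) xs
∏-positive⇒All []       b pos = []
∏-positive⇒All (x ∷ xs) b pos = go (b x) refl pos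
  where
  go : ∀ c → b x ≡ c → 0ℚ < 𝟙 c * ∏ xs (𝟙 ∘ b) → All (λ x → b x ≡ true) (x ∷ xs)
  go true  e pos = e ∷ ∏-positive⇒All xs b (subst (0ℚ <_) (*-identityˡ (∏ xs (𝟙 ∘ b))) pos)
  go false e pos = contradiction (subst (0ℚ <_) (*-zeroˡ (∏ xs (𝟙 ∘ b))) pos) (<-irrefl refl)

allVecs-unique : ∀ {X : Set} {xs : List X} k → Unique xs → Unique (allVecs xs k)
allVecs-unique zero    u = [] ∷ []
allVecs-unique {xs = xs} (suc k) u = subst Unique (product≡ xs) (Uniqueₚ.cartesianProductWith⁺ _∷_ Vecₚ.∷-injective u (allVecs-unique k u))
  where
  product≡ : ∀ ys → List.cartesianProductWith _∷_ ys (allVecs xs k) ≡ List.concatMap (λ x → List.map (x ∷_) (allVecs xs k)) ys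
  product≡ []       = refl
  product≡ (y ∷ ys) = cong (List.map (y ∷_) (allVecs xs k) ++_) (product≡ ys)

∈-allVecs-Fin : ∀ {M q} (t : Vec (Fin M) q) → t ∈ allVecs (allFin M) q
∈-allVecs-Fin t = ∈-allVecs t (λ p → ∈ₚ.∈-allFin (lookup t p))

increasing-setOf : ∀ {M q} {s t : Vec (Fin M) q} → Increasing s → Increasing t → setOf s ≡ setOf t → s ≡ t
increasing-setOf {s = s} {t} inc inc′ e = go (Vecₚ.≡-dec Finₚ._≟_ s t)
  where
  go : Dec (s ≡ t) → s ≡ t
  go (yes p) = p
  go (no ne) = let (p , out) = increasing-uncovered {s = s} {t} inc inc′ ne in
    contradiction (setOf-sound s (lookup t p) (trans (cong (λ S → lookup S (lookup t p)) e) (setOf-complete t p))) out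

module Conclusion (i : ℕ) (F : Graph) {ε d : ℚ} (0<ε : 0ℚ < ε) (ε≤1 : ε ≤ 1ℚ) (m N′ : ℕ)
                  (hyp : ∀ (A : Reduced (suc (suc i)) m) → DenseR (d - (ε + ε + ε + ε)) A → Embeds F A)
                  {σ : ℚ} (0<σ : 0ℚ < σ) (enough : 1ℚ ≤ ℕ→ℚ (suc N′) * (σ * σ)) {ρ : ℚ} (0<ρ : 0ℚ < ρ) where

  module IE = InjectiveEmbedding (suc i) F m N′ {d - (ε + ε + ε + ε)} hyp {ρ * half} (half-pos 0<ρ)
  open IE using (M; f; N; transversals; transversal; transversal-increasing; clamp; clamp-toℕ)

  private
    k : ℕ
    k = suc (suc i)

  Q : ℕ
  Q = M ℕ.^ suc i

  EdgeTuple : Vec (Fin M) f → Vec (Fin M) k → Set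
  EdgeTuple φ T = Increasing T × Any (λ e → IsEdge k F e × setOf T ≡ image (lookup φ) e) (allSubsets f)

  edgeTuple? : ∀ φ T → Dec (EdgeTuple φ T)
  edgeTuple? φ T = increasing? T ×-dec Any.any? (λ e → (edgeB k F e Boolₚ.≟ true) ×-dec Vecₚ.≡-dec Boolₚ._≟_ (setOf T) (image (lookup φ) e)) (allSubsets f)

  tuplesₖ : List (Vec (Fin M) k)
  tuplesₖ = allVecs (allFin M) k

  edgeTuples : Vec (Fin M) f → List (Vec (Fin M) k)
  edgeTuples φ = List.filter (edgeTuple? φ) tuplesₖ

  -- The images of the vertices of `F` and, for every slot, the number of the sample used there.
  Code : Set
  Code = Vec (Fin M) f × Vec (Fin N) Q

  codes : List Code
  codes = List.cartesianProduct (allVecs (allFin M) f) (allVecs (allFin N) Q)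

  labels : Vec (Fin N) Q → Vec (Fin M) k → Vec (Fin N) k
  labels α T = tabulate (λ l → lookup α (code (removeAt T l)))

  -- The part of a realisation that does not involve the oracle: if a code is realised by a single
  -- outcome, its `φ` is faithful for good.
  Faithful : Vec (Fin M) f → Set
  Faithful φ = (∀ x y → lookup φ x ≡ lookup φ y → x ≡ y) × All (λ e → IsEdge k F e → Any (λ T → setOf T ≡ image (lookup φ) e) (edgeTuples φ)) (allSubsets f)

  Accepted : (Vec (Fin M) k → Vec (Fin N) k → Bool) → Code → Set
  Accepted oracle (φ , α) = All (λ T → oracle T (labels α T) ≡ true) (edgeTuples φ)

  Realises : (Vec (Fin M) k → Vec (Fin N) k → Bool) → Code → Set
  Realises oracle c = Faithful (proj₁ c) × Accepted oracle c

  realises? : ∀ oracle c → Dec (Realises oracle c)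
  realises? oracle (φ , α) =
    (Finₚ.all? (λ x → Finₚ.all? (λ y → (lookup φ x Finₚ.≟ lookup φ y) →-dec (x Finₚ.≟ y)))
      ×-dec All.all? (λ e → (edgeB k F e Boolₚ.≟ true) →-dec Any.any? (λ T → Vecₚ.≡-dec Boolₚ._≟_ (setOf T) (image (lookup φ) e)) (edgeTuples φ)) (allSubsets f))
    ×-dec All.all? (λ T → oracle T (labels α T) Boolₚ.≟ true) (edgeTuples φ)

  pattern-realised : ∀ oracle → Pattern F oracle → ∃[ c ] (c ∈ codes × Realises oracle c)
  pattern-realised oracle P = (φ , α) , ∈ₚ.∈-cartesianProduct⁺ (∈-allVecs-Fin φ) (∈-allVecs-Fin α) , (injective , All.tabulate (λ {e} _ isE → covers e isE)) , All.tabulate accepts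
    where
    open Pattern P
    φ : Vec (Fin M) f
    φ = tabulate φ*
    α : Vec (Fin N) Q
    α = tabulate (λ q → ψ* (preimage φ* (decode (suc i) q)))
    φ≡ : ∀ x → lookup φ x ≡ φ* x
    φ≡ = Vecₚ.lookup∘tabulate φ*
    injective : ∀ x y → lookup φ x ≡ lookup φ y → x ≡ y
    injective x y e = φ*-injective (trans (sym (φ≡ x)) (trans e (φ≡ y)))
    covers : ∀ e → IsEdge k F e → Any (λ T → setOf T ≡ image (lookup φ) e) (edgeTuples φ)
    covers e isE = let (T , inc , set , _) = edges e isE in let set′ = trans set (sym (image-cong φ≡ e)) in
      lose (∈ₚ.∈-filter⁺ (edgeTuple? φ) (∈-allVecs-Fin T) (inc , lose (∈-allSubsets e) (isE , set′))) set′
    labels≡ : ∀ T → labels α T ≡ tabulate (λ l → ψ* (preimage φ* (removeAt T l)))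
    labels≡ T = Vecₚ.tabulate-cong (λ l → trans (Vecₚ.lookup∘tabulate (λ q → ψ* (preimage φ* (decode (suc i) q))) (code (removeAt T l))) (cong (ψ* ∘ preimage φ*) (decode-code (removeAt T l))))
    accepts : ∀ {T} → T ∈ edgeTuples φ → oracle T (labels α T) ≡ true
    accepts {T} T∈ = let (inc , any) = proj₂ (∈ₚ.∈-filter⁻ (edgeTuple? φ) {xs = tuplesₖ} T∈) in let (e , _ , isE , set) = Membership.find any in let (T′ , inc′ , set′ , ok) = edges e isE in
      let T≡ = increasing-setOf {s = T} {T′} inc inc′ (trans set (trans (image-cong φ≡ e) (sym set′))) in
      trans (cong (oracle T) (labels≡ T)) (subst (λ T → oracle T (tabulate (λ l → ψ* (preimage φ* (removeAt T l)))) ≡ true) (sym T≡) ok)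

  -- Taken over all k-tuples, it is a lower bound for the product over the edge tuples of any `φ`,
  -- so it can be fixed before the pattern is known.
  weight : ℚ
  weight = ∏ tuplesₖ (λ _ → ε)

  frequency : ℚ
  frequency = (ρ * half) * inv (ℕ→ℚ (suc (length codes)))

  frequency-pos : 0ℚ < frequency
  frequency-pos = *-pos (half-pos 0<ρ) (inv-pos (ℕ→ℚ-pos (length codes)))

  weight-pos : 0ℚ < weight
  weight-pos = go tuplesₖ
    where
    go : ∀ (Ts : List (Vec (Fin M) k)) → 0ℚ < ∏ Ts (λ _ → ε)
    go []       = 0<1
    go (_ ∷ Ts) = *-pos 0<ε (go Ts)

  module _ (n′ : ℕ) (EH : Subset (suc n′) → Bool) where

    open DenseGraph n′ i EH hiding (k)

    copy : ∀ φ → Faithful φ → (v : Vec V M) → distinct v ≡ true → All (λ T → Hv (v ⟦ T ⟧) ≡ true) (edgeTuples φ) → Contains k H F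
    copy φ (φ-inj , covers) v dv real = (λ x → lookup v (lookup φ x)) , (λ x y e → φ-inj x y (distinct⇒injective v dv e)) , edges
      where
      edges : ∀ e → IsEdge k F e → IsEdge k H (image (λ x → lookup v (lookup φ x)) e)
      edges e isE = let (T , T∈ , set) = Membership.find (All.lookup covers (∈-allSubsets e) isE) in
        subst (λ S → edgeB k H S ≡ true) (image≡ T set) (trans (sym (Hv-edgeB (v ⟦ T ⟧))) (All.lookup real T∈))
        where
        image≡ : ∀ T → setOf T ≡ image (lookup φ) e → setOf (v ⟦ T ⟧) ≡ image (λ x → lookup v (lookup φ x)) e
        image≡ T set = subset-ext to from
          where
          to : ∀ y → lookup (setOf (v ⟦ T ⟧)) y ≡ true → lookup (image (λ x → lookup v (lookup φ x)) e) y ≡ true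
          to y p = let (l , q) = setOf-sound (v ⟦ T ⟧) y p in
            let (x , x∈ , h) = image-sound (lookup φ) e (lookup T l) (trans (cong (λ S → lookup S (lookup T l)) (sym set)) (setOf-complete T l)) in
            subst (λ z → lookup (image (λ x → lookup v (lookup φ x)) e) z ≡ true) (trans (cong (lookup v) h) (trans (sym (lookup-⟦⟧ v T l)) q)) (image-complete (λ x → lookup v (lookup φ x)) e x x∈)
          from : ∀ y → lookup (image (λ x → lookup v (lookup φ x)) e) y ≡ true → lookup (setOf (v ⟦ T ⟧)) y ≡ true
          from y p = let (x , x∈ , h) = image-sound (λ x → lookup v (lookup φ x)) e y p in
            let (l , q) = setOf-sound T (lookup φ x) (trans (cong (λ S → lookup S (lookup φ x)) set) (image-complete (lookup φ) e x x∈)) in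
            subst (λ z → lookup (setOf (v ⟦ T ⟧)) z ≡ true) (trans (lookup-⟦⟧ v T l) (trans (cong (lookup v) q) h)) (setOf-complete (v ⟦ T ⟧) l)

    -- Tuples with a repeated vertex have probability at most M²/n. What exceeds this bound comes
    -- from a distinct tuple at which all factors are 1.
    copy-exists : ∀ φ → Faithful φ → ℕ→ℚ (M ℕ.* M) * inv (ℕ→ℚ (suc n′)) < 𝔼 (U M) (λ v → ∏ (edgeTuples φ) (λ T → edge (v ⟦ T ⟧))) → Contains k H F
    copy-exists φ faithful lt = go (𝔼-positive⇒∃ (U M) (λ v → P v - R v) (subst (0ℚ <_) (sym (𝔼-- (U M) P R)) (<⇒0<- (≤-<-trans (Vertices.repeats-rare n′ M) lt))))
      where
      P R : Vec V M → ℚ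
      P v = ∏ (edgeTuples φ) (λ T → edge (v ⟦ T ⟧))
      R v = 𝟙 (not (distinct v))
      go : (∃[ v ] 0ℚ < P v - R v) → Contains k H F
      go (v , pos) = split (distinct v) refl pos
        where
        split : ∀ b → distinct v ≡ b → 0ℚ < P v - 𝟙 (not b) → Contains k H F
        split true  e pos = copy φ faithful v e (∏-positive⇒All (edgeTuples φ) (λ T → Hv (v ⟦ T ⟧)) (subst (0ℚ <_) (+-identityʳ (P v)) pos))
        split false e pos = contradiction (<-≤-trans (0<-⇒< pos) (∏-≤1 (edgeTuples φ) (λ T → 𝟙-nonneg (Hv (v ⟦ T ⟧))) (λ T → 𝟙-≤1 (Hv (v ⟦ T ⟧))))) (<-irrefl refl)

    module _ {a b : ℕ} (A : Vec V a) (B : Vec V b) where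

      open LowCells A B using (D)
      open Gaps {M} A B using (gap₁; gap₂; gap₂-nonneg)
      open Transfer n′ i EH M N′ 0<σ enough 0<ε A B hiding (Q)
      open Sampling N′ 0<σ enough using (choices; denseR-reduced)

      Outcome : Set
      Outcome = Vec V M × Vec (Vec (Top a) N) Q

      outcomes : Dist Outcome
      outcomes = bindD (U M) (λ v → mapD (v ,_) (samplesAt v))

      𝔼-outcomes : ∀ (g : Outcome → ℚ) → 𝔼 outcomes g ≡ 𝔼 (U M) (λ v → 𝔼 (samplesAt v) (λ ζ → g (v , ζ)))
      𝔼-outcomes g = trans (𝔼-bind (U M) (λ v → mapD (v ,_) (samplesAt v)) g) (𝔼-cong (U M) (λ v → 𝔼-map (v ,_) (samplesAt v) g))

      𝔼-outcomes-proj₁ : ∀ (g : Vec V M → ℚ) → 𝔼 outcomes (g ∘ proj₁) ≡ 𝔼 (U M) g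
      𝔼-outcomes-proj₁ g = trans (𝔼-outcomes (g ∘ proj₁)) (𝔼-cong (U M) (λ v → 𝔼-const (samplesAt v) (g v)))

      oracleAt : Outcome → Vec (Fin M) k → Vec (Fin N) k → Bool
      oracleAt (v , ζ) = oracle v ζ

      dense? : ∀ ω τ → Dec (DenseR (d - (ε + ε + ε + ε)) (IE.graph (oracleAt ω) τ))
      dense? ω τ = IE.dense? (oracleAt ω) τ

      module _ {g : ℚ} (good : Vec V m → Bool) (good-sound : ∀ v → good v ≡ true → ∀ T → Increasing T → d - ε ≤ D (v ⟦ T ⟧))
               (often : g ≤ 𝔼 (U m) (𝟙 ∘ good)) (small : ℕ→ℚ (length (allVecs (allFin m) k)) * (ℕ→ℚ Q * gap₂ + ℕ→ℚ k * σ) ≤ ε * (g - ρ)) where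

        -- Restricted to a fixed transversal, `v` is a uniform m-tuple and hence good with
        -- probability at least `g`. For a good tuple, density can fail only if some increasing `T`
        -- is off or fluctuates; a union bound with `off-rare` and `fluctuates-rare` limits that to
        -- `g - ρ`.
        dense-often : ∀ τ → ρ ≤ 𝔼 outcomes (λ ω → 𝟙 (does (dense? ω τ)))
        dense-often τ = *-cancelˡ ε 0<ε (by-difference (re ε g ρ P) (≤⇒0≤- (≤-trans chain (+-monoʳ-≤ (ε * P) small))))
          where
          ι : Vec (Fin M) m
          ι = transversal τ
          ι-inc : Increasing ι
          ι-inc = transversal-increasing τ
          tuplesₘ : List (Vec (Fin m) k)
          tuplesₘ = allVecs (allFin m) k
          P : ℚ
          P = 𝔼 outcomes (λ ω → 𝟙 (does (dense? ω τ)))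
          re : ∀ e g r p → e * p - e * r ≡ (e * p + e * (g - r)) - e * g
          re = solve-∀ ℚ-ring
          off₀ fl₀ : Vec (Fin m) k → Outcome → Bool
          off₀ T ω = off (proj₁ ω ⟦ ι ⟦ T ⟧ ⟧)
          fl₀ T ω = fluctuates (proj₁ ω) (proj₂ ω) (ι ⟦ T ⟧)
          bad : Vec (Fin m) k → Outcome → ℚ
          bad T ω = 𝟙 (does (increasing? T)) * (𝟙 (off₀ T ω) + 𝟙 (fl₀ T ω))
          bad-nonneg : ∀ ω T → 0ℚ ≤ bad T ω
          bad-nonneg ω T = *-nonneg (𝟙-nonneg (does (increasing? T))) (+-nonneg (𝟙-nonneg (off₀ T ω)) (𝟙-nonneg (fl₀ T ω)))
          test≡ : ∀ ω T s → 𝟙 (IE.test (oracleAt ω) τ T (Vec.map toℕ s)) ≡ 𝟙 (oracleAt ω (ι ⟦ T ⟧) s)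
          test≡ ω T s = cong (λ s → 𝟙 (oracleAt ω (ι ⟦ T ⟧) s)) (trans (sym (Vecₚ.map-∘ clamp toℕ s)) (trans (Vecₚ.map-cong clamp-toℕ s) (Vecₚ.map-id s)))
          is-dense : ∀ ω → good (proj₁ ω ⟦ ι ⟧) ≡ true → ¬ Any (λ T → Increasing T × (off₀ T ω ≡ true ⊎ fl₀ T ω ≡ true)) tuplesₘ → DenseR (d - (ε + ε + ε + ε)) (IE.graph (oracleAt ω) τ)
          is-dense ω@(v , ζ) ok none = denseR-reduced (IE.test (oracleAt ω) τ) (λ T inc → subst (d - (ε + ε + ε + ε) ≤_) (sym (𝔼-cong (choices k) (test≡ ω T)))
            (sampled-large {d} v ζ (ι ⟦ T ⟧) (increasing-⟦⟧ {s = ι} {T} ι-inc inc) (subst (λ x → d - ε ≤ D x) (⟦⟧-assoc v ι T) (good-sound (v ⟦ ι ⟧) ok T inc))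
              (Boolₚ.¬-not (λ e → none (lose (∈-allVecs-Fin T) (inc , inj₁ e)))) (Boolₚ.¬-not (λ e → none (lose (∈-allVecs-Fin T) (inc , inj₂ e))))))
          cover : ∀ ω → 𝟙 (good (proj₁ ω ⟦ ι ⟧)) ≤ 𝟙 (does (dense? ω τ)) + ∑ tuplesₘ (λ T → bad T ω)
          cover ω = go (good (proj₁ ω ⟦ ι ⟧)) refl (dense? ω τ)
            where
            sum-nonneg : 0ℚ ≤ ∑ tuplesₘ (λ T → bad T ω)
            sum-nonneg = ∑-nonneg tuplesₘ (bad-nonneg ω)
            one≤ : ∀ a b → a ≡ true ⊎ b ≡ true → 1ℚ ≤ 1ℚ * (𝟙 a + 𝟙 b)
            one≤ true b _ = subst (1ℚ ≤_) (sym (*-identityˡ (1ℚ + 𝟙 b))) (x≤x+ (𝟙-nonneg b))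
            one≤ false true _ = ≤-refl
            one≤ false false (inj₁ ())
            one≤ false false (inj₂ ())
            go : ∀ c → good (proj₁ ω ⟦ ι ⟧) ≡ c → (Δ : Dec (DenseR (d - (ε + ε + ε + ε)) (IE.graph (oracleAt ω) τ))) → 𝟙 c ≤ 𝟙 (does Δ) + ∑ tuplesₘ (λ T → bad T ω)
            go false _ Δ       = +-nonneg (𝟙-nonneg (does Δ)) sum-nonneg
            go true  _ (yes _) = x≤x+ sum-nonneg
            go true  e (no ¬dense) = subst (1ℚ ≤_) (sym (+-identityˡ (∑ tuplesₘ (λ T → bad T ω)))) (locate (Any.any? (λ T → increasing? T ×-dec ((off₀ T ω Boolₚ.≟ true) ⊎-dec (fl₀ T ω Boolₚ.≟ true))) tuplesₘ))
              where
              locate : Dec (Any (λ T → Increasing T × (off₀ T ω ≡ true ⊎ fl₀ T ω ≡ true)) tuplesₘ) → 1ℚ ≤ ∑ tuplesₘ (λ T → bad T ω)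
              locate (no none) = contradiction (is-dense ω e none) ¬dense
              locate (yes any) = let (T , T∈ , inc , which) = Membership.find any in
                ≤-trans (subst (λ z → 1ℚ ≤ 𝟙 z * (𝟙 (off₀ T ω) + 𝟙 (fl₀ T ω))) (sym (dec-true (increasing? T) inc)) (one≤ (off₀ T ω) (fl₀ T ω) which)) (∑-member (bad-nonneg ω) T∈)
          slackₜ : ℚ
          slackₜ = ℕ→ℚ Q * gap₂ + ℕ→ℚ k * σ
          slackₜ-nonneg : 0ℚ ≤ slackₜ
          slackₜ-nonneg = +-nonneg (*-nonneg (ℕ→ℚ-nonneg Q) gap₂-nonneg) (*-nonneg (ℕ→ℚ-nonneg k) (<⇒≤ 0<σ))
          each : ∀ T (Δ : Dec (Increasing T)) → ε * 𝔼 outcomes (λ ω → 𝟙 (does Δ) * (𝟙 (off₀ T ω) + 𝟙 (fl₀ T ω))) ≤ slackₜ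
          each T (no _) = ≤-trans (≤-reflexive (trans (cong (ε *_) (trans (𝔼-cong outcomes (λ ω → *-zeroˡ (𝟙 (off₀ T ω) + 𝟙 (fl₀ T ω)))) (𝔼-const outcomes 0ℚ))) (*-zeroʳ ε))) slackₜ-nonneg
          each T (yes inc) = begin
            ε * 𝔼 outcomes (λ ω → 1ℚ * (𝟙 (off₀ T ω) + 𝟙 (fl₀ T ω)))
              ≡⟨ cong (ε *_) (trans (𝔼-cong outcomes (λ ω → *-identityˡ (𝟙 (off₀ T ω) + 𝟙 (fl₀ T ω)))) (𝔼-+ outcomes (λ ω → 𝟙 (off₀ T ω)) (λ ω → 𝟙 (fl₀ T ω)))) ⟩
            ε * (𝔼 outcomes (λ ω → 𝟙 (off₀ T ω)) + 𝔼 outcomes (λ ω → 𝟙 (fl₀ T ω)))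
              ≡⟨ trans (*-distribˡ-+ ε (𝔼 outcomes (λ ω → 𝟙 (off₀ T ω))) (𝔼 outcomes (λ ω → 𝟙 (fl₀ T ω)))) (cong₂ (λ x y → ε * x + y) (𝔼-outcomes-proj₁ (λ v → 𝟙 (off (v ⟦ ι ⟦ T ⟧ ⟧)))) (trans (cong (ε *_) (𝔼-outcomes (λ ω → 𝟙 (fl₀ T ω)))) (sym (𝔼-* (U M) ε (λ v → 𝔼 (samplesAt v) (λ ζ → 𝟙 (fl₀ T (v , ζ)))))))) ⟩
            ε * 𝔼 (U M) (λ v → 𝟙 (off (v ⟦ ι ⟦ T ⟧ ⟧))) + 𝔼 (U M) (λ v → ε * 𝔼 (samplesAt v) (λ ζ → 𝟙 (fl₀ T (v , ζ))))
              ≤⟨ +-mono-≤ (off-rare (ι ⟦ T ⟧) inc′) (𝔼-≤const (U M) (λ v → fluctuates-rare v (ι ⟦ T ⟧) inc′)) ⟩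
            slackₜ ∎
            where
            open ≤-Reasoning
            inc′ : Increasing (ι ⟦ T ⟧)
            inc′ = increasing-⟦⟧ {s = ι} {T} ι-inc inc
          chain : ε * g ≤ ε * P + ℕ→ℚ (length tuplesₘ) * slackₜ
          chain = begin
            ε * g
              ≤⟨ *-monoˡ ε (<⇒≤ 0<ε) often ⟩
            ε * 𝔼 (U m) (𝟙 ∘ good)
              ≡⟨ cong (ε *_) (sym (trans (𝔼-outcomes-proj₁ (λ v → 𝟙 (good (v ⟦ ι ⟧)))) (U-⟦⟧ ι (increasing⇒injective {s = ι} ι-inc) (𝟙 ∘ good)))) ⟩
            ε * 𝔼 outcomes (λ ω → 𝟙 (good (proj₁ ω ⟦ ι ⟧)))
              ≤⟨ *-monoˡ ε (<⇒≤ 0<ε) (𝔼-mono outcomes cover) ⟩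
            ε * 𝔼 outcomes (λ ω → 𝟙 (does (dense? ω τ)) + ∑ tuplesₘ (λ T → bad T ω))
              ≡⟨ cong (ε *_) (trans (𝔼-+ outcomes (λ ω → 𝟙 (does (dense? ω τ))) (λ ω → ∑ tuplesₘ (λ T → bad T ω))) (cong (P +_) (𝔼-∑ outcomes tuplesₘ (λ ω T → bad T ω)))) ⟩
            ε * (P + ∑ tuplesₘ (λ T → 𝔼 outcomes (bad T)))
              ≡⟨ trans (*-distribˡ-+ ε P (∑ tuplesₘ (λ T → 𝔼 outcomes (bad T)))) (cong (ε * P +_) (sym (∑-* tuplesₘ ε (λ T → 𝔼 outcomes (bad T))))) ⟩
            ε * P + ∑ tuplesₘ (λ T → ε * 𝔼 outcomes (bad T))
              ≤⟨ +-monoʳ-≤ (ε * P) (∑-mono tuplesₘ (λ T → each T (increasing? T))) ⟩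
            ε * P + ∑ tuplesₘ (λ _ → slackₜ)
              ≡⟨ cong (ε * P +_) (∑-const tuplesₘ slackₜ) ⟩
            ε * P + ℕ→ℚ (length tuplesₘ) * slackₜ ∎
            where open ≤-Reasoning

      realisation : Code → Outcome → ℚ
      realisation c ω = 𝟙 (does (realises? (oracleAt ω) c))

      -- Exchanging the averages over transversals and outcomes shows that with probability at least
      -- ρ/2 an outcome has a fraction of at least ρ/2 dense transversals. Each such outcome
      -- realises a code, and a pigeonhole over all codes fixes one.
      frequent-code : (∀ τ → ρ ≤ 𝔼 outcomes (λ ω → 𝟙 (does (dense? ω τ)))) → ∃[ c ] frequency ≤ 𝔼 outcomes (realisation c)
      frequent-code dense = ∑-pigeonhole codes (λ c → 𝔼 outcomes (realisation c)) (half-pos 0<ρ) (begin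
        ρ * half
          ≤⟨ by-difference (re (𝔼 outcomes (𝟙 ∘ rich))) (≤⇒0≤- averaged) ⟩
        𝔼 outcomes (𝟙 ∘ rich)
          ≤⟨ 𝔼-mono outcomes (λ ω → 𝟙-≤-∑ (rich ω) codes (λ c → realisation c ω) (λ c → 𝟙-nonneg (does (realises? (oracleAt ω) c))) (witness ω)) ⟩
        𝔼 outcomes (λ ω → ∑ codes (λ c → realisation c ω))
          ≡⟨ 𝔼-∑ outcomes codes (λ ω c → realisation c ω) ⟩
        ∑ codes (λ c → 𝔼 outcomes (realisation c)) ∎)
        where
        open ≤-Reasoning
        frac : Outcome → ℚ
        frac ω = 𝔼 transversals (λ τ → 𝟙 (does (dense? ω τ)))
        rich : Outcome → Bool
        rich ω = does (ρ * half ≤? frac ω)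
        re : ∀ p → p - ρ * half ≡ (p + ρ * half) - ρ
        re p = trans (lem p (ρ * half)) (cong (λ z → (p + ρ * half) - z) (half-half ρ))
          where
          lem : ∀ p h → p - h ≡ (p + h) - (h + h)
          lem = solve-∀ ℚ-ring
        frac≤1 : ∀ ω → frac ω ≤ 1ℚ
        frac≤1 ω = 𝔼-≤const transversals (λ τ → 𝟙-≤1 (does (dense? ω τ)))
        split : ∀ {x} → x ≤ 1ℚ → (Δ : Dec (ρ * half ≤ x)) → x ≤ 𝟙 (does Δ) + ρ * half
        split x≤1 (yes _) = ≤-trans x≤1 (x≤x+ (<⇒≤ (half-pos 0<ρ)))
        split x≤1 (no ne) = ≤-trans (<⇒≤ (≰⇒> ne)) (≤-reflexive (sym (+-identityˡ (ρ * half))))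
        averaged : ρ ≤ 𝔼 outcomes (𝟙 ∘ rich) + ρ * half
        averaged = begin
          ρ
            ≡⟨ sym (𝔼-const transversals ρ) ⟩
          𝔼 transversals (λ _ → ρ)
            ≤⟨ 𝔼-mono transversals dense ⟩
          𝔼 transversals (λ τ → 𝔼 outcomes (λ ω → 𝟙 (does (dense? ω τ))))
            ≡⟨ 𝔼-swap transversals outcomes (λ τ ω → 𝟙 (does (dense? ω τ))) ⟩
          𝔼 outcomes frac
            ≤⟨ 𝔼-mono outcomes (λ ω → split (frac≤1 ω) (ρ * half ≤? frac ω)) ⟩
          𝔼 outcomes (λ ω → 𝟙 (rich ω) + ρ * half)
            ≡⟨ trans (𝔼-+ outcomes (𝟙 ∘ rich) (λ _ → ρ * half)) (cong (𝔼 outcomes (𝟙 ∘ rich) +_) (𝔼-const outcomes (ρ * half))) ⟩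
          𝔼 outcomes (𝟙 ∘ rich) + ρ * half ∎
        witness : ∀ ω → rich ω ≡ true → ∃[ c ] (c ∈ codes × 1ℚ ≤ realisation c ω)
        witness ω e = let (c , c∈ , real) = pattern-realised (oracleAt ω) (IE.pattern-exists (oracleAt ω) (does⇒ (ρ * half ≤? frac ω) e)) in
          c , c∈ , ≤-reflexive (sym (cong 𝟙 (dec-true (realises? (oracleAt ω) c) real)))

      faithful : ∀ c → frequency ≤ 𝔼 outcomes (realisation c) → Faithful (proj₁ c)
      faithful c le = let (ω , pos) = 𝔼-positive⇒∃ outcomes (realisation c) (<-≤-trans frequency-pos le) in extract (realises? (oracleAt ω) c) pos
        where
        extract : ∀ {X : Set} (Δ : Dec (Faithful (proj₁ c) × X)) → 0ℚ < 𝟙 (does Δ) → Faithful (proj₁ c)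
        extract (yes p) _   = proj₁ p
        extract (no _)  pos = contradiction pos (<-irrefl refl)

      -- Acceptance by the oracle at every edge tuple means that each of the conditional
      -- probabilities in `hats` is at least `ε`.
      realised-weight : ∀ c ω → realisation c ω * weight ≤ hats (edgeTuples (proj₁ c)) (proj₁ ω) (pick (proj₂ ω) (proj₂ c))
      realised-weight c@(φ , α) ω@(v , ζ) = go (realises? (oracleAt ω) c)
        where
        hatAt : Vec (Fin M) k → ℚ
        hatAt T = hat A B (low A B (v ⟦ T ⟧)) (tabulate (λ l → lookup (pick ζ α) (faceSlots T l)))
        hatAt-nonneg : ∀ T → 0ℚ ≤ hatAt T
        hatAt-nonneg T = hat-nonneg A B (low A B (v ⟦ T ⟧)) (tabulate (λ l → lookup (pick ζ α) (faceSlots T l)))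
        picked : ∀ T → tabulate (λ l → lookup (lookup ζ (faceSlots T l)) (lookup (labels α T) l)) ≡ tabulate (λ l → lookup (pick ζ α) (faceSlots T l))
        picked T = Vecₚ.tabulate-cong (λ l → trans (cong (lookup (lookup ζ (faceSlots T l))) (Vecₚ.lookup∘tabulate (λ l → lookup α (code (removeAt T l))) l)) (sym (Vecₚ.lookup-zipWith lookup (faceSlots T l) ζ α)))
        go : (Δ : Dec (Realises (oracleAt ω) c)) → 𝟙 (does Δ) * weight ≤ ∏ (edgeTuples φ) hatAt
        go (no _)  = ≤-trans (≤-reflexive (*-zeroˡ weight)) (∏-nonneg (edgeTuples φ) hatAt-nonneg)
        go (yes r) = ≤-trans (≤-reflexive (*-identityˡ weight)) (≤-trans (∏-filter (edgeTuple? φ) tuplesₖ (<⇒≤ 0<ε) ε≤1)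
          (∏-mono-∈ (edgeTuples φ) (λ _ → <⇒≤ 0<ε) hatAt-nonneg (λ {T} T∈ → subst (λ ps → ε ≤ hat A B (low A B (v ⟦ T ⟧)) ps) (picked T)
            (does⇒ (ε ≤? hat A B (low A B (v ⟦ T ⟧)) (tabulate (λ l → lookup (lookup ζ (faceSlots T l)) (lookup (labels α T) l)))) (All.lookup (proj₂ r) T∈)))))

      many-copies : ∀ c → frequency ≤ 𝔼 outcomes (realisation c) →
        frequency * weight - (ℕ→ℚ Q * gap₂ + ℕ→ℚ (length (edgeTuples (proj₁ c))) * gap₁) ≤ 𝔼 (U M) (λ v → ∏ (edgeTuples (proj₁ c)) (λ T → edge (v ⟦ T ⟧)))
      many-copies c@(φ , α) le = ≤-trans (+-monoˡ-≤ (- (ℕ→ℚ Q * gap₂ + ℕ→ℚ (length (edgeTuples φ)) * gap₁)) (begin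
        frequency * weight
          ≤⟨ *-monoʳ weight (<⇒≤ weight-pos) le ⟩
        𝔼 outcomes (realisation c) * weight
          ≡⟨ sym (𝔼-*ʳ outcomes weight (realisation c)) ⟩
        𝔼 outcomes (λ ω → realisation c ω * weight)
          ≤⟨ 𝔼-mono outcomes (realised-weight c) ⟩
        𝔼 outcomes (λ ω → hats (edgeTuples φ) (proj₁ ω) (pick (proj₂ ω) α))
          ≡⟨ 𝔼-outcomes (λ ω → hats (edgeTuples φ) (proj₁ ω) (pick (proj₂ ω) α)) ⟩
        𝔼 (U M) (λ v → 𝔼 (samplesAt v) (λ ζ → hats (edgeTuples φ) v (pick ζ α))) ∎))
        (counting (edgeTuples φ) (All.tabulate (λ T∈ → proj₁ (proj₂ (∈ₚ.∈-filter⁻ (edgeTuple? φ) {xs = tuplesₖ} T∈)))) (Uniqueₚ.filter⁺ (edgeTuple? φ) (allVecs-unique k (Uniqueₚ.allFin⁺ M))) α)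
        where open ≤-Reasoning

-- Choice of constants

below : ∀ {x y} → 0ℚ < x → 0ℚ < y → ∃[ z ] (0ℚ < z × z ≤ x × z ≤ y)
below {x} {y} 0<x 0<y = [ (λ x≤y → x , 0<x , ≤-refl , x≤y) , (λ y≤x → y , 0<y , y≤x , ≤-refl) ]′ (≤-total x y)

half-≤ : ∀ {x} → 0ℚ < x → x * half ≤ x
half-≤ {x} 0<x = subst (x * half ≤_) (half-half x) (x≤x+ (<⇒≤ (half-pos 0<x)))

half-< : ∀ {x} → 0ℚ < x → x * half < x
half-< {x} 0<x = subst₂ _<_ (+-identityʳ (x * half)) (half-half x) (+-monoʳ-< (x * half) (half-pos 0<x))

abstract
  scaled : ∀ C {δ} → 0ℚ ≤ C → 0ℚ < δ → ∃[ t ] (0ℚ < t × C * t ≤ δ)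
  scaled C {δ} 0≤C 0<δ = δ * inv (1ℚ + C) , *-pos 0<δ (inv-pos 0<1+C) , subst (C * (δ * inv (1ℚ + C)) ≤_) total (*-monoʳ (δ * inv (1ℚ + C)) (<⇒≤ (*-pos 0<δ (inv-pos 0<1+C))) (subst (_≤ 1ℚ + C) (+-identityˡ C) (+-monoˡ-≤ C 0≤1)))
    where
    0<1+C : 0ℚ < 1ℚ + C
    0<1+C = +-pos-nonneg 0<1 0≤C
    re : ∀ c d i → c * (d * i) ≡ d * (c * i)
    re = solve-∀ ℚ-ring
    total : (1ℚ + C) * (δ * inv (1ℚ + C)) ≡ δ
    total = trans (re (1ℚ + C) δ (inv (1ℚ + C))) (trans (cong (δ *_) (inv-inverse 0<1+C)) (*-identityʳ δ))

  archimedean-< : ∀ {δ} C → 0ℚ < δ → ∃[ K ] C < ℕ→ℚ K * δ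
  archimedean-< {δ} C 0<δ = let (K , le) = archimedean′ C 0<δ in suc K , ≤-<-trans le (subst₂ _<_ (+-identityˡ (ℕ→ℚ K * δ)) (suc-bound K δ) (+-monoˡ-< (ℕ→ℚ K * δ) 0<δ))

  vanishes : ∀ C {δ} → 0ℚ < δ → ∃[ n₀ ] (∀ n′ → n₀ ℕ.≤ suc n′ → C * inv (ℕ→ℚ (suc n′)) < δ)
  vanishes C {δ} 0<δ = let (K , lt) = archimedean-< C 0<δ in K , λ n′ le → 0<-⇒< (subst (0ℚ <_) (trans (re (inv (ℕ→ℚ (suc n′))) (ℕ→ℚ (suc n′)) δ C) (trans (cong (λ z → δ * z - C * inv (ℕ→ℚ (suc n′))) (inv-inverse (ℕ→ℚ-pos n′))) (cong (_- C * inv (ℕ→ℚ (suc n′))) (*-identityʳ δ))))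
    (*-pos (inv-pos (ℕ→ℚ-pos n′)) (<⇒0<- (<-≤-trans lt (*-monoʳ δ (<⇒≤ 0<δ) (ℕ→ℚ-mono le))))))
    where
    re : ∀ i n d c → i * (n * d - c) ≡ d * (n * i) - c * i
    re = solve-∀ ℚ-ring

  least : (f : ℕ → ℚ) → (∀ a → 0ℚ < f a) → ∀ K → ∃[ κ ] (0ℚ < κ × (∀ a → a ℕ.≤ K → κ ≤ f a))
  least f pos zero    = f 0 , pos 0 , λ { zero _ → ≤-refl }
  least f pos (suc K) = let (κ , 0<κ , low) = least f pos K in let (z , 0<z , z≤ , z≤′) = below 0<κ (pos (suc K)) in
    z , 0<z , λ a a≤ → [ (λ lt → ≤-trans z≤ (low a (ℕₚ.≤-pred lt))) , (λ { refl → z≤′ }) ]′ (ℕₚ.m≤n⇒m<n∨m≡n a≤)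

factorial-nonneg : ∀ q → 0ℚ ≤ factorial q
factorial-nonneg zero    = 0≤1
factorial-nonneg (suc q) = *-nonneg (ℕ→ℚ-nonneg (suc q)) (factorial-nonneg q)

length-pos : ∀ {X : Set} {x : X} {xs} → x ∈ xs → 0ℚ < ℕ→ℚ (length xs)
length-pos {xs = _ ∷ xs} _ = ℕ→ℚ-pos (length xs)

module Constants (i : ℕ) (1≤i : 1 ℕ.≤ i) (F : Graph) {ε d : ℚ} (0<ε : 0ℚ < ε) (ε≤1 : ε ≤ 1ℚ) (0≤d : 0ℚ ≤ d) (d≤1 : d ≤ 1ℚ) (m : ℕ)
                 (hyp : ∀ (A : Reduced (suc (suc i)) m) → DenseR (d - (ε + ε + ε + ε)) A → Embeds F A) where

  module Th = Threshold i 1≤i 0<ε ε≤1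

  private
    k : ℕ
    k = suc (suc i)

  nT : ℕ
  nT = length (allVecs (allFin m) k)

  -- Of the frequency `g` of good tuples half is kept as `ρ`. The other half, times `ε`, is two
  -- budgets: one for resampling, one for sampling.
  g ρ budget : ℚ
  g = Th.goodRate m
  ρ = g * half
  budget = ε * (ρ * half)

  0<ρ : 0ℚ < ρ
  0<ρ = half-pos (Th.goodRate-pos m)

  0<budget : 0ℚ < budget
  0<budget = *-pos 0<ε (half-pos 0<ρ)

  choice-σ : ∃[ σ ] (0ℚ < σ × ℕ→ℚ nT * ℕ→ℚ k * σ ≤ budget)
  choice-σ = scaled (ℕ→ℚ nT * ℕ→ℚ k) (*-nonneg (ℕ→ℚ-nonneg nT) (ℕ→ℚ-nonneg k)) 0<budget

  σ : ℚ
  σ = proj₁ choice-σ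

  0<σ : 0ℚ < σ
  0<σ = proj₁ (proj₂ choice-σ)

  choice-N : ∃[ N′ ] 1ℚ < ℕ→ℚ N′ * (σ * σ)
  choice-N = archimedean-< 1ℚ (*-pos 0<σ 0<σ)

  N′ : ℕ
  N′ = proj₁ choice-N

  enough : 1ℚ ≤ ℕ→ℚ (suc N′) * (σ * σ)
  enough = ≤-trans (<⇒≤ (proj₂ choice-N)) (*-monoʳ (σ * σ) (<⇒≤ (*-pos 0<σ 0<σ)) (ℕ→ℚ-mono (ℕₚ.n≤1+n N′)))

  module Co = Conclusion i F {ε} {d} 0<ε ε≤1 m N′ hyp {σ} 0<σ enough {ρ} 0<ρ
  open Co using (Q; frequency; weight; frequency-pos; weight-pos; tuplesₖ; edgeTuples)
  open Co.IE using (M)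

  fw : ℚ
  fw = frequency * weight

  0<fw : 0ℚ < fw
  0<fw = *-pos frequency-pos weight-pos

  -- The bound on both gaps has two uses: resampling must stay within its budget, and the two
  -- replacements in the count of copies may use up half of `fw`.
  choice-γ : ∃[ γ ] (0ℚ < γ × (ℕ→ℚ nT * ℕ→ℚ Q) * γ ≤ budget × (ℕ→ℚ Q + ℕ→ℚ (length tuplesₖ)) * γ ≤ fw * half)
  choice-γ = γ , 0<γ , ≤-trans (*-monoˡ C C≥0 γ≤) (proj₂ (proj₂ first)) , ≤-trans (*-monoˡ C′ C′≥0 γ≤′) (proj₂ (proj₂ second))
    where
    C C′ : ℚ
    C = ℕ→ℚ nT * ℕ→ℚ Q
    C′ = ℕ→ℚ Q + ℕ→ℚ (length tuplesₖ)
    C≥0 : 0ℚ ≤ C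
    C≥0 = *-nonneg (ℕ→ℚ-nonneg nT) (ℕ→ℚ-nonneg Q)
    C′≥0 : 0ℚ ≤ C′
    C′≥0 = +-nonneg (ℕ→ℚ-nonneg Q) (ℕ→ℚ-nonneg (length tuplesₖ))
    first : ∃[ t ] (0ℚ < t × C * t ≤ budget)
    first = scaled C C≥0 0<budget
    second : ∃[ t ] (0ℚ < t × C′ * t ≤ fw * half)
    second = scaled C′ C′≥0 (half-pos 0<fw)
    chosen : ∃[ z ] (0ℚ < z × z ≤ proj₁ first × z ≤ proj₁ second)
    chosen = below (proj₁ (proj₂ first)) (proj₁ (proj₂ second))
    γ : ℚ
    γ = proj₁ chosen
    0<γ : 0ℚ < γ
    0<γ = proj₁ (proj₂ chosen)
    γ≤ : γ ≤ proj₁ first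
    γ≤ = proj₁ (proj₂ (proj₂ chosen))
    γ≤′ : γ ≤ proj₁ second
    γ≤′ = proj₂ (proj₂ (proj₂ chosen))

  γ t : ℚ
  γ = proj₁ choice-γ
  -- With both mean gaps at most γ/4, their sum averages to at most γ/2, so some pair `A`, `B` has
  -- both gaps below `γ`.
  t = (γ * half) * half

  0<γ : 0ℚ < γ
  0<γ = proj₁ (proj₂ choice-γ)

  0<t : 0ℚ < t
  0<t = half-pos (half-pos 0<γ)

  -- Equals the number of tops, but is spelled out without a hypergraph because `η₂` has to be fixed
  -- in advance.
  topCount : ℕ → ℚ
  topCount a = ℕ→ℚ (length (allSubsets (length (allVecs (indices (suc i) (allFin a)) k))))

  topCount-pos : ∀ a → 0ℚ < topCount a
  topCount-pos a = length-pos (∈-allSubsets (Vec.replicate (length (allVecs (indices (suc i) (allFin a)) k)) true))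

  η₂ : ℕ → ℚ
  η₂ a = t * (t * inv (topCount a))

  η₂-pos : ∀ a → 0ℚ < η₂ a
  η₂-pos a = *-pos 0<t (*-pos 0<t (inv-pos (topCount-pos a)))

  module Se = Select M {t * t} (proj₁ (archimedean-< 1ℚ (*-pos 0<t 0<t))) (proj₂ (archimedean-< 1ℚ (*-pos 0<t 0<t))) η₂ (λ a → proj₁ (archimedean-< 1ℚ (η₂-pos a))) (λ a → proj₂ (archimedean-< 1ℚ (η₂-pos a)))

  limit : ℕ → ℕ → ℚ
  limit a b = Th.threshold (Th.classMass m a b)

  rows : ∀ a → ∃[ κ ] (0ℚ < κ × (∀ b → b ℕ.≤ Se.bound → κ ≤ limit a b))
  rows a = least (limit a) (λ b → Th.threshold-pos (Th.classMass-pos m a b)) Se.bound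

  -- The sizes of `A` and `B` depend on the hypergraph and only their bound is known here, so the
  -- least threshold over all admissible sizes is taken.
  choice-κ : ∃[ κ ] (0ℚ < κ × (∀ a → a ℕ.≤ Se.bound → κ ≤ proj₁ (rows a)))
  choice-κ = least (λ a → proj₁ (rows a)) (λ a → proj₁ (proj₂ (rows a))) Se.bound

  κ : ℚ
  κ = proj₁ choice-κ

  0<κ : 0ℚ < κ
  0<κ = proj₁ (proj₂ choice-κ)

  κ≤ : ∀ {a b} → a ℕ.≤ Se.bound → b ℕ.≤ Se.bound → κ ≤ limit a b
  κ≤ {a} {b} a≤ b≤ = ≤-trans (proj₂ (proj₂ choice-κ) a a≤) (proj₂ (proj₂ (rows a)) b b≤)

  -- Half of `κ` is reserved for the error μ, the other half for repeated vertices; together they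
  -- bound `slack μ`.
  choice-μ : ∃[ μ ] (0ℚ < μ × factorial k * μ ≤ κ * half)
  choice-μ = scaled (factorial k) (factorial-nonneg k) (half-pos 0<κ)

  μ : ℚ
  μ = proj₁ choice-μ

  choice-n₁ : ∃[ n₀ ] (∀ n′ → n₀ ℕ.≤ suc n′ → ℕ→ℚ (k ℕ.* k) * inv (ℕ→ℚ (suc n′)) < κ * half)
  choice-n₁ = vanishes (ℕ→ℚ (k ℕ.* k)) (half-pos 0<κ)

  choice-n₂ : ∃[ n₀ ] (∀ n′ → n₀ ℕ.≤ suc n′ → ℕ→ℚ (M ℕ.* M) * inv (ℕ→ℚ (suc n′)) < fw * half)
  choice-n₂ = vanishes (ℕ→ℚ (M ℕ.* M)) (half-pos 0<fw)

  n₀ : ℕ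
  n₀ = suc (proj₁ choice-n₁ ℕ.+ proj₁ choice-n₂)

  module _ (n′ : ℕ) (n₀≤ : n₀ ℕ.≤ suc n′) (EH : Subset (suc n′) → Bool) (dense : Dense k i d μ (DenseGraph.H n′ i EH)) where

    open DenseGraph n′ i EH hiding (k)
    module En = Energy (suc i) Hv Hv-repeat (uniformFin n′) (uniformFin-charged n′)

    large₁ : ℕ→ℚ (k ℕ.* k) * inv (ℕ→ℚ (suc n′)) < κ * half
    large₁ = proj₂ choice-n₁ n′ (ℕₚ.≤-trans (ℕₚ.m≤n⇒m≤1+n (ℕₚ.m≤m+n (proj₁ choice-n₁) (proj₁ choice-n₂))) n₀≤)

    large₂ : ℕ→ℚ (M ℕ.* M) * inv (ℕ→ℚ (suc n′)) < fw * half
    large₂ = proj₂ choice-n₂ n′ (ℕₚ.≤-trans (ℕₚ.m≤n⇒m≤1+n (ℕₚ.m≤n+m (proj₁ choice-n₂) (proj₁ choice-n₁))) n₀≤)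

    slack-small : slack μ < κ
    slack-small = subst (slack μ <_) (half-half κ) (+-mono-≤-< (proj₂ (proj₂ choice-μ)) large₁)

    contained : ∀ {a b} → a ℕ.≤ Se.bound → b ℕ.≤ Se.bound → (A : Vec V a) (B : Vec V b) → Gaps.gap₁ {M} A B ≤ γ → Gaps.gap₂ {M} A B ≤ γ → Contains k H F
    contained {a} {b} a≤ b≤ A B gap₁≤ gap₂≤ = Co.copy-exists n′ EH (proj₁ c) (Co.faithful n′ EH A B c (proj₂ chosen)) (<-≤-trans large₂ (≤-trans positive-part (Co.many-copies n′ EH A B c (proj₂ chosen))))
      where
      gap₁ gap₂ : ℚ
      gap₁ = Gaps.gap₁ {M} A B
      gap₂ = Gaps.gap₂ {M} A B
      good : Vec V m → Bool
      good v = does (Th.allGood? n′ EH {d} {μ} dense 0≤d d≤1 A B v)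
      small : ℕ→ℚ nT * (ℕ→ℚ Q * gap₂ + ℕ→ℚ k * σ) ≤ ε * (g - ρ)
      small = begin
        ℕ→ℚ nT * (ℕ→ℚ Q * gap₂ + ℕ→ℚ k * σ)
          ≡⟨ re (ℕ→ℚ nT) (ℕ→ℚ Q) gap₂ (ℕ→ℚ k) σ ⟩
        (ℕ→ℚ nT * ℕ→ℚ Q) * gap₂ + ℕ→ℚ nT * ℕ→ℚ k * σ
          ≤⟨ +-mono-≤ (≤-trans (*-monoˡ (ℕ→ℚ nT * ℕ→ℚ Q) (*-nonneg (ℕ→ℚ-nonneg nT) (ℕ→ℚ-nonneg Q)) gap₂≤) (proj₁ (proj₂ (proj₂ choice-γ)))) (proj₂ (proj₂ choice-σ)) ⟩
        budget + budget
          ≡⟨ trans (sym (*-distribˡ-+ ε (ρ * half) (ρ * half))) (cong (ε *_) (trans (half-half ρ) (trans (re′ ρ) (cong (_- ρ) (half-half g))))) ⟩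
        ε * (g - ρ) ∎
        where
        open ≤-Reasoning
        re : ∀ n q x k s → n * (q * x + k * s) ≡ (n * q) * x + n * k * s
        re = solve-∀ ℚ-ring
        re′ : ∀ r → r ≡ (r + r) - r
        re′ = solve-∀ ℚ-ring
      chosen : ∃[ c ] frequency ≤ 𝔼 (Co.outcomes n′ EH A B) (Co.realisation n′ EH A B c)
      chosen = Co.frequent-code n′ EH A B (Co.dense-often n′ EH A B {g} good (λ v e → does⇒ (Th.allGood? n′ EH {d} {μ} dense 0≤d d≤1 A B v) e) (Th.good-often n′ EH {d} {μ} dense 0≤d d≤1 A B m (<-≤-trans slack-small (κ≤ a≤ b≤))) small)
      c : Co.Code
      c = proj₁ chosen
      Ts : List (Vec (Fin M) k)
      Ts = edgeTuples (proj₁ c)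
      positive-part : fw * half ≤ fw - (ℕ→ℚ Q * gap₂ + ℕ→ℚ (length Ts) * gap₁)
      positive-part = by-difference (trans (cong (λ z → (z - (ℕ→ℚ Q * gap₂ + ℕ→ℚ (length Ts) * gap₁)) - fw * half) (sym (half-half fw))) (re (fw * half) (ℕ→ℚ Q * gap₂ + ℕ→ℚ (length Ts) * gap₁))) (≤⇒0≤- (begin
        ℕ→ℚ Q * gap₂ + ℕ→ℚ (length Ts) * gap₁
          ≤⟨ +-mono-≤ (*-monoˡ (ℕ→ℚ Q) (ℕ→ℚ-nonneg Q) gap₂≤) (*-mono (ℕ→ℚ-nonneg (length Ts)) (<⇒≤ 0<γ) (ℕ→ℚ-mono (Listₚ.length-filter (Co.edgeTuple? (proj₁ c)) tuplesₖ)) gap₁≤) ⟩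
        ℕ→ℚ Q * γ + ℕ→ℚ (length tuplesₖ) * γ
          ≡⟨ sym (*-distribʳ-+ γ (ℕ→ℚ Q) (ℕ→ℚ (length tuplesₖ))) ⟩
        (ℕ→ℚ Q + ℕ→ℚ (length tuplesₖ)) * γ
          ≤⟨ proj₂ (proj₂ (proj₂ choice-γ)) ⟩
        fw * half ∎))
        where
        open ≤-Reasoning
        re : ∀ h x → ((h + h) - x) - h ≡ h - x
        re = solve-∀ ℚ-ring

    small-gaps : ∀ {a b} → En.q₁ (M ℕ.+ a) b - En.q₁ a b ≤ t * t → En.q₂ a (M ℕ.+ b) - En.q₂ a b ≤ η₂ a → Σ[ A ∈ Vec V a ] Σ[ B ∈ Vec V b ] (Gaps.gap₁ {M} A B ≤ γ × Gaps.gap₂ {M} A B ≤ γ)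
    small-gaps {a} {b} le₁ le₂ = A , B , ≤-trans (x≤x+ 0≤gap₂) (<⇒≤ both<γ) , ≤-trans (subst (gap₂ A B ≤_) (+-comm (gap₂ A B) (gap₁ A B)) (x≤x+ 0≤gap₁)) (<⇒≤ both<γ)
      where
      gap₁ gap₂ : Vec V a → Vec V b → ℚ
      gap₁ A B = Gaps.gap₁ {M} A B
      gap₂ A B = Gaps.gap₂ {M} A B
      topCount≡ : topCount a ≡ En.#tops a
      topCount≡ = cong (λ w → ℕ→ℚ (length (allSubsets w))) (sym (FullInfo.width≡ a))
      E₁ : 𝔼 (U a) (λ A → 𝔼 (U b) (gap₁ A)) ≤ t
      E₁ = En.gap₁-bound M 0<t le₁
      E₂ : 𝔼 (U a) (λ A → 𝔼 (U b) (gap₂ A)) ≤ t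
      E₂ = En.gap₂-bound M 0<t (subst (0ℚ <_) topCount≡ (topCount-pos a)) (subst (λ z → En.q₂ a (M ℕ.+ b) - En.q₂ a b ≤ t * (t * inv z)) topCount≡ le₂)
      rest : Vec V a → Vec V b → ℚ
      rest A B = γ - (gap₁ A B + gap₂ A B)
      average : 𝔼 (U a) (λ A → 𝔼 (U b) (rest A)) ≡ γ - (𝔼 (U a) (λ A → 𝔼 (U b) (gap₁ A)) + 𝔼 (U a) (λ A → 𝔼 (U b) (gap₂ A)))
      average = trans (𝔼-cong (U a) (λ A → trans (𝔼-- (U b) (λ _ → γ) (λ B → gap₁ A B + gap₂ A B)) (cong₂ _-_ (𝔼-const (U b) γ) (𝔼-+ (U b) (gap₁ A) (gap₂ A)))))
        (trans (𝔼-- (U a) (λ _ → γ) (λ A → 𝔼 (U b) (gap₁ A) + 𝔼 (U b) (gap₂ A))) (cong₂ _-_ (𝔼-const (U a) γ) (𝔼-+ (U a) (λ A → 𝔼 (U b) (gap₁ A)) (λ A → 𝔼 (U b) (gap₂ A)))))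
      positive-average : 0ℚ < 𝔼 (U a) (λ A → 𝔼 (U b) (rest A))
      positive-average = subst (0ℚ <_) (sym average) (<⇒0<- (≤-<-trans (+-mono-≤ E₁ E₂) (subst (_< γ) (sym (half-half (γ * half))) (half-< 0<γ))))
      foundA : ∃[ A ] 0ℚ < 𝔼 (U b) (rest A)
      foundA = 𝔼-positive⇒∃ (U a) (λ A → 𝔼 (U b) (rest A)) positive-average
      A : Vec V a
      A = proj₁ foundA
      foundB : ∃[ B ] 0ℚ < rest A B
      foundB = 𝔼-positive⇒∃ (U b) (rest A) (proj₂ foundA)
      B : Vec V b
      B = proj₁ foundB
      both<γ : gap₁ A B + gap₂ A B < γ
      both<γ = 0<-⇒< (proj₂ foundB)
      0≤gap₁ : 0ℚ ≤ gap₁ A B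
      0≤gap₁ = 𝔼-nonneg (U M) (λ u → 𝔼-nonneg (U k) (λ x → 0≤∣p∣ _))
      0≤gap₂ : 0ℚ ≤ gap₂ A B
      0≤gap₂ = Gaps.gap₂-nonneg {M} A B

    contains : Contains k H F
    contains = go (Se.select En.q₁ En.q₂ En.q₁-nonneg En.q₁-≤1 En.q₂-nonneg En.q₂-≤1 En.q₁-mono)
      where
      go : ∃[ a ] ∃[ b ] (a ℕ.≤ Se.bound × b ℕ.≤ Se.bound × En.q₁ (M ℕ.+ a) b - En.q₁ a b ≤ t * t × En.q₂ a (M ℕ.+ b) - En.q₂ a b ≤ η₂ a) → Contains k H F
      go (a , b , a≤ , b≤ , le₁ , le₂) = let (A , B , s₁ , s₂) = small-gaps {a} {b} le₁ le₂ in contained a≤ b≤ A B s₁ s₂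

theorem1p13 : (k : ℕ) → 3 ℕ.≤ k → (F : Graph) → (d : ℚ) → 0ℚ ≤ d → d ≤ 1ℚ →
    (∀ (ε : ℚ) → 0ℚ < ε → ∃[ m ] (∀ (A : Reduced k m) → DenseR (d + ε) A → Embeds F A)) →
    PiLe k (k ℕ.∸ 2) F d
theorem1p13 (suc (suc (suc i′))) (s≤s (s≤s (s≤s _))) F d 0≤d d≤1 hyp d′ d<d′ d′≤1 inPi = go (inPi Con.μ (proj₁ (proj₂ Con.choice-μ)) Con.n₀)
  where
  k : ℕ
  k = suc (suc (suc i′))
  -- `d + gain` is the midpoint of `d` and `d′`, and the four losses of `ε` together amount to
  -- `gain`.
  gain ε : ℚ
  gain = (d′ - d) * half
  ε = (gain * half) * half
  0<gain : 0ℚ < gain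
  0<gain = half-pos (<⇒0<- d<d′)
  0<ε : 0ℚ < ε
  0<ε = half-pos (half-pos 0<gain)
  ε≤1 : ε ≤ 1ℚ
  ε≤1 = ≤-trans (half-≤ (half-pos 0<gain)) (≤-trans (half-≤ 0<gain) (≤-trans (half-≤ (<⇒0<- d<d′)) (≤-trans (by-difference (re d d′) 0≤d) d′≤1)))
    where
    re : ∀ d e → e - (e - d) ≡ d
    re = solve-∀ ℚ-ring
  four : ε + ε + ε + ε ≡ gain
  four = trans (re ε) (trans (cong₂ _+_ (half-half (gain * half)) (half-half (gain * half))) (half-half gain))
    where
    re : ∀ e → e + e + e + e ≡ (e + e) + (e + e)
    re = solve-∀ ℚ-ring
  density : d′ - (ε + ε + ε + ε) ≡ d + gain
  density = trans (cong (λ z → d′ - z) four) (trans (re d d′ gain) (trans (cong (λ z → (d + z) - gain) (sym (half-half (d′ - d)))) (re′ d gain)))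
    where
    re : ∀ d e g → e - g ≡ (d + (e - d)) - g
    re = solve-∀ ℚ-ring
    re′ : ∀ d g → (d + (g + g)) - g ≡ d + g
    re′ = solve-∀ ℚ-ring
  m : ℕ
  m = proj₁ (hyp gain 0<gain)
  module Con = Constants (suc i′) (s≤s z≤n) F {ε} {d′} 0<ε ε≤1 (≤-trans 0≤d (<⇒≤ d<d′)) d′≤1 m (λ A dense → proj₂ (hyp gain 0<gain) A (subst (λ c → DenseR c A) density dense))
  go : ¬ (∃[ H ] (Con.n₀ ℕ.≤ vn H × Free k F H × Dense k (suc i′) d′ Con.μ H))
  -- `n₀` is a successor, which rules out the hypergraph without vertices.
  go (record { vn = zero ; E = EH } , () , _)
  go (record { vn = suc n′ ; E = EH } , large , free , dense) = free (Con.contains n′ large EH dense)
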